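{- Let $a<b$ be coprime positive integers, let $1\le k\le a$, and let $X$ be the set of $\pi\in\mathsf{NC}(a,b)$ having exactly $k$ blocks. Let $C=\mathbb{Z}_{b-1}$ act on $X$ by rotation. Then $(X,C,X(q))$ exhibits the cyclic sieving phenomenon, where $$X(q)=\mathsf{Nar}_q(a,b,k)=\frac{1}{[a]_q}\begin{bmatrix}a\\k\end{bmatrix}_q\begin{bmatrix}b-1\\k-1\end{bmatrix}_q.$$
   Context: Let $a<b$ be coprime positive integers and $[b-1]=\{1,\dots,b-1\}$. An $a,b$-Dyck path is a lattice path from $(0,0)$ to $(b,a)$ using unit north and east steps that stays weakly above the line $y=\frac{a}{b}x$. A valley of such a path $D$ is a lattice point of $D$ immediately preceded by an east step and immediately followed by a north step. From each valley $P$ fire the laser $\ell(P)$: the segment of slope $\frac ab$ from $P$ going northeast until it first meets $D$ again. Label the east endpoints of the first $b-1$ east steps of $D$ from left to right by $1,\dots,b-1$, each label regarded as sitting slightly below its lattice point. The set partition $\pi(D)$ of $[b-1]$ declares $i\sim j$ iff labels $i,j$ are not separated by any valley laser. $\mathsf{NC}(a,b)=\{\pi(D): D\text{ an }a,b\text{ -Dyck path}\}$. Rotation: a generator of $\mathbb Z_{b-1}$ acts by $\mathtt{rot}$, the permutation $i\mapsto i+1$ ($i<b-1$), $b-1\mapsto1$, applied blockwise. Notation: $[n]_q=1+q+\cdots+q^{n-1}$, $[n]_q!=[1]_q\cdots[n]_q$, $\begin{bmatrix}n\\k\end{bmatrix}_q=\frac{[n]_q!}{[k]_q![n-k]_q!}$.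 Cyclic sieving: for a finite set $X$ acted on by a cyclic group $C=\langle c\rangle$ of order $n$ and a polynomial $X(q)$ with nonnegative integer coefficients, $(X,C,X(q))$ exhibits the cyclic sieving phenomenon if $X(\zeta^d)=|\{x\in X: c^d.x=x\}|$ for all $d\ge0$, where $\zeta$ is a primitive $n$-th root of unity. -}

module Defs where

open import Data.Bool using (Bool; true; false; _∧_; _∨_; not; _xor_; if_then_else_)
open import Data.Nat using (ℕ; zero; suc; _+_; _*_; _∸_; _<ᵇ_; _≤ᵇ_; _≡ᵇ_; _%_)
open import Data.List using (List; []; _∷_; _++_; [_]; map; foldr; length; filterᵇ;
  upTo; zip; replicate; concatMap; deduplicate)
open import Data.Bool.ListAction using (any; all)
open import Data.List.Relation.Unary.All using (All)
open import Data.Product using (_,_; proj₁; proj₂; _×_)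
open import Data.Integer as ℤ using (ℤ; +_)
open import Data.Maybe using (Maybe; just; nothing)
open import Relation.Nullary using (does)
open import Relation.Binary.PropositionalEquality using (_≡_)
import Data.List.Properties as LP
import Data.Bool.Properties as BP

nthD : {A : Set} → A → List A → ℕ → A
nthD d []       _       = d
nthD d (x ∷ xs) zero    = x
nthD d (x ∷ xs) (suc i) = nthD d xs i

iter : {A : Set} → (A → A) → ℕ → A → A
iter f zero    x = x
iter f (suc n) x = f (iter f n x)

-- Polynomials with integer coefficients: coefficient lists, constant
-- term first (trailing zeros allowed).

Poly : Set
Poly = List ℤ

addP : Poly → Poly → Poly
addP []      q       = q
addP (c ∷ p) []      = c ∷ p
addP (c ∷ p) (e ∷ q) = (c ℤ.+ e) ∷ addP p q

negP : Poly → Poly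
negP = map (λ c → ℤ.- c)

subP : Poly → Poly → Poly
subP p q = addP p (negP q)

scaleP : ℤ → Poly → Poly
scaleP c = map (c ℤ.*_)

mulP : Poly → Poly → Poly
mulP []      q = []
mulP (c ∷ p) q = addP (scaleP c q) (+ 0 ∷ mulP p q)

coeff : Poly → ℕ → ℤ
coeff = nthD (+ 0)

IsZeroP : Poly → Set
IsZeroP p = All (_≡ + 0) p

_≈P_ : Poly → Poly → Set
p ≈P q = IsZeroP (subP p q)

isZeroℤ : ℤ → Bool
isZeroℤ c = does (c ℤ.≟ + 0)

consT : ℤ → Poly → Poly
consT c []      = if isZeroℤ c then [] else [ c ]
consT c (x ∷ p) = c ∷ x ∷ p

trim : Poly → Poly
trim []      = []
trim (c ∷ p) = consT c (trim p)

xPow : ℕ → Poly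
xPow m = replicate m (+ 0) ++ [ + 1 ]

compose : Poly → Poly → Poly
compose p r = foldr (λ c acc → addP [ c ] (mulP r acc)) [] p

-- Division with remainder by a MONIC polynomial g (given with its
-- leading coefficient 1 as last entry): returns (quotient , remainder),
-- with deg remainder < deg g.  Long division, processed by Horner.
divModMonic : Poly → Poly → Poly × Poly
divModMonic g []      = [] , []
divModMonic g (c ∷ p) =
  let m  = length g ∸ 1
      qr = divModMonic g p
      s  = c ∷ proj₂ qr
      t  = coeff s m
  in addP (+ 0 ∷ proj₁ qr) [ t ] , Data.List.take m (subP s (scaleP t g))
  where import Data.List

quotMonic remMonic : Poly → Poly → Poly
quotMonic g p = proj₁ (divModMonic g p)
remMonic  g p = proj₂ (divModMonic g p)

-- Cyclotomic polynomials, by the standard recursion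
--   x^m - 1 = ∏_{e ∣ m} Φ_e(x).
-- cycList m = [Φ_1 , … , Φ_m]  (each trimmed, monic).
cycList : ℕ → List Poly
cycList zero    = []
cycList (suc m) =
  let prev = cycList m
      den  = foldr mulP [ + 1 ]
               (map proj₂ (filterᵇ (λ tp → (suc m % suc (proj₁ tp)) ≡ᵇ 0)
                                     (zip (upTo m) prev)))
  in prev ++ [ trim (quotMonic (trim den) (subP (xPow (suc m)) [ + 1 ])) ]

cyclotomic : ℕ → Poly
cyclotomic n = nthD [] (cycList n) (n ∸ 1)

-- "p(ζ^d) = c" for ζ a primitive n-th root of unity (n ≥ 1):
-- evaluating in ℚ(ζ) ≅ ℚ[x]/(Φ_n), ζ ↦ x, i.e. Φ_n ∣ p(x^d) - c.
EvalRootOfUnity : ℕ → ℕ → Poly → ℤ → Set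
EvalRootOfUnity n d p c =
  IsZeroP (remMonic (cyclotomic n) (subP (compose p (xPow d)) [ c ]))

qInt : ℕ → Poly
qInt n = replicate n (+ 1)

qFact : ℕ → Poly
qFact zero    = [ + 1 ]
qFact (suc n) = mulP (qFact n) (qInt (suc n))

toPoly : List ℕ → Poly
toPoly = map (λ n → + n)

data Step : Set where
  N E : Step

words : ℕ → List (List Step)
words zero    = [ [] ]
words (suc m) = concatMap (λ w → (N ∷ w) ∷ (E ∷ w) ∷ []) (words m)

countN countE : List Step → ℕ
countN []      = 0
countN (N ∷ w) = suc (countN w)
countN (E ∷ w) = countN w
countE []      = 0
countE (N ∷ w) = countE w
countE (E ∷ w) = suc (countE w)

aboveᵇ : ℕ → ℕ → ℕ → ℕ → Bool
aboveᵇ a b x y = (a * x) ≤ᵇ (b * y)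

staysAbove : ℕ → ℕ → ℕ → ℕ → List Step → Bool
staysAbove a b x y []      = aboveᵇ a b x y
staysAbove a b x y (N ∷ w) = aboveᵇ a b x y ∧ staysAbove a b x (suc y) w
staysAbove a b x y (E ∷ w) = aboveᵇ a b x y ∧ staysAbove a b (suc x) y w

isDyckᵇ : ℕ → ℕ → List Step → Bool
isDyckᵇ a b w = (countN w ≡ᵇ a) ∧ (countE w ≡ᵇ b) ∧ staysAbove a b 0 0 w

dyckPaths : ℕ → ℕ → List (List Step)
dyckPaths a b = filterᵇ (isDyckᵇ a b) (words (a + b))

-- heights y_1, …, y_b of the east steps (y_i = y-coordinate of the
-- i-th east step; its east endpoint is (i , y_i))
eastHeights : ℕ → List Step → List ℕ
eastHeights y []      = []
eastHeights y (N ∷ w) = eastHeights (suc y) w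
eastHeights y (E ∷ w) = y ∷ eastHeights y w

yAt : List Step → ℕ → ℕ
yAt w i = nthD 0 (eastHeights 0 w) (i ∸ 1)

-- x-coordinates of the valleys (a valley is the east endpoint (x0 , y_x0)
-- of an east step which is immediately followed by a north step)
valleysFrom : ℕ → List Step → List ℕ
valleysFrom x []            = []
valleysFrom x (N ∷ w)       = valleysFrom x w
valleysFrom x (E ∷ [])      = []
valleysFrom x (E ∷ N ∷ w)   = suc x ∷ valleysFrom (suc x) (N ∷ w)
valleysFrom x (E ∷ E ∷ w)   = valleysFrom (suc x) (E ∷ w)

valleys : List Step → List ℕ
valleys = valleysFrom 0

-- The laser from the valley P = (x0 , y0) has points (x , y0 + a(x-x0)/b).
-- It first meets D on the east step j (between x = j-1 and x = j, at
-- height y_j), where j is the least j > x0 with a(j-x0) > b(y_j - y0):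
-- the laser is strictly below D over the columns x0 < x ≤ j-1 and
-- strictly above height y_j at x = j.  (Default b; never reached for
-- Dyck paths.)
firstHitFrom : ℕ → ℕ → List Step → ℕ → ℕ → List ℕ → ℕ
firstHitFrom a b w x0 y0 []       = b
firstHitFrom a b w x0 y0 (j ∷ js) =
  if (b * (yAt w j ∸ y0)) <ᵇ (a * (j ∸ x0)) then j else firstHitFrom a b w x0 y0 js

laserHitStep : ℕ → ℕ → List Step → ℕ → ℕ
laserHitStep a b w x0 = firstHitFrom a b w x0 (yAt w x0) (map (λ t → suc (x0 + t)) (upTo (b ∸ x0)))

-- Label i sits at (i , y_i - ε).  It lies in the region cut off from the
-- rest by the laser ℓ(P) (between ℓ(P) and D) iff its x-coordinate lies
-- strictly inside the horizontal extent of ℓ(P) (x0 < i < hit point,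
-- i.e. i < j) and it lies strictly above the laser:
-- b (y_i - y0) > a (i - x0).
cutOffᵇ : ℕ → ℕ → List Step → ℕ → ℕ → Bool
cutOffᵇ a b w x0 i =
  (x0 <ᵇ i) ∧ (i <ᵇ laserHitStep a b w x0) ∧
  ((a * (i ∸ x0)) <ᵇ (b * (yAt w i ∸ yAt w x0)))

sameBlockᵇ : ℕ → ℕ → List Step → ℕ → ℕ → Bool
sameBlockᵇ a b w i j = all (λ x0 → not (cutOffᵇ a b w x0 i xor cutOffᵇ a b w x0 j)) (valleys w)

-- Set partitions of [n] = {1,…,n}, represented by their equivalence
-- relation as an n×n Boolean matrix: row r, column s (0-based) says
-- whether r+1 ∼ s+1.

SetPartition : Set
SetPartition = List (List Bool)

_≟SP_ : (p q : SetPartition) → Relation.Nullary.Dec (p ≡ q)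
_≟SP_ = LP.≡-dec (LP.≡-dec BP._≟_)
  where import Relation.Nullary

rel : SetPartition → ℕ → ℕ → Bool
rel π r s = nthD false (nthD [] π r) s

πD : ℕ → ℕ → List Step → SetPartition
πD a b w = map (λ r → map (λ s → sameBlockᵇ a b w (suc r) (suc s)) (upTo (b ∸ 1))) (upTo (b ∸ 1))

-- number of blocks of a partition of [n]: number of elements that are the
-- least element of their block
numBlocks : ℕ → SetPartition → ℕ
numBlocks n π = length (filterᵇ (λ r → not (any (λ s → rel π s r) (upTo r))) (upTo n))

NCk : ℕ → ℕ → ℕ → List SetPartition
NCk a b k = deduplicate _≟SP_
  (filterᵇ (λ π → numBlocks (b ∸ 1) π ≡ᵇ k) (map (πD a b) (dyckPaths a b)))

-- rot acting on a partition of [n]: the block B is sent to rot(B), where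
-- rot(i) = i+1 (i<n), rot(n) = 1.  So i ∼' j iff rot⁻¹ i ∼ rot⁻¹ j.
rotInv : ℕ → ℕ → ℕ
rotInv n zero    = n ∸ 1
rotInv n (suc r) = r

rot : ℕ → SetPartition → SetPartition
rot n π = map (λ r → map (λ s → rel π (rotInv n r) (rotInv n s)) (upTo n)) (upTo n)

fixedCount : ℕ → ℕ → ℕ → ℕ → ℕ
fixedCount a b k d =
  length (filterᵇ (λ π → does (iter (rot (b ∸ 1)) d π ≟SP π)) (NCk a b k))

{-# OPTIONS --safe #-}
-- Put n = b − 1.  X is the integral combination u [a,k] [n,k−1] + v [b,k] [a−1,k−1] of products of
-- Gaussian binomials, where u [a]_q + v [b]_q = 1, and it satisfies [k]_q X = F := [a−1,k−1] [n,k−1].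
-- F is unimodal, by an sl₂-action on functions on pairs of binary words, and (1 − q^k) X = (1 − q) F
-- turns this into nonnegativity of the coefficients of X.  In ℤ[x]/(Φ_n) the element ω = x^d has order
-- m = n / gcd(d, n), no factor 1 − ω^j with 0 < j < m is a zero divisor, and q-Lucas evaluates X at ω.
--
-- A path with heights y has the walk S(i) = b y_i − a i.  The laser description says that labels i and j
-- lie in one block iff the last positions before i and before j at which S is smaller coincide (their
-- parents); this determines the path, and rotation moves the north run at the parent of the last label to
-- the origin.  A partition is fixed by rot^d iff it is fixed by rot^q with q = gcd(d, n).  If m ≥ 2, the
-- fixed partitions correspond to the q-periodic words z of naturals with s ≤ a, where s is the sum of n
-- consecutive letters: the positive letters are the ranks of the non-central blocks, and a − s is the rank
-- of the central block (absent if 0).  So the number of blocks is m times the number of positive letters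
-- in a period, plus 1 if s < a, and counting words gives the value of X at ω.  If m = 1, everything is
-- fixed, and the cycle lemma counts the paths with k north runs.
module Submission where

open import Defs
open import Data.Nat using (ℕ; _<_; _≤_; _∸_)
open import Data.Nat.Coprimality using (Coprime)
open import Data.List using (List)
open import Data.Product using (Σ; _×_)
open import Data.Integer using (+_)

open import Algebra.Bundles using (CommutativeRing)
import Algebra.Properties.AbelianGroup as AbProps
import Algebra.Properties.Ring as RingProps
import Algebra.Properties.Semiring.Exp as Exp
import Algebra.Properties.Semiring.Mult.TCOptimised as Mult
import Algebra.Solver.Ring
open import Algebra.Solver.Ring.AlmostCommutativeRing using (_-Raw-AlmostCommutative⟶_; fromCommutativeRing)
open import Data.Integer as ℤ using (-[1+_]; ℤ)
import Data.Integer.Properties as ℤₚ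
open import Data.Maybe using (Maybe; just; nothing)
open import Data.Nat as ℕ using (suc; s≤s; zero; z≤n)
open import Data.Nat.GCD using (gcd; gcd-GCD; module Bézout)
import Data.Nat.Properties as ℕₚ
open import Data.Product using (_,_; ∃; ∃₂)
open import Level using (0ℓ)
open import Relation.Binary.PropositionalEquality as ≡ using (_≡_)
import Relation.Binary.Reasoning.Setoid as SetoidReasoning
open import Relation.Nullary using (no; yes)

-- Irreducibility of Φ_n never enters. Coprimality of two polynomials is replaced by the statement
-- that their ideal contains a positive integer. Positive integers cancel modulo a monic polynomial,
-- so this gives both the exactness of the divisions that define Φ_n and the regularity of the
-- factors 1 - ω^j. On the combinatorial side the obstacle is that a path has an origin while
-- rotation has none: the run that opens the central block stands at the origin of some rotated
-- paths and elsewhere in others. Words and paths are therefore compared through kinship of labels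
-- on a periodic walk over ℕ, which is compatible with translation. A word is translated until it
-- can be cut open into a path, and a fixed path is rotated until its runs are periodic away from
-- the origin. Over n letters the walk of z changes by a - b r, with r the rank of the central
-- block, so it drifts downwards exactly when there is a central block; this decides where to cut.
-- The condition m ≥ 2 gives 2q ≤ n, which keeps positions less than 2q apart distinct modulo n.

-- Equations in commutative rings, with integer constants

module Solver (R : CommutativeRing 0ℓ 0ℓ) where
  open CommutativeRing R hiding (zero)
  open Mult semiring using (×-homo-+; ×1-homo-*; 1+×) renaming (_×_ to _×ₙ_)
  open RingProps ring using (-‿distribˡ-*; -‿distribʳ-*; -0#≈0#; -‿involutive)
  open AbProps +-abelianGroup using (⁻¹-∙-comm)
  open import Relation.Binary.Reasoning.Setoid setoid

  ⟦_⟧ℤ : ℤ → Carrier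
  ⟦ + n ⟧ℤ = n ×ₙ 1#
  ⟦ -[1+ n ] ⟧ℤ = - (suc n ×ₙ 1#)

  neg-hom : ∀ i → ⟦ ℤ.- i ⟧ℤ ≈ - ⟦ i ⟧ℤ
  neg-hom (+ zero) = sym -0#≈0#
  neg-hom (+ suc n) = refl
  neg-hom (-[1+ n ]) = sym (-‿involutive _)

  private
    cancel₁ : ∀ x y → (1# + x) - (1# + y) ≈ x - y
    cancel₁ x y = begin
      (1# + x) - (1# + y)      ≈⟨ +-cong (+-comm 1# x) (sym (⁻¹-∙-comm 1# y)) ⟩
      (x + 1#) + (- 1# - y)    ≈⟨ +-assoc x 1# _ ⟩
      x + (1# + (- 1# - y))    ≈⟨ +-congˡ (sym (+-assoc 1# (- 1#) (- y))) ⟩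
      x + (1# - 1# - y)        ≈⟨ +-congˡ (+-congʳ (-‿inverseʳ 1#)) ⟩
      x + (0# - y)             ≈⟨ +-congˡ (+-identityˡ _) ⟩
      x - y ∎

  ⊖-hom : ∀ m n → ⟦ m ℤ.⊖ n ⟧ℤ ≈ (m ×ₙ 1#) - (n ×ₙ 1#)
  ⊖-hom m zero = sym (trans (+-congˡ -0#≈0#) (+-identityʳ _))
  ⊖-hom zero (suc n) = sym (+-identityˡ _)
  ⊖-hom (suc m) (suc n) = begin
    ⟦ suc m ℤ.⊖ suc n ⟧ℤ               ≡⟨ ≡.cong ⟦_⟧ℤ (ℤₚ.[1+m]⊖[1+n]≡m⊖n m n) ⟩
    ⟦ m ℤ.⊖ n ⟧ℤ                       ≈⟨ ⊖-hom m n ⟩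
    (m ×ₙ 1#) - (n ×ₙ 1#)                ≈⟨ sym (cancel₁ _ _) ⟩
    (1# + m ×ₙ 1#) - (1# + n ×ₙ 1#)      ≈⟨ +-cong (sym (1+× m 1#)) (-‿cong (sym (1+× n 1#))) ⟩
    (suc m ×ₙ 1#) - (suc n ×ₙ 1#) ∎

  +-hom : ∀ i j → ⟦ i ℤ.+ j ⟧ℤ ≈ ⟦ i ⟧ℤ + ⟦ j ⟧ℤ
  +-hom (+ m) (+ n) = ×-homo-+ 1# m n
  +-hom (+ m) (-[1+ n ]) = ⊖-hom m (suc n)
  +-hom (-[1+ m ]) (+ n) = trans (⊖-hom n (suc m)) (+-comm _ _)
  +-hom (-[1+ m ]) (-[1+ n ]) = begin
    - (suc (suc (m ℕ.+ n)) ×ₙ 1#)        ≡⟨ ≡.cong (λ k → - (suc k ×ₙ 1#)) (≡.sym (ℕₚ.+-suc m n)) ⟩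
    - ((suc m ℕ.+ suc n) ×ₙ 1#)          ≈⟨ -‿cong (×-homo-+ 1# (suc m) (suc n)) ⟩
    - ((suc m ×ₙ 1#) + (suc n ×ₙ 1#))     ≈⟨ sym (⁻¹-∙-comm _ _) ⟩
    - (suc m ×ₙ 1#) - (suc n ×ₙ 1#) ∎
    where import Data.Nat.Properties as ℕₚ

  private
    +*-hom : ∀ m j → ⟦ + m ℤ.* j ⟧ℤ ≈ (m ×ₙ 1#) * ⟦ j ⟧ℤ
    +*-hom m (+ n) = trans (reflexive (≡.cong ⟦_⟧ℤ (≡.sym (ℤₚ.pos-* m n)))) (×1-homo-* m n)
    +*-hom m (-[1+ n ]) = begin
      ⟦ + m ℤ.* -[1+ n ] ⟧ℤ               ≡⟨ ≡.cong ⟦_⟧ℤ (≡.sym (ℤₚ.neg-distribʳ-* (+ m) (+ suc n))) ⟩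
      ⟦ ℤ.- (+ m ℤ.* + suc n) ⟧ℤ          ≈⟨ neg-hom (+ m ℤ.* + suc n) ⟩
      - ⟦ + m ℤ.* + suc n ⟧ℤ              ≈⟨ -‿cong (+*-hom m (+ suc n)) ⟩
      - ((m ×ₙ 1#) * (suc n ×ₙ 1#))         ≈⟨ -‿distribʳ-* _ _ ⟩
      (m ×ₙ 1#) * - (suc n ×ₙ 1#) ∎

  *-hom : ∀ i j → ⟦ i ℤ.* j ⟧ℤ ≈ ⟦ i ⟧ℤ * ⟦ j ⟧ℤ
  *-hom (+ m) j = +*-hom m j
  *-hom (-[1+ m ]) j = begin
    ⟦ -[1+ m ] ℤ.* j ⟧ℤ                 ≡⟨ ≡.cong ⟦_⟧ℤ (≡.sym (ℤₚ.neg-distribˡ-* (+ suc m) j)) ⟩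
    ⟦ ℤ.- (+ suc m ℤ.* j) ⟧ℤ            ≈⟨ neg-hom (+ suc m ℤ.* j) ⟩
    - ⟦ + suc m ℤ.* j ⟧ℤ                ≈⟨ -‿cong (+*-hom (suc m) j) ⟩
    - ((suc m ×ₙ 1#) * ⟦ j ⟧ℤ)           ≈⟨ -‿distribˡ-* _ _ ⟩
    - (suc m ×ₙ 1#) * ⟦ j ⟧ℤ ∎

  private
    morphism : ℤ.+-*-rawRing -Raw-AlmostCommutative⟶ fromCommutativeRing R
    morphism = record { ⟦_⟧ = ⟦_⟧ℤ ; +-homo = +-hom ; *-homo = *-hom ; -‿homo = neg-hom
                      ; 0-homo = refl ; 1-homo = refl }
    dec : ∀ i j → Maybe (⟦ i ⟧ℤ ≈ ⟦ j ⟧ℤ)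
    dec i j with i ℤ.≟ j
    ... | yes p = just (reflexive (≡.cong ⟦_⟧ℤ p))
    ... | no _ = nothing

  open Algebra.Solver.Ring ℤ.+-*-rawRing (fromCommutativeRing R) morphism dec public
    using (solve; _:=_; _:+_; _:*_; _:-_; :-_; con; _:^_)

-- Quotient rings, powers and comaximality

module Quotient (R : CommutativeRing 0ℓ 0ℓ) (g : CommutativeRing.Carrier R) where
  open CommutativeRing R hiding (zero)
  open Solver R
  open SetoidReasoning setoid

  infix 4 _~_
  -- The cofactor is kept as data: an equation of the quotient ring can be turned back into a
  -- divisibility of polynomials.
  record _~_ (x y : Carrier) : Set where
    constructor modBy
    field factor : Carrier
          eq : x ≈ y + factor * g
  open _~_ public

  ≈⇒~ : ∀ {x y} → x ≈ y → x ~ y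
  ≈⇒~ e = modBy 0# (trans e (solve 2 (λ y g → y := y :+ con (+ 0) :* g) refl _ g))

  ~-sym : ∀ {x y} → x ~ y → y ~ x
  ~-sym {x} {y} (modBy u e) = modBy (- u) (begin
    y ≈⟨ solve 3 (λ y u g → y := (y :+ u :* g) :+ (:- u) :* g) refl y u g ⟩
    (y + u * g) + (- u) * g ≈⟨ +-congʳ (sym e) ⟩
    x + (- u) * g ∎)

  ~-trans : ∀ {x y z} → x ~ y → y ~ z → x ~ z
  ~-trans {x} {y} {z} (modBy u e) (modBy v f) = modBy (u + v) (begin
    x ≈⟨ e ⟩
    y + u * g ≈⟨ +-congʳ f ⟩
    (z + v * g) + u * g ≈⟨ solve 4 (λ z v u g → (z :+ v :* g) :+ u :* g := z :+ (u :+ v) :* g) refl z v u g ⟩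
    z + (u + v) * g ∎)

  +-cong~ : ∀ {x y z w} → x ~ y → z ~ w → (x + z) ~ (y + w)
  +-cong~ {x} {y} {z} {w} (modBy u e) (modBy v f) = modBy (u + v) (trans (+-cong e f)
    (solve 5 (λ y w u v g → (y :+ u :* g) :+ (w :+ v :* g) := (y :+ w) :+ (u :+ v) :* g) refl y w u v g))

  *-cong~ : ∀ {x y z w} → x ~ y → z ~ w → (x * z) ~ (y * w)
  *-cong~ {x} {y} {z} {w} (modBy u e) (modBy v f) = modBy (u * w + y * v + u * v * g) (trans (*-cong e f)
    (solve 5 (λ y w u v g → (y :+ u :* g) :* (w :+ v :* g)
                          := (y :* w) :+ (u :* w :+ y :* v :+ u :* v :* g) :* g) refl y w u v g))

  neg-cong~ : ∀ {x y} → x ~ y → (- x) ~ (- y)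
  neg-cong~ {x} {y} (modBy u e) = modBy (- u) (trans (-‿cong e)
    (solve 3 (λ y u g → :- (y :+ u :* g) := (:- y) :+ (:- u) :* g) refl y u g))

  quotientRing : CommutativeRing 0ℓ 0ℓ
  quotientRing = record
    { Carrier = Carrier ; _≈_ = _~_ ; _+_ = _+_ ; _*_ = _*_ ; -_ = -_ ; 0# = 0# ; 1# = 1#
    ; isCommutativeRing = record
      { isRing = record
        { +-isAbelianGroup = record
          { isGroup = record
            { isMonoid = record
              { isSemigroup = record
                { isMagma = record
                  { isEquivalence = record { refl = ≈⇒~ refl ; sym = ~-sym ; trans = ~-trans }
                  ; ∙-cong = +-cong~ }
                ; assoc = λ a b c → ≈⇒~ (+-assoc a b c) }
              ; identity = (λ a → ≈⇒~ (+-identityˡ a)) , (λ a → ≈⇒~ (+-identityʳ a)) }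
            ; inverse = (λ a → ≈⇒~ (-‿inverseˡ a)) , (λ a → ≈⇒~ (-‿inverseʳ a))
            ; ⁻¹-cong = neg-cong~ }
          ; comm = λ a b → ≈⇒~ (+-comm a b) }
        ; *-cong = *-cong~
        ; *-assoc = λ a b c → ≈⇒~ (*-assoc a b c)
        ; *-identity = (λ a → ≈⇒~ (*-identityˡ a)) , (λ a → ≈⇒~ (*-identityʳ a))
        ; distrib = (λ a b c → ≈⇒~ (distribˡ a b c)) , (λ a b c → ≈⇒~ (distribʳ a b c)) }
      ; *-comm = λ a b → ≈⇒~ (*-comm a b) } }

module Powers (R : CommutativeRing 0ℓ 0ℓ) where
  open CommutativeRing R hiding (zero)
  open Solver R
  open SetoidReasoning setoid
  open Exp semiring public using (_^_; ^-homo-*; ^-assocʳ)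
  open RingProps ring using (-‿distribˡ-*)

  -- The sum `1 + z + … + z^(t−1)` in Horner form, that is, the q-integer of `t` at `q = z`.
  geom : Carrier → ℕ → Carrier
  geom z zero    = 0#
  geom z (suc t) = 1# + z * geom z t

  geom-telescope : ∀ z t → (z - 1#) * geom z t ≈ z ^ t - 1#
  geom-telescope z zero = solve 1 (λ z → (z :- con (+ 1)) :* con (+ 0) := con (+ 1) :- con (+ 1)) refl z
  geom-telescope z (suc t) = begin
    (z - 1#) * (1# + z * geom z t)
      ≈⟨ solve 2 (λ z h → (z :- con (+ 1)) :* (con (+ 1) :+ z :* h)
           := (z :- con (+ 1)) :+ z :* ((z :- con (+ 1)) :* h)) refl z (geom z t) ⟩
    (z - 1#) + z * ((z - 1#) * geom z t) ≈⟨ +-congˡ (*-congˡ (geom-telescope z t)) ⟩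
    (z - 1#) + z * (z ^ t - 1#)
      ≈⟨ solve 2 (λ z p → (z :- con (+ 1)) :+ z :* (p :- con (+ 1)) := z :* p :- con (+ 1)) refl z (z ^ t) ⟩
    z * z ^ t - 1# ∎

  natTimes : ℕ → Carrier
  natTimes zero    = 0#
  natTimes (suc t) = 1# + natTimes t

  -- The geometric sum is congruent to its number of terms modulo z − 1.
  geomDefect : Carrier → ℕ → Carrier
  geomDefect z zero    = 0#
  geomDefect z (suc t) = natTimes t + z * geomDefect z t

  geom-mod : ∀ z t → geom z t ≈ natTimes t + geomDefect z t * (z - 1#)
  geom-mod z zero = solve 1 (λ z → con (+ 0) := con (+ 0) :+ con (+ 0) :* (z :- con (+ 1))) refl z
  geom-mod z (suc t) = trans (+-congˡ (*-congˡ (geom-mod z t)))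
    (solve 3 (λ z n s → con (+ 1) :+ z :* (n :+ s :* (z :- con (+ 1)))
      := (con (+ 1) :+ n) :+ (n :+ z :* s) :* (z :- con (+ 1))) refl z (natTimes t) (geomDefect z t))

  pow-multiple : ∀ z u j → z ^ (u ℕ.* j) - 1# ≈ geom (z ^ j) u * (z ^ j - 1#)
  pow-multiple z u j = begin
    z ^ (u ℕ.* j) - 1#    ≡⟨ ≡.cong (λ k → z ^ k - 1#) (ℕₚ.*-comm u j) ⟩
    z ^ (j ℕ.* u) - 1#    ≈⟨ +-congʳ (sym (^-assocʳ z j u)) ⟩
    (z ^ j) ^ u - 1#      ≈⟨ sym (geom-telescope (z ^ j) u) ⟩
    (z ^ j - 1#) * geom (z ^ j) u ≈⟨ *-comm _ _ ⟩
    geom (z ^ j) u * (z ^ j - 1#) ∎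

  private
    -- Bézout in the exponents: from `g + y j = x i`, the element `z^g − 1` is the difference of
    -- `z^(x i) − 1` and `z^g (z^(y j) − 1)`, and each of these is a multiple of one generator.
    -- Bézout coefficients are natural numbers here, so the caller treats two signs.
    step : ∀ z g i j y x → g ℕ.+ y ℕ.* j ≡.≡ x ℕ.* i →
           z ^ g - 1# ≈ geom (z ^ i) x * (z ^ i - 1#) + (- (z ^ g * geom (z ^ j) y)) * (z ^ j - 1#)
    step z g i j y x e = begin
      z ^ g - 1#
        ≈⟨ solve 2 (λ p q → p :- con (+ 1) := (p :* q :- con (+ 1)) :- p :* (q :- con (+ 1))) refl (z ^ g) (z ^ (y ℕ.* j)) ⟩
      (z ^ g * z ^ (y ℕ.* j) - 1#) - z ^ g * (z ^ (y ℕ.* j) - 1#)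
        ≈⟨ +-cong (+-congʳ (trans (sym (^-homo-* z g (y ℕ.* j))) (reflexive (≡.cong (z ^_) e))))
                  (-‿cong (*-congˡ (pow-multiple z y j))) ⟩
      (z ^ (x ℕ.* i) - 1#) - z ^ g * (geom (z ^ j) y * (z ^ j - 1#))
        ≈⟨ +-congʳ (pow-multiple z x i) ⟩
      geom (z ^ i) x * (z ^ i - 1#) - z ^ g * (geom (z ^ j) y * (z ^ j - 1#))
        ≈⟨ solve 4 (λ a p h c → a :- p :* (h :* c) := a :+ (:- (p :* h)) :* c) refl _ (z ^ g) _ _ ⟩
      geom (z ^ i) x * (z ^ i - 1#) + (- (z ^ g * geom (z ^ j) y)) * (z ^ j - 1#) ∎

  pow-gcd : ∀ z i j → ∃₂ λ α β → z ^ gcd i j - 1# ≈ α * (z ^ i - 1#) + β * (z ^ j - 1#)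
  pow-gcd z i j with Bézout.identity (gcd-GCD i j)
  ... | Bézout.+- x y e = _ , _ , step z (gcd i j) i j y x e
  ... | Bézout.-+ x y e = _ , _ , trans (step z (gcd i j) j i x y e) (+-comm _ _)

module Comaximality (R : CommutativeRing 0ℓ 0ℓ) where
  open CommutativeRing R hiding (zero)
  open Solver R
  open Powers R using (natTimes; geom; geomDefect; geom-mod; geom-telescope; pow-gcd; _^_; ^-assocʳ)
  open SetoidReasoning setoid

  natTimes-+ : ∀ m n → natTimes (m ℕ.+ n) ≈ natTimes m + natTimes n
  natTimes-+ zero    n = sym (+-identityˡ _)
  natTimes-+ (suc m) n = trans (+-congˡ (natTimes-+ m n)) (sym (+-assoc _ _ _))

  natTimes-* : ∀ m n → natTimes (m ℕ.* n) ≈ natTimes m * natTimes n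
  natTimes-* zero    n = sym (zeroˡ _)
  natTimes-* (suc m) n = trans (natTimes-+ n (m ℕ.* n)) (trans (+-congˡ (natTimes-* m n))
    (solve 2 (λ m n → n :+ m :* n := (con (+ 1) :+ m) :* n) refl (natTimes m) (natTimes n)))

  -- The ideal (f , g) contains a positive integer.
  record Comaximal (f g : Carrier) : Set where
    constructor comax
    field
      t   : ℕ
      u v : Carrier
      eq  : u * f + v * g ≈ natTimes (suc t)

  comax-sym : ∀ {f g} → Comaximal f g → Comaximal g f
  comax-sym (comax t u v e) = comax t v u (trans (+-comm _ _) e)

  comax-multiple : ∀ {f g h} w → f ≈ w * h → Comaximal f g → Comaximal h g
  comax-multiple {f} {g} {h} w f≈ (comax t u v e) = comax t (u * w) v (trans (+-congʳ
    (trans (*-assoc _ _ _) (*-congˡ (sym f≈)))) e)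

  comax-mul : ∀ {f g h} → Comaximal f h → Comaximal g h → Comaximal (f * g) h
  comax-mul {f} {g} {h} (comax t u v e) (comax s u′ v′ e′) =
    comax (s ℕ.+ t ℕ.* suc s) (u * u′) (u * f * v′ + v * u′ * g + v * v′ * h) (begin
      u * u′ * (f * g) + (u * f * v′ + v * u′ * g + v * v′ * h) * h
        ≈⟨ solve 7 (λ f g h u u′ v v′ → u :* u′ :* (f :* g) :+ (u :* f :* v′ :+ v :* u′ :* g :+ v :* v′ :* h) :* h
             := (u :* f :+ v :* h) :* (u′ :* g :+ v′ :* h)) refl f g h u u′ v v′ ⟩
      (u * f + v * h) * (u′ * g + v′ * h) ≈⟨ *-cong e e′ ⟩
      natTimes (suc t) * natTimes (suc s) ≈⟨ sym (natTimes-* (suc t) (suc s)) ⟩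
      natTimes (suc t ℕ.* suc s) ∎)

  -- Over the integers, two comaximal divisors of `p` only make an integer multiple of `p` divisible
  -- by their product. The integer is removed later, when the divisors are monic.
  comax-divides : ∀ {f g} ((comax t _ _ _) : Comaximal f g) {p a b} → p ≈ a * f → p ≈ b * g →
    ∃ λ w → natTimes (suc t) * p ≈ w * (f * g)
  comax-divides {f} {g} (comax t u v e) {p} {a} {b} p≈af p≈bg = u * b + v * a , (begin
    natTimes (suc t) * p ≈⟨ *-congʳ (sym e) ⟩
    (u * f + v * g) * p ≈⟨ distribʳ _ _ _ ⟩
    u * f * p + v * g * p ≈⟨ +-cong (*-congˡ p≈bg) (*-congˡ p≈af) ⟩
    u * f * (b * g) + v * g * (a * f)
      ≈⟨ solve 6 (λ f g u v a b → u :* f :* (b :* g) :+ v :* g :* (a :* f) := (u :* b :+ v :* a) :* (f :* g)) refl f g u v a b ⟩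
    (u * b + v * a) * (f * g) ∎)

  -- With g = gcd(e, j), the quotient (x^e − 1)/(x^g − 1) is a multiple of F and is congruent
  -- to e/g modulo x^g − 1, which lies in the ideal (x^j − 1, x^e − 1).
  cofactor-comaximal : ∀ x e j t g {D F w} → gcd e j ≡.≡ g → e ≡.≡ suc t ℕ.* g → D * F ≈ x ^ e - 1# →
    D ≈ w * (x ^ g - 1#) → (∀ f → f * (x ^ g - 1#) ≈ 0# → f ≈ 0#) → Comaximal F (x ^ j - 1#)
  cofactor-comaximal x e j t _ {D} {F} {w} ≡.refl e≡ DF≈ D≈ cancel with pow-gcd x e j
  -- `w F` is the geometric sum `h`, and `h` is `suc t` plus `s G`. Replacing `G` by its expression
  -- in `D F` and `J` from `pow-gcd` and solving for `suc t` gives these coefficients.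
  ... | α , β , pg = comax t (w - s * α * D) (- (s * β)) (begin
      (w - s * α * D) * F + (- (s * β)) * J
        ≈⟨ solve 7 (λ w s α D F β J → (w :- s :* α :* D) :* F :+ (:- (s :* β)) :* J
             := w :* F :- s :* (α :* (D :* F) :+ β :* J)) refl w s α D F β J ⟩
      w * F - s * (α * (D * F) + β * J)
        ≈⟨ +-cong θ≈ (-‿cong (*-congˡ (trans (+-congʳ (*-congˡ DF≈)) (sym pg)))) ⟩
      geom z (suc t) - s * G ≈⟨ +-congʳ (geom-mod z (suc t)) ⟩
      (natTimes (suc t) + s * G) - s * G
        ≈⟨ solve 2 (λ n a → (n :+ a) :- a := n) refl (natTimes (suc t)) (s * G) ⟩
      natTimes (suc t) ∎)
    where
    z = x ^ gcd e j
    G = z - 1#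
    J = x ^ j - 1#
    s = geomDefect z (suc t)
    h = geom z (suc t)
    -- Multiplied by `G`, both sides become `x^e − 1`; the hypothesis `cancel` removes `G`.
    θ≈ : w * F ≈ h
    θ≈ = begin
      w * F ≈⟨ solve 2 (λ a b → a := (a :- b) :+ b) refl (w * F) h ⟩
      (w * F - h) + h ≈⟨ +-congʳ (cancel _ (begin
        (w * F - h) * G ≈⟨ solve 4 (λ w F h G → (w :* F :- h) :* G := w :* G :* F :- G :* h) refl w F h G ⟩
        w * G * F - G * h ≈⟨ +-cong (*-congʳ (sym D≈)) (-‿cong (geom-telescope z (suc t))) ⟩
        D * F - (z ^ suc t - 1#) ≈⟨ +-cong DF≈ (-‿cong (+-congʳ (trans (^-assocʳ x (gcd e j) (suc t))
              (reflexive (≡.cong (x ^_) (≡.trans (ℕₚ.*-comm (gcd e j) (suc t)) (≡.sym e≡))))))) ⟩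
        (x ^ e - 1#) - (x ^ e - 1#) ≈⟨ -‿inverseʳ _ ⟩
        0# ∎)) ⟩
      0# + h ≈⟨ +-identityˡ h ⟩
      h ∎

-- Gaussian binomials and their values at roots of unity

choose : ℕ → ℕ → ℕ
choose n       zero    = 1
choose zero    (suc k) = 0
choose (suc n) (suc k) = choose n k ℕ.+ choose n (suc k)

module QBinomials (R : CommutativeRing 0ℓ 0ℓ) (ω : CommutativeRing.Carrier R) where
  open CommutativeRing R hiding (zero)
  open Solver R
  open Powers R
  open Comaximality R using (natTimes-+; natTimes-*)
  open SetoidReasoning setoid

  [_] : ℕ → Carrier
  [ n ] = geom ω n

  [_]! : ℕ → Carrier
  [ zero ]!  = 1#
  [ suc n ]! = [ n ]! * [ suc n ]

  -- The Gaussian binomial through q-Pascal, without division: it keeps its meaning at roots of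
  -- unity, where the factorials in the quotient formula vanish.
  G : ℕ → ℕ → Carrier
  G n       zero    = 1#
  G zero    (suc k) = 0#
  G (suc n) (suc k) = G n k + ω ^ suc k * G n (suc k)

  []-+ : ∀ m n → [ m ℕ.+ n ] ≈ [ m ] + ω ^ m * [ n ]
  []-+ zero n = sym (trans (+-identityˡ _) (*-identityˡ _))
  []-+ (suc m) n = trans (+-congˡ (*-congˡ ([]-+ m n)))
    (solve 4 (λ w a p b → con (+ 1) :+ w :* (a :+ p :* b) := (con (+ 1) :+ w :* a) :+ (w :* p) :* b) refl ω [ m ] (ω ^ m) [ n ])

  G-zero : ∀ {n k} → n < k → G n k ≈ 0#
  G-zero {zero} {suc k} _ = refl
  G-zero {suc n} {suc k} (s≤s lt) = trans (+-cong (G-zero lt) (*-congˡ (G-zero (ℕₚ.m≤n⇒m≤1+n lt))))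
    (trans (+-identityˡ _) (zeroʳ _))

  G-diag : ∀ n → G n n ≈ 1#
  G-diag zero = refl
  G-diag (suc n) = trans (+-cong (G-diag n) (*-congˡ (G-zero {n} ℕₚ.≤-refl)))
    (trans (+-congˡ (zeroʳ _)) (+-identityʳ _))

  -- The two Pascal terms contribute `[ suc i ]` and `ω ^ suc i * [ suc j ]` times the same
  -- factorial, and `[]-+` adds these to the last factor of `[ suc i + suc j ]!`.
  G-factorial : ∀ i j → G (i ℕ.+ j) i * ([ i ]! * [ j ]!) ≈ [ i ℕ.+ j ]!
  G-factorial zero j = trans (*-identityˡ _) (*-identityˡ _)
  G-factorial (suc i) zero rewrite ℕₚ.+-identityʳ i =
    trans (*-cong (G-diag (suc i)) (*-identityʳ _)) (*-identityˡ _)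
  G-factorial (suc i) (suc j) = begin
    (G (i ℕ.+ suc j) i + ω ^ suc i * G (i ℕ.+ suc j) (suc i)) * ([ i ]! * [ suc i ] * ([ j ]! * [ suc j ]))
      ≈⟨ solve 7 (λ g h p a b c d → (g :+ p :* h) :* (a :* b :* (c :* d))
           := g :* (a :* (c :* d)) :* b :+ p :* d :* (h :* (a :* b :* c))) refl
           (G (i ℕ.+ suc j) i) (G (i ℕ.+ suc j) (suc i)) (ω ^ suc i) [ i ]! [ suc i ] [ j ]! [ suc j ] ⟩
    G (i ℕ.+ suc j) i * ([ i ]! * ([ j ]! * [ suc j ])) * [ suc i ]
      + ω ^ suc i * [ suc j ] * (G (i ℕ.+ suc j) (suc i) * ([ suc i ]! * [ j ]!))
      ≈⟨ +-cong (*-congʳ (G-factorial i (suc j))) (*-congˡ second) ⟩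
    [ i ℕ.+ suc j ]! * [ suc i ] + ω ^ suc i * [ suc j ] * [ i ℕ.+ suc j ]!
      ≈⟨ solve 4 (λ f a p b → f :* a :+ p :* b :* f := f :* (a :+ p :* b)) refl [ i ℕ.+ suc j ]! [ suc i ] (ω ^ suc i) [ suc j ] ⟩
    [ i ℕ.+ suc j ]! * ([ suc i ] + ω ^ suc i * [ suc j ]) ≈⟨ *-congˡ (sym ([]-+ (suc i) (suc j))) ⟩
    [ i ℕ.+ suc j ]! * [ suc i ℕ.+ suc j ] ∎
    where
    second : G (i ℕ.+ suc j) (suc i) * ([ suc i ]! * [ j ]!) ≈ [ i ℕ.+ suc j ]!
    second rewrite ℕₚ.+-suc i j = G-factorial (suc i) j

  -- m is a multiple of the multiplicative order, with no zero divisors among the 1 − ω^j for 0 < j < m.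
  module RootOfUnity (m′ : ℕ) (ω^m≈1 : ω ^ suc m′ ≈ 1#)
                     (regular : ∀ j → 0 < j → j < suc m′ → ∀ f → (ω ^ j - 1#) * f ≈ 0# → f ≈ 0#) where
    private m = suc m′

    []-regular : ∀ j → 0 < j → j < m → ∀ f → [ j ] * f ≈ 0# → f ≈ 0#
    []-regular j 0<j j<m f e = regular j 0<j j<m f (begin
      (ω ^ j - 1#) * f ≈⟨ *-congʳ (sym (geom-telescope ω j)) ⟩
      (ω - 1#) * [ j ] * f ≈⟨ *-assoc _ _ _ ⟩
      (ω - 1#) * ([ j ] * f) ≈⟨ *-congˡ e ⟩
      (ω - 1#) * 0# ≈⟨ zeroʳ _ ⟩
      0# ∎)

    []!-regular : ∀ j → j < m → ∀ f → [ j ]! * f ≈ 0# → f ≈ 0#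
    []!-regular zero _ f e = trans (sym (*-identityˡ f)) e
    []!-regular (suc j) j<m f e = []-regular (suc j) (s≤s z≤n) j<m f
      ([]!-regular j (ℕₚ.<-trans (ℕₚ.n<1+n j) j<m) _ (trans (sym (*-assoc _ _ _)) e))

    [m]≈0 : 1 < m → [ m ] ≈ 0#
    [m]≈0 1<m = regular 1 (s≤s z≤n) 1<m [ m ] (begin
      (ω ^ 1 - 1#) * [ m ] ≈⟨ *-congʳ (+-congʳ (*-identityʳ ω)) ⟩
      (ω - 1#) * [ m ] ≈⟨ geom-telescope ω m ⟩
      ω ^ m - 1# ≈⟨ +-congʳ ω^m≈1 ⟩
      1# - 1# ≈⟨ -‿inverseʳ 1# ⟩
      0# ∎)

    -- `[ m ]!` contains the factor `[ m ]`, which is zero, whereas `[ j ]!` and `[ m − j ]!` are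
    -- built from regular factors only and can be cancelled.
    G-vanish : ∀ j → 0 < j → j < m → G m j ≈ 0#
    G-vanish j 0<j j<m = []!-regular i i<m (G m j) ([]!-regular j j<m _ (begin
      [ j ]! * ([ i ]! * G m j) ≈⟨ solve 3 (λ a b g → a :* (b :* g) := g :* (a :* b)) refl [ j ]! [ i ]! (G m j) ⟩
      G m j * ([ j ]! * [ i ]!) ≡⟨ ≡.cong (λ k → G k j * ([ j ]! * [ i ]!)) (≡.sym j+i) ⟩
      G (j ℕ.+ i) j * ([ j ]! * [ i ]!) ≈⟨ G-factorial j i ⟩
      [ j ℕ.+ i ]! ≡⟨ ≡.cong [_]! j+i ⟩
      [ m′ ]! * [ m ] ≈⟨ *-congˡ ([m]≈0 (ℕₚ.≤-<-trans 0<j j<m)) ⟩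
      [ m′ ]! * 0# ≈⟨ zeroʳ _ ⟩
      0# ∎))
      where
      i = m ℕ.∸ j
      j+i : j ℕ.+ i ≡ m
      j+i = ℕₚ.m+[n∸m]≡n (ℕₚ.<⇒≤ j<m)
      i<m : i < m
      i<m = ℕₚ.∸-monoʳ-< 0<j (ℕₚ.<⇒≤ j<m)

    ω^m+ : ∀ k → ω ^ (m ℕ.+ k) ≈ ω ^ k
    ω^m+ k = trans (^-homo-* ω m k) (trans (*-congʳ ω^m≈1) (*-identityˡ _))

    -- Row `m` has only its two end entries, as in `1 + y^m`. Starting Pascal's recursion from this
    -- row gives row `n + m` in terms of row `n`; the weights `ω ^ k` are unaffected by adding `m`
    -- to `k`. Below column `m` only the left end is felt, and `G-shift-high` has both.
    G-shift-low : ∀ n k → k < m → G (n ℕ.+ m) k ≈ G n k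
    G-shift-low n zero _ = refl
    G-shift-low zero (suc k) k<m = G-vanish (suc k) (s≤s z≤n) k<m
    G-shift-low (suc n) (suc k) k<m =
      +-cong (G-shift-low n k (ℕₚ.<-trans (ℕₚ.n<1+n k) k<m)) (*-congˡ (G-shift-low n (suc k) k<m))

    G-shift-high : ∀ n k → G (n ℕ.+ m) (m ℕ.+ k) ≈ G n (m ℕ.+ k) + G n k
    G-shift-high zero zero rewrite ℕₚ.+-identityʳ m′ = trans (G-diag m) (sym (+-identityˡ _))
    G-shift-high zero (suc k) = trans (G-zero {m} {m ℕ.+ suc k} (ℕₚ.m<m+n m (s≤s z≤n))) (sym (+-identityˡ _))
    G-shift-high (suc n) zero = begin
      G (n ℕ.+ m) (m′ ℕ.+ 0) + ω ^ (m ℕ.+ 0) * G (n ℕ.+ m) (m ℕ.+ 0)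
        ≈⟨ +-cong (G-shift-low n (m′ ℕ.+ 0) (ℕₚ.≤-reflexive (≡.cong suc (ℕₚ.+-identityʳ m′)))) (*-congˡ (G-shift-high n 0)) ⟩
      G n (m′ ℕ.+ 0) + ω ^ (m ℕ.+ 0) * (G n (m ℕ.+ 0) + 1#)
        ≈⟨ solve 3 (λ a p g → a :+ p :* (g :+ con (+ 1)) := (a :+ p :* g) :+ p) refl (G n (m′ ℕ.+ 0)) (ω ^ (m ℕ.+ 0)) (G n (m ℕ.+ 0)) ⟩
      (G n (m′ ℕ.+ 0) + ω ^ (m ℕ.+ 0) * G n (m ℕ.+ 0)) + ω ^ (m ℕ.+ 0) ≈⟨ +-congˡ (ω^m+ 0) ⟩
      G (suc n) (m ℕ.+ 0) + 1# ∎
    G-shift-high (suc n) (suc k) = begin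
      G (n ℕ.+ m) (m′ ℕ.+ suc k) + ω ^ (m ℕ.+ suc k) * G (n ℕ.+ m) (m ℕ.+ suc k)
        ≈⟨ +-cong lower (*-congˡ (G-shift-high n (suc k))) ⟩
      (G n (m′ ℕ.+ suc k) + G n k) + ω ^ (m ℕ.+ suc k) * (G n (m ℕ.+ suc k) + G n (suc k))
        ≈⟨ solve 5 (λ a b p c d → (a :+ b) :+ p :* (c :+ d) := (a :+ p :* c) :+ (b :+ p :* d)) refl _ _ _ _ _ ⟩
      G (suc n) (m ℕ.+ suc k) + (G n k + ω ^ (m ℕ.+ suc k) * G n (suc k))
        ≈⟨ +-congˡ (+-congˡ (*-congʳ (ω^m+ (suc k)))) ⟩
      G (suc n) (m ℕ.+ suc k) + G (suc n) (suc k) ∎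
      where
      lower : G (n ℕ.+ m) (m′ ℕ.+ suc k) ≈ G n (m′ ℕ.+ suc k) + G n k
      lower rewrite ℕₚ.+-suc m′ k = G-shift-high n k

    -- The q-Lucas theorem. Removing one block of `m` rows splits an entry in two by `G-shift-high`,
    -- and this is the Pascal recursion of `choose u v`; the residues `r` and `s` stay untouched.
    lucas : ∀ u r v s → r < m → s < m → G (u ℕ.* m ℕ.+ r) (v ℕ.* m ℕ.+ s) ≈ natTimes (choose u v) * G r s
    lucas zero r zero s _ _ = sym (trans (*-congʳ (+-identityʳ 1#)) (*-identityˡ _))
    lucas zero r (suc v) s r<m _ = trans (G-zero {r} (ℕₚ.<-≤-trans r<m (ℕₚ.≤-trans (ℕₚ.m≤m+n m _) (ℕₚ.m≤m+n _ s))))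
      (sym (zeroˡ _))
    lucas (suc u) r zero s r<m s<m = begin
      G (m ℕ.+ u ℕ.* m ℕ.+ r) s ≡⟨ ≡.cong (λ k → G k s) (rearrange u r) ⟩
      G (u ℕ.* m ℕ.+ r ℕ.+ m) s ≈⟨ G-shift-low (u ℕ.* m ℕ.+ r) s s<m ⟩
      G (u ℕ.* m ℕ.+ r) s ≈⟨ lucas u r zero s r<m s<m ⟩
      natTimes (choose u 0) * G r s ∎
      where
      rearrange : ∀ u r → m ℕ.+ u ℕ.* m ℕ.+ r ≡ u ℕ.* m ℕ.+ r ℕ.+ m
      rearrange u r = ≡.trans (ℕₚ.+-assoc m _ r) (ℕₚ.+-comm m _)
    lucas (suc u) r (suc v) s r<m s<m = begin
      G (m ℕ.+ u ℕ.* m ℕ.+ r) (m ℕ.+ v ℕ.* m ℕ.+ s)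
        ≡⟨ ≡.cong₂ G (≡.trans (ℕₚ.+-assoc m _ r) (ℕₚ.+-comm m _)) (ℕₚ.+-assoc m _ s) ⟩
      G (u ℕ.* m ℕ.+ r ℕ.+ m) (m ℕ.+ (v ℕ.* m ℕ.+ s)) ≈⟨ G-shift-high (u ℕ.* m ℕ.+ r) (v ℕ.* m ℕ.+ s) ⟩
      G (u ℕ.* m ℕ.+ r) (m ℕ.+ (v ℕ.* m ℕ.+ s)) + G (u ℕ.* m ℕ.+ r) (v ℕ.* m ℕ.+ s)
        ≡⟨ ≡.cong (λ k → G (u ℕ.* m ℕ.+ r) k + G (u ℕ.* m ℕ.+ r) (v ℕ.* m ℕ.+ s)) (≡.sym (ℕₚ.+-assoc m _ s)) ⟩
      G (u ℕ.* m ℕ.+ r) (suc v ℕ.* m ℕ.+ s) + G (u ℕ.* m ℕ.+ r) (v ℕ.* m ℕ.+ s)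
        ≈⟨ +-cong (lucas u r (suc v) s r<m s<m) (lucas u r v s r<m s<m) ⟩
      natTimes (choose u (suc v)) * G r s + natTimes (choose u v) * G r s ≈⟨ sym (distribʳ _ _ _) ⟩
      (natTimes (choose u (suc v)) + natTimes (choose u v)) * G r s
        ≈⟨ *-congʳ (trans (+-comm _ _) (sym (natTimes-+ (choose u v) (choose u (suc v))))) ⟩
      natTimes (choose (suc u) (suc v)) * G r s ∎

    [vm+s] : 1 < m → ∀ v s → [ v ℕ.* m ℕ.+ s ] ≈ [ s ]
    [vm+s] 1<m zero s = refl
    [vm+s] 1<m (suc v) s = begin
      [ m ℕ.+ v ℕ.* m ℕ.+ s ] ≡⟨ ≡.cong [_] (ℕₚ.+-assoc m _ s) ⟩
      [ m ℕ.+ (v ℕ.* m ℕ.+ s) ] ≈⟨ []-+ m _ ⟩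
      [ m ] + ω ^ m * [ v ℕ.* m ℕ.+ s ] ≈⟨ +-cong ([m]≈0 1<m) (*-cong ω^m≈1 ([vm+s] 1<m v s)) ⟩
      0# + 1# * [ s ] ≈⟨ trans (+-identityˡ _) (*-identityˡ _) ⟩
      [ s ] ∎

    [1]≈1 : [ 1 ] ≈ 1#
    [1]≈1 = trans (+-congˡ (zeroʳ ω)) (+-identityʳ 1#)

    -- The values at ω of the solution X of [k′+1] X = G a′ k′ · G (qm) k′.
    module Narayana (q u r : ℕ) (r<m : r < m) (X : Carrier) where
      private
        n = q ℕ.* m ℕ.+ 0
        a′ = u ℕ.* m ℕ.+ r

      value-central : 1 < m → ∀ v → [ suc (v ℕ.* m ℕ.+ 0) ] * X ≈ G a′ (v ℕ.* m ℕ.+ 0) * G n (v ℕ.* m ℕ.+ 0) →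
        X ≈ natTimes (choose u v ℕ.* choose q v)
      value-central 1<m v e = begin
        X ≈⟨ sym (*-identityˡ X) ⟩
        1# * X ≈⟨ *-congʳ (sym (trans (reflexive (≡.cong [_] (≡.sym (ℕₚ.+-suc (v ℕ.* m) 0)))) (trans ([vm+s] 1<m v 1) [1]≈1))) ⟩
        [ suc (v ℕ.* m ℕ.+ 0) ] * X ≈⟨ e ⟩
        G a′ (v ℕ.* m ℕ.+ 0) * G n (v ℕ.* m ℕ.+ 0) ≈⟨ *-cong (lucas u r v 0 r<m (s≤s z≤n)) (lucas q 0 v 0 (s≤s z≤n) (s≤s z≤n)) ⟩
        natTimes (choose u v) * 1# * (natTimes (choose q v) * 1#) ≈⟨ *-cong (*-identityʳ _) (*-identityʳ _) ⟩
        natTimes (choose u v) * natTimes (choose q v) ≈⟨ sym (natTimes-* (choose u v) (choose q v)) ⟩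
        natTimes (choose u v ℕ.* choose q v) ∎

      -- Here `m` divides `k`, so `[k]` vanishes at ω and `[k] X = F` carries no information. The
      -- equation used instead has the factor `[b − k]`, and `b − k` is 1 modulo `m`.
      value-free : 1 < m → ∀ v w → [ w ℕ.* m ℕ.+ 1 ] * X ≈ G a′ (v ℕ.* m ℕ.+ m′) * G n (suc v ℕ.* m ℕ.+ 0) →
        X ≈ natTimes (choose u v) * G r m′ * natTimes (choose q (suc v))
      value-free 1<m v w e = begin
        X ≈⟨ sym (*-identityˡ X) ⟩
        1# * X ≈⟨ *-congʳ (sym (trans ([vm+s] 1<m w 1) [1]≈1)) ⟩
        [ w ℕ.* m ℕ.+ 1 ] * X ≈⟨ e ⟩
        G a′ (v ℕ.* m ℕ.+ m′) * G n (suc v ℕ.* m ℕ.+ 0)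
          ≈⟨ *-cong (lucas u r v m′ r<m ℕₚ.≤-refl) (trans (lucas q 0 (suc v) 0 (s≤s z≤n) (s≤s z≤n)) (*-identityʳ _)) ⟩
        natTimes (choose u v) * G r m′ * natTimes (choose q (suc v)) ∎

      -- `m` divides `q m` but not `v m + s`, so q-Lucas makes the second binomial zero. As
      -- `s + 1 < m`, the factor on the left is regular.
      value-other : ∀ v s → 0 < s → suc s < m → [ suc (v ℕ.* m ℕ.+ s) ] * X ≈ G a′ (v ℕ.* m ℕ.+ s) * G n (v ℕ.* m ℕ.+ s) →
        X ≈ 0#
      value-other v s 0<s s<m e = []-regular (suc s) (s≤s z≤n) s<m X (begin
        [ suc s ] * X ≈⟨ *-congʳ (sym (trans (reflexive (≡.cong [_] (≡.sym (ℕₚ.+-suc (v ℕ.* m) s)))) ([vm+s] (ℕₚ.≤-<-trans (s≤s z≤n) s<m) v (suc s)))) ⟩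
        [ suc (v ℕ.* m ℕ.+ s) ] * X ≈⟨ e ⟩
        G a′ (v ℕ.* m ℕ.+ s) * G n (v ℕ.* m ℕ.+ s)
          ≈⟨ *-congˡ (trans (lucas q 0 v s (s≤s z≤n) (ℕₚ.<-trans (ℕₚ.n<1+n s) s<m)) (trans (*-congˡ (G-zero {0} 0<s)) (zeroʳ _))) ⟩
        G a′ (v ℕ.* m ℕ.+ s) * 0# ≈⟨ zeroʳ _ ⟩
        0# ∎)

  module AtOne (ω≈1 : ω ≈ 1#) where
    [n]≈n : ∀ n → [ n ] ≈ natTimes n
    [n]≈n zero = refl
    [n]≈n (suc n) = +-congˡ (trans (*-cong ω≈1 ([n]≈n n)) (*-identityˡ _))

    ^≈1 : ∀ n → ω ^ n ≈ 1#
    ^≈1 zero = refl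
    ^≈1 (suc n) = trans (*-cong ω≈1 (^≈1 n)) (*-identityˡ _)

    G≈choose : ∀ n k → G n k ≈ natTimes (choose n k)
    G≈choose n zero = sym (+-identityʳ 1#)
    G≈choose zero (suc k) = refl
    G≈choose (suc n) (suc k) = trans (+-cong (G≈choose n k) (trans (*-cong (^≈1 (suc k)) (G≈choose n (suc k))) (*-identityˡ _)))
      (sym (natTimes-+ (choose n k) (choose n (suc k))))

open import Data.Bool using (Bool; T?; _xor_; _∧_; false; if_then_else_; not; true) renaming (T to IsTrue)
open import Data.Bool.ListAction using (all; any)
import Data.Bool.Properties as Boolₚ
open import Data.Empty using (⊥; ⊥-elim)
open import Data.List using ([]; [_]; _++_; _∷_; applyUpTo; cartesianProduct; concatMap; filter; filterᵇ; foldr;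
  length; map; replicate; take; upTo; zip)
open import Data.List.Membership.Propositional using (_∈_; find; lose)
open import Data.List.Membership.Propositional.Properties using (∈-++⁺ʳ; ∈-++⁺ˡ; ∈-++⁻; ∈-cartesianProduct⁺;
  ∈-cartesianProduct⁻; ∈-concatMap⁺; ∈-concatMap⁻; ∈-deduplicate⁺; ∈-deduplicate⁻; ∈-filter⁺; ∈-filter⁻; ∈-map⁺;
  ∈-map⁻; ∈-upTo⁺; ∈-upTo⁻; ∈-∃++)
open import Data.List.Properties as Listₚ using (length-map)
open import Data.List.Relation.Unary.All as All using (All; []; _∷_)
import Data.List.Relation.Unary.All.Properties as Allₚ
open import Data.List.Relation.Unary.AllPairs as AllPairs using (AllPairs; []; _∷_)
open import Data.List.Relation.Unary.Any using (here; there)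
import Data.List.Relation.Unary.Any.Properties as Anyₚ
import Data.List.Relation.Unary.Unique.DecPropositional.Properties as UniqueDecₚ
open import Data.List.Relation.Unary.Unique.Propositional using (Unique)
import Data.List.Relation.Unary.Unique.Propositional.Properties as Uniqueₚ
open import Data.Nat as ℕ using (NonZero; _%_; _/_; _<ᵇ_; _≡ᵇ_; _≤′_; _⊓_; ≤′-refl; ≤′-step)
open import Data.Nat.Coprimality as Coprimality using (coprime-divisor; coprime⇒gcd≡1; gcd≡1⇒coprime)
open import Data.Nat.DivMod using (%-distribˡ-+; [m+kn]%n≡m%n; [m+n]%n≡m%n; m%n%n≡m%n; m%n<n; m<n⇒m%n≡m;
  m≡m%n+[m/n]*n; n%n≡0)
open import Data.Nat.Divisibility using (*-cancelˡ-∣; _∣?_; _∣_; divides; m%n≡0⇒n∣m; m∣m*n; n∣m⇒m%n≡0; ∣-antisym;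
  ∣-trans; ∣m+n∣m⇒∣n; ∣⇒≤)
open import Data.Nat.GCD using (c*gcd[m,n]≡gcd[cm,cn]; gcd-comm; gcd[m,n]∣m; gcd[m,n]∣n)
open import Data.Nat.Induction using (<-rec)
open import Data.Nat.Properties using (*-assoc; *-cancelʳ-≡; *-cancelˡ-<; *-cancelˡ-≡; *-cancelˡ-≤; *-comm;
  *-distribʳ-+; *-distribʳ-∸; *-distribˡ-+; *-identityʳ; *-identityˡ; *-monoʳ-<; *-monoʳ-≤; *-monoˡ-≤; *-suc; *-zeroʳ;
  +-assoc; +-cancelʳ-<; +-cancelʳ-≡; +-cancelʳ-≤; +-cancelˡ-<; +-cancelˡ-≡; +-cancelˡ-≤; +-comm; +-identityʳ;
  +-mono-<-≤; +-mono-≤; +-mono-≤-<; +-monoʳ-<; +-monoʳ-≤; +-monoˡ-<; +-monoˡ-≤; +-suc; +-∸-assoc; <-cmp; <-irrefl;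
  <-trans; <-≤-trans; <ᵇ⇒<; <⇒<ᵇ; <⇒≢; <⇒≤; <⇒≱; [m+n]∸[m+o]≡n∸o; anyUpTo?; m+[n∸m]≡n; m+n∸m≡n; m+n∸n≡m; m<m+n; m<n+m;
  m<n⇒0<n∸m; m∸n+n≡m; m∸n≡0⇒m≤n; m≤m*n; m≤m+n; m≤n+m; m≤n⇒m<n∨m≡n; m≤n⇒m∸n≡0; m≤n⇒m≤1+n; m≤n⇒m⊓n≡m; m≤n⇒∃[o]m+o≡n;
  m≥n⇒m⊓n≡n; n<1+n; n∸n≡0; n≢0⇒n>0; n≤1+n; suc-injective; suc-pred; ∸-cancelˡ-≡; ∸-monoʳ-<; ∸-monoˡ-≤; ≡ᵇ⇒≡; ≡⇒≡ᵇ;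
  ≤-<-connex; ≤-<-trans; ≤-antisym; ≤-pred; ≤-refl; ≤-reflexive; ≤-trans; ≤ᵇ⇒≤; ≤⇒≤ᵇ; ≤⇒≤′; ≤∧≢⇒<; ≮⇒≥; ≰⇒>; ⊓-glb)
import Data.Nat.Tactic.RingSolver as ℕSolver
open import Data.Product using (proj₁; proj₂)
import Data.Product.Properties as Productₚ
open import Data.Sum using (_⊎_; inj₁; inj₂)
open import Data.Unit using (tt)
open import Function using (Equivalence; _∘_)
open import Relation.Binary.Bundles using (Setoid)
open import Relation.Binary.Definitions using (Tri; tri<; tri>; tri≈)
open import Relation.Binary.PropositionalEquality using (_≡_; _≢_; cong; cong₂; module ≡-Reasoning; refl; subst;
  subst₂; sym; trans)
open import Relation.Nullary using (Dec; does; ¬_)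
open import Relation.Nullary.Decidable using (_×-dec_; dec-false; dec-true)

-- Unimodality of the product of two Gaussian binomials

module Unimodality where
  open import Data.Integer using (_+_; _*_; _-_; -_)
  open import Data.Integer.Tactic.RingSolver using (solve-∀)
  -- Injectivity of ladder operators

  -- Elimination: more test functions than linear conditions leave a nonzero combination.  Each function f
  -- carries a point x with f x ≠ 0 at which all the other functions of the list vanish.
  module Elimination {A : Set} where
    Pointed : Set
    Pointed = A × (A → ℤ)

    Separated : Pointed → Pointed → Set
    Separated (x , f) (y , g) = f y ≡ + 0 × g x ≡ + 0

    combination : ℤ → (A → ℤ) → ℤ → (A → ℤ) → A → ℤ
    combination c f d g a = c * f a - d * g a

    Linear : ((A → ℤ) → ℤ) → Set
    Linear φ = ∀ c f d g → φ (combination c f d g) ≡ c * φ f - d * φ g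

    Closed : ((A → ℤ) → Set) → Set
    Closed P = ∀ c f d g → P f → P g → P (combination c f d g)

    Good : ((A → ℤ) → Set) → Pointed → Set
    Good P (x , f) = f x ≢ + 0 × P f

    module _ (φ : (A → ℤ) → ℤ) where
      -- Cross-multiplication takes the place of division by the pivot value `φ g`. The pivot `g`
      -- vanishes at `y`, so the new function has the value `φ g * f y` there, which is still
      -- nonzero.
      reduce : Pointed → Pointed → Pointed
      reduce (x , g) (y , f) = y , combination (φ g) f (φ f) g

      eliminate : List Pointed → List Pointed
      eliminate [] = []
      eliminate (v ∷ vs) with φ (proj₂ v) ℤ.≟ + 0
      ... | yes _ = v ∷ eliminate vs
      ... | no _ = map (reduce v) vs

      length-eliminate : ∀ vs → length vs ≤ suc (length (eliminate vs))
      length-eliminate [] = z≤n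
      length-eliminate (v ∷ vs) with φ (proj₂ v) ℤ.≟ + 0
      ... | yes _ = s≤s (length-eliminate vs)
      ... | no _ = s≤s (≤-reflexive (sym (length-map (reduce v) vs)))

      private
        zero-comb : ∀ c d {u v} → u ≡ + 0 → v ≡ + 0 → c * u - d * v ≡ + 0
        zero-comb c d refl refl = trans (cong₂ _-_ (ℤₚ.*-zeroʳ c) (ℤₚ.*-zeroʳ d)) refl

      separated-reduce : ∀ v u vs → Separated u v → All (Separated u) vs → All (Separated u) (map (reduce v) vs)
      separated-reduce v u [] s [] = []
      separated-reduce (y , g) (x , f) ((z , h) ∷ vs) s ((p , q) ∷ ss) =
        (p , zero-comb (φ g) (φ h) q (proj₂ s)) ∷ separated-reduce (y , g) (x , f) vs s ss

      separated-eliminate : ∀ u vs → All (Separated u) vs → All (Separated u) (eliminate vs)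
      separated-eliminate u [] [] = []
      separated-eliminate u (v ∷ vs) (s ∷ ss) with φ (proj₂ v) ℤ.≟ + 0
      ... | yes _ = s ∷ separated-eliminate u vs ss
      ... | no _ = separated-reduce v u vs s ss

      pairs-reduce : ∀ v vs → All (Separated v) vs → AllPairs Separated vs → AllPairs Separated (map (reduce v) vs)
      pairs-reduce v [] [] [] = []
      pairs-reduce (x , g) ((y , f) ∷ vs) ((p , q) ∷ ss) (r ∷ rs) = go vs ss r ∷ pairs-reduce (x , g) vs ss rs
        where
        go : ∀ vs → All (Separated (x , g)) vs → All (Separated (y , f)) vs → All (Separated (reduce (x , g) (y , f))) (map (reduce (x , g)) vs)
        go [] [] [] = []
        go ((z , h) ∷ vs) ((p′ , q′) ∷ ss) ((p″ , q″) ∷ rs) =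
          (zero-comb (φ g) (φ f) p″ p′ , zero-comb (φ g) (φ h) q″ p) ∷ go vs ss rs

      pairs-eliminate : ∀ vs → AllPairs Separated vs → AllPairs Separated (eliminate vs)
      pairs-eliminate [] [] = []
      pairs-eliminate (v ∷ vs) (s ∷ ss) with φ (proj₂ v) ℤ.≟ + 0
      ... | yes _ = separated-eliminate v vs s ∷ pairs-eliminate vs ss
      ... | no _ = pairs-reduce v vs s ss

      module _ (lin : Linear φ) (P : (A → ℤ) → Set) (closed : Closed P) where
        good-reduce : ∀ v vs → φ (proj₂ v) ≢ + 0 → P (proj₂ v) → All (Separated v) vs → All (Good P) vs →
          All (Good (λ f → P f × φ f ≡ + 0)) (map (reduce v) vs)
        good-reduce v [] _ _ [] [] = []
        good-reduce (x , g) ((y , f) ∷ vs) φg≢0 Pg ((p , q) ∷ ss) ((fy≢0 , Pf) ∷ gs) =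
          ((λ e → nonzero (trans (sym (trans (cong (λ t → φ g * f y - φ f * t) p)
              (trans (cong (_-_ (φ g * f y)) (ℤₚ.*-zeroʳ (φ f))) (ℤₚ.+-identityʳ _)))) e))
          , closed (φ g) f (φ f) g Pf Pg
          , trans (lin (φ g) f (φ f) g) (trans (cong (_- φ f * φ g) (ℤₚ.*-comm (φ g) (φ f))) (ℤₚ.+-inverseʳ (φ f * φ g))))
          ∷ good-reduce (x , g) vs φg≢0 Pg ss gs
          where
          nonzero : φ g * f y ≢ + 0
          nonzero e with ℤₚ.i*j≡0⇒i≡0∨j≡0 (φ g) e
          ... | inj₁ e′ = φg≢0 e′
          ... | inj₂ e′ = fy≢0 e′

        good-eliminate : ∀ vs → AllPairs Separated vs → All (Good P) vs → All (Good (λ f → P f × φ f ≡ + 0)) (eliminate vs)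
        good-eliminate [] [] [] = []
        good-eliminate (v ∷ vs) (s ∷ ss) ((n , p) ∷ gs) with φ (proj₂ v) ℤ.≟ + 0
        ... | yes e = (n , p , e) ∷ good-eliminate vs ss gs
        ... | no φ≢0 = good-reduce v vs φ≢0 p s gs

    -- Each functional costs at most one vector, the pivot. The equations already solved are added
    -- to the closed property `P`, which survives further combinations; a vector is left at the end
    -- because there were more vectors than functionals.
    kernel-vector : ∀ (φs : List ((A → ℤ) → ℤ)) → All Linear φs → ∀ P → Closed P →
      ∀ vs → AllPairs Separated vs → All (Good P) vs → length φs < length vs →
      ∃ λ ((x , f) : Pointed) → f x ≢ + 0 × P f × All (λ φ → φ f ≡ + 0) φs
    kernel-vector [] [] P cl (v ∷ vs) _ (( n , p) ∷ _) _ = v , n , p , []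
    kernel-vector (φ ∷ φs) (l ∷ ls) P cl vs ss gs lt
      with kernel-vector φs ls (λ f → P f × φ f ≡ + 0)
             (λ { c f d g (pf , ef) (pg , eg) → cl c f d g pf pg
                , trans (l c f d g) (trans (cong₂ (λ s t → c * s - d * t) ef eg) (trans (cong₂ _-_ (ℤₚ.*-zeroʳ c) (ℤₚ.*-zeroʳ d)) refl)) })
             (eliminate φ vs) (pairs-eliminate φ vs ss) (good-eliminate φ l P cl vs ss gs)
             (≤-pred (≤-trans lt (length-eliminate φ vs)))
    ... | v , n , (p , e) , es = v , n , p , e ∷ es

  -- If A lowers the level, kills level 0 and satisfies A B = B A + h with h positive, then B is injective:
  -- from A B f = − σ f one gets B (A f) = − (σ + h) f, so A f satisfies the same hypothesis one level lower.
  module Injectivity {X : Set} (A B : (X → ℤ) → X → ℤ) (Level : ℕ → (X → ℤ) → Set) (h : ℕ → ℤ)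
    (A-cong : ∀ {f g} → (∀ a → f a ≡ g a) → ∀ a → A f a ≡ A g a)
    (B-cong : ∀ {f g} → (∀ a → f a ≡ g a) → ∀ a → B f a ≡ B g a)
    (A-scale : ∀ c f a → A (λ a → c * f a) a ≡ c * A f a)
    (B-zero : ∀ a → B (λ _ → + 0) a ≡ + 0)
    (A-level : ∀ r {f} → Level (suc r) f → Level r (A f))
    (A-bottom : ∀ {f} → Level 0 f → ∀ a → A f a ≡ + 0)
    (commutator : ∀ r {f} → Level r f → ∀ a → A (B f) a ≡ B (A f) a + h r * f a) where

    eigen-zero : ∀ r → (∀ s → s ≤ r → + 0 ℤ.< h s) → ∀ {f} → Level r f → ∀ σ → + 0 ℤ.≤ σ →
      (∀ a → A (B f) a ≡ - σ * f a) → ∀ a → f a ≡ + 0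
    eigen-zero r pos {f} lev σ 0≤σ eig a = cancel (trans (sym (BA a)) (trans (B-cong (Af≡0 r lev pos) a) (B-zero a)))
      where
      τ = σ + h r
      BA : ∀ a → B (A f) a ≡ - τ * f a
      BA a = trans (lemma (B (A f) a) (h r * f a)) (trans (cong (_- h r * f a) (trans (sym (commutator r lev a)) (eig a))) (lemma′ σ (h r) (f a)))
        where
        lemma : ∀ u v → u ≡ u + v - v
        lemma = solve-∀
        lemma′ : ∀ σ η u → - σ * u - η * u ≡ - (σ + η) * u
        lemma′ = solve-∀
      0<τ : + 0 ℤ.< τ
      0<τ = ℤₚ.+-mono-≤-< 0≤σ (pos r ≤-refl)
      Af≡0 : ∀ r′ → Level r′ f → (∀ s → s ≤ r′ → + 0 ℤ.< h s) → ∀ a → A f a ≡ + 0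
      Af≡0 zero lev _ = A-bottom lev
      -- `A f` has the eigenvalue `− τ` for `A B`. Since `σ` is nonnegative and `h r` positive, `τ`
      -- is again nonnegative, as the recursion requires.
      Af≡0 (suc r′) lev pos = eigen-zero r′ (λ s s≤ → pos s (m≤n⇒m≤1+n s≤)) (A-level r′ lev) τ (ℤₚ.<⇒≤ 0<τ)
        (λ a → trans (A-cong BA a) (A-scale (- τ) f a))
      cancel : - τ * f a ≡ + 0 → f a ≡ + 0
      cancel e with ℤₚ.i*j≡0⇒i≡0∨j≡0 (- τ) e
      ... | inj₂ e′ = e′
      ... | inj₁ e′ = ⊥-elim (ℤₚ.<-irrefl (trans (cong -_ (sym e′)) (ℤₚ.neg-involutive τ)) 0<τ)

    injective : ∀ r → (∀ s → s ≤ r → + 0 ℤ.< h s) → ∀ {f} → Level r f → (∀ a → B f a ≡ + 0) → ∀ a → f a ≡ + 0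
    injective r pos {f} lev Bf≡0 = eigen-zero r pos lev (+ 0) ℤₚ.≤-refl
      (λ a → trans (A-cong Bf≡0 a) (trans (A-scale (+ 0) (λ _ → + 0) a) refl))

  -- Raising and lowering operators on binary words

  open ≡-Reasoning

  Word : Set
  Word = List Bool

  Fn : Set
  Fn = Word → ℤ

  bit : Bool → ℤ
  bit true  = + 1
  bit false = + 0

  -- lower is the transpose of replacing a factor 01 by 10; raise p is the transpose of replacing 10 by 01 at
  -- position i of a word of length N with weight (p + i + 1)(N − 1 − i), which makes the commutator linear
  -- in the number of inversions.
  lowerHead : Fn → Bool → Word → ℤ
  lowerHead f true  (false ∷ s) = f (false ∷ true ∷ s)
  lowerHead f true  (true ∷ s)  = + 0
  lowerHead f true  []          = + 0
  lowerHead f false s           = + 0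

  raiseHead : ℕ → Fn → Bool → Word → ℤ
  raiseHead p f false (true ∷ s)  = + (suc p ℕ.* suc (length s)) * f (true ∷ false ∷ s)
  raiseHead p f false (false ∷ s) = + 0
  raiseHead p f false []          = + 0
  raiseHead p f true  s           = + 0

  lower : Fn → Fn
  lower f []      = + 0
  lower f (x ∷ s) = lowerHead f x s + lower (λ t → f (x ∷ t)) s

  raise : ℕ → Fn → Fn
  raise p f []      = + 0
  raise p f (x ∷ s) = raiseHead p f x s + raise (suc p) (λ t → f (x ∷ t)) s

  -- The commutator of `lower` and `raise` is diagonal. The factor in front contributes its weight
  -- with sign plus if it is 10, with sign minus if it is 01.
  weightHead : ℕ → Bool → Word → ℤ
  weightHead p x []      = + 0
  weightHead p x (y ∷ s) = + (suc p ℕ.* suc (length s)) * (bit x - bit y)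

  weight : ℕ → Word → ℤ
  weight p []      = + 0
  weight p (x ∷ s) = weightHead p x s + weight (suc p) s

  lowerHead-cong : ∀ {f g} → (∀ s → f s ≡ g s) → ∀ x s → lowerHead f x s ≡ lowerHead g x s
  lowerHead-cong e true  (false ∷ s) = e _
  lowerHead-cong e true  (true ∷ s)  = refl
  lowerHead-cong e true  []          = refl
  lowerHead-cong e false s           = refl

  lower-cong : ∀ {f g} → (∀ s → f s ≡ g s) → ∀ s → lower f s ≡ lower g s
  lower-cong e []      = refl
  lower-cong e (x ∷ s) = cong₂ _+_ (lowerHead-cong e x s) (lower-cong (λ t → e (x ∷ t)) s)

  raiseHead-cong : ∀ p {f g} → (∀ s → f s ≡ g s) → ∀ x s → raiseHead p f x s ≡ raiseHead p g x s
  raiseHead-cong p e false (true ∷ s)  = cong (_*_ (+ (suc p ℕ.* suc (length s)))) (e (true ∷ false ∷ s))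
  raiseHead-cong p e false (false ∷ s) = refl
  raiseHead-cong p e false []          = refl
  raiseHead-cong p e true  s           = refl

  raise-cong : ∀ p {f g} → (∀ s → f s ≡ g s) → ∀ s → raise p f s ≡ raise p g s
  raise-cong p e []      = refl
  raise-cong p e (x ∷ s) = cong₂ _+_ (raiseHead-cong p e x s) (raise-cong (suc p) (λ t → e (x ∷ t)) s)

  private
    lin-sum : ∀ c a b d u v → (c * a + d * u) + (c * b + d * v) ≡ c * (a + b) + d * (u + v)
    lin-sum = solve-∀

    lin-zero : ∀ c d → + 0 ≡ c * + 0 + d * + 0
    lin-zero c d = sym (cong₂ _+_ (ℤₚ.*-zeroʳ c) (ℤₚ.*-zeroʳ d))

    lin-weight : ∀ w c f d g → w * (c * f + d * g) ≡ c * (w * f) + d * (w * g)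
    lin-weight = solve-∀

  lower-linear : ∀ c f d g s → lower (λ t → c * f t + d * g t) s ≡ c * lower f s + d * lower g s
  lower-linear c f d g []      = lin-zero c d
  lower-linear c f d g (x ∷ s) = trans (cong₂ _+_ (head x s) (lower-linear c (λ t → f (x ∷ t)) d (λ t → g (x ∷ t)) s))
    (lin-sum c (lowerHead f x s) (lower (λ t → f (x ∷ t)) s) d (lowerHead g x s) (lower (λ t → g (x ∷ t)) s))
    where
    head : ∀ x s → lowerHead (λ t → c * f t + d * g t) x s ≡ c * lowerHead f x s + d * lowerHead g x s
    head true  (false ∷ s) = refl
    head true  (true ∷ s)  = lin-zero c d
    head true  []          = lin-zero c d
    head false s           = lin-zero c d

  raise-linear : ∀ p c f d g s → raise p (λ t → c * f t + d * g t) s ≡ c * raise p f s + d * raise p g s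
  raise-linear p c f d g []      = lin-zero c d
  raise-linear p c f d g (x ∷ s) = trans (cong₂ _+_ (head x s) (raise-linear (suc p) c (λ t → f (x ∷ t)) d (λ t → g (x ∷ t)) s))
    (lin-sum c (raiseHead p f x s) (raise (suc p) (λ t → f (x ∷ t)) s) d (raiseHead p g x s) (raise (suc p) (λ t → g (x ∷ t)) s))
    where
    head : ∀ x s → raiseHead p (λ t → c * f t + d * g t) x s ≡ c * raiseHead p f x s + d * raiseHead p g x s
    head false (true ∷ s)  = lin-weight (+ (suc p ℕ.* suc (length s))) c (f (true ∷ false ∷ s)) d (g (true ∷ false ∷ s))
    head false (false ∷ s) = lin-zero c d
    head false []          = lin-zero c d
    head true  s           = lin-zero c d

  private
    unit : ∀ u v → + 1 * u + + 1 * v ≡ u + v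
    unit = solve-∀
    unit₀ : ∀ c u v → c * u + + 0 * v ≡ c * u
    unit₀ = solve-∀

  lower-+ : ∀ f g s → lower (λ t → f t + g t) s ≡ lower f s + lower g s
  lower-+ f g s = trans (lower-cong (λ t → sym (unit (f t) (g t))) s) (trans (lower-linear (+ 1) f (+ 1) g s) (unit (lower f s) (lower g s)))

  lower-scale : ∀ c f s → lower (λ t → c * f t) s ≡ c * lower f s
  lower-scale c f s = trans (lower-cong (λ t → sym (unit₀ c (f t) (f t))) s) (trans (lower-linear c f (+ 0) f s) (unit₀ c (lower f s) (lower f s)))

  lower-0 : ∀ s → lower (λ _ → + 0) s ≡ + 0
  lower-0 s = lower-scale (+ 0) (λ _ → + 0) s

  raise-+ : ∀ p f g s → raise p (λ t → f t + g t) s ≡ raise p f s + raise p g s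
  raise-+ p f g s = trans (raise-cong p (λ t → sym (unit (f t) (g t))) s) (trans (raise-linear p (+ 1) f (+ 1) g s) (unit (raise p f s) (raise p g s)))

  raise-scale : ∀ p c f s → raise p (λ t → c * f t) s ≡ c * raise p f s
  raise-scale p c f s = trans (raise-cong p (λ t → sym (unit₀ c (f t) (f t))) s) (trans (raise-linear p c f (+ 0) f s) (unit₀ c (raise p f s) (raise p f s)))

  raise-0 : ∀ p s → raise p (λ _ → + 0) s ≡ + 0
  raise-0 p s = raise-scale p (+ 0) (λ _ → + 0) s

  private
    -- Moves of overlapping factors compose to zero in either order, so only the two moves of the same factor
    -- contribute to the commutator.
    head-commutator : ∀ p f x s →
      lowerHead (raise p f) x s + lower (raiseHead p f x) s
        ≡ raiseHead p (lower f) x s + raise (suc p) (lowerHead f x) s + weightHead p x s * f (x ∷ s)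
    head-commutator p f true [] = refl
    head-commutator p f false [] = refl
    head-commutator p f true (true ∷ s) = begin
      + 0 + lower (λ _ → + 0) (true ∷ s) ≡⟨ cong (_+_ (+ 0)) (lower-0 (true ∷ s)) ⟩
      + 0 ≡⟨ sym (ring (+ (suc p ℕ.* suc (length s))) (f (true ∷ true ∷ s))) ⟩
      + 0 + (+ 0 + + 0) + + (suc p ℕ.* suc (length s)) * (+ 1 - + 1) * f (true ∷ true ∷ s)
        ≡⟨ cong (λ t → + 0 + (+ 0 + t) + + (suc p ℕ.* suc (length s)) * (+ 1 - + 1) * f (true ∷ true ∷ s)) (sym (raise-0 (suc (suc p)) s)) ⟩
      + 0 + (+ 0 + raise (suc (suc p)) (λ _ → + 0) s) + + (suc p ℕ.* suc (length s)) * (+ 1 - + 1) * f (true ∷ true ∷ s) ∎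
      where
      ring : ∀ w v → + 0 + (+ 0 + + 0) + w * (+ 1 - + 1) * v ≡ + 0
      ring = solve-∀
    head-commutator p f true (false ∷ s) = begin
      raise p f (false ∷ true ∷ s) + (+ 0 + lower (λ _ → + 0) s)
        ≡⟨ cong (λ t → raise p f (false ∷ true ∷ s) + (+ 0 + t)) (lower-0 s) ⟩
      W * F + (+ 0 + R) + (+ 0 + + 0) ≡⟨ ring W F R ⟩
      + 0 + (+ 0 + R) + W * (+ 1 - + 0) * F
        ≡⟨ cong (λ t → + 0 + t + W * (+ 1 - + 0) * F) (sym (raise-tail s)) ⟩
      + 0 + raise (suc p) (lowerHead f true) (false ∷ s) + W * (+ 1 - + 0) * F ∎
      where
      W = + (suc p ℕ.* suc (length s))
      F = f (true ∷ false ∷ s)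
      R = raise (suc (suc p)) (λ t → f (false ∷ true ∷ t)) s
      ring : ∀ w v r → w * v + (+ 0 + r) + (+ 0 + + 0) ≡ + 0 + (+ 0 + r) + w * (+ 1 - + 0) * v
      ring = solve-∀
      raise-tail : ∀ s → raise (suc p) (lowerHead f true) (false ∷ s) ≡ + 0 + raise (suc (suc p)) (λ t → f (false ∷ true ∷ t)) s
      raise-tail [] = refl
      raise-tail (false ∷ s) = refl
      raise-tail (true ∷ s) = cong (_+ raise (suc (suc p)) (λ t → f (false ∷ true ∷ t)) (true ∷ s)) (ℤₚ.*-zeroʳ (+ (suc (suc p) ℕ.* suc (length s))))
    head-commutator p f false (false ∷ s) = begin
      + 0 + (+ 0 + lower (λ _ → + 0) s) ≡⟨ cong (λ t → + 0 + (+ 0 + t)) (lower-0 s) ⟩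
      + 0 ≡⟨ sym (ring (+ (suc p ℕ.* suc (length s))) (f (false ∷ false ∷ s))) ⟩
      + 0 + + 0 + + (suc p ℕ.* suc (length s)) * (+ 0 - + 0) * f (false ∷ false ∷ s)
        ≡⟨ cong (λ t → + 0 + t + + (suc p ℕ.* suc (length s)) * (+ 0 - + 0) * f (false ∷ false ∷ s)) (sym (raise-0 (suc p) (false ∷ s))) ⟩
      + 0 + raise (suc p) (λ _ → + 0) (false ∷ s) + + (suc p ℕ.* suc (length s)) * (+ 0 - + 0) * f (false ∷ false ∷ s) ∎
      where
      ring : ∀ w v → + 0 + + 0 + w * (+ 0 - + 0) * v ≡ + 0
      ring = solve-∀
    head-commutator p f false (true ∷ s) = begin
      + 0 + lower (raiseHead p f false) (true ∷ s) ≡⟨ cong (_+_ (+ 0)) (lower-tail s) ⟩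
      + 0 + (+ 0 + lower (raiseHead p f false ∘₁) s) ≡⟨ cong (λ t → + 0 + (+ 0 + t)) (weighted s) ⟩
      + 0 + (+ 0 + W * L) ≡⟨ ring W L F ⟩
      W * (F + (+ 0 + L)) + + 0 + W * (+ 0 - + 1) * F
        ≡⟨ cong (λ t → W * (F + (+ 0 + L)) + t + W * (+ 0 - + 1) * F) (sym (raise-0 (suc p) (true ∷ s))) ⟩
      W * (F + (+ 0 + L)) + raise (suc p) (λ _ → + 0) (true ∷ s) + W * (+ 0 - + 1) * F ∎
      where
      W = + (suc p ℕ.* suc (length s))
      F = f (false ∷ true ∷ s)
      L = lower (λ t → f (true ∷ false ∷ t)) s
      _∘₁ : Fn → Fn
      (g ∘₁) t = g (true ∷ t)
      ring : ∀ w l v → + 0 + (+ 0 + w * l) ≡ w * (v + (+ 0 + l)) + + 0 + w * (+ 0 - + 1) * v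
      ring = solve-∀
      lower-tail : ∀ s → lower (raiseHead p f false) (true ∷ s) ≡ + 0 + lower (raiseHead p f false ∘₁) s
      lower-tail [] = refl
      lower-tail (true ∷ s) = refl
      lower-tail (false ∷ s) = refl
      -- The weight depends on the word only through its length, which moves preserve, so it can be
      -- taken out of `lower`. In `go`, `i` counts the letters already removed, to keep the length
      -- of the whole word in view.
      weighted′ : ∀ k g s → length s ≡ k → lower (λ t → + (suc p ℕ.* suc (length t)) * g t) s ≡ + (suc p ℕ.* suc k) * lower g s
      weighted′ k g s refl = go g s 0 refl
        where
        go : ∀ g t i → i ℕ.+ length t ≡ length s → lower (λ t → + (suc p ℕ.* suc (i ℕ.+ length t)) * g t) t ≡ + (suc p ℕ.* suc (length s)) * lower g t
        go g [] i e = sym (ℤₚ.*-zeroʳ (+ (suc p ℕ.* suc (length s))))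
        go g (y ∷ t) i e = trans (cong₂ _+_ (hd y t e) (trans (lower-cong (λ u → cong (λ k → + (suc p ℕ.* suc k) * g (y ∷ u)) (+-suc i (length u))) t)
            (go (λ u → g (y ∷ u)) t (suc i) (trans (sym (+-suc i (length t))) e))))
          (sym (ℤₚ.*-distribˡ-+ (+ (suc p ℕ.* suc (length s))) (lowerHead g y t) _))
          where
          hd : ∀ y t → i ℕ.+ length (y ∷ t) ≡ length s → lowerHead (λ u → + (suc p ℕ.* suc (i ℕ.+ length u)) * g u) y t ≡ + (suc p ℕ.* suc (length s)) * lowerHead g y t
          hd true (false ∷ t) e = cong (λ k → + (suc p ℕ.* suc k) * g (false ∷ true ∷ t)) e
          hd true (true ∷ t) e = sym (ℤₚ.*-zeroʳ (+ (suc p ℕ.* suc (length s))))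
          hd true [] e = sym (ℤₚ.*-zeroʳ (+ (suc p ℕ.* suc (length s))))
          hd false t e = sym (ℤₚ.*-zeroʳ (+ (suc p ℕ.* suc (length s))))
      weighted : ∀ s → lower (raiseHead p f false ∘₁) s ≡ + (suc p ℕ.* suc (length s)) * lower (λ t → f (true ∷ false ∷ t)) s
      weighted s = weighted′ (length s) (λ t → f (true ∷ false ∷ t)) s refl

  commutator : ∀ p f s → lower (raise p f) s ≡ raise p (lower f) s + weight p s * f s
  commutator p f [] = refl
  commutator p f (x ∷ s) = begin
    lowerHead (raise p f) x s + lower (λ t → raiseHead p f x t + raise (suc p) fₓ t) s
      ≡⟨ cong (_+_ (lowerHead (raise p f) x s)) (lower-+ (raiseHead p f x) (raise (suc p) fₓ) s) ⟩
    lowerHead (raise p f) x s + (lower (raiseHead p f x) s + lower (raise (suc p) fₓ) s)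
      ≡⟨ sym (ℤₚ.+-assoc (lowerHead (raise p f) x s) _ _) ⟩
    (lowerHead (raise p f) x s + lower (raiseHead p f x) s) + lower (raise (suc p) fₓ) s
      ≡⟨ cong₂ _+_ (head-commutator p f x s) (commutator (suc p) fₓ s) ⟩
    (raiseHead p (lower f) x s + raise (suc p) (lowerHead f x) s + weightHead p x s * f (x ∷ s))
      + (raise (suc p) (lower fₓ) s + weight (suc p) s * f (x ∷ s))
      ≡⟨ ring (raiseHead p (lower f) x s) (raise (suc p) (lowerHead f x) s) (weightHead p x s) (f (x ∷ s)) (raise (suc p) (lower fₓ) s) (weight (suc p) s) ⟩
    (raiseHead p (lower f) x s + (raise (suc p) (lowerHead f x) s + raise (suc p) (lower fₓ) s))
      + (weightHead p x s + weight (suc p) s) * f (x ∷ s)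
      ≡⟨ cong (λ t → (raiseHead p (lower f) x s + t) + (weightHead p x s + weight (suc p) s) * f (x ∷ s))
           (sym (raise-+ (suc p) (lowerHead f x) (lower fₓ) s)) ⟩
    raise p (lower f) (x ∷ s) + weight p (x ∷ s) * f (x ∷ s) ∎
    where
    fₓ : Fn
    fₓ t = f (x ∷ t)
    ring : ∀ a b w v c u → (a + b + w * v) + (c + u * v) ≡ (a + (b + c)) + (w + u) * v
    ring = solve-∀

  lower-raise-exchange : ∀ p (f : Word → Fn) s t → lower (λ s′ → raise p (f s′) t) s ≡ raise p (λ t′ → lower (λ s′ → f s′ t′) s) t
  lower-raise-exchange p f [] t = sym (raise-0 p t)
  lower-raise-exchange p f (x ∷ s) t = trans (cong₂ _+_ (head x s) (lower-raise-exchange p (λ s′ → f (x ∷ s′)) s t))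
    (sym (raise-+ p (λ t′ → lowerHead (λ s′ → f s′ t′) x s) (λ t′ → lower (λ s′ → f (x ∷ s′) t′) s) t))
    where
    head : ∀ x s → lowerHead (λ s′ → raise p (f s′) t) x s ≡ raise p (λ t′ → lowerHead (λ s′ → f s′ t′) x s) t
    head true  (false ∷ s) = refl
    head true  (true ∷ s)  = sym (raise-0 p t)
    head true  []          = sym (raise-0 p t)
    head false s           = sym (raise-0 p t)

  -- Unimodality

  ones zeros inversions : Word → ℕ
  ones []          = 0
  ones (true ∷ s)  = suc (ones s)
  ones (false ∷ s) = ones s
  zeros []          = 0
  zeros (true ∷ s)  = zeros s
  zeros (false ∷ s) = suc (zeros s)
  inversions []          = 0
  inversions (true ∷ s)  = inversions s
  inversions (false ∷ s) = ones s ℕ.+ inversions s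

  length-ones-zeros : ∀ s → length s ≡ ones s ℕ.+ zeros s
  length-ones-zeros [] = refl
  length-ones-zeros (true ∷ s) = cong suc (length-ones-zeros s)
  length-ones-zeros (false ∷ s) = trans (cong suc (length-ones-zeros s)) (sym (+-suc (ones s) (zeros s)))

  private
    headBit : Word → ℤ
    headBit [] = + 0
    headBit (x ∷ s) = bit x

    -- Summation by parts in `weight`: the differences of consecutive weights
    -- `(p + i + 1)(N − 1 − i)` are linear in the position `i`, so the ones contribute their
    -- positions, which count inversions. The term with `headBit` is the boundary term at the left
    -- end, where the weight would be `p N`; it disappears for `p = 0`.
    predicted : ℕ → Word → ℤ
    predicted p s = + ones s * (+ zeros s - + p) - + 2 * + inversions s + headBit s * (+ p * + length s)

    weight-predicted : ∀ p s → weight p s ≡ predicted p s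
    weight-predicted p [] = refl
    weight-predicted p (true ∷ []) = sym (lemma (+ p))
      where
      lemma : ∀ p → + 1 * (+ 0 - p) - + 0 + + 1 * (p * + 1) ≡ + 0
      lemma = solve-∀
    weight-predicted p (false ∷ []) = refl
    weight-predicted p (x ∷ s@(y ∷ u)) = begin
      + (suc p ℕ.* suc (length u)) * (bit x - bit y) + weight (suc p) s
        ≡⟨ cong₂ (λ w v → w * (bit x - bit y) + v) (trans (ℤₚ.pos-* (suc p) (length s)) (cong (λ l → + suc p * + l) (length-ones-zeros s))) (weight-predicted (suc p) s) ⟩
      + suc p * + (ones s ℕ.+ zeros s) * (bit x - bit y) + (+ ones s * (+ zeros s - + suc p) - + 2 * + inversions s + bit y * (+ suc p * + length s))
        ≡⟨ cong (λ l → + suc p * + (ones s ℕ.+ zeros s) * (bit x - bit y) + (+ ones s * (+ zeros s - + suc p) - + 2 * + inversions s + bit y * (+ suc p * + l))) (length-ones-zeros s) ⟩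
      + suc p * + (ones s ℕ.+ zeros s) * (bit x - bit y) + (+ ones s * (+ zeros s - + suc p) - + 2 * + inversions s + bit y * (+ suc p * + (ones s ℕ.+ zeros s)))
        ≡⟨ final x (+ p) (+ ones s) (+ zeros s) (+ inversions s) (bit y) ⟩
      predicted′ x (+ p) (+ ones s) (+ zeros s) (+ inversions s) ≡⟨ collect x ⟩
      predicted p (x ∷ s) ∎
      where
      predicted′ : Bool → ℤ → ℤ → ℤ → ℤ → ℤ
      predicted′ true p k z i = (+ 1 + k) * (z - p) - + 2 * i + + 1 * (p * (+ 1 + (k + z)))
      predicted′ false p k z i = k * ((+ 1 + z) - p) - + 2 * (k + i) + + 0 * (p * (+ 1 + (k + z)))
      one : ∀ p k z i β → (+ 1 + p) * (k + z) * (+ 1 - β) + (k * (z - (+ 1 + p)) - + 2 * i + β * ((+ 1 + p) * (k + z)))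
            ≡ (+ 1 + k) * (z - p) - + 2 * i + + 1 * (p * (+ 1 + (k + z)))
      one = solve-∀
      zer : ∀ p k z i β → (+ 1 + p) * (k + z) * (+ 0 - β) + (k * (z - (+ 1 + p)) - + 2 * i + β * ((+ 1 + p) * (k + z)))
            ≡ k * ((+ 1 + z) - p) - + 2 * (k + i) + + 0 * (p * (+ 1 + (k + z)))
      zer = solve-∀
      final : ∀ x p k z i β → (+ 1 + p) * (k + z) * (bit x - β) + (k * (z - (+ 1 + p)) - + 2 * i + β * ((+ 1 + p) * (k + z))) ≡ predicted′ x p k z i
      final true = one
      final false = zer
      collect : ∀ x → predicted′ x (+ p) (+ ones s) (+ zeros s) (+ inversions s) ≡ predicted p (x ∷ s)
      collect true = cong (λ l → + suc (ones s) * (+ zeros s - + p) - + 2 * + inversions s + + 1 * (+ p * + suc l)) (sym (length-ones-zeros s))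
      collect false = cong (λ l → + ones s * (+ suc (zeros s) - + p) - + 2 * + (ones s ℕ.+ inversions s) + + 0 * (+ p * + suc l)) (sym (length-ones-zeros s))

  weight-formula : ∀ s → weight 0 s ≡ + ones s * + zeros s - + 2 * + inversions s
  weight-formula s = trans (weight-predicted 0 s) (lemma (+ ones s) (+ zeros s) (+ inversions s) (headBit s) (+ length s))
    where
    lemma : ∀ k z i β l → k * (z - + 0) - + 2 * i + β * (+ 0 * l) ≡ k * z - + 2 * i
    lemma = solve-∀

  record SameContent (s s′ : Word) : Set where
    constructor same
    field
      ones≡  : ones s ≡ ones s′
      zeros≡ : zeros s ≡ zeros s′

  sum-nonzero : ∀ u v → u + v ≢ + 0 → u ≢ + 0 ⊎ v ≢ + 0
  sum-nonzero u v n with u ℤ.≟ + 0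
  ... | no u≢0 = inj₁ u≢0
  ... | yes refl = inj₂ (λ e → n (trans (ℤₚ.+-identityˡ v) e))

  private
    same-∷ : ∀ x {s s′} → SameContent s s′ → SameContent (x ∷ s) (x ∷ s′)
    same-∷ true (same o z) = same (cong suc o) z
    same-∷ false (same o z) = same o (cong suc z)

    inversions-∷ : ∀ x {s s′} → SameContent s s′ → inversions s ≡ suc (inversions s′) → inversions (x ∷ s) ≡ suc (inversions (x ∷ s′))
    inversions-∷ true _ e = e
    inversions-∷ false {s} {s′} (same o _) e = trans (cong₂ ℕ._+_ o e) (+-suc (ones s′) (inversions s′))

  lower-support : ∀ f s → lower f s ≢ + 0 → ∃ λ s′ → f s′ ≢ + 0 × SameContent s′ s × inversions s′ ≡ suc (inversions s)
  lower-support f [] n = ⊥-elim (n refl)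
  lower-support f (x ∷ s) n with sum-nonzero (lowerHead f x s) _ n
  ... | inj₂ n′ with lower-support (λ t → f (x ∷ t)) s n′
  ...   | s′ , n″ , c , i = x ∷ s′ , n″ , same-∷ x c , inversions-∷ x c i
  lower-support f (true ∷ false ∷ s) n | inj₁ n′ = false ∷ true ∷ s , n′ , same refl refl , refl
  lower-support f (true ∷ true ∷ s) n | inj₁ n′ = ⊥-elim (n′ refl)
  lower-support f (true ∷ []) n | inj₁ n′ = ⊥-elim (n′ refl)
  lower-support f (false ∷ s) n | inj₁ n′ = ⊥-elim (n′ refl)

  raise-support : ∀ p f s → raise p f s ≢ + 0 → ∃ λ s′ → f s′ ≢ + 0 × SameContent s′ s × inversions s ≡ suc (inversions s′)
  raise-support p f [] n = ⊥-elim (n refl)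
  raise-support p f (x ∷ s) n with sum-nonzero (raiseHead p f x s) _ n
  ... | inj₂ n′ with raise-support (suc p) (λ t → f (x ∷ t)) s n′
  ...   | s′ , n″ , c@(same o z) , i = x ∷ s′ , n″ , same-∷ x c , inversions-∷ x (same (sym o) (sym z)) i
  raise-support p f (false ∷ true ∷ s) n | inj₁ n′ = true ∷ false ∷ s
    , (λ e → n′ (trans (cong (_*_ (+ (suc p ℕ.* suc (length s)))) e) (ℤₚ.*-zeroʳ (+ (suc p ℕ.* suc (length s)))))) , same refl refl , refl
  raise-support p f (false ∷ false ∷ s) n | inj₁ n′ = ⊥-elim (n′ refl)
  raise-support p f (false ∷ []) n | inj₁ n′ = ⊥-elim (n′ refl)
  raise-support p f (true ∷ s) n | inj₁ n′ = ⊥-elim (n′ refl)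

  inversions-bound : ∀ s → inversions s ≤ ones s ℕ.* zeros s
  inversions-bound [] = z≤n
  inversions-bound (true ∷ s) = ≤-trans (inversions-bound s) (m≤n+m _ (zeros s))
  inversions-bound (false ∷ s) = ≤-trans (+-monoʳ-≤ (ones s) (inversions-bound s)) (≤-reflexive (sym (*-suc (ones s) (zeros s))))

  Words² : Set
  Words² = Word × Word

  _≟²_ : (a b : Words²) → Dec (a ≡ b)
  _≟²_ = Productₚ.≡-dec (Listₚ.≡-dec Boolₚ._≟_) (Listₚ.≡-dec Boolₚ._≟_)

  lower² raise² : (Words² → ℤ) → Words² → ℤ
  lower² f (s , t) = lower (λ s′ → f (s′ , t)) s + lower (λ t′ → f (s , t′)) t
  raise² f (s , t) = raise 0 (λ s′ → f (s′ , t)) s + raise 0 (λ t′ → f (s , t′)) t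

  lower²-cong : ∀ {f g} → (∀ a → f a ≡ g a) → ∀ a → lower² f a ≡ lower² g a
  lower²-cong e (s , t) = cong₂ _+_ (lower-cong (λ s′ → e (s′ , t)) s) (lower-cong (λ t′ → e (s , t′)) t)

  raise²-cong : ∀ {f g} → (∀ a → f a ≡ g a) → ∀ a → raise² f a ≡ raise² g a
  raise²-cong e (s , t) = cong₂ _+_ (raise-cong 0 (λ s′ → e (s′ , t)) s) (raise-cong 0 (λ t′ → e (s , t′)) t)

  private
    neg-form : ∀ c d u v → c * u - d * v ≡ c * u + (- d) * v
    neg-form = solve-∀

  lower²-linear : ∀ c f d g a → lower² (λ a → c * f a - d * g a) a ≡ c * lower² f a - d * lower² g a
  lower²-linear c f d g (s , t) = trans (lower²-cong {λ a → c * f a - d * g a} {λ a → c * f a + (- d) * g a} (λ a → neg-form c d (f a) (g a)) (s , t))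
    (trans (cong₂ _+_ (lower-linear c (λ s′ → f (s′ , t)) (- d) (λ s′ → g (s′ , t)) s) (lower-linear c (λ t′ → f (s , t′)) (- d) (λ t′ → g (s , t′)) t))
    (trans (lin-sum c (lower (λ s′ → f (s′ , t)) s) (lower (λ t′ → f (s , t′)) t) (- d) (lower (λ s′ → g (s′ , t)) s) (lower (λ t′ → g (s , t′)) t))
           (sym (neg-form c d (lower² f (s , t)) (lower² g (s , t))))))

  raise²-linear : ∀ c f d g a → raise² (λ a → c * f a - d * g a) a ≡ c * raise² f a - d * raise² g a
  raise²-linear c f d g (s , t) = trans (raise²-cong {λ a → c * f a - d * g a} {λ a → c * f a + (- d) * g a} (λ a → neg-form c d (f a) (g a)) (s , t))
    (trans (cong₂ _+_ (raise-linear 0 c (λ s′ → f (s′ , t)) (- d) (λ s′ → g (s′ , t)) s) (raise-linear 0 c (λ t′ → f (s , t′)) (- d) (λ t′ → g (s , t′)) t))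
    (trans (lin-sum c (raise 0 (λ s′ → f (s′ , t)) s) (raise 0 (λ t′ → f (s , t′)) t) (- d) (raise 0 (λ s′ → g (s′ , t)) s) (raise 0 (λ t′ → g (s , t′)) t))
           (sym (neg-form c d (raise² f (s , t)) (raise² g (s , t))))))

  lower²-scale : ∀ c f a → lower² (λ a → c * f a) a ≡ c * lower² f a
  lower²-scale c f (s , t) = trans (cong₂ _+_ (lower-scale c (λ s′ → f (s′ , t)) s) (lower-scale c (λ t′ → f (s , t′)) t)) (sym (ℤₚ.*-distribˡ-+ c _ _))

  raise²-scale : ∀ c f a → raise² (λ a → c * f a) a ≡ c * raise² f a
  raise²-scale c f (s , t) = trans (cong₂ _+_ (raise-scale 0 c (λ s′ → f (s′ , t)) s) (raise-scale 0 c (λ t′ → f (s , t′)) t)) (sym (ℤₚ.*-distribˡ-+ c _ _))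

  -- `lower²` and `raise²` act on pairs by the product rule. Operators on different components
  -- commute, so the mixed terms cancel and the weights add.
  commutator² : ∀ f s t → lower² (raise² f) (s , t) ≡ raise² (lower² f) (s , t) + (weight 0 s + weight 0 t) * f (s , t)
  commutator² f s t = begin
    lower (λ s′ → raise 0 (fₜ t) s′ + raise 0 (fₛ s′) t) s + lower (λ t′ → raise 0 (fₜ t′) s + raise 0 (fₛ s) t′) t
      ≡⟨ cong₂ _+_ (lower-+ (raise 0 (fₜ t)) (λ s′ → raise 0 (fₛ s′) t) s) (lower-+ (λ t′ → raise 0 (fₜ t′) s) (raise 0 (fₛ s)) t) ⟩
    (lower (raise 0 (fₜ t)) s + lower (λ s′ → raise 0 (fₛ s′) t) s) + (lower (λ t′ → raise 0 (fₜ t′) s) t + lower (raise 0 (fₛ s)) t)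
      ≡⟨ cong₂ _+_ (cong₂ _+_ (commutator 0 (fₜ t) s) (lower-raise-exchange 0 fₛ s t))
                   (cong₂ _+_ (lower-raise-exchange 0 fₜ t s) (commutator 0 (fₛ s) t)) ⟩
    ((raise 0 (lower (fₜ t)) s + weight 0 s * F) + raise 0 (λ t′ → lower (fₜ t′) s) t)
      + (raise 0 (λ s′ → lower (fₛ s′) t) s + (raise 0 (lower (fₛ s)) t + weight 0 t * F))
      ≡⟨ ring (raise 0 (lower (fₜ t)) s) (weight 0 s) F (raise 0 (λ t′ → lower (fₜ t′) s) t) (raise 0 (λ s′ → lower (fₛ s′) t) s) (raise 0 (lower (fₛ s)) t) (weight 0 t) ⟩
    ((raise 0 (lower (fₜ t)) s + raise 0 (λ s′ → lower (fₛ s′) t) s) + (raise 0 (λ t′ → lower (fₜ t′) s) t + raise 0 (lower (fₛ s)) t))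
      + (weight 0 s + weight 0 t) * F
      ≡⟨ cong (_+ (weight 0 s + weight 0 t) * F) (sym (cong₂ _+_ (raise-+ 0 (lower (fₜ t)) (λ s′ → lower (fₛ s′) t) s) (raise-+ 0 (λ t′ → lower (fₜ t′) s) (lower (fₛ s)) t))) ⟩
    raise² (lower² f) (s , t) + (weight 0 s + weight 0 t) * F ∎
    where
    F = f (s , t)
    fₜ fₛ : Word → Fn
    fₜ t s′ = f (s′ , t)
    fₛ s t′ = f (s , t′)
    ring : ∀ a w v b c d u → ((a + w * v) + b) + (c + (d + u * v)) ≡ ((a + c) + (b + d)) + (w + u) * v
    ring = solve-∀

  module Levels (k₁ j₁ k₂ j₂ : ℕ) where
    top : ℕ
    top = k₁ ℕ.* j₁ ℕ.+ k₂ ℕ.* j₂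

    record InLevel (r : ℕ) (a : Words²) : Set where
      constructor inLevel
      field
        ones₁ : ones (proj₁ a) ≡ k₁
        zeros₁ : zeros (proj₁ a) ≡ j₁
        ones₂ : ones (proj₂ a) ≡ k₂
        zeros₂ : zeros (proj₂ a) ≡ j₂
        level : inversions (proj₁ a) ℕ.+ inversions (proj₂ a) ≡ r

    Level : ℕ → (Words² → ℤ) → Set
    Level r f = ∀ a → f a ≢ + 0 → InLevel r a

    lower²-level : ∀ r {f} → Level (suc r) f → Level r (lower² f)
    lower²-level r {f} lev (s , t) n with sum-nonzero (lower (λ s′ → f (s′ , t)) s) _ n
    ... | inj₁ n′ with lower-support (λ s′ → f (s′ , t)) s n′
    ...   | s′ , n″ , same o z , i with lev (s′ , t) n″
    ...     | inLevel o₁ z₁ o₂ z₂ l = inLevel (trans (sym o) o₁) (trans (sym z) z₁) o₂ z₂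
                  (suc-injective (trans (cong (ℕ._+ inversions t) (sym i)) l))
    lower²-level r {f} lev (s , t) n | inj₂ n′ with lower-support (λ t′ → f (s , t′)) t n′
    ...   | t′ , n″ , same o z , i with lev (s , t′) n″
    ...     | inLevel o₁ z₁ o₂ z₂ l = inLevel o₁ z₁ (trans (sym o) o₂) (trans (sym z) z₂)
                  (suc-injective (trans (sym (+-suc (inversions s) (inversions t))) (trans (cong (inversions s ℕ.+_) (sym i)) l)))

    raise²-level : ∀ r {f} → Level r f → Level (suc r) (raise² f)
    raise²-level r {f} lev (s , t) n with sum-nonzero (raise 0 (λ s′ → f (s′ , t)) s) _ n
    ... | inj₁ n′ with raise-support 0 (λ s′ → f (s′ , t)) s n′
    ...   | s′ , n″ , same o z , i with lev (s′ , t) n″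
    ...     | inLevel o₁ z₁ o₂ z₂ l = inLevel (trans (sym o) o₁) (trans (sym z) z₁) o₂ z₂
                  (trans (cong (ℕ._+ inversions t) i) (cong suc l))
    raise²-level r {f} lev (s , t) n | inj₂ n′ with raise-support 0 (λ t′ → f (s , t′)) t n′
    ...   | t′ , n″ , same o z , i with lev (s , t′) n″
    ...     | inLevel o₁ z₁ o₂ z₂ l = inLevel o₁ z₁ (trans (sym o) o₂) (trans (sym z) z₂)
                  (trans (cong (inversions s ℕ.+_) i) (trans (+-suc (inversions s) (inversions t′)) (cong suc l)))

    level-bound : ∀ {r a} → InLevel r a → r ≤ top
    level-bound {r} {s , t} (inLevel refl refl refl refl refl) = +-mono-≤ (inversions-bound s) (inversions-bound t)

    lower²-bottom : ∀ {f} → Level 0 f → ∀ a → lower² f a ≡ + 0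
    lower²-bottom {f} lev a with lower² f a ℤ.≟ + 0
    ... | yes e = e
    lower²-bottom {f} lev (s , t) | no n with sum-nonzero (lower (λ s′ → f (s′ , t)) s) _ n
    ... | inj₁ n′ with lower-support (λ s′ → f (s′ , t)) s n′
    ...   | s′ , n″ , _ , i with trans (cong (ℕ._+ inversions t) (sym i)) (InLevel.level (lev (s′ , t) n″))
    ...     | ()
    lower²-bottom {f} lev (s , t) | no n | inj₂ n′ with lower-support (λ t′ → f (s , t′)) t n′
    ...   | t′ , n″ , _ , i with trans (sym (+-suc (inversions s) (inversions t))) (trans (cong (inversions s ℕ.+_) (sym i)) (InLevel.level (lev (s , t′) n″)))
    ...     | ()

    raise²-top : ∀ {f} → Level top f → ∀ a → raise² f a ≡ + 0
    raise²-top {f} lev a with raise² f a ℤ.≟ + 0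
    ... | yes e = e
    ... | no n = ⊥-elim (<-irrefl refl (level-bound (raise²-level top lev a n)))

    h : ℕ → ℤ
    h r = + top - + 2 * + r

    weight-level : ∀ r {f} → Level r f → ∀ s t → (weight 0 s + weight 0 t) * f (s , t) ≡ h r * f (s , t)
    weight-level r {f} lev s t with f (s , t) ℤ.≟ + 0
    ... | yes e rewrite e = trans (ℤₚ.*-zeroʳ (weight 0 s + weight 0 t)) (sym (ℤₚ.*-zeroʳ (h r)))
    ... | no n with lev (s , t) n
    ...   | inLevel refl refl refl refl refl = cong (_* f (s , t)) (begin
      weight 0 s + weight 0 t ≡⟨ cong₂ _+_ (weight-formula s) (weight-formula t) ⟩
      (+ ones s * + zeros s - + 2 * + inversions s) + (+ ones t * + zeros t - + 2 * + inversions t)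
        ≡⟨ cong₂ (λ u v → (u - + 2 * + inversions s) + (v - + 2 * + inversions t)) (sym (ℤₚ.pos-* (ones s) (zeros s))) (sym (ℤₚ.pos-* (ones t) (zeros t))) ⟩
      (+ (ones s ℕ.* zeros s) - + 2 * + inversions s) + (+ (ones t ℕ.* zeros t) - + 2 * + inversions t)
        ≡⟨ ring (+ (ones s ℕ.* zeros s)) (+ inversions s) (+ (ones t ℕ.* zeros t)) (+ inversions t) ⟩
      (+ (ones s ℕ.* zeros s) + + (ones t ℕ.* zeros t)) - + 2 * (+ inversions s + + inversions t) ∎)
      where
      ring : ∀ a i b j → (a - + 2 * i) + (b - + 2 * j) ≡ (a + b) - + 2 * (i + j)
      ring = solve-∀

    commutator-level : ∀ r {f} → Level r f → ∀ a → lower² (raise² f) a ≡ raise² (lower² f) a + h r * f a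
    commutator-level r {f} lev (s , t) = trans (commutator² f s t) (cong (_+_ (raise² (lower² f) (s , t))) (weight-level r {f} lev s t))

    private
      raise²-0 : ∀ a → raise² (λ _ → + 0) a ≡ + 0
      raise²-0 (s , t) = cong₂ _+_ (raise-0 0 s) (raise-0 0 t)

      lower²-0 : ∀ a → lower² (λ _ → + 0) a ≡ + 0
      lower²-0 (s , t) = cong₂ _+_ (lower-0 s) (lower-0 t)

    module Up = Injectivity lower² raise² Level h lower²-cong raise²-cong lower²-scale
      raise²-0 lower²-level lower²-bottom commutator-level

    -- The levels counted from the top, for the injectivity of the lowering operator in the upper half.
    CoLevel : ℕ → (Words² → ℤ) → Set
    CoLevel r f = ∃ λ r′ → r ℕ.+ r′ ≡ top × Level r′ f

    private
      co-level : ∀ r {f} → CoLevel (suc r) f → CoLevel r (raise² f)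
      co-level r (r′ , e , lev) = suc r′ , trans (+-suc r r′) e , raise²-level r′ lev

      co-bottom : ∀ {f} → CoLevel 0 f → ∀ a → raise² f a ≡ + 0
      co-bottom {f} (_ , refl , lev) = raise²-top {f} lev

      co-commutator : ∀ r {f} → CoLevel r f → ∀ a → raise² (lower² f) a ≡ lower² (raise² f) a + h r * f a
      co-commutator r {f} (r′ , e , lev) a = begin
        raise² (lower² f) a ≡⟨ ring (raise² (lower² f) a) (h r′ * f a) ⟩
        (raise² (lower² f) a + h r′ * f a) - h r′ * f a ≡⟨ cong (_- h r′ * f a) (sym (commutator-level r′ lev a)) ⟩
        lower² (raise² f) a - h r′ * f a ≡⟨ cong (λ t → lower² (raise² f) a - (+ t - + 2 * + r′) * f a) (sym e) ⟩
        lower² (raise² f) a - (+ (r ℕ.+ r′) - + 2 * + r′) * f a ≡⟨ ring′ (lower² (raise² f) a) (+ r) (+ r′) (f a) ⟩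
        lower² (raise² f) a + (+ (r ℕ.+ r′) - + 2 * + r) * f a ≡⟨ cong (λ t → lower² (raise² f) a + (+ t - + 2 * + r) * f a) e ⟩
        lower² (raise² f) a + h r * f a ∎
        where
        ring : ∀ u v → u ≡ u + v - v
        ring = solve-∀
        ring′ : ∀ u r r′ v → u - ((r + r′) - + 2 * r′) * v ≡ u + ((r + r′) - + 2 * r) * v
        ring′ = solve-∀

    module Down = Injectivity raise² lower² CoLevel h raise²-cong lower²-cong raise²-scale
      lower²-0 co-level co-bottom co-commutator

    open Elimination {Words²}

    private
      δ : Words² → Words² → ℤ
      δ a b with a ≟² b
      ... | yes _ = + 1
      ... | no _ = + 0

      δ-same : ∀ a → δ a a ≢ + 0
      δ-same a e with a ≟² a
      δ-same a () | yes _
      ... | no n = n refl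

      δ-other : ∀ a b → a ≢ b → δ a b ≡ + 0
      δ-other a b n with a ≟² b
      ... | yes e = ⊥-elim (n e)
      ... | no _ = refl

      δ-level : ∀ r a → InLevel r a → Level r (δ a)
      δ-level r a l b n with a ≟² b
      ... | yes refl = l
      ... | no _ = ⊥-elim (n refl)

      deltas : List Words² → List Pointed
      deltas = map (λ a → a , δ a)

      separated : ∀ xs → Unique xs → AllPairs Separated (deltas xs)
      separated [] [] = []
      separated (x ∷ xs) (u ∷ us) = Allₚ.map⁺ (All.map (λ {y} n → δ-other x y n , δ-other y x (λ e → n (sym e))) u) ∷ separated xs us

      closed : ∀ r → Closed (Level r)
      closed r c f d g pf pg a n with f a ℤ.≟ + 0 | g a ℤ.≟ + 0
      ... | no f≢0 | _ = pf a f≢0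
      ... | yes _ | no g≢0 = pg a g≢0
      ... | yes e | yes e′ = ⊥-elim (n (trans (cong₂ (λ u v → c * u - d * v) e e′) (cong₂ _-_ (ℤₚ.*-zeroʳ c) (ℤₚ.*-zeroʳ d))))

      -- If `xs` were longer than `ys`, the delta functions of `xs` would have a nonzero integral
      -- combination whose image under `B` vanishes at all of `ys`. That image is supported on level
      -- `r′`, hence zero, against the injectivity of `B`.
      compare : ∀ r r′ (B : (Words² → ℤ) → Words² → ℤ) → (∀ c f d g a → B (λ a → c * f a - d * g a) a ≡ c * B f a - d * B g a) →
        (∀ {f} → Level r f → Level r′ (B f)) → (∀ {f} → Level r f → (∀ a → B f a ≡ + 0) → ∀ a → f a ≡ + 0) →
        ∀ xs ys → Unique xs → All (InLevel r) xs → (∀ a → InLevel r′ a → a ∈ ys) → length xs ≤ length ys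
      compare r r′ B lin lev inj xs ys uniq lxs lys with length xs ℕ.≤? length ys
      ... | yes le = le
      ... | no nle with kernel-vector (map (λ y f → B f y) ys) (Allₚ.map⁺ (All.universal (λ y c f d g → lin c f d g y) ys)) (Level r) (closed r)
              (deltas xs) (separated xs uniq) (Allₚ.map⁺ (All.map (λ {a} l → δ-same a , δ-level r a l) lxs))
              (≤-trans (s≤s (≤-reflexive (Listₚ.length-map _ ys))) (≤-trans (≰⇒> nle) (≤-reflexive (sym (Listₚ.length-map _ xs)))))
      ...   | (x , f) , fx≢0 , lf , zs = ⊥-elim (fx≢0 (inj lf vanish x))
        where
        vanish : ∀ a → B f a ≡ + 0
        vanish a with B f a ℤ.≟ + 0
        ... | yes e = e
        ... | no n = All.lookup (Allₚ.map⁻ zs) (lys a (lev lf a n))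

      h-positive : ∀ r → 2 ℕ.* r < top → + 0 ℤ.< h r
      h-positive r lt = subst (λ w → + 0 ℤ.< + top - w) (ℤₚ.pos-* 2 r)
        (subst (ℤ._< + top - + (2 ℕ.* r)) (ℤₚ.+-inverseʳ (+ (2 ℕ.* r))) (ℤₚ.+-monoˡ-< (- + (2 ℕ.* r)) (ℤ.+<+ lt)))

    rank-increasing : ∀ r → 2 ℕ.* r < top → ∀ xs ys → Unique xs → All (InLevel r) xs → (∀ a → InLevel (suc r) a → a ∈ ys) → length xs ≤ length ys
    rank-increasing r lt = compare r (suc r) raise² raise²-linear (λ {f} → raise²-level r {f})
      (λ {f} → Up.injective r (λ s s≤r → h-positive s (≤-<-trans (*-monoʳ-≤ 2 s≤r) lt)) {f})

    rank-decreasing : ∀ r → top < 2 ℕ.* suc r → ∀ xs ys → Unique xs → All (InLevel (suc r)) xs → (∀ a → InLevel r a → a ∈ ys) → length xs ≤ length ys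
    rank-decreasing r lt = compare (suc r) r lower² lower²-linear (λ {f} → lower²-level r {f}) inject
      where
      inject : ∀ {f} → Level (suc r) f → (∀ a → lower² f a ≡ + 0) → ∀ a → f a ≡ + 0
      inject {f} lev z a with f a ℤ.≟ + 0
      ... | yes e = e
      -- `suc r ≤ top` is not among the hypotheses; the point where `f` is nonzero provides it.
      ... | no n = Down.injective i (λ s s≤i → h-positive s (≤-<-trans (*-monoʳ-≤ 2 s≤i) 2i<top)) {f} (suc r , i+r≡top , lev) z a
        where
        r≤top : suc r ≤ top
        r≤top = level-bound (lev a n)
        i = top ℕ.∸ suc r
        i+r≡top : i ℕ.+ suc r ≡ top
        i+r≡top = m∸n+n≡m r≤top
        2i<top : 2 ℕ.* i < top
        2i<top = +-cancelʳ-< (2 ℕ.* suc r) _ _ (≤-<-trans (≤-reflexive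
          (trans (sym (*-distribˡ-+ 2 i (suc r))) (trans (cong (2 ℕ.*_) i+r≡top) (cong (top ℕ.+_) (+-identityʳ top)))))
          (+-monoʳ-< top lt))

-- Integer polynomials, cyclotomic polynomials and the q-Narayana polynomial

module Polynomials where
  open Unimodality

  -- The ring of integer polynomials

  infix 4 _≈_
  -- Equality of coefficient functions, because a list may end in zeros.
  record _≈_ (p q : Poly) : Set where
    constructor mk
    field at : ∀ i → coeff p i ≡ coeff q i
  open _≈_ public

  ≈-refl : ∀ {p} → p ≈ p
  ≈-refl = mk λ _ → refl

  ≈-sym : ∀ {p q} → p ≈ q → q ≈ p
  ≈-sym e = mk λ i → sym (at e i)

  ≈-trans : ∀ {p q r} → p ≈ q → q ≈ r → p ≈ r
  ≈-trans e f = mk λ i → trans (at e i) (at f i)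

  coeff-add : ∀ p q i → coeff (addP p q) i ≡ coeff p i ℤ.+ coeff q i
  coeff-add []      q       i       = sym (ℤₚ.+-identityˡ _)
  coeff-add (c ∷ p) []      zero    = sym (ℤₚ.+-identityʳ _)
  coeff-add (c ∷ p) []      (suc i) = sym (ℤₚ.+-identityʳ _)
  coeff-add (c ∷ p) (e ∷ q) zero    = refl
  coeff-add (c ∷ p) (e ∷ q) (suc i) = coeff-add p q i

  coeff-neg : ∀ p i → coeff (negP p) i ≡ ℤ.- coeff p i
  coeff-neg []      i       = refl
  coeff-neg (c ∷ p) zero    = refl
  coeff-neg (c ∷ p) (suc i) = coeff-neg p i

  coeff-scale : ∀ c p i → coeff (scaleP c p) i ≡ c ℤ.* coeff p i
  coeff-scale c []      i       = sym (ℤₚ.*-zeroʳ c)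
  coeff-scale c (e ∷ p) zero    = refl
  coeff-scale c (e ∷ p) (suc i) = coeff-scale c p i

  coeff-sub : ∀ p q i → coeff (subP p q) i ≡ coeff p i ℤ.- coeff q i
  coeff-sub p q i = trans (coeff-add p (negP q) i) (cong (ℤ._+_ (coeff p i)) (coeff-neg q i))

  add-cong : ∀ {p p′ q q′} → p ≈ p′ → q ≈ q′ → addP p q ≈ addP p′ q′
  add-cong {p} {p′} {q} {q′} e f = mk λ i →
    trans (coeff-add p q i) (trans (cong₂ ℤ._+_ (at e i) (at f i)) (sym (coeff-add p′ q′ i)))

  addˡ : ∀ p {q q′} → q ≈ q′ → addP p q ≈ addP p q′
  addˡ p = add-cong {p} ≈-refl

  addʳ : ∀ q {p p′} → p ≈ p′ → addP p q ≈ addP p′ q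
  addʳ q e = add-cong {q = q} e ≈-refl

  neg-cong : ∀ {p q} → p ≈ q → negP p ≈ negP q
  neg-cong {p} {q} e = mk λ i → trans (coeff-neg p i) (trans (cong ℤ.-_ (at e i)) (sym (coeff-neg q i)))

  scale-cong : ∀ c {p q} → p ≈ q → scaleP c p ≈ scaleP c q
  scale-cong c {p} {q} e = mk λ i →
    trans (coeff-scale c p i) (trans (cong (c ℤ.*_) (at e i)) (sym (coeff-scale c q i)))

  ∷-cong : ∀ {c e p q} → c ≡ e → p ≈ q → (c ∷ p) ≈ (e ∷ q)
  ∷-cong c≡ p≈ = mk λ { zero → c≡ ; (suc i) → at p≈ i }

  tail-≈ : ∀ {c e p q} → (c ∷ p) ≈ (e ∷ q) → p ≈ q
  tail-≈ e = mk λ i → at e (suc i)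

  0∷[] : (+ 0 ∷ []) ≈ []
  0∷[] = mk λ { zero → refl ; (suc i) → refl }

  add-comm : ∀ p q → addP p q ≈ addP q p
  add-comm p q = mk λ i → trans (coeff-add p q i) (trans (ℤₚ.+-comm (coeff p i) (coeff q i)) (sym (coeff-add q p i)))

  add-assoc : ∀ p q r → addP (addP p q) r ≈ addP p (addP q r)
  add-assoc p q r = mk λ i → trans (coeff-add (addP p q) r i) (trans (cong (ℤ._+ coeff r i) (coeff-add p q i))
    (trans (ℤₚ.+-assoc (coeff p i) _ _) (sym (trans (coeff-add p (addP q r) i) (cong (ℤ._+_ (coeff p i)) (coeff-add q r i))))))

  add-idʳ : ∀ p → addP p [] ≈ p
  add-idʳ p = mk λ i → trans (coeff-add p [] i) (ℤₚ.+-identityʳ _)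

  add-invʳ : ∀ p → addP p (negP p) ≈ []
  add-invʳ p = mk λ i → trans (coeff-sub p p i) (ℤₚ.+-inverseʳ (coeff p i))

  add-invˡ : ∀ p → addP (negP p) p ≈ []
  add-invˡ p = ≈-trans (add-comm (negP p) p) (add-invʳ p)

  scale-add : ∀ c p q → scaleP c (addP p q) ≈ addP (scaleP c p) (scaleP c q)
  scale-add c p q = mk λ i → begin
    coeff (scaleP c (addP p q)) i ≡⟨ coeff-scale c (addP p q) i ⟩
    c ℤ.* coeff (addP p q) i ≡⟨ cong (c ℤ.*_) (coeff-add p q i) ⟩
    c ℤ.* (coeff p i ℤ.+ coeff q i) ≡⟨ ℤₚ.*-distribˡ-+ c _ _ ⟩
    c ℤ.* coeff p i ℤ.+ c ℤ.* coeff q i ≡⟨ cong₂ ℤ._+_ (sym (coeff-scale c p i)) (sym (coeff-scale c q i)) ⟩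
    coeff (scaleP c p) i ℤ.+ coeff (scaleP c q) i ≡⟨ sym (coeff-add (scaleP c p) (scaleP c q) i) ⟩
    coeff (addP (scaleP c p) (scaleP c q)) i ∎
    where open ≡-Reasoning

  scale-* : ∀ c e p → scaleP c (scaleP e p) ≈ scaleP (c ℤ.* e) p
  scale-* c e p = mk λ i → trans (coeff-scale c (scaleP e p) i) (trans (cong (c ℤ.*_) (coeff-scale e p i))
    (trans (sym (ℤₚ.*-assoc c e _)) (sym (coeff-scale (c ℤ.* e) p i))))

  scale-0 : ∀ p → scaleP (+ 0) p ≈ []
  scale-0 p = mk λ i → coeff-scale (+ 0) p i

  scale-1 : ∀ p → scaleP (+ 1) p ≈ p
  scale-1 p = mk λ i → trans (coeff-scale (+ 1) p i) (ℤₚ.*-identityˡ _)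

  scale-0∷ : ∀ c p → scaleP c (+ 0 ∷ p) ≈ (+ 0 ∷ scaleP c p)
  scale-0∷ c p = ∷-cong (ℤₚ.*-zeroʳ c) ≈-refl

  polySetoid : Setoid 0ℓ 0ℓ
  polySetoid = record { Carrier = Poly ; _≈_ = _≈_
    ; isEquivalence = record { refl = ≈-refl ; sym = ≈-sym ; trans = ≈-trans } }

  open SetoidReasoning polySetoid

  interchange : ∀ p q r s → addP (addP p q) (addP r s) ≈ addP (addP p r) (addP q s)
  interchange p q r s = begin
    addP (addP p q) (addP r s) ≈⟨ add-assoc p q _ ⟩
    addP p (addP q (addP r s)) ≈⟨ addˡ p (≈-sym (add-assoc q r s)) ⟩
    addP p (addP (addP q r) s) ≈⟨ addˡ p (addʳ s (add-comm q r)) ⟩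
    addP p (addP (addP r q) s) ≈⟨ addˡ p (add-assoc r q s) ⟩
    addP p (addP r (addP q s)) ≈⟨ ≈-sym (add-assoc p r _) ⟩
    addP (addP p r) (addP q s) ∎

  mul-congʳ : ∀ p {q q′} → q ≈ q′ → mulP p q ≈ mulP p q′
  mul-congʳ []      e = ≈-refl
  mul-congʳ (c ∷ p) e = add-cong (scale-cong c e) (∷-cong refl (mul-congʳ p e))

  mul-zeroʳ : ∀ p → mulP p [] ≈ []
  mul-zeroʳ []      = ≈-refl
  mul-zeroʳ (c ∷ p) = ≈-trans (∷-cong refl (mul-zeroʳ p)) 0∷[]

  mul-shiftˡ : ∀ p q → mulP (+ 0 ∷ p) q ≈ (+ 0 ∷ mulP p q)
  mul-shiftˡ p q = addʳ (+ 0 ∷ mulP p q) (scale-0 q)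

  mul-∷ʳ : ∀ p c q → mulP p (c ∷ q) ≈ addP (scaleP c p) (+ 0 ∷ mulP p q)
  mul-∷ʳ []      c q = ≈-sym 0∷[]
  mul-∷ʳ (e ∷ p) c q = ∷-cong (cong (ℤ._+ + 0) (ℤₚ.*-comm e c)) (begin
    addP (scaleP e q) (mulP p (c ∷ q)) ≈⟨ addˡ (scaleP e q) (mul-∷ʳ p c q) ⟩
    addP (scaleP e q) (addP (scaleP c p) (+ 0 ∷ mulP p q)) ≈⟨ ≈-sym (add-assoc (scaleP e q) _ _) ⟩
    addP (addP (scaleP e q) (scaleP c p)) (+ 0 ∷ mulP p q) ≈⟨ addʳ (+ 0 ∷ mulP p q) (add-comm (scaleP e q) _) ⟩
    addP (addP (scaleP c p) (scaleP e q)) (+ 0 ∷ mulP p q) ≈⟨ add-assoc (scaleP c p) _ _ ⟩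
    addP (scaleP c p) (addP (scaleP e q) (+ 0 ∷ mulP p q)) ∎)

  mul-comm : ∀ p q → mulP p q ≈ mulP q p
  mul-comm []      q = ≈-sym (mul-zeroʳ q)
  mul-comm (c ∷ p) q = begin
    addP (scaleP c q) (+ 0 ∷ mulP p q) ≈⟨ addˡ (scaleP c q) (∷-cong refl (mul-comm p q)) ⟩
    addP (scaleP c q) (+ 0 ∷ mulP q p) ≈⟨ ≈-sym (mul-∷ʳ q c p) ⟩
    mulP q (c ∷ p) ∎

  mul-cong : ∀ {p p′ q q′} → p ≈ p′ → q ≈ q′ → mulP p q ≈ mulP p′ q′
  mul-cong {p} {p′} {q} {q′} e f = begin
    mulP p q ≈⟨ mul-congʳ p f ⟩
    mulP p q′ ≈⟨ mul-comm p q′ ⟩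
    mulP q′ p ≈⟨ mul-congʳ q′ e ⟩
    mulP q′ p′ ≈⟨ mul-comm q′ p′ ⟩
    mulP p′ q′ ∎

  mul-distribˡ : ∀ p q r → mulP p (addP q r) ≈ addP (mulP p q) (mulP p r)
  mul-distribˡ []      q r = ≈-refl
  mul-distribˡ (c ∷ p) q r = begin
    addP (scaleP c (addP q r)) (+ 0 ∷ mulP p (addP q r))
      ≈⟨ add-cong (scale-add c q r) (∷-cong refl (mul-distribˡ p q r)) ⟩
    addP (addP (scaleP c q) (scaleP c r)) (addP (+ 0 ∷ mulP p q) (+ 0 ∷ mulP p r))
      ≈⟨ interchange (scaleP c q) _ _ _ ⟩
    addP (mulP (c ∷ p) q) (mulP (c ∷ p) r) ∎

  mul-distribʳ : ∀ r p q → mulP (addP p q) r ≈ addP (mulP p r) (mulP q r)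
  mul-distribʳ r p q = begin
    mulP (addP p q) r ≈⟨ mul-comm (addP p q) r ⟩
    mulP r (addP p q) ≈⟨ mul-distribˡ r p q ⟩
    addP (mulP r p) (mulP r q) ≈⟨ add-cong (mul-comm r p) (mul-comm r q) ⟩
    addP (mulP p r) (mulP q r) ∎

  mul-scaleˡ : ∀ c p q → mulP (scaleP c p) q ≈ scaleP c (mulP p q)
  mul-scaleˡ c []      q = ≈-refl
  mul-scaleˡ c (e ∷ p) q = begin
    addP (scaleP (c ℤ.* e) q) (+ 0 ∷ mulP (scaleP c p) q)
      ≈⟨ add-cong (≈-sym (scale-* c e q)) (∷-cong refl (mul-scaleˡ c p q)) ⟩
    addP (scaleP c (scaleP e q)) (+ 0 ∷ scaleP c (mulP p q))
      ≈⟨ addˡ (scaleP c (scaleP e q)) (≈-sym (scale-0∷ c (mulP p q))) ⟩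
    addP (scaleP c (scaleP e q)) (scaleP c (+ 0 ∷ mulP p q))
      ≈⟨ ≈-sym (scale-add c (scaleP e q) _) ⟩
    scaleP c (mulP (e ∷ p) q) ∎

  mul-assoc : ∀ p q r → mulP (mulP p q) r ≈ mulP p (mulP q r)
  mul-assoc []      q r = ≈-refl
  mul-assoc (c ∷ p) q r = begin
    mulP (addP (scaleP c q) (+ 0 ∷ mulP p q)) r
      ≈⟨ mul-distribʳ r (scaleP c q) _ ⟩
    addP (mulP (scaleP c q) r) (mulP (+ 0 ∷ mulP p q) r)
      ≈⟨ add-cong (mul-scaleˡ c q r) (mul-shiftˡ (mulP p q) r) ⟩
    addP (scaleP c (mulP q r)) (+ 0 ∷ mulP (mulP p q) r)
      ≈⟨ addˡ (scaleP c (mulP q r)) (∷-cong refl (mul-assoc p q r)) ⟩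
    addP (scaleP c (mulP q r)) (+ 0 ∷ mulP p (mulP q r)) ∎

  mul-const : ∀ c p → mulP [ c ] p ≈ scaleP c p
  mul-const c p = ≈-trans (addˡ (scaleP c p) 0∷[]) (add-idʳ (scaleP c p))

  mul-idˡ : ∀ p → mulP [ + 1 ] p ≈ p
  mul-idˡ p = ≈-trans (mul-const (+ 1) p) (scale-1 p)

  mul-idʳ : ∀ p → mulP p [ + 1 ] ≈ p
  mul-idʳ p = ≈-trans (mul-comm p [ + 1 ]) (mul-idˡ p)

  polyRing : CommutativeRing 0ℓ 0ℓ
  polyRing = record
    { Carrier = Poly ; _≈_ = _≈_ ; _+_ = addP ; _*_ = mulP ; -_ = negP ; 0# = [] ; 1# = [ + 1 ]
    ; isCommutativeRing = record
      { isRing = record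
        { +-isAbelianGroup = record
          { isGroup = record
            { isMonoid = record
              { isSemigroup = record
                { isMagma = record { isEquivalence = Setoid.isEquivalence polySetoid ; ∙-cong = add-cong }
                ; assoc = add-assoc }
              ; identity = (λ p → ≈-refl) , add-idʳ }
            ; inverse = add-invˡ , add-invʳ
            ; ⁻¹-cong = neg-cong }
          ; comm = add-comm }
        ; *-cong = mul-cong
        ; *-assoc = mul-assoc
        ; *-identity = mul-idˡ , mul-idʳ
        ; distrib = mul-distribˡ , mul-distribʳ }
      ; *-comm = mul-comm } }

  ≈⇒isZero : ∀ {p} → p ≈ [] → IsZeroP p
  ≈⇒isZero {[]}    e = []
  ≈⇒isZero {c ∷ p} e = at e 0 ∷ ≈⇒isZero (mk λ i → at e (suc i))

  ≈⇒≈P : ∀ {p q} → p ≈ q → p ≈P q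
  ≈⇒≈P {p} {q} e = ≈⇒isZero (≈-trans (addʳ (negP q) e) (add-invʳ q))

  opaque
    x : Poly
    x = + 0 ∷ [ + 1 ]

    mul-x : ∀ p → mulP x p ≈ (+ 0 ∷ p)
    mul-x p = ≈-trans (mul-shiftˡ [ + 1 ] p) (∷-cong refl (mul-idˡ p))

  ∷-decomp : ∀ c p → (c ∷ p) ≈ addP [ c ] (mulP x p)
  ∷-decomp c p = ≈-sym (≈-trans (addˡ [ c ] (mul-x p)) (∷-cong (ℤₚ.+-identityʳ c) ≈-refl))

  mulConst : ∀ c e → mulP [ c ] [ e ] ≈ [ c ℤ.* e ]
  mulConst c e = ∷-cong (ℤₚ.+-identityʳ _) ≈-refl

  coeff-const* : ∀ c p i → coeff (mulP [ c ] p) i ≡ c ℤ.* coeff p i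
  coeff-const* c p i = trans (at (mul-const c p) i) (coeff-scale c p i)

  const-cancel : ∀ c .{{_ : ℤ.NonZero c}} p → mulP [ c ] p ≈ [] → p ≈ []
  const-cancel c p e = mk λ i → ℤₚ.*-cancelˡ-≡ c _ _ (trans (sym (coeff-const* c p i)) (trans (at e i) (sym (ℤₚ.*-zeroʳ c))))

  -- Division by monic polynomials

  record Monic (g : Poly) (m : ℕ) : Set where
    constructor monic
    field
      leading : coeff g m ≡ + 1
      above   : ∀ j → m < j → coeff g j ≡ + 0
  open Monic public

  Monic-≈ : ∀ {f g m} → f ≈ g → Monic f m → Monic g m
  Monic-≈ e (monic l a) = monic (trans (sym (at e _)) l) (λ j lt → trans (sym (at e j)) (a j lt))

  coeff-mul-suc : ∀ c f g j → coeff (mulP (c ∷ f) g) (suc j) ≡ c ℤ.* coeff g (suc j) ℤ.+ coeff (mulP f g) j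
  coeff-mul-suc c f g j = trans (coeff-add (scaleP c g) (+ 0 ∷ mulP f g) (suc j))
    (cong (ℤ._+ coeff (mulP f g) j) (coeff-scale c g (suc j)))

  1≢0 : ¬ + 1 ≡ + 0
  1≢0 ()

  module _ {g : Poly} {m : ℕ} (mon : Monic g m) where
    coeff-mul-above : ∀ c f j → m ≤ j → coeff (mulP (c ∷ f) g) (suc j) ≡ coeff (mulP f g) j
    coeff-mul-above c f j m≤j = trans (coeff-mul-suc c f g j)
      (trans (cong (λ z → c ℤ.* z ℤ.+ coeff (mulP f g) j) (above mon (suc j) (s≤s m≤j)))
        (trans (cong (ℤ._+ coeff (mulP f g) j) (ℤₚ.*-zeroʳ c)) (ℤₚ.+-identityˡ _)))

    coeff-mul-lead : ∀ c f → f ≈ [] → coeff (mulP (c ∷ f) g) m ≡ c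
    coeff-mul-lead c f f≈ = trans (at (mul-cong {c ∷ f} {[ c ]} {g} (∷-cong refl f≈) ≈-refl) m)
      (trans (coeff-const* c g m) (trans (cong (c ℤ.*_) (leading mon)) (ℤₚ.*-identityʳ c)))

    -- Uniqueness of division with remainder: as `g` is monic of degree `m`, the leading coefficient
    -- of a nonzero `f` would reappear in the product in a degree at least `m`.
    mul-vanishing : ∀ f → (∀ j → m ≤ j → coeff (mulP f g) j ≡ + 0) → f ≈ []
    mul-vanishing [] h = ≈-refl
    mul-vanishing (c ∷ f) h = ≈-trans (∷-cong c≡0 f≈[]) 0∷[]
      where
      f≈[] : f ≈ []
      f≈[] = mul-vanishing f (λ j m≤j → trans (sym (coeff-mul-above c f j m≤j)) (h (suc j) (m≤n⇒m≤1+n m≤j)))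
      c≡0 : c ≡ + 0
      c≡0 = trans (sym (coeff-mul-lead c f f≈[])) (h m ≤-refl)

    mul-cancel-zero : ∀ f → mulP f g ≈ [] → f ≈ []
    mul-cancel-zero f e = mul-vanishing f (λ j _ → at e j)

    Monic-mul : ∀ {f d} → Monic f d → Monic (mulP f g) (d ℕ.+ m)
    Monic-mul {[]} (monic () _)
    Monic-mul {c ∷ f} {zero} (monic c≡1 ab) = monic
      (trans (coeff-mul-lead c f f≈[]) c≡1)
      (λ { (suc j) (s≤s m≤j) → trans (coeff-mul-above c f j m≤j) (at (mul-cong {f} {[]} {g} f≈[] ≈-refl) j) })
      where
      f≈[] : f ≈ []
      f≈[] = mk λ j → ab (suc j) (s≤s z≤n)
    Monic-mul {c ∷ f} {suc d} (monic l ab) with Monic-mul {f} {d} (monic l (λ j lt → ab (suc j) (s≤s lt)))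
    ... | monic l′ ab′ = monic
      (trans (coeff-mul-above c f (d ℕ.+ m) (m≤n+m m d)) l′)
      (λ { (suc j) (s≤s lt) → trans (coeff-mul-above c f j (≤-trans (m≤n+m m d) (<⇒≤ lt))) (ab′ j lt) })

    isZero? : ∀ p → Dec (p ≈ [])
    isZero? [] = yes ≈-refl
    isZero? (c ∷ p) with c ℤ.≟ + 0 | isZero? p
    ... | yes c≡ | yes p≈ = yes (≈-trans (∷-cong c≡ p≈) 0∷[])
    ... | no  c≢ | _ = no λ e → c≢ (at e 0)
    ... | yes _  | no p≉ = no λ e → p≉ (mk λ i → at e (suc i))

    -- Needed for the quotient that defines a cyclotomic polynomial. Constant terms are stripped
    -- until only zeros remain behind the head; that head is then the leading coefficient and is
    -- compared with the one of the product.
    Monic-quotient : ∀ f D → Monic (mulP f g) D → ∃ (Monic f)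
    Monic-quotient [] D (monic () _)
    Monic-quotient (c ∷ f) D (monic l ab) with isZero? f
    ... | yes f≈ = 0 , monic c≡1 (λ { (suc j) _ → at f≈ j })
      where
      D≡m : D ≡ m
      D≡m with <-cmp D m
      ... | tri≈ _ e _ = e
      ... | tri> _ _ m<D = ⊥-elim (1≢0 (trans (sym l) (trans (at (mul-cong {c ∷ f} {[ c ]} {g} (∷-cong refl f≈) ≈-refl) D)
                (trans (coeff-const* c g D) (trans (cong (c ℤ.*_) (above mon D m<D)) (ℤₚ.*-zeroʳ c))))))
      ... | tri< D<m _ _ = ⊥-elim (1≢0 (trans (sym l) (at (mul-cong {c ∷ f} {[]} {g} (≈-trans (∷-cong c0 f≈) 0∷[]) ≈-refl) D)))
        where
        c0 : c ≡ + 0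
        c0 = trans (sym (coeff-mul-lead c f f≈)) (ab m D<m)
      c≡1 : c ≡ + 1
      c≡1 = trans (sym (coeff-mul-lead c f f≈)) (trans (cong (coeff (mulP (c ∷ f) g)) (sym D≡m)) l)
    ... | no f≉ with m ℕ.<? D
    ...   | no m≮D = ⊥-elim (f≉ (mul-vanishing f λ j m≤j →
              trans (sym (coeff-mul-above c f j m≤j)) (ab (suc j) (s≤s (≤-trans (≮⇒≥ m≮D) m≤j)))))
    Monic-quotient (c ∷ f) (suc D) (monic l ab) | no f≉ | yes (s≤s m≤D)
      with Monic-quotient f D (monic (trans (sym (coeff-mul-above c f D m≤D)) l)
             (λ j lt → trans (sym (coeff-mul-above c f j (≤-trans m≤D (<⇒≤ lt)))) (ab (suc j) (s≤s lt))))
    ... | d , monic l′ ab′ = suc d , monic l′ (λ { (suc j) (s≤s lt) → ab′ j lt })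

  trim-≈ : ∀ p → trim p ≈ p
  trim-≈ [] = ≈-refl
  trim-≈ (c ∷ p) with trim p | trim-≈ p
  ... | y ∷ q | e = ∷-cong refl e
  ... | [] | e with c ℤ.≟ + 0
  ...   | yes c≡ = ≈-sym (≈-trans (∷-cong c≡ (≈-sym e)) 0∷[])
  ...   | no _ = ∷-cong refl e

  trim-zero : ∀ p → p ≈ [] → trim p ≡ []
  trim-zero [] e = refl
  trim-zero (c ∷ p) e rewrite trim-zero p (mk λ i → at e (suc i)) | at e 0 = refl

  -- `divModMonic` reads the degree of the divisor off the length of its list, so it is only
  -- meaningful for divisors without trailing zeros.
  trim-length : ∀ {p d} → Monic p d → length (trim p) ≡ suc d
  trim-length {[]} (monic () _)
  trim-length {c ∷ p} {zero} (monic l ab) rewrite trim-zero p (mk λ j → ab (suc j) (s≤s z≤n)) | l = refl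
  trim-length {c ∷ p} {suc d} (monic l ab) with trim p | trim-length {p} {d} (monic l (λ j lt → ab (suc j) (s≤s lt)))
  ... | y ∷ q | e = cong suc e

  take-≈ : ∀ m p → (∀ j → m ≤ j → coeff p j ≡ + 0) → take m p ≈ p
  take-≈ zero p h = mk λ i → sym (h i z≤n)
  take-≈ (suc m) [] h = ≈-refl
  take-≈ (suc m) (c ∷ p) h = ∷-cong refl (take-≈ m p λ j m≤j → h (suc j) (s≤s m≤j))

  take-above : ∀ m p j → m ≤ j → coeff (take m p) j ≡ + 0
  take-above zero p j _ = refl
  take-above (suc m) [] j _ = refl
  take-above (suc m) (c ∷ p) (suc j) (s≤s m≤j) = take-above m p j m≤j

  module DivMod (g : Poly) (m : ℕ) (len : length g ≡ suc m) (mon : Monic g m) where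
    open Solver polyRing

    rem-below : ∀ p j → m ≤ j → coeff (remMonic g p) j ≡ + 0
    rem-below [] j _ = refl
    rem-below (c ∷ p) j m≤j = take-above (length g ∸ 1) _ j (subst (_≤ j) (sym (cong (_∸ 1) len)) m≤j)

    private
      reduce : Poly → Poly
      reduce s = subP s (scaleP (coeff s m) g)

      reduce-above : ∀ s → (∀ j → suc m ≤ j → coeff s j ≡ + 0) → ∀ j → m ≤ j → coeff (reduce s) j ≡ + 0
      reduce-above s h j m≤j = trans (coeff-sub s (scaleP (coeff s m) g) j)
        (trans (cong (λ z → coeff s j ℤ.- z) (coeff-scale (coeff s m) g j)) (go (m ℕ.≟ j)))
        where
        go : Dec (m ≡ j) → coeff s j ℤ.- coeff s m ℤ.* coeff g j ≡ + 0
        go (yes refl) rewrite leading mon | ℤₚ.*-identityʳ (coeff s m) = ℤₚ.+-inverseʳ (coeff s m)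
        go (no m≢j) rewrite above mon j (≤∧≢⇒< m≤j m≢j) | ℤₚ.*-zeroʳ (coeff s m) | h j (≤∧≢⇒< m≤j m≢j) = refl

    division : ∀ p → p ≈ addP (mulP (quotMonic g p) g) (remMonic g p)
    division [] = ≈-refl
    division (c ∷ p) = ≈-sym (begin
      addP (mulP (addP (+ 0 ∷ q) [ coeff s m′ ]) g) (take m′ (subP s (scaleP (coeff s m′) g)))
        ≡⟨ cong (λ k → addP (mulP (addP (+ 0 ∷ q) [ coeff s k ]) g) (take k (subP s (scaleP (coeff s k) g)))) m′≡m ⟩
      addP (mulP (addP (+ 0 ∷ q) [ t ]) g) (take m (reduce s))
        ≈⟨ add-cong {mulP (addP (+ 0 ∷ q) [ t ]) g} {mulP (addP (mulP x q) [ t ]) g}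
             (mul-cong {q = g} (addʳ [ t ] (≈-sym (mul-x q))) ≈-refl)
             (take-≈ m (reduce s) (reduce-above s s-above)) ⟩
      addP (mulP (addP (mulP x q) [ t ]) g) (addP s (negP (scaleP t g)))
        ≈⟨ addˡ (mulP (addP (mulP x q) [ t ]) g) (add-cong {q = negP (scaleP t g)} (∷-decomp c r) (neg-cong (≈-sym (mul-const t g)))) ⟩
      addP (mulP (addP (mulP x q) [ t ]) g) (addP (addP [ c ] (mulP x r)) (negP (mulP [ t ] g)))
        ≈⟨ solve 6 (λ x q t g c r → (x :* q :+ t) :* g :+ ((c :+ x :* r) :- t :* g) := c :+ x :* (q :* g :+ r))
             ≈-refl x q [ t ] g [ c ] r ⟩
      addP [ c ] (mulP x (addP (mulP q g) r))
        ≈⟨ addˡ [ c ] (mul-cong {x} ≈-refl (≈-sym (division p))) ⟩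
      addP [ c ] (mulP x p) ≈⟨ ≈-sym (∷-decomp c p) ⟩
      c ∷ p ∎)
      where
      m′ = length g ∸ 1
      m′≡m : m′ ≡ m
      m′≡m = cong (_∸ 1) len
      q = quotMonic g p
      r = remMonic g p
      s = c ∷ r
      t = coeff s m
      s-above : ∀ j → suc m ≤ j → coeff s j ≡ + 0
      s-above (suc j) (s≤s m≤j) = rem-below p j m≤j

    -- The remainder is a difference of multiples of `g`, hence a multiple itself, and its degree is
    -- below `m`; `mul-vanishing` makes the cofactor zero.
    rem-of-multiple : ∀ u p → p ≈ mulP u g → remMonic g p ≈ []
    rem-of-multiple u p e = ≈-trans r≈ (mul-cong {q = g} d≈[] ≈-refl)
      where
      q = quotMonic g p
      r = remMonic g p
      d = subP u q
      r≈ : r ≈ mulP d g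
      r≈ = begin
        r ≈⟨ solve 2 (λ a r → r := (a :+ r) :- a) ≈-refl (mulP q g) r ⟩
        subP (addP (mulP q g) r) (mulP q g) ≈⟨ addʳ (negP (mulP q g)) (≈-trans (≈-sym (division p)) e) ⟩
        subP (mulP u g) (mulP q g) ≈⟨ solve 3 (λ u q g → u :* g :- q :* g := (u :- q) :* g) ≈-refl u q g ⟩
        mulP d g ∎
      d≈[] : d ≈ []
      d≈[] = mul-vanishing mon d (λ j m≤j → trans (sym (at r≈ j)) (rem-below p j m≤j))

    -- Divisibility by a monic polynomial descends along nonzero integer multiples.
    divisible-from-multiple : ∀ c .{{_ : ℤ.NonZero c}} w p → mulP [ c ] p ≈ mulP w g → p ≈ mulP (quotMonic g p) g
    divisible-from-multiple c w p e = begin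
      p ≈⟨ division p ⟩
      addP (mulP q g) r ≈⟨ addˡ (mulP q g) r≈[] ⟩
      addP (mulP q g) [] ≈⟨ add-idʳ _ ⟩
      mulP q g ∎
      where
      q = quotMonic g p
      r = remMonic g p
      d = subP w (mulP [ c ] q)
      cr≈ : mulP [ c ] r ≈ mulP d g
      cr≈ = begin
        mulP [ c ] r ≈⟨ solve 4 (λ c q g r → c :* r := c :* (q :* g :+ r) :- (c :* q) :* g) ≈-refl [ c ] q g r ⟩
        subP (mulP [ c ] (addP (mulP q g) r)) (mulP (mulP [ c ] q) g)
          ≈⟨ addʳ (negP (mulP (mulP [ c ] q) g)) (≈-trans (mul-congʳ [ c ] (≈-sym (division p))) e) ⟩
        subP (mulP w g) (mulP (mulP [ c ] q) g)
          ≈⟨ solve 3 (λ w e g → w :* g :- e :* g := (w :- e) :* g) ≈-refl w (mulP [ c ] q) g ⟩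
        mulP d g ∎
      d≈[] : d ≈ []
      d≈[] = mul-vanishing mon d (λ j m≤j → trans (sym (at cr≈ j))
        (trans (coeff-const* c r j) (trans (cong (c ℤ.*_) (rem-below p j m≤j)) (ℤₚ.*-zeroʳ c))))
      r≈[] : r ≈ []
      r≈[] = const-cancel c r (≈-trans cr≈ (mul-cong {q = g} d≈[] ≈-refl))

  -- Cyclotomic polynomials

  open Powers polyRing using (^-assocʳ; ^-homo-*; _^_; geom; geom-mod; geom-telescope; geomDefect; natTimes; pow-gcd; pow-multiple)
  open Comaximality polyRing using (Comaximal; cofactor-comaximal; comax; comax-divides; comax-mul; comax-multiple; comax-sym; natTimes-*)
  open Solver polyRing

  opaque
    -- Indexed by the position in `cycList`, hence shifted by one: `Φ i` belongs to the roots of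
    -- unity of order `i + 1`.
    Φ : ℕ → Poly
    Φ i = cyclotomic (suc i)

  private
    denominator : ℕ → Poly
    denominator i = foldr mulP [ + 1 ] (map proj₂ (filterᵇ (λ tp → (suc i % suc (proj₁ tp)) ≡ᵇ 0) (zip (upTo i) (cycList i))))

    length-cycList : ∀ i → length (cycList i) ≡ i
    length-cycList zero = refl
    length-cycList (suc i) = trans (Listₚ.length-++ (cycList i)) (trans (+-comm _ 1) (cong suc (length-cycList i)))

    nthD-snoc : ∀ {A : Set} (d : A) xs y → nthD d (xs ++ [ y ]) (length xs) ≡ y
    nthD-snoc d [] y = refl
    nthD-snoc d (x ∷ xs) y = nthD-snoc d xs y

    opaque
      unfolding Φ
      Φ-def : ∀ i → Φ i ≡ trim (quotMonic (trim (denominator i)) (subP (xPow (suc i)) [ + 1 ]))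
      Φ-def i = trans (cong (nthD [] (cycList (suc i))) (sym (length-cycList i))) (nthD-snoc [] (cycList i) _)

    cycList-Φ : ∀ i → cycList i ≡ map Φ (upTo i)
    cycList-Φ zero = refl
    cycList-Φ (suc i) = trans (cong₂ (λ xs y → xs ++ [ y ]) (cycList-Φ i) (sym (Φ-def i)))
      (trans (sym (Listₚ.map-++ Φ (upTo i) [ i ])) (cong (map Φ) (Listₚ.upTo-∷ʳ i)))

    prodOver : (ℕ → Bool) → List ℕ → Poly
    prodOver P xs = foldr mulP [ + 1 ] (map proj₂ (filterᵇ (λ tp → P (proj₁ tp)) (zip xs (map Φ xs))))

    prodOver-snoc : ∀ P xs y → prodOver P (xs ++ [ y ]) ≈ (if P y then mulP (prodOver P xs) (Φ y) else prodOver P xs)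
    prodOver-snoc P [] y with P y
    ... | true = mul-comm (Φ y) [ + 1 ]
    ... | false = ≈-refl
    prodOver-snoc P (z ∷ xs) y with P z | prodOver-snoc P xs y
    ... | false | h = h
    ... | true | h with P y
    ...   | true = ≈-trans (mul-congʳ (Φ z) h) (≈-sym (mul-assoc (Φ z) _ _))
    ...   | false = mul-congʳ (Φ z) h

  divides? : ℕ → ℕ → Bool
  divides? K t = (K % suc t) ≡ᵇ 0

  -- The product of the cyclotomic polynomials whose orders divide `K` and are at most `L`. The
  -- denominator in the recursion is the case `K = L + 1`.
  divisorProduct : ℕ → ℕ → Poly
  divisorProduct K zero = [ + 1 ]
  divisorProduct K (suc L) = if divides? K L then mulP (divisorProduct K L) (Φ L) else divisorProduct K L

  private
    prodOver-upTo : ∀ K L → prodOver (divides? K) (upTo L) ≈ divisorProduct K L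
    prodOver-upTo K zero = ≈-refl
    prodOver-upTo K (suc L) = ≈-trans
      (mk λ i → cong (λ xs → coeff (prodOver (divides? K) xs) i) (sym (Listₚ.upTo-∷ʳ L)))
      (≈-trans (prodOver-snoc (divides? K) (upTo L) L) branch)
      where
      branch : (if divides? K L then mulP (prodOver (divides? K) (upTo L)) (Φ L) else prodOver (divides? K) (upTo L)) ≈ divisorProduct K (suc L)
      branch with divides? K L
      ... | true = mul-cong {q = Φ L} (prodOver-upTo K L) ≈-refl
      ... | false = prodOver-upTo K L

    denominator-≈ : ∀ i → denominator i ≈ divisorProduct (suc i) i
    denominator-≈ i rewrite cycList-Φ i = prodOver-upTo (suc i) i

  divides?⇒∣ : ∀ K t → IsTrue (divides? K t) → suc t ∣ K
  divides?⇒∣ K t p = m%n≡0⇒n∣m K (suc t) (≡ᵇ⇒≡ _ 0 p)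

  ∣⇒divides? : ∀ K t → suc t ∣ K → divides? K t ≡ true
  ∣⇒divides? K t p = cong (_≡ᵇ 0) (n∣m⇒m%n≡0 K (suc t) p)

  infix 4 _∣ₚ_
  record _∣ₚ_ (g p : Poly) : Set where
    constructor _by_
    field
      cofactor : Poly
      equation : p ≈ mulP cofactor g
  open _∣ₚ_

  ∣ₚ-refl : ∀ {p} → p ∣ₚ p
  ∣ₚ-refl {p} = [ + 1 ] by ≈-sym (mul-idˡ p)

  ∣ₚ-trans : ∀ {f g h} → f ∣ₚ g → g ∣ₚ h → f ∣ₚ h
  ∣ₚ-trans {f} {g} {h} (u by e) (v by e′) = mulP v u by (≈-trans e′ (≈-trans (mul-congʳ v e) (≈-sym (mul-assoc v u f))))

  divisorProduct-mono : ∀ {M K} → M ∣ K → ∀ L → divisorProduct M L ∣ₚ divisorProduct K L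
  divisorProduct-mono M∣N zero = ∣ₚ-refl
  divisorProduct-mono {M} {K} M∣N (suc L) with divides? M L in eqM | divides? K L in eqN | divisorProduct-mono M∣N L
  ... | false | false | d = d
  ... | false | true | (u by e) = mulP u (Φ L) by (begin
      mulP (divisorProduct K L) (Φ L) ≈⟨ mul-cong {q = Φ L} e ≈-refl ⟩
      mulP (mulP u (divisorProduct M L)) (Φ L)
        ≈⟨ solve 3 (λ u p q → u :* p :* q := u :* q :* p) ≈-refl u (divisorProduct M L) (Φ L) ⟩
      mulP (mulP u (Φ L)) (divisorProduct M L) ∎)
  ... | true | true | (u by e) = u by ≈-trans (mul-cong {q = Φ L} e ≈-refl) (mul-assoc u (divisorProduct M L) (Φ L))
  ... | true | false | d with trans (sym eqN) (∣⇒divides? K L (∣-trans (divides?⇒∣ M L (subst IsTrue (sym eqM) tt)) M∣N))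
  ...   | ()

  divisorProduct-step-∣ : ∀ K L → divisorProduct K L ∣ₚ divisorProduct K (suc L)
  divisorProduct-step-∣ K L with divides? K L
  ... | true = Φ L by mul-comm (divisorProduct K L) (Φ L)
  ... | false = ∣ₚ-refl

  divisorProduct-∣-≤′ : ∀ K {L L′} → L ≤′ L′ → divisorProduct K L ∣ₚ divisorProduct K L′
  divisorProduct-∣-≤′ K ≤′-refl = ∣ₚ-refl
  divisorProduct-∣-≤′ K (≤′-step {L′} l) = ∣ₚ-trans (divisorProduct-∣-≤′ K l) (divisorProduct-step-∣ K L′)

  xPow-≈ : ∀ n → xPow n ≈ x ^ n
  xPow-≈ zero = ≈-refl
  xPow-≈ (suc n) = ≈-trans (∷-cong refl (xPow-≈ n)) (≈-sym (mul-x (x ^ n)))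

  xPow-Monic : ∀ n → Monic (xPow n) n
  xPow-Monic zero = monic refl (λ { (suc j) _ → refl })
  xPow-Monic (suc n) with xPow-Monic n
  ... | monic l a = monic l (λ { (suc j) (s≤s lt) → a j lt })

  xⁿ-1 : ℕ → Poly
  xⁿ-1 n = subP (x ^ n) [ + 1 ]

  x^-1-Monic : ∀ n → Monic ((xⁿ-1 (suc n))) (suc n)
  x^-1-Monic n = Monic-≈ (addʳ (negP [ + 1 ]) (xPow-≈ (suc n))) (monic
    (trans (coeff-sub (xPow (suc n)) [ + 1 ] (suc n)) (trans (ℤₚ.+-identityʳ _) (leading (xPow-Monic (suc n)))))
    (λ { (suc j) lt → trans (coeff-sub (xPow (suc n)) [ + 1 ] (suc j)) (trans (ℤₚ.+-identityʳ _) (above (xPow-Monic (suc n)) (suc j) lt)) }))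

  record IsCyclotomic (i : ℕ) : Set where
    field
      degree  : ℕ
      monicΦ  : Monic (Φ i) degree
      product : mulP (divisorProduct (suc i) i) (Φ i) ≈ (xⁿ-1 (suc i))

  open IsCyclotomic

  natTimes-const : ∀ n → natTimes n ≈ [ + n ]
  natTimes-const zero = ≈-sym 0∷[]
  natTimes-const (suc n) = addˡ [ + 1 ] (natTimes-const n)

  module _ {e : ℕ} (ce : IsCyclotomic e) where

    Φ-∣-x^-1 : Φ e ∣ₚ (xⁿ-1 (suc e))
    Φ-∣-x^-1 = divisorProduct (suc e) e by ≈-sym (product ce)

    x^-1-multiple : ∀ m n → m ∣ n → (xⁿ-1 m) ∣ₚ (xⁿ-1 n)
    x^-1-multiple m n (divides u refl) = geom (x ^ m) u by pow-multiple x u m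

    -- The gcd of `suc e` and `j` is a proper divisor of `suc e`. By the product formula for this
    -- smaller index, `x` to the gcd minus 1 is made of factors that all occur in the denominator
    -- `divisorProduct (suc e) e`, as `cofactor-comaximal` requires.
    Φ-comaximal : (∀ g → suc g ∣ suc e → g < e → IsCyclotomic g) →
                  ∀ j → ¬ suc e ∣ j → Comaximal (Φ e) (xⁿ-1 j)
    Φ-comaximal smaller j e∤j = go (gcd (suc e) j) refl (gcd[m,n]∣m (suc e) j) (gcd[m,n]∣n (suc e) j)
      where
      go : ∀ g → gcd (suc e) j ≡ g → g ∣ suc e → g ∣ j → Comaximal (Φ e) (xⁿ-1 j)
      go zero _ (divides q e≡) _ with trans e≡ (*-zeroʳ q)
      ... | ()
      go (suc g) _ (divides zero ()) _
      go (suc g) gcd≡ g∣e@(divides (suc t) e≡) g∣j =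
        cofactor-comaximal x (suc e) j t (suc g) {divisorProduct (suc e) e} {Φ e} {cofactor G∣D} gcd≡ e≡ (product ce) D≈ (mul-cancel-zero (x^-1-Monic g))
        where
        g<e : g < e
        g<e = ℕ.s≤s⁻¹ (≤∧≢⇒< (∣⇒≤ g∣e) (λ g≡e → e∤j (subst (_∣ j) g≡e g∣j)))
        G≈ : xⁿ-1 (suc g) ≈ divisorProduct (suc g) (suc g)
        G≈ rewrite ∣⇒divides? (suc g) g (divides 1 (sym (+-identityʳ _))) = ≈-sym (product (smaller g g∣e g<e))
        G∣D : divisorProduct (suc g) (suc g) ∣ₚ divisorProduct (suc e) e
        G∣D = ∣ₚ-trans (divisorProduct-mono g∣e (suc g)) (divisorProduct-∣-≤′ (suc e) (≤⇒≤′ g<e))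
        D≈ : divisorProduct (suc e) e ≈ mulP (cofactor G∣D) (xⁿ-1 (suc g))
        D≈ = ≈-trans (equation G∣D) (mul-congʳ (cofactor G∣D) (≈-sym G≈))

  divide-out : ∀ {g m} → Monic g m → ∀ c .{{_ : ℤ.NonZero c}} w p → mulP [ c ] p ≈ mulP w g → g ∣ₚ p
  divide-out {g} {m} mon c w p e = quotMonic (trim g) p by
      ≈-trans (divisible-from-multiple c w p (≈-trans e (mul-congʳ w (≈-sym (trim-≈ g)))))
              (mul-congʳ (quotMonic (trim g) p) (trim-≈ g))
    where open DivMod (trim g) m (trim-length mon) (Monic-≈ (≈-sym (trim-≈ g)) mon)

  exact-quotient : ∀ {g m} → Monic g m → ∀ {p} → g ∣ₚ p → p ≈ mulP (quotMonic (trim g) p) g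
  exact-quotient {g} {m} mon {p} (u by e) = begin
    p ≈⟨ division p ⟩
    addP (mulP Q (trim g)) (remMonic (trim g) p)
      ≈⟨ addˡ (mulP Q (trim g)) (rem-of-multiple u p (≈-trans e (mul-congʳ u (≈-sym (trim-≈ g))))) ⟩
    addP (mulP Q (trim g)) [] ≈⟨ add-idʳ _ ⟩
    mulP Q (trim g) ≈⟨ mul-congʳ Q (trim-≈ g) ⟩
    mulP Q g ∎
    where
    Q = quotMonic (trim g) p
    open DivMod (trim g) m (trim-length mon) (Monic-≈ (≈-sym (trim-≈ g)) mon)

  module CycStep (i : ℕ) (ih : ∀ {j} → j < i → IsCyclotomic j) where

    -- For distinct orders at least one does not divide the other. The polynomial of that order is
    -- comaximal with `x` to the other order minus 1, of which the other cyclotomic polynomial is a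
    -- factor.
    comaximal-Φ : ∀ {s t} → s < i → t < i → s ≢ t → Comaximal (Φ s) (Φ t)
    comaximal-Φ {s} {t} s<i t<i s≢t with suc s ∣? suc t
    ... | no s∤t = comax-sym (comax-multiple (divisorProduct (suc t) t) (equation (Φ-∣-x^-1 (ih t<i)))
            (comax-sym (Φ-comaximal (ih s<i) (λ g _ g<s → ih (<-trans g<s s<i)) (suc t) s∤t)))
    ... | yes s∣t = comax-multiple (divisorProduct (suc s) s) (equation (Φ-∣-x^-1 (ih s<i))) (comax-sym
            (Φ-comaximal (ih t<i) (λ g _ g<t → ih (<-trans g<t t<i)) (suc s)
              (λ t∣s → s≢t (suc-injective (∣-antisym s∣t t∣s)))))

    comaximal-D : ∀ K L t → L ≤ t → t < i → Comaximal (divisorProduct K L) (Φ t)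
    comaximal-D K zero t _ _ = comax 0 [ + 1 ] [] (≈-trans (add-idʳ _) (mul-idˡ [ + 1 ]))
    comaximal-D K (suc L) t L<t t<i with divides? K L
    ... | false = comaximal-D K L t (<⇒≤ L<t) t<i
    ... | true = comax-mul (comaximal-D K L t (<⇒≤ L<t) t<i) (comaximal-Φ (<-trans L<t t<i) t<i (<⇒≢ L<t))

    D-monic : ∀ K L → L ≤ i → ∃ (Monic (divisorProduct K L))
    D-monic K zero _ = 0 , monic refl (λ { (suc j) _ → refl })
    D-monic K (suc L) L<i with divides? K L | D-monic K L (<⇒≤ L<i)
    ... | false | m = m
    ... | true | (d , m) = _ , Monic-mul (monicΦ (ih L<i)) m

    -- The factors are collected one at a time. Comaximality yields divisibility of an integer
    -- multiple of `p` only, and `divide-out` removes the integer because the product collected so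
    -- far is monic. This makes the division in the definition of `Φ i` exact.
    D∣P : ∀ K p → (∀ t → t < i → suc t ∣ K → Φ t ∣ₚ p) → ∀ L → L ≤ i → divisorProduct K L ∣ₚ p
    D∣P K p Φ∣p zero _ = p by ≈-sym (mul-idʳ p)
    D∣P K p Φ∣p (suc L) L<i with divides? K L in eq
    ... | false = D∣P K p Φ∣p L (<⇒≤ L<i)
    ... | true = combine (D∣P K p Φ∣p L (<⇒≤ L<i)) (Φ∣p L L<i (divides?⇒∣ K L (subst IsTrue (sym eq) tt)))
        (comaximal-D K L L ≤-refl L<i) (proj₂ (D-monic K L (<⇒≤ L<i)))
      where
      combine : ∀ {f m} → f ∣ₚ p → Φ L ∣ₚ p → Comaximal f (Φ L) → Monic f m → mulP f (Φ L) ∣ₚ p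
      combine {f} (a by pa) (b by pb) cm mf = finish (comax-divides cm {p} {a} {b} pa pb)
        where
        t = suc (Comaximal.t cm)
        finish : (∃ λ w → mulP (natTimes t) p ≈ mulP w (mulP f (Φ L))) → mulP f (Φ L) ∣ₚ p
        finish (w , pw) = divide-out (Monic-mul (monicΦ (ih L<i)) mf) (+ t) w p
                       (≈-trans (mul-cong {p = [ + t ]} {p′ = natTimes t} {q = p} (≈-sym (natTimes-const t)) ≈-refl) pw)

    private
      D = divisorProduct (suc i) i
      P′ = subP (xPow (suc i)) [ + 1 ]

    P′≈P : P′ ≈ xⁿ-1 (suc i)
    P′≈P = addʳ (negP [ + 1 ]) (xPow-≈ (suc i))

    D∣P′ : D ∣ₚ P′
    D∣P′ = D∣P (suc i) P′ (λ t t<i t∣N → ∣ₚ-trans (Φ-∣-x^-1 (ih t<i))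
      (∣ₚ-trans (x^-1-multiple (ih t<i) (suc t) (suc i) t∣N) ([ + 1 ] by ≈-trans P′≈P (≈-sym (mul-idˡ _))))) i ≤-refl

    isCyclotomicStep : IsCyclotomic i
    isCyclotomicStep = record
      { degree = proj₁ Q-monic
      ; monicΦ = Monic-≈ (≈-sym Φ≈Q) (proj₂ Q-monic)
      ; product = ≈-trans (mul-comm D (Φ i)) (≈-trans (mul-cong {q = D} Φ≈Q ≈-refl) (≈-trans (≈-sym exact) P′≈P)) }
      where
      D-monic-i : ∃ (Monic D)
      D-monic-i = D-monic (suc i) i ≤-refl
      den : Poly
      den = denominator i
      Q : Poly
      Q = quotMonic (trim den) P′
      den-≈ : den ≈ D
      den-≈ = denominator-≈ i
      exact : P′ ≈ mulP Q D
      exact = ≈-trans (exact-quotient (Monic-≈ (≈-sym den-≈) (proj₂ D-monic-i))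
                         (cofactor D∣P′ by ≈-trans (equation D∣P′) (mul-congʳ (cofactor D∣P′) (≈-sym den-≈))))
                      (mul-congʳ Q den-≈)
      Q-monic : ∃ (Monic Q)
      Q-monic = Monic-quotient (proj₂ D-monic-i) Q (suc i) (Monic-≈ (≈-trans (≈-sym P′≈P) exact) (x^-1-Monic i))
      Φ≈Q : Φ i ≈ Q
      Φ≈Q = ≈-trans (mk λ j → cong (λ p → coeff p j) (Φ-def i)) (trim-≈ Q)

  isCyclotomic : ∀ i → IsCyclotomic i
  isCyclotomic = <-rec IsCyclotomic CycStep.isCyclotomicStep

  Φ-length : ∀ i → length (Φ i) ≡ suc (degree (isCyclotomic i))
  Φ-length i = trans (cong length (Φ-def i)) (trim-length {Q} Q-monic)
    where
    Q : Poly
    Q = quotMonic (trim (denominator i)) (subP (xPow (suc i)) [ + 1 ])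
    Q-monic : Monic Q (degree (isCyclotomic i))
    Q-monic = Monic-≈ {Φ i} (≈-trans (mk λ j → cong (λ p → coeff p j) (Φ-def i)) (trim-≈ Q)) (monicΦ (isCyclotomic i))

  opaque
    unfolding Φ
    remainder-zero : ∀ i u p → p ≈ mulP u (Φ i) → IsZeroP (remMonic (cyclotomic (suc i)) p)
    remainder-zero i u p e = ≈⇒isZero (DivMod.rem-of-multiple (Φ i) _ (Φ-length i) (monicΦ (isCyclotomic i)) u p e)

  Φ-∣-cancel-nat : ∀ i t p → Φ i ∣ₚ mulP (natTimes (suc t)) p → Φ i ∣ₚ p
  Φ-∣-cancel-nat i t p (w by e) = divide-out (monicΦ (isCyclotomic i)) (+ suc t) w p
    (≈-trans (mul-cong {p = [ + suc t ]} {p′ = natTimes (suc t)} {q = p} (≈-sym (natTimes-const (suc t))) ≈-refl) e)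

  -- `x^j − 1` is no zero divisor modulo `Φ i`: the ideal of the two contains a positive integer, so
  -- an integer multiple of `p` is divisible by `Φ i`, and integers cancel modulo a monic
  -- polynomial.
  Φ-∣-cancel : ∀ i j p → ¬ suc i ∣ j → Φ i ∣ₚ mulP (xⁿ-1 j) p → Φ i ∣ₚ p
  Φ-∣-cancel i j p i∤j (w by e) = finish (Φ-comaximal (isCyclotomic i) (λ g _ _ → isCyclotomic g) j i∤j)
    where
    finish : Comaximal (Φ i) (xⁿ-1 j) → Φ i ∣ₚ p
    finish (comax t u v eq) = Φ-∣-cancel-nat i t p (addP (mulP u p) (mulP v w) by (begin
      mulP (natTimes (suc t)) p ≈⟨ mul-cong {p = natTimes (suc t)} {q = p} (≈-sym eq) ≈-refl ⟩
      mulP (addP (mulP u (Φ i)) (mulP v (xⁿ-1 j))) p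
        ≈⟨ solve 5 (λ u F v J p → (u :* F :+ v :* J) :* p := u :* F :* p :+ v :* (J :* p)) ≈-refl u (Φ i) v (xⁿ-1 j) p ⟩
      addP (mulP (mulP u (Φ i)) p) (mulP v (mulP (xⁿ-1 j) p)) ≈⟨ addˡ (mulP (mulP u (Φ i)) p) (mul-congʳ v e) ⟩
      addP (mulP (mulP u (Φ i)) p) (mulP v (mulP w (Φ i)))
        ≈⟨ solve 5 (λ u F v w p → u :* F :* p :+ v :* (w :* F) := (u :* p :+ v :* w) :* F) ≈-refl u (Φ i) v w p ⟩
      mulP (addP (mulP u p) (mulP v w)) (Φ i) ∎))

  -- Evaluation at roots of unity

  module _ (r : Poly) where
    compose-zero : ∀ p → p ≈ [] → compose p r ≈ []
    compose-zero [] _ = ≈-refl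
    compose-zero (c ∷ p) e = ≈-trans (add-cong {[ c ]} {[]} (≈-trans (∷-cong (at e 0) ≈-refl) 0∷[])
      (≈-trans (mul-congʳ r (compose-zero p (mk λ i → at e (suc i)))) (mul-zeroʳ r))) ≈-refl

    compose-cong : ∀ p q → p ≈ q → compose p r ≈ compose q r
    compose-cong [] q e = ≈-sym (compose-zero q (≈-sym e))
    compose-cong (c ∷ p) [] e = compose-zero (c ∷ p) e
    compose-cong (c ∷ p) (d ∷ q) e = add-cong {[ c ]} {[ d ]} (∷-cong (at e 0) ≈-refl) (mul-congʳ r (compose-cong p q (tail-≈ e)))

    compose-add : ∀ p q → compose (addP p q) r ≈ addP (compose p r) (compose q r)
    compose-add [] q = ≈-refl
    compose-add (c ∷ p) [] = ≈-sym (add-idʳ (compose (c ∷ p) r))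
    compose-add (c ∷ p) (d ∷ q) = ≈-trans (addˡ [ c ℤ.+ d ] (mul-congʳ r (compose-add p q)))
      (solve 5 (λ c d r p q → (c :+ d) :+ r :* (p :+ q) := (c :+ r :* p) :+ (d :+ r :* q)) ≈-refl [ c ] [ d ] r (compose p r) (compose q r))

    compose-scale : ∀ c p → compose (scaleP c p) r ≈ mulP [ c ] (compose p r)
    compose-scale c [] = ≈-sym 0∷[]
    compose-scale c (d ∷ p) = begin
      addP [ c ℤ.* d ] (mulP r (compose (scaleP c p) r))
        ≈⟨ add-cong {[ c ℤ.* d ]} {mulP [ c ] [ d ]} (≈-sym (mulConst c d)) (mul-congʳ r (compose-scale c p)) ⟩
      addP (mulP [ c ] [ d ]) (mulP r (mulP [ c ] (compose p r)))
        ≈⟨ solve 4 (λ c d r p → c :* d :+ r :* (c :* p) := c :* (d :+ r :* p)) ≈-refl [ c ] [ d ] r (compose p r) ⟩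
      mulP [ c ] (compose (d ∷ p) r) ∎

    compose-shift : ∀ p → compose (+ 0 ∷ p) r ≈ mulP r (compose p r)
    compose-shift p = addʳ (mulP r (compose p r)) 0∷[]

    compose-mul : ∀ p q → compose (mulP p q) r ≈ mulP (compose p r) (compose q r)
    compose-mul [] q = ≈-refl
    compose-mul (c ∷ p) q = begin
      compose (addP (scaleP c q) (+ 0 ∷ mulP p q)) r ≈⟨ compose-add (scaleP c q) (+ 0 ∷ mulP p q) ⟩
      addP (compose (scaleP c q) r) (compose (+ 0 ∷ mulP p q) r)
        ≈⟨ add-cong (compose-scale c q) (≈-trans (compose-shift (mulP p q)) (mul-congʳ r (compose-mul p q))) ⟩
      addP (mulP [ c ] (compose q r)) (mulP r (mulP (compose p r) (compose q r)))
        ≈⟨ solve 4 (λ c r p q → c :* q :+ r :* (p :* q) := (c :+ r :* p) :* q) ≈-refl [ c ] r (compose p r) (compose q r) ⟩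
      mulP (compose (c ∷ p) r) (compose q r) ∎

    compose-const : ∀ c → compose [ c ] r ≈ [ c ]
    compose-const c = ≈-trans (addˡ [ c ] (mul-zeroʳ r)) (add-idʳ [ c ])

    opaque
      unfolding x
      compose-x : compose x r ≈ r
      compose-x = ≈-trans (compose-shift [ + 1 ]) (≈-trans (mul-congʳ r (compose-const (+ 1))) (mul-idʳ r))

    private
      module Gx = QBinomials polyRing x
      module Gr = QBinomials polyRing r

    compose-^ : ∀ n → compose (x ^ n) r ≈ r ^ n
    compose-^ zero = compose-const (+ 1)
    compose-^ (suc n) = ≈-trans (compose-mul x (x ^ n)) (mul-cong {compose x r} {r} compose-x (compose-^ n))

    compose-[] : ∀ n → compose Gx.[ n ] r ≈ Gr.[ n ]
    compose-[] zero = ≈-refl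
    compose-[] (suc n) = ≈-trans (compose-add [ + 1 ] (mulP x Gx.[ n ])) (add-cong {compose [ + 1 ] r} {[ + 1 ]} (compose-const (+ 1))
      (≈-trans (compose-mul x Gx.[ n ]) (mul-cong {compose x r} {r} compose-x (compose-[] n))))

    compose-G : ∀ n k → compose (Gx.G n k) r ≈ Gr.G n k
    compose-G n zero = compose-const (+ 1)
    compose-G zero (suc k) = ≈-refl
    compose-G (suc n) (suc k) = ≈-trans (compose-add (Gx.G n k) (mulP (x ^ suc k) (Gx.G n (suc k))))
      (add-cong {compose (Gx.G n k) r} (compose-G n k) (≈-trans (compose-mul (x ^ suc k) (Gx.G n (suc k)))
        (mul-cong {compose (x ^ suc k) r} {r ^ suc k} (compose-^ (suc k)) (compose-G n (suc k)))))

  module Gx = QBinomials polyRing x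

  geom-qInt : ∀ n → qInt n ≈ Gx.[ n ]
  geom-qInt zero = ≈-refl
  geom-qInt (suc n) = ≈-trans (∷-decomp (+ 1) (qInt n)) (addˡ [ + 1 ] (mul-congʳ x (geom-qInt n)))

  qFact-≈ : ∀ n → qFact n ≈ Gx.[ n ]!
  qFact-≈ zero = ≈-refl
  qFact-≈ (suc n) = mul-cong (qFact-≈ n) (geom-qInt (suc n))

  qInt-Monic : ∀ n → Monic (qInt (suc n)) n
  qInt-Monic zero = monic refl (λ { (suc j) _ → refl })
  qInt-Monic (suc n) with qInt-Monic n
  ... | monic l a = monic l (λ { (suc j) (s≤s lt) → a j lt })

  []-Monic : ∀ n → Monic Gx.[ suc n ] n
  []-Monic n = Monic-≈ (geom-qInt (suc n)) (qInt-Monic n)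

  []!-Monic : ∀ n → ∃ (Monic Gx.[ n ]!)
  []!-Monic zero = 0 , monic refl (λ { (suc j) _ → refl })
  []!-Monic (suc n) = _ , Monic-mul ([]-Monic n) (proj₂ ([]!-Monic n))

  Monic-cancel : ∀ {g m} → Monic g m → ∀ p q → mulP p g ≈ mulP q g → p ≈ q
  Monic-cancel {g} mon p q e = begin
    p ≈⟨ solve 2 (λ p q → p := (p :- q) :+ q) ≈-refl p q ⟩
    addP (subP p q) q ≈⟨ addʳ q (mul-cancel-zero mon (subP p q) (begin
      mulP (subP p q) g ≈⟨ solve 3 (λ p q g → (p :- q) :* g := p :* g :- q :* g) ≈-refl p q g ⟩
      subP (mulP p g) (mulP q g) ≈⟨ addʳ (negP (mulP q g)) e ⟩
      subP (mulP q g) (mulP q g) ≈⟨ add-invʳ (mulP q g) ⟩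
      [] ∎)) ⟩
    q ∎

  -- This is `pow-gcd` at `x`, with the common factor `x − 1` cancelled on both sides.
  q-bezout : ∀ a b → gcd a b ≡ 1 → ∃₂ λ u v → addP (mulP u Gx.[ a ]) (mulP v Gx.[ b ]) ≈ [ + 1 ]
  q-bezout a b gcd≡1 = finish (pow-gcd x a b)
    where
    X-1 = subP x [ + 1 ]
    finish : (∃₂ λ α β → subP (x ^ gcd a b) [ + 1 ] ≈ addP (mulP α (xⁿ-1 a)) (mulP β (xⁿ-1 b))) →
             ∃₂ λ u v → addP (mulP u Gx.[ a ]) (mulP v Gx.[ b ]) ≈ [ + 1 ]
    finish (α , β , e) = α , β , Monic-cancel (x^-1-Monic 0) (addP (mulP α Gx.[ a ]) (mulP β Gx.[ b ])) [ + 1 ] (begin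
      mulP (addP (mulP α Gx.[ a ]) (mulP β Gx.[ b ])) (xⁿ-1 1)
        ≈⟨ mul-congʳ (addP (mulP α Gx.[ a ]) (mulP β Gx.[ b ])) (addʳ (negP [ + 1 ]) (mul-idʳ x)) ⟩
      mulP (addP (mulP α Gx.[ a ]) (mulP β Gx.[ b ])) X-1
        ≈⟨ solve 5 (λ α A β B X → (α :* A :+ β :* B) :* X := α :* (X :* A) :+ β :* (X :* B)) ≈-refl α Gx.[ a ] β Gx.[ b ] X-1 ⟩
      addP (mulP α (mulP X-1 Gx.[ a ])) (mulP β (mulP X-1 Gx.[ b ]))
        ≈⟨ add-cong (mul-congʳ α (geom-telescope x a)) (mul-congʳ β (geom-telescope x b)) ⟩
      addP (mulP α (xⁿ-1 a)) (mulP β (xⁿ-1 b)) ≈⟨ ≈-sym e ⟩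
      subP (x ^ gcd a b) [ + 1 ] ≈⟨ mk (λ i → cong (λ k → coeff (xⁿ-1 k) i) gcd≡1) ⟩
      xⁿ-1 1 ≈⟨ ≈-sym (mul-idˡ (xⁿ-1 1)) ⟩
      mulP [ + 1 ] (xⁿ-1 1) ∎)

  G-absorb : ∀ n k → k ≤ n → mulP Gx.[ suc k ] (Gx.G (suc n) (suc k)) ≈ mulP Gx.[ suc n ] (Gx.G n k)
  G-absorb n k k≤n = go (n ∸ k) (sym (m+[n∸m]≡n k≤n))
    where
    go : ∀ j → n ≡ k ℕ.+ j → mulP Gx.[ suc k ] (Gx.G (suc n) (suc k)) ≈ mulP Gx.[ suc n ] (Gx.G n k)
    go j refl = Monic-cancel (Monic-mul (proj₂ ([]!-Monic j)) (proj₂ ([]!-Monic k))) _ _ (begin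
      mulP (mulP Gx.[ suc k ] (Gx.G (suc n) (suc k))) (mulP Gx.[ k ]! Gx.[ j ]!)
        ≈⟨ solve 4 (λ s g f h → s :* g :* (f :* h) := g :* (f :* s :* h)) ≈-refl Gx.[ suc k ] (Gx.G (suc n) (suc k)) Gx.[ k ]! Gx.[ j ]! ⟩
      mulP (Gx.G (suc n) (suc k)) (mulP Gx.[ suc k ]! Gx.[ j ]!) ≈⟨ Gx.G-factorial (suc k) j ⟩
      mulP Gx.[ n ]! Gx.[ suc n ] ≈⟨ mul-cong {q = Gx.[ suc n ]} (≈-sym (Gx.G-factorial k j)) ≈-refl ⟩
      mulP (mulP (Gx.G n k) (mulP Gx.[ k ]! Gx.[ j ]!)) Gx.[ suc n ]
        ≈⟨ solve 3 (λ g f s → g :* f :* s := s :* g :* f) ≈-refl (Gx.G n k) (mulP Gx.[ k ]! Gx.[ j ]!) Gx.[ suc n ] ⟩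
      mulP (mulP Gx.[ suc n ] (Gx.G n k)) (mulP Gx.[ k ]! Gx.[ j ]!) ∎)

  G-absorb-lower : ∀ k j → mulP Gx.[ suc k ] (Gx.G (suc k ℕ.+ j) (suc k)) ≈ mulP Gx.[ suc j ] (Gx.G (suc k ℕ.+ j) k)
  G-absorb-lower k j = Monic-cancel (Monic-mul (proj₂ ([]!-Monic j)) (proj₂ ([]!-Monic k))) _ _ (begin
      mulP (mulP Gx.[ suc k ] (Gx.G (suc k ℕ.+ j) (suc k))) (mulP Gx.[ k ]! Gx.[ j ]!)
        ≈⟨ solve 4 (λ s g f h → s :* g :* (f :* h) := g :* (f :* s :* h)) ≈-refl Gx.[ suc k ] (Gx.G (suc k ℕ.+ j) (suc k)) Gx.[ k ]! Gx.[ j ]! ⟩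
      mulP (Gx.G (suc k ℕ.+ j) (suc k)) (mulP Gx.[ suc k ]! Gx.[ j ]!) ≈⟨ Gx.G-factorial (suc k) j ⟩
      Gx.[ suc k ℕ.+ j ]! ≈⟨ mk (λ i → cong (λ t → coeff Gx.[ t ]! i) (sym (+-suc k j))) ⟩
      Gx.[ k ℕ.+ suc j ]! ≈⟨ ≈-sym (Gx.G-factorial k (suc j)) ⟩
      mulP (Gx.G (k ℕ.+ suc j) k) (mulP Gx.[ k ]! Gx.[ suc j ]!)
        ≈⟨ mk (λ i → cong (λ t → coeff (mulP (Gx.G t k) (mulP Gx.[ k ]! Gx.[ suc j ]!)) i) (+-suc k j)) ⟩
      mulP (Gx.G (suc k ℕ.+ j) k) (mulP Gx.[ k ]! (mulP Gx.[ j ]! Gx.[ suc j ]))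
        ≈⟨ solve 4 (λ g f h s → g :* (f :* (h :* s)) := s :* g :* (f :* h)) ≈-refl (Gx.G (suc k ℕ.+ j) k) Gx.[ k ]! Gx.[ j ]! Gx.[ suc j ] ⟩
      mulP (mulP Gx.[ suc j ] (Gx.G (suc k ℕ.+ j) k)) (mulP Gx.[ k ]! Gx.[ j ]!) ∎)

  -- The q-Narayana polynomial

  module Narayana (a′ k′ j : ℕ) (gcd≡1 : gcd (suc a′) (suc (suc k′ ℕ.+ j)) ≡ 1) (k′≤a′ : k′ ≤ a′) where
    private
      n = suc k′ ℕ.+ j
      uv = q-bezout (suc a′) (suc n) gcd≡1
      u = proj₁ uv
      v = proj₁ (proj₂ uv)
      [a] = Gx.[ suc a′ ]
      [b] = Gx.[ suc n ]
      [k] = Gx.[ suc k′ ]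
      A = mulP (Gx.G (suc a′) (suc k′)) (Gx.G n k′)
      B = mulP (Gx.G (suc n) (suc k′)) (Gx.G a′ k′)
      F = mulP (Gx.G a′ k′) (Gx.G n k′)

    -- `A / [a]` and `B / [b]` are the same fraction `F / [k]`. A combination with
    -- `u [a] + v [b] = 1` is therefore equal to that fraction, and it is visibly a polynomial.
    X : Poly
    X = addP (mulP u A) (mulP v B)

    private
      kA : mulP [k] A ≈ mulP [a] F
      kA = begin
        mulP [k] A ≈⟨ ≈-sym (mul-assoc [k] (Gx.G (suc a′) (suc k′)) (Gx.G n k′)) ⟩
        mulP (mulP [k] (Gx.G (suc a′) (suc k′))) (Gx.G n k′) ≈⟨ mul-cong {q = Gx.G n k′} (G-absorb a′ k′ k′≤a′) ≈-refl ⟩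
        mulP (mulP [a] (Gx.G a′ k′)) (Gx.G n k′) ≈⟨ mul-assoc [a] (Gx.G a′ k′) (Gx.G n k′) ⟩
        mulP [a] F ∎

      kB : mulP [k] B ≈ mulP [b] F
      kB = begin
        mulP [k] B ≈⟨ ≈-sym (mul-assoc [k] (Gx.G (suc n) (suc k′)) (Gx.G a′ k′)) ⟩
        mulP (mulP [k] (Gx.G (suc n) (suc k′))) (Gx.G a′ k′)
          ≈⟨ mul-cong {q = Gx.G a′ k′} (G-absorb n k′ (≤-trans (n≤1+n k′) (m≤m+n (suc k′) j))) ≈-refl ⟩
        mulP (mulP [b] (Gx.G n k′)) (Gx.G a′ k′) ≈⟨ solve 3 (λ b g h → b :* g :* h := b :* (h :* g)) ≈-refl [b] (Gx.G n k′) (Gx.G a′ k′) ⟩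
        mulP [b] F ∎

    X-k : mulP [k] X ≈ F
    X-k = begin
      mulP [k] X ≈⟨ solve 5 (λ k u a v b → k :* (u :* a :+ v :* b) := u :* (k :* a) :+ v :* (k :* b)) ≈-refl [k] u A v B ⟩
      addP (mulP u (mulP [k] A)) (mulP v (mulP [k] B)) ≈⟨ add-cong (mul-congʳ u kA) (mul-congʳ v kB) ⟩
      addP (mulP u (mulP [a] F)) (mulP v (mulP [b] F))
        ≈⟨ solve 5 (λ u a v b f → u :* (a :* f) :+ v :* (b :* f) := (u :* a :+ v :* b) :* f) ≈-refl u [a] v [b] F ⟩
      mulP (addP (mulP u [a]) (mulP v [b])) F ≈⟨ mul-cong {q = F} (proj₂ (proj₂ uv)) ≈-refl ⟩
      mulP [ + 1 ] F ≈⟨ mul-idˡ F ⟩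
      F ∎

    private
      cancel-k : ∀ p q → mulP [k] p ≈ mulP [k] q → p ≈ q
      cancel-k p q e = Monic-cancel ([]-Monic k′) p q (≈-trans (mul-comm p [k]) (≈-trans e (mul-comm [k] q)))

    X-a : mulP [a] X ≈ A
    X-a = cancel-k (mulP [a] X) A (begin
      mulP [k] (mulP [a] X) ≈⟨ solve 3 (λ k a y → k :* (a :* y) := a :* (k :* y)) ≈-refl [k] [a] X ⟩
      mulP [a] (mulP [k] X) ≈⟨ mul-congʳ [a] X-k ⟩
      mulP [a] F ≈⟨ ≈-sym kA ⟩
      mulP [k] A ∎)

    -- Here `suc j` is `b − k`. This form serves at the roots of unity where `[k]` vanishes.
    X-b-k : mulP Gx.[ suc j ] X ≈ mulP (Gx.G a′ k′) (Gx.G n (suc k′))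
    X-b-k = cancel-k (mulP Gx.[ suc j ] X) (mulP (Gx.G a′ k′) (Gx.G n (suc k′))) (begin
      mulP [k] (mulP Gx.[ suc j ] X) ≈⟨ solve 3 (λ k a y → k :* (a :* y) := a :* (k :* y)) ≈-refl [k] Gx.[ suc j ] X ⟩
      mulP Gx.[ suc j ] (mulP [k] X) ≈⟨ mul-congʳ Gx.[ suc j ] X-k ⟩
      mulP Gx.[ suc j ] (mulP (Gx.G a′ k′) (Gx.G n k′))
        ≈⟨ solve 3 (λ a g h → a :* (g :* h) := g :* (a :* h)) ≈-refl Gx.[ suc j ] (Gx.G a′ k′) (Gx.G n k′) ⟩
      mulP (Gx.G a′ k′) (mulP Gx.[ suc j ] (Gx.G n k′)) ≈⟨ mul-congʳ (Gx.G a′ k′) (≈-sym (G-absorb-lower k′ j)) ⟩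
      mulP (Gx.G a′ k′) (mulP [k] (Gx.G n (suc k′)))
        ≈⟨ solve 3 (λ g k h → g :* (k :* h) := k :* (g :* h)) ≈-refl (Gx.G a′ k′) [k] (Gx.G n (suc k′)) ⟩
      mulP [k] (mulP (Gx.G a′ k′) (Gx.G n (suc k′))) ∎)

    X-factorials : ∀ i → suc k′ ℕ.+ i ≡ suc a′ →
      mulP X (mulP (qInt (suc a′)) (mulP (qFact (suc k′)) (mulP (qFact i) (mulP (qFact k′) (qFact (suc j))))))
        ≈ mulP (qFact (suc a′)) (qFact n)
    X-factorials i k+i≡a = begin
      mulP X (mulP (qInt (suc a′)) (mulP (qFact (suc k′)) (mulP (qFact i) (mulP (qFact k′) (qFact (suc j))))))
        ≈⟨ mul-congʳ X (mul-cong (geom-qInt (suc a′)) (mul-cong (qFact-≈ (suc k′)) (mul-cong (qFact-≈ i) (mul-cong (qFact-≈ k′) (qFact-≈ (suc j)))))) ⟩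
      mulP X (mulP [a] (mulP Gx.[ suc k′ ]! (mulP Gx.[ i ]! (mulP Gx.[ k′ ]! Gx.[ suc j ]!))))
        ≈⟨ solve 6 (λ y a k i l j → y :* (a :* (k :* (i :* (l :* j)))) := a :* y :* ((k :* i) :* (l :* j))) ≈-refl
             X [a] Gx.[ suc k′ ]! Gx.[ i ]! Gx.[ k′ ]! Gx.[ suc j ]! ⟩
      mulP (mulP [a] X) (mulP (mulP Gx.[ suc k′ ]! Gx.[ i ]!) (mulP Gx.[ k′ ]! Gx.[ suc j ]!))
        ≈⟨ mul-cong {q = mulP (mulP Gx.[ suc k′ ]! Gx.[ i ]!) (mulP Gx.[ k′ ]! Gx.[ suc j ]!)} X-a ≈-refl ⟩
      mulP A (mulP (mulP Gx.[ suc k′ ]! Gx.[ i ]!) (mulP Gx.[ k′ ]! Gx.[ suc j ]!))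
        ≈⟨ solve 4 (λ g h p q → g :* h :* (p :* q) := (g :* p) :* (h :* q)) ≈-refl (Gx.G (suc a′) (suc k′)) (Gx.G n k′) _ _ ⟩
      mulP (mulP (Gx.G (suc a′) (suc k′)) (mulP Gx.[ suc k′ ]! Gx.[ i ]!)) (mulP (Gx.G n k′) (mulP Gx.[ k′ ]! Gx.[ suc j ]!))
        ≈⟨ mul-cong (factorial (suc k′) i (suc a′) k+i≡a) (factorial k′ (suc j) n (+-suc k′ j)) ⟩
      mulP Gx.[ suc a′ ]! Gx.[ n ]! ≈⟨ mul-cong (≈-sym (qFact-≈ (suc a′))) (≈-sym (qFact-≈ n)) ⟩
      mulP (qFact (suc a′)) (qFact n) ∎
      where
      factorial : ∀ p q m → p ℕ.+ q ≡ m → mulP (Gx.G m p) (mulP Gx.[ p ]! Gx.[ q ]!) ≈ Gx.[ m ]!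
      factorial p q _ refl = Gx.G-factorial p q

  module AtRoot (i d : ℕ) where
    ω : Poly
    ω = xPow d
    open Quotient polyRing (Φ i) public
    open CommutativeRing quotientRing public using () renaming (refl to ~-refl; setoid to ~-setoid)
    module Gq = QBinomials quotientRing ω
    module Pq = Powers quotientRing
    private
      module Gr = QBinomials polyRing ω

    evaluates : ∀ p c → compose p ω ~ [ c ] → EvalRootOfUnity (suc i) d p c
    evaluates p c (modBy u e) = remainder-zero i u (subP (compose p ω) [ c ]) (begin
      subP (compose p ω) [ c ] ≈⟨ addʳ (negP [ c ]) e ⟩
      subP (addP [ c ] (mulP u (Φ i))) [ c ] ≈⟨ solve 2 (λ c w → (c :+ w) :- c := w) ≈-refl [ c ] (mulP u (Φ i)) ⟩
      mulP u (Φ i) ∎)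

    evaluates-≈ : ∀ p c → compose p ω ~ [ c ] → ∀ p′ → p′ ≈ p → EvalRootOfUnity (suc i) d p′ c
    evaluates-≈ p c e p′ p′≈p = evaluates p′ c (~-trans (≈⇒~ (compose-cong ω p′ p p′≈p)) e)

    ∣⇒~0 : ∀ {p} → Φ i ∣ₚ p → p ~ []
    ∣⇒~0 (u by e) = modBy u e

    ~0⇒∣ : ∀ {p} → p ~ [] → Φ i ∣ₚ p
    ~0⇒∣ (modBy u e) = u by e

    -- The quotient ring shares the carrier and operations of the polynomial ring, so the same
    -- recursion yields identical polynomials there, not merely congruent ones.
    ^-agree : ∀ n → ω Pq.^ n ≡ ω ^ n
    ^-agree zero = refl
    ^-agree (suc n) = cong (mulP ω) (^-agree n)

    []-agree : ∀ n → Gq.[ n ] ≡ Gr.[ n ]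
    []-agree zero = refl
    []-agree (suc n) = cong (λ t → addP [ + 1 ] (mulP ω t)) ([]-agree n)

    G-agree : ∀ n k → Gq.G n k ≡ Gr.G n k
    G-agree n zero = refl
    G-agree zero (suc k) = refl
    G-agree (suc n) (suc k) = cong₂ addP (G-agree n k) (cong₂ mulP (^-agree (suc k)) (G-agree n (suc k)))

    natTimes-agree : ∀ n → Pq.natTimes n ≡ natTimes n
    natTimes-agree zero = refl
    natTimes-agree (suc n) = cong (addP [ + 1 ]) (natTimes-agree n)

    ω^-≈ : ∀ j → ω Pq.^ j ≈ x ^ (d ℕ.* j)
    ω^-≈ j = begin
      ω Pq.^ j ≡⟨ ^-agree j ⟩
      ω ^ j ≈⟨ ^-cong j ⟩
      (x ^ d) ^ j ≈⟨ ^-assocʳ x d j ⟩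
      x ^ (d ℕ.* j) ∎
      where
      ^-cong : ∀ j → ω ^ j ≈ (x ^ d) ^ j
      ^-cong zero = ≈-refl
      ^-cong (suc j) = mul-cong {ω} {x ^ d} (xPow-≈ d) (^-cong j)

    ω^-1 : ∀ j → suc i ∣ d ℕ.* j → ω Pq.^ j ~ [ + 1 ]
    ω^-1 j N∣dj = finish (∣ₚ-trans (Φ-∣-x^-1 (isCyclotomic i)) (x^-1-multiple (isCyclotomic i) (suc i) (d ℕ.* j) N∣dj))
      where
      finish : Φ i ∣ₚ xⁿ-1 (d ℕ.* j) → ω Pq.^ j ~ [ + 1 ]
      finish (u by e) = modBy u (begin
        ω Pq.^ j ≈⟨ ω^-≈ j ⟩
        x ^ (d ℕ.* j) ≈⟨ solve 1 (λ y → y := con (+ 1) :+ (y :- con (+ 1))) ≈-refl (x ^ (d ℕ.* j)) ⟩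
        addP [ + 1 ] (xⁿ-1 (d ℕ.* j)) ≈⟨ addˡ [ + 1 ] e ⟩
        addP [ + 1 ] (mulP u (Φ i)) ∎)

    ω^-regular : ∀ j → ¬ suc i ∣ d ℕ.* j → ∀ f → mulP (subP (ω Pq.^ j) [ + 1 ]) f ~ [] → f ~ []
    ω^-regular j N∤dj f e = ∣⇒~0 (Φ-∣-cancel i (d ℕ.* j) f N∤dj (~0⇒∣ (~-trans
      (≈⇒~ (mul-cong {q = f} (addʳ (negP [ + 1 ]) (≈-sym (ω^-≈ j))) ≈-refl)) e)))

    nat-regular : ∀ t f → mulP (natTimes (suc t)) f ~ [] → f ~ []
    nat-regular t f e = ∣⇒~0 (Φ-∣-cancel-nat i t f (~0⇒∣ e))

    compose-[]ω : ∀ n → compose Gx.[ n ] ω ~ Gq.[ n ]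
    compose-[]ω n = ≈⇒~ (≈-trans (compose-[] ω n) (mk λ t → cong (λ p → coeff p t) (sym ([]-agree n))))

    compose-Gω : ∀ n k → compose (Gx.G n k) ω ~ Gq.G n k
    compose-Gω n k = ≈⇒~ (≈-trans (compose-G ω n k) (mk λ t → cong (λ p → coeff p t) (sym (G-agree n k))))

    transport : ∀ {s X n k n′ k′} → mulP Gx.[ s ] X ≈ mulP (Gx.G n k) (Gx.G n′ k′) →
      mulP Gq.[ s ] (compose X ω) ~ mulP (Gq.G n k) (Gq.G n′ k′)
    transport {s} {X} {n} {k} {n′} {k′} e =
      ~-trans (*-cong~ (~-sym (compose-[]ω s)) (≈⇒~ {compose X ω} ≈-refl))
     (~-trans (≈⇒~ (≈-trans (≈-sym (compose-mul ω Gx.[ s ] X)) (≈-trans (compose-cong ω (mulP Gx.[ s ] X) _ e) (compose-mul ω (Gx.G n k) (Gx.G n′ k′)))))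
              (*-cong~ (compose-Gω n k) (compose-Gω n′ k′)))

    module Order (q m′ : ℕ) (q≡gcd : gcd d (suc i) ≡ q) (N≡qm : suc i ≡ q ℕ.* suc m′) where
      private
        m = suc m′
        e∣d : q ∣ d
        e∣d = subst (_∣ d) q≡gcd (gcd[m,n]∣m d (suc i))
        e : ℕ
        e = _∣_.quotient e∣d
        d≡eq : d ≡ e ℕ.* q
        d≡eq = _∣_.equality e∣d
        instance
          q≢0 : ℕ.NonZero q
          q≢0 = nz q N≡qm
            where
            nz : ∀ q → suc i ≡ q ℕ.* suc m′ → ℕ.NonZero q
            nz zero ()
            nz (suc q) _ = _
        coprime-m-e : Coprime m e
        coprime-m-e = gcd≡1⇒coprime (*-cancelˡ-≡ (gcd m e) 1 q (trans (c*gcd[m,n]≡gcd[cm,cn] q m e)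
          (trans (cong₂ gcd (sym N≡qm) (trans (*-comm q e) (sym d≡eq))) (trans (trans (gcd-comm (suc i) d) q≡gcd) (sym (*-identityʳ q))))))

      ω^m~1 : ω Pq.^ m ~ [ + 1 ]
      ω^m~1 = ω^-1 m (divides e (trans (cong (ℕ._* m) d≡eq) (trans (*-assoc e q m) (cong (e ℕ.*_) (sym N≡qm)))))

      -- With `d = e q`, divisibility of `d j` by `q m` reduces to that of `e j` by `m`. As `e` is
      -- prime to `m`, it would force `m ∣ j`, impossible for `0 < j < m`.
      regular : ∀ j → 0 < j → j < m → ∀ f → mulP (subP (ω Pq.^ j) [ + 1 ]) f ~ [] → f ~ []
      regular (suc j) _ j<m = ω^-regular (suc j) (λ N∣dj → <⇒≱ j<m (∣⇒≤ (coprime-divisor coprime-m-e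
        (*-cancelˡ-∣ q (subst (q ℕ.* m ∣_) (rearrange) (subst (_∣ d ℕ.* suc j) N≡qm N∣dj))))))
        where
        rearrange : d ℕ.* suc j ≡ q ℕ.* (e ℕ.* suc j)
        rearrange = trans (cong (ℕ._* suc j) (trans d≡eq (*-comm e q))) (*-assoc q e (suc j))

      module Root = Gq.RootOfUnity m′ ω^m~1 regular

  module NarayanaValues (a′ k′ j : ℕ) (gcd≡1 : gcd (suc a′) (suc (suc k′ ℕ.+ j)) ≡ 1) (k′≤a′ : k′ ≤ a′)
                        (d q m′ : ℕ) (q≡gcd : gcd d (suc k′ ℕ.+ j) ≡ q) (n≡qm : suc k′ ℕ.+ j ≡ q ℕ.* suc m′) where
    open Narayana a′ k′ j gcd≡1 k′≤a′ public
    open AtRoot (k′ ℕ.+ j) d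
    open Order q m′ q≡gcd n≡qm
    private
      n = suc k′ ℕ.+ j
      m = suc m′

      convert : ∀ {s S a A k K n M l L Y} → s ≡ S → a ≡ A → k ≡ K → n ≡ M → l ≡ L →
        mulP Gq.[ s ] Y ~ mulP (Gq.G a k) (Gq.G n l) → mulP Gq.[ S ] Y ~ mulP (Gq.G A K) (Gq.G M L)
      convert refl refl refl refl refl e = e

      n≡ : n ≡ q ℕ.* m ℕ.+ 0
      n≡ = trans n≡qm (sym (+-identityʳ _))

      nat-value : ∀ {Y} c → Y ~ Pq.natTimes c → Y ~ [ + c ]
      nat-value c e = ~-trans e (≈⇒~ (≈-trans (mk λ t → cong (λ p → coeff p t) (natTimes-agree c)) (natTimes-const c)))

    eval-central : 1 < m → ∀ u r v → r < m → a′ ≡ u ℕ.* m ℕ.+ r → k′ ≡ v ℕ.* m ℕ.+ 0 →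
      ∀ p → p ≈ X → EvalRootOfUnity n d p (+ (choose u v ℕ.* choose q v))
    eval-central 1<m u r v r<m a≡ k≡ = evaluates-≈ X _ (nat-value _ (Root.Narayana.value-central q u r r<m (compose X ω) 1<m v
      (convert {Y = compose X ω} (cong suc k≡) a≡ k≡ n≡ k≡ (transport {suc k′} {X} {a′} {k′} {n} {k′} X-k))))

    private
      free : 1 < m → ∀ u r v → r < m → a′ ≡ u ℕ.* m ℕ.+ r → k′ ≡ v ℕ.* m ℕ.+ m′ →
        compose X ω ~ mulP (mulP (Pq.natTimes (choose u v)) (Gq.G r m′)) (Pq.natTimes (choose q (suc v)))
      free 1<m u r v r<m a≡ k≡ = Root.Narayana.value-free q u r r<m (compose X ω) 1<m v (q ∸ suc v)
        (convert {Y = compose X ω} j≡ a≡ k≡ n≡ suck≡ (transport {suc j} {X} {a′} {k′} {n} {suc k′} X-b-k))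
        where
        suck≡ : suc k′ ≡ suc v ℕ.* m ℕ.+ 0
        suck≡ = trans (cong suc k≡) (trans (sym (+-suc (v ℕ.* m) m′)) (trans (+-comm (v ℕ.* m) m) (sym (+-identityʳ _))))
        j≡′ : j ≡ (q ∸ suc v) ℕ.* m
        j≡′ = trans (sym (m+n∸m≡n (suc k′) j)) (trans (cong₂ _∸_ n≡qm (trans suck≡ (+-identityʳ _))) (sym (*-distribʳ-∸ m q (suc v))))
        j≡ : suc j ≡ (q ∸ suc v) ℕ.* m ℕ.+ 1
        j≡ = trans (cong suc j≡′) (+-comm 1 _)

    eval-free : 1 < m → ∀ u v → a′ ≡ u ℕ.* m ℕ.+ m′ → k′ ≡ v ℕ.* m ℕ.+ m′ →
      ∀ p → p ≈ X → EvalRootOfUnity n d p (+ (choose q (suc v) ℕ.* choose u v))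
    eval-free 1<m u v a≡ k≡ = evaluates-≈ X _ (nat-value _ (~-trans (free 1<m u m′ v ≤-refl a≡ k≡)
      (~-trans (*-cong~ (~-trans (*-cong~ (~-refl {Pq.natTimes (choose u v)}) (Gq.G-diag m′)) (≈⇒~ (mul-idʳ (Pq.natTimes (choose u v))))) (~-refl {Pq.natTimes (choose q (suc v))}))
      (~-trans (~-sym (Comaximality.natTimes-* quotientRing (choose u v) (choose q (suc v))))
        (≈⇒~ (mk λ t → cong (λ c → coeff (Pq.natTimes c) t) (*-comm (choose u v) (choose q (suc v)))))))))

    eval-free-empty : 1 < m → ∀ u r v → r < m′ → a′ ≡ u ℕ.* m ℕ.+ r → k′ ≡ v ℕ.* m ℕ.+ m′ →
      ∀ p → p ≈ X → EvalRootOfUnity n d p (+ 0)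
    eval-free-empty 1<m u r v r<m′ a≡ k≡ = evaluates-≈ X _ (nat-value 0 (~-trans (free 1<m u r v (m≤n⇒m≤1+n r<m′) a≡ k≡)
      (~-trans (*-cong~ (~-trans (*-cong~ (~-refl {Pq.natTimes (choose u v)}) (Gq.G-zero r<m′)) (≈⇒~ (mul-zeroʳ (Pq.natTimes (choose u v))))) (~-refl {Pq.natTimes (choose q (suc v))})) ~-refl)))

    eval-other : ∀ u r v s → r < m → 0 < s → suc s < m → a′ ≡ u ℕ.* m ℕ.+ r → k′ ≡ v ℕ.* m ℕ.+ s →
      ∀ p → p ≈ X → EvalRootOfUnity n d p (+ 0)
    eval-other u r v s r<m 0<s s<m a≡ k≡ = evaluates-≈ X _ (nat-value 0 (Root.Narayana.value-other q u r r<m (compose X ω) v s 0<s s<m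
      (convert {Y = compose X ω} (cong suc k≡) a≡ k≡ n≡ k≡ (transport {suc k′} {X} {a′} {k′} {n} {k′} X-k))))

    -- For `m = 1` the value ω is 1 and `[k]` becomes the integer `k`. It is cancelled by
    -- `nat-regular`, so it is enough that `c` solves the corresponding equation of natural numbers.
    eval-one : m′ ≡ 0 → ∀ c → suc k′ ℕ.* c ≡ choose a′ k′ ℕ.* choose n k′ → ∀ p → p ≈ X → EvalRootOfUnity n d p (+ c)
    eval-one m′≡0 c kc≡ = evaluates-≈ X _ (nat-value c difference)
      where
      Y : Poly
      Y = compose X ω
      ω~1 : ω ~ [ + 1 ]
      ω~1 = ~-trans (≈⇒~ (≈-sym (mul-idʳ ω))) (subst (λ t → ω Pq.^ suc t ~ [ + 1 ]) m′≡0 ω^m~1)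
      open Gq.AtOne ω~1
      kY : mulP (Pq.natTimes (suc k′)) Y ~ mulP (Pq.natTimes (suc k′)) (Pq.natTimes c)
      kY = ~-trans (*-cong~ (~-sym ([n]≈n (suc k′))) (~-refl {Y}))
        (~-trans (transport {suc k′} {X} {a′} {k′} {n} {k′} X-k)
        (~-trans (*-cong~ (G≈choose a′ k′) (G≈choose n k′))
        (~-trans (~-sym (Comaximality.natTimes-* quotientRing (choose a′ k′) (choose n k′)))
        (~-trans (≈⇒~ (mk λ t → cong (λ c → coeff (Pq.natTimes c) t) (sym kc≡)))
                 (Comaximality.natTimes-* quotientRing (suc k′) c)))))
      difference : Y ~ Pq.natTimes c
      difference = ~-trans (≈⇒~ (solve 2 (λ y z → y := (y :- z) :+ z) ≈-refl Y C))
        (+-cong~ {y = []} (nat-regular k′ (subP Y C) (~-trans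
          (≈⇒~ (≈-trans (mk λ t → cong (λ p → coeff (mulP p (subP Y C)) t) (sym (natTimes-agree (suc k′))))
                        (solve 3 (λ k y z → k :* (y :- z) := k :* y :- k :* z) ≈-refl (Pq.natTimes (suc k′)) Y C)))
          (~-trans (+-cong~ kY (~-refl {negP (mulP (Pq.natTimes (suc k′)) C)})) (≈⇒~ (add-invʳ (mulP (Pq.natTimes (suc k′)) C))))))
          (~-refl {C}))
        where
        C : Poly
        C = Pq.natTimes c

  -- Positivity of the coefficients

  module _ {A : Set} (ρ : A → ℕ) where
    gen : List A → Poly
    gen [] = []
    gen (a ∷ as) = addP (x ^ ρ a) (gen as)

    gen-++ : ∀ as bs → gen (as ++ bs) ≈ addP (gen as) (gen bs)
    gen-++ [] bs = ≈-refl
    gen-++ (a ∷ as) bs = ≈-trans (addˡ (x ^ ρ a) (gen-++ as bs)) (≈-sym (add-assoc (x ^ ρ a) (gen as) (gen bs)))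

  coeff-xPow-same : ∀ m → coeff (xPow m) m ≡ + 1
  coeff-xPow-same zero = refl
  coeff-xPow-same (suc m) = coeff-xPow-same m

  coeff-xPow-other : ∀ m r → m ≢ r → coeff (xPow m) r ≡ + 0
  coeff-xPow-other zero zero n = ⊥-elim (n refl)
  coeff-xPow-other zero (suc r) n = refl
  coeff-xPow-other (suc m) zero n = refl
  coeff-xPow-other (suc m) (suc r) n = coeff-xPow-other m r (λ e → n (cong suc e))

  coeff-gen : ∀ {A : Set} (ρ : A → ℕ) as r → coeff (gen ρ as) r ≡ + length (filter (λ a → ρ a ℕ.≟ r) as)
  coeff-gen ρ [] r = refl
  coeff-gen ρ (a ∷ as) r = trans (coeff-add (x ^ ρ a) (gen ρ as) r)
    (trans (cong₂ ℤ._+_ (sym (at (xPow-≈ (ρ a)) r)) (coeff-gen ρ as r)) (step (ρ a ℕ.≟ r)))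
    where
    step : Dec (ρ a ≡ r) → coeff (xPow (ρ a)) r ℤ.+ + length (filter (λ a → ρ a ℕ.≟ r) as) ≡ + length (filter (λ a → ρ a ℕ.≟ r) (a ∷ as))
    step (yes refl) rewrite Listₚ.filter-accept (λ b → ρ b ℕ.≟ ρ a) {a} {as} refl | coeff-xPow-same (ρ a) = refl
    step (no n) rewrite Listₚ.filter-reject (λ b → ρ b ℕ.≟ r) {a} {as} n | coeff-xPow-other (ρ a) r n = refl

  gen-shift : ∀ {A B : Set} (ρ : A → ℕ) (σ : B → ℕ) (f : A → B) k as → All (λ a → σ (f a) ≡ k ℕ.+ ρ a) as → gen σ (map f as) ≈ mulP (x ^ k) (gen ρ as)
  gen-shift ρ σ f k [] [] = ≈-sym (mul-zeroʳ (x ^ k))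
  gen-shift ρ σ f k (a ∷ as) (e ∷ es) = begin
    addP (x ^ σ (f a)) (gen σ (map f as)) ≡⟨ cong (λ t → addP (x ^ t) (gen σ (map f as))) e ⟩
    addP (x ^ (k ℕ.+ ρ a)) (gen σ (map f as)) ≈⟨ add-cong (^-homo-* x k (ρ a)) (gen-shift ρ σ f k as es) ⟩
    addP (mulP (x ^ k) (x ^ ρ a)) (mulP (x ^ k) (gen ρ as)) ≈⟨ ≈-sym (mul-distribˡ (x ^ k) (x ^ ρ a) (gen ρ as)) ⟩
    mulP (x ^ k) (gen ρ (a ∷ as)) ∎

  gen-product : ∀ {A B : Set} (ρ : A → ℕ) (σ : B → ℕ) as bs →
    mulP (gen ρ as) (gen σ bs) ≈ gen (λ p → ρ (proj₁ p) ℕ.+ σ (proj₂ p)) (cartesianProduct as bs)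
  gen-product ρ σ [] bs = ≈-refl
  gen-product ρ σ (a ∷ as) bs = begin
    mulP (addP (x ^ ρ a) (gen ρ as)) (gen σ bs) ≈⟨ mul-distribʳ (gen σ bs) (x ^ ρ a) (gen ρ as) ⟩
    addP (mulP (x ^ ρ a) (gen σ bs)) (mulP (gen ρ as) (gen σ bs))
      ≈⟨ add-cong (≈-sym (gen-shift σ τ (λ b → a , b) (ρ a) bs (All.universal (λ _ → refl) bs))) (gen-product ρ σ as bs) ⟩
    addP (gen τ (map (λ b → a , b) bs)) (gen τ (cartesianProduct as bs)) ≈⟨ ≈-sym (gen-++ τ (map (λ b → a , b) bs) (cartesianProduct as bs)) ⟩
    gen τ (cartesianProduct (a ∷ as) bs) ∎
    where
    τ : _ → ℕ
    τ p = ρ (proj₁ p) ℕ.+ σ (proj₂ p)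

  binaryWords : ℕ → ℕ → List Word
  binaryWords n       zero    = [ replicate n false ]
  binaryWords zero    (suc k) = []
  binaryWords (suc n) (suc k) = map (true ∷_) (binaryWords n k) ++ map (false ∷_) (binaryWords n (suc k))

  ones-replicate : ∀ n → ones (replicate n false) ≡ 0
  ones-replicate zero = refl
  ones-replicate (suc n) = ones-replicate n

  zeros-replicate : ∀ n → zeros (replicate n false) ≡ n
  zeros-replicate zero = refl
  zeros-replicate (suc n) = cong suc (zeros-replicate n)

  inversions-replicate : ∀ n → inversions (replicate n false) ≡ 0
  inversions-replicate zero = refl
  inversions-replicate (suc n) = cong₂ ℕ._+_ (ones-replicate n) (inversions-replicate n)

  binaryWords-content : ∀ n k {s} → s ∈ binaryWords n k → ones s ≡ k × ones s ℕ.+ zeros s ≡ n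
  binaryWords-content n zero (here refl) = ones-replicate n , trans (cong (ℕ._+ zeros (replicate n false)) (ones-replicate n)) (zeros-replicate n)
  binaryWords-content (suc n) (suc k) s∈ with ∈-++⁻ (map (true ∷_) (binaryWords n k)) s∈
  ... | inj₁ p with ∈-map⁻ (true ∷_) p
  ...   | s′ , s′∈ , refl = cong suc (proj₁ (binaryWords-content n k s′∈)) , cong suc (proj₂ (binaryWords-content n k s′∈))
  binaryWords-content (suc n) (suc k) s∈ | inj₂ p with ∈-map⁻ (false ∷_) p
  ...   | s′ , s′∈ , refl = proj₁ (binaryWords-content n (suc k) s′∈) , trans (+-suc (ones s′) (zeros s′)) (cong suc (proj₂ (binaryWords-content n (suc k) s′∈)))

  no-ones : ∀ s → ones s ≡ 0 → s ≡ replicate (zeros s) false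
  no-ones [] _ = refl
  no-ones (false ∷ s) e = cong (false ∷_) (no-ones s e)

  ∈-binaryWords : ∀ s → s ∈ binaryWords (ones s ℕ.+ zeros s) (ones s)
  ∈-binaryWords [] = here refl
  ∈-binaryWords (true ∷ s) = ∈-++⁺ˡ (∈-map⁺ (true ∷_) (∈-binaryWords s))
  ∈-binaryWords (false ∷ s) with ones s in eq | ∈-binaryWords s
  ... | zero | _ = here (cong (false ∷_) (no-ones s eq))
  ... | suc k | s∈ rewrite +-suc k (zeros s) = ∈-++⁺ʳ (map (true ∷_) (binaryWords (suc (k ℕ.+ zeros s)) k)) (∈-map⁺ (false ∷_) s∈)

  binaryWords-unique : ∀ n k → Unique (binaryWords n k)
  binaryWords-unique n zero = [] ∷ []
  binaryWords-unique zero (suc k) = []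
  binaryWords-unique (suc n) (suc k) = Uniqueₚ.++⁺ (Uniqueₚ.map⁺ Listₚ.∷-injectiveʳ (binaryWords-unique n k))
    (Uniqueₚ.map⁺ Listₚ.∷-injectiveʳ (binaryWords-unique n (suc k))) disjoint
    where
    disjoint : ∀ {s} → ¬ (s ∈ map (true ∷_) (binaryWords n k) × s ∈ map (false ∷_) (binaryWords n (suc k)))
    disjoint (p , q) with ∈-map⁻ (true ∷_) p | ∈-map⁻ (false ∷_) q
    ... | _ , _ , refl | _ , _ , ()

  -- Pascal's recursion on the first letter: a leading `false` forms an inversion with each of the
  -- `suc k` ones behind it, and this is the factor `x ^ suc k`.
  G-gen : ∀ n k → Gx.G n k ≈ gen inversions (binaryWords n k)
  G-gen n zero = ≈-sym (≈-trans (add-idʳ _) (mk λ i → cong (λ t → coeff (x ^ t) i) (inversions-replicate n)))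
  G-gen zero (suc k) = ≈-refl
  G-gen (suc n) (suc k) = begin
    addP (Gx.G n k) (mulP (x ^ suc k) (Gx.G n (suc k))) ≈⟨ add-cong (G-gen n k) (mul-congʳ (x ^ suc k) (G-gen n (suc k))) ⟩
    addP (gen inversions (binaryWords n k)) (mulP (x ^ suc k) (gen inversions (binaryWords n (suc k))))
      ≈⟨ add-cong (≈-trans (≈-sym (mul-idˡ _)) (≈-sym (gen-shift inversions inversions (true ∷_) 0 (binaryWords n k) (All.universal (λ _ → refl) _))))
           (≈-sym (gen-shift inversions inversions (false ∷_) (suc k) (binaryWords n (suc k)) (All.tabulate λ {s} s∈ → cong (ℕ._+ inversions s) (proj₁ (binaryWords-content n (suc k) s∈))))) ⟩
    addP (gen inversions (map (true ∷_) (binaryWords n k))) (gen inversions (map (false ∷_) (binaryWords n (suc k))))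
      ≈⟨ ≈-sym (gen-++ inversions (map (true ∷_) (binaryWords n k)) (map (false ∷_) (binaryWords n (suc k)))) ⟩
    gen inversions (binaryWords (suc n) (suc k)) ∎

  module Product (k₁ j₁ k₂ j₂ : ℕ) where
    open Levels k₁ j₁ k₂ j₂

    GG : Poly
    GG = mulP (Gx.G (k₁ ℕ.+ j₁) k₁) (Gx.G (k₂ ℕ.+ j₂) k₂)

    private
      rank : Words² → ℕ
      rank p = inversions (proj₁ p) ℕ.+ inversions (proj₂ p)

      pairs : List Words²
      pairs = cartesianProduct (binaryWords (k₁ ℕ.+ j₁) k₁) (binaryWords (k₂ ℕ.+ j₂) k₂)

      ofRank : ℕ → List Words²
      ofRank r = filter (λ p → rank p ℕ.≟ r) pairs

      coeff-GG : ∀ r → coeff GG r ≡ + length (ofRank r)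
      coeff-GG r = trans (at (≈-trans (mul-cong (G-gen (k₁ ℕ.+ j₁) k₁) (G-gen (k₂ ℕ.+ j₂) k₂))
        (gen-product inversions inversions (binaryWords (k₁ ℕ.+ j₁) k₁) (binaryWords (k₂ ℕ.+ j₂) k₂))) r) (coeff-gen rank pairs r)

      ofRank-unique : ∀ r → Unique (ofRank r)
      ofRank-unique r = Uniqueₚ.filter⁺ (λ p → rank p ℕ.≟ r) (Uniqueₚ.cartesianProduct⁺ (binaryWords-unique _ k₁) (binaryWords-unique _ k₂))

      content : ∀ k j {s} → s ∈ binaryWords (k ℕ.+ j) k → ones s ≡ k × zeros s ≡ j
      content k j {s} s∈ with binaryWords-content (k ℕ.+ j) k s∈
      ... | o , oz = o , +-cancelˡ-≡ k _ _ (trans (cong (ℕ._+ zeros s) (sym o)) oz)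

      ofRank-sound : ∀ r → All (InLevel r) (ofRank r)
      ofRank-sound r = All.tabulate sound
        where
        sound : ∀ {p} → p ∈ ofRank r → InLevel r p
        sound p∈ with ∈-filter⁻ (λ p → rank p ℕ.≟ r) {xs = pairs} p∈
        ... | p∈′ , e with ∈-cartesianProduct⁻ (binaryWords (k₁ ℕ.+ j₁) k₁) (binaryWords (k₂ ℕ.+ j₂) k₂) p∈′
        ...   | s∈ , t∈ = inLevel (proj₁ (content k₁ j₁ s∈)) (proj₂ (content k₁ j₁ s∈)) (proj₁ (content k₂ j₂ t∈)) (proj₂ (content k₂ j₂ t∈)) e

      ofRank-complete : ∀ r a → InLevel r a → a ∈ ofRank r
      ofRank-complete r (s , t) (inLevel refl refl refl refl e) = ∈-filter⁺ (λ p → rank p ℕ.≟ r) (∈-cartesianProduct⁺ (∈-binaryWords s) (∈-binaryWords t)) e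

    coeff-increasing : ∀ r → 2 ℕ.* r < top → coeff GG r ℤ.≤ coeff GG (suc r)
    coeff-increasing r lt = subst (ℤ._≤ coeff GG (suc r)) (sym (coeff-GG r)) (subst (+ length (ofRank r) ℤ.≤_) (sym (coeff-GG (suc r)))
      (ℤ.+≤+ (rank-increasing r lt (ofRank r) (ofRank (suc r)) (ofRank-unique r) (ofRank-sound r) (ofRank-complete (suc r)))))

    coeff-decreasing : ∀ r → top < 2 ℕ.* suc r → coeff GG (suc r) ℤ.≤ coeff GG r
    coeff-decreasing r lt = subst (ℤ._≤ coeff GG r) (sym (coeff-GG (suc r))) (subst (+ length (ofRank (suc r)) ℤ.≤_) (sym (coeff-GG r))
      (ℤ.+≤+ (rank-decreasing r lt (ofRank (suc r)) (ofRank r) (ofRank-unique (suc r)) (ofRank-sound (suc r)) (ofRank-complete r))))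

    coeff-GG-nonneg : ∀ r → + 0 ℤ.≤ coeff GG r
    coeff-GG-nonneg r = subst (+ 0 ℤ.≤_) (sym (coeff-GG r)) (ℤ.+≤+ z≤n)

  coeff-x^* : ∀ k p i → coeff (mulP (x ^ k) p) (k ℕ.+ i) ≡ coeff p i
  coeff-x^* zero p i = at (mul-idˡ p) i
  coeff-x^* (suc k) p i = trans (at (≈-trans (mul-assoc x (x ^ k) p) (mul-x (mulP (x ^ k) p))) (suc k ℕ.+ i)) (coeff-x^* k p i)

  coeff-x^*-below : ∀ k p i → i < k → coeff (mulP (x ^ k) p) i ≡ + 0
  coeff-x^*-below (suc k) p zero _ = at (≈-trans (mul-assoc x (x ^ k) p) (mul-x (mulP (x ^ k) p))) 0
  coeff-x^*-below (suc k) p (suc i) (s≤s i<k) = trans (at (≈-trans (mul-assoc x (x ^ k) p) (mul-x (mulP (x ^ k) p))) (suc i)) (coeff-x^*-below k p i i<k)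

  coeff-beyond : ∀ p i → length p ≤ i → coeff p i ≡ + 0
  coeff-beyond [] i _ = refl
  coeff-beyond (c ∷ p) (suc i) (s≤s le) = coeff-beyond p i le

  -- (1 − q^k) X = (1 − q) F: the coefficients of X are partial sums, with step k, of the differences of F,
  -- which are nonnegative up to the middle; beyond the middle one sums from the top.
  module QuotientPositive (X F : Poly) (k top : ℕ) (kX≈F : mulP Gx.[ suc k ] X ≈ F)
    (nonneg : + 0 ℤ.≤ coeff F 0)
    (increasing : ∀ r → 2 ℕ.* r < top → coeff F r ℤ.≤ coeff F (suc r))
    (decreasing : ∀ r → top < 2 ℕ.* suc r → coeff F (suc r) ℤ.≤ coeff F r) where

    private
      difference : addP (mulP (x ^ suc k) X) F ≈ addP (mulP x F) X
      difference = begin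
        addP (mulP (x ^ suc k) X) F
          ≈⟨ solve 3 (λ p y f → p :* y :+ f := ((p :- con (+ 1)) :* y :+ y) :+ f) ≈-refl (x ^ suc k) X F ⟩
        addP (addP (mulP (xⁿ-1 (suc k)) X) X) F
          ≈⟨ addʳ F (addʳ X (mul-cong {q = X} (≈-sym (geom-telescope x (suc k))) ≈-refl)) ⟩
        addP (addP (mulP (mulP (subP x [ + 1 ]) Gx.[ suc k ]) X) X) F
          ≈⟨ solve 4 (λ z g y f → (z :* g :* y :+ y) :+ f := (z :* (g :* y) :+ y) :+ f) ≈-refl (subP x [ + 1 ]) Gx.[ suc k ] X F ⟩
        addP (addP (mulP (subP x [ + 1 ]) (mulP Gx.[ suc k ] X)) X) F
          ≈⟨ addʳ F (addʳ X (mul-congʳ (subP x [ + 1 ]) kX≈F)) ⟩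
        addP (addP (mulP (subP x [ + 1 ]) F) X) F
          ≈⟨ solve 3 (λ z y f → ((z :- con (+ 1)) :* f :+ y) :+ f := z :* f :+ y) ≈-refl x X F ⟩
        addP (mulP x F) X ∎

      at-difference : ∀ i → coeff (mulP (x ^ suc k) X) i ℤ.+ coeff F i ≡ coeff (mulP x F) i ℤ.+ coeff X i
      at-difference i = trans (sym (coeff-add (mulP (x ^ suc k) X) F i)) (trans (at difference i) (coeff-add (mulP x F) X i))

      step : ∀ i → coeff X i ℤ.+ coeff F (suc (k ℕ.+ i)) ≡ coeff F (k ℕ.+ i) ℤ.+ coeff X (suc (k ℕ.+ i))
      step i = trans (cong (ℤ._+ coeff F (suc (k ℕ.+ i))) (sym (coeff-x^* (suc k) X i)))
        (trans (at-difference (suc (k ℕ.+ i))) (cong (ℤ._+ coeff X (suc (k ℕ.+ i))) (at (mul-x F) (suc (k ℕ.+ i)))))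

      compare-≤ : ∀ {u v f g} → u ℤ.+ g ≡ f ℤ.+ v → f ℤ.≤ g → u ℤ.≤ v
      compare-≤ {u} {v} {f} {g} e f≤g = ℤₚ.≮⇒≥ λ v<u → ℤₚ.<-irrefl (trans (ℤₚ.+-comm v f) (sym e)) (ℤₚ.+-mono-<-≤ v<u f≤g)

      compare-≥ : ∀ {u v f g} → u ℤ.+ g ≡ f ℤ.+ v → g ℤ.≤ f → v ℤ.≤ u
      compare-≥ {u} {v} {f} {g} e g≤f = ℤₚ.≮⇒≥ λ u<v → ℤₚ.<-irrefl (trans e (ℤₚ.+-comm f v)) (ℤₚ.+-mono-<-≤ u<v g≤f)

      NonNeg : ℕ → Set
      NonNeg i = + 0 ℤ.≤ coeff X i

      lower-half : ∀ i → 2 ℕ.* i ≤ top → NonNeg i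
      lower-half = <-rec (λ i → 2 ℕ.* i ≤ top → NonNeg i) go
        where
        prev : ∀ i → 2 ℕ.* suc i ≤ top → 2 ℕ.* i < top
        prev i = <-≤-trans (*-monoʳ-< 2 (n<1+n i))
        go : ∀ i → (∀ {j} → j < i → 2 ℕ.* j ≤ top → NonNeg j) → 2 ℕ.* i ≤ top → NonNeg i
        go i ih le with suc k ℕ.≤? i
        ... | yes k<i = subst NonNeg i≡ (ℤₚ.≤-trans (ih j<i (≤-trans (*-monoʳ-≤ 2 (<⇒≤ j<i)) le))
                  (compare-≤ (step (i ∸ suc k)) (increasing (k ℕ.+ (i ∸ suc k)) (prev _ (subst (λ t → 2 ℕ.* t ≤ top) (sym i≡) le)))))
          where
          i≡ : suc (k ℕ.+ (i ∸ suc k)) ≡ i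
          i≡ = m+[n∸m]≡n k<i
          j<i : i ∸ suc k < i
          j<i = ∸-monoʳ-< (s≤s z≤n) k<i
        go zero ih le | no _ = ℤₚ.≤-trans nonneg (ℤₚ.≤-reflexive (trans (sym (trans (cong (ℤ._+ coeff F 0) (coeff-x^*-below (suc k) X 0 (s≤s z≤n))) (ℤₚ.+-identityˡ _)))
          (trans (at-difference 0) (trans (cong (ℤ._+ coeff X 0) (at (mul-x F) 0)) (ℤₚ.+-identityˡ _)))))
        -- Below degree `k + 1` the shifted copy of `X` contributes nothing, so this coefficient is
        -- a single difference of consecutive coefficients of `F`.
        go (suc i) ih le | no k≮i = compare-≤ (trans (cong (ℤ._+ coeff F (suc i)) (sym (coeff-x^*-below (suc k) X (suc i) (≰⇒> k≮i))))
          (trans (at-difference (suc i)) (cong (ℤ._+ coeff X (suc i)) (at (mul-x F) (suc i))))) (increasing i (prev i le))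

      -- Beyond the middle the coefficient at `i` is at least the one at `i + k + 1`. Iterating
      -- leads past the end of the list, where coefficients are zero; `fuel` bounds the number of
      -- iterations.
      upper-half : ∀ fuel i → length X ≤ fuel ℕ.+ i → top < 2 ℕ.* i → NonNeg i
      upper-half zero i le _ = ℤₚ.≤-reflexive (sym (coeff-beyond X i le))
      upper-half (suc fuel) i le lt = ℤₚ.≤-trans (upper-half fuel (suc (k ℕ.+ i))
          (≤-trans le (≤-trans (≤-reflexive (sym (+-suc fuel i))) (+-monoʳ-≤ fuel (s≤s (m≤n+m i k))))) beyond)
        (compare-≥ (step i) (decreasing (k ℕ.+ i) beyond))
        where
        beyond : top < 2 ℕ.* suc (k ℕ.+ i)
        beyond = <-≤-trans lt (*-monoʳ-≤ 2 (≤-trans (m≤n+m i k) (n≤1+n _)))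

    coeff-nonneg : ∀ i → + 0 ℤ.≤ coeff X i
    coeff-nonneg i with 2 ℕ.* i ℕ.≤? top
    ... | yes le = lower-half i le
    ... | no nle = upper-half (length X) i (m≤m+n (length X) i) (≰⇒> nle)

  toℕPoly : Poly → List ℕ
  toℕPoly = map ℤ.∣_∣

  toPoly-toℕPoly : ∀ p → (∀ i → + 0 ℤ.≤ coeff p i) → toPoly (toℕPoly p) ≈ p
  toPoly-toℕPoly [] _ = ≈-refl
  toPoly-toℕPoly (c ∷ p) h = ∷-cong (ℤₚ.0≤i⇒+∣i∣≡i (h 0)) (toPoly-toℕPoly p (λ i → h (suc i)))

-- Rational Dyck paths, their partitions and the count of invariant partitions

module Paths where
  open import Data.Integer using (_-_)
  open import Data.Integer.Tactic.RingSolver using (solve-∀)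
  open import Data.Nat using (_+_; _*_)
  -- Walks and parents

  record PrevSmaller (S : ℕ → ℤ) (p j : ℕ) : Set where
    constructor prev
    field
      before  : p < j
      smaller : S p ℤ.< S j
      between : ∀ t → p < t → t < j → S j ℤ.< S t
  open PrevSmaller public

  prevSmaller-unique : ∀ {S p p′ j} → PrevSmaller S p j → PrevSmaller S p′ j → p ≡ p′
  prevSmaller-unique {S} {p} {p′} P P′ with <-cmp p p′
  ... | tri< p<p′ _ _ = ⊥-elim (ℤₚ.<-asym (smaller P′) (between P p′ p<p′ (before P′)))
  ... | tri≈ _ e _ = e
  ... | tri> _ _ p′<p = ⊥-elim (ℤₚ.<-asym (smaller P) (between P′ p p′<p (before P)))

  prevSmaller-exists : ∀ S j t₀ → (∀ t → t₀ ≤ t → t < j → S t ≢ S j) → t₀ < j → S t₀ ℤ.< S j → ∃ λ p → PrevSmaller S p j × t₀ ≤ p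
  prevSmaller-exists S j t₀ distinct t₀<j low = search j ≤-refl t₀<j (λ t j≤t t<j → ⊥-elim (<⇒≱ t<j j≤t))
    where
    search : ∀ i → i ≤ j → t₀ < i → (∀ t → i ≤ t → t < j → S j ℤ.< S t) → ∃ λ p → PrevSmaller S p j × t₀ ≤ p
    search (suc i) i<j (s≤s t₀≤i) above with S i ℤ.<? S j
    ... | yes lt = i , prev i<j lt (λ t i<t → above t i<t) , t₀≤i
    ... | no nlt = search i (<⇒≤ i<j) (≤∧≢⇒< t₀≤i (λ { refl → nlt low })) above′
      where
      above′ : ∀ t → i ≤ t → t < j → S j ℤ.< S t
      above′ t i≤t t<j with m≤n⇒m<n∨m≡n i≤t
      ... | inj₁ i<t = above t i<t t<j
      ... | inj₂ refl = ℤₚ.≤∧≢⇒< (ℤₚ.≮⇒≥ nlt) (λ e → distinct t t₀≤i t<j (sym e))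

  -- 0 when no smaller value precedes.
  searchPS : (ℕ → ℤ) → ℤ → ℕ → ℕ
  searchPS S v zero = 0
  searchPS S v (suc i) with S i ℤ.<? v
  ... | yes _ = i
  ... | no _ = searchPS S v i

  ps : (ℕ → ℤ) → ℕ → ℕ
  ps S j = searchPS S (S j) j

  ps-of : ∀ {S p j} → PrevSmaller S p j → ps S j ≡ p
  ps-of {S} {p} {j} P = go j (before P) ≤-refl
    where
    go : ∀ i → p < i → i ≤ j → searchPS S (S j) i ≡ p
    go (suc i) (s≤s p≤i) i<j with S i ℤ.<? S j | m≤n⇒m<n∨m≡n p≤i
    ... | yes lt | inj₁ p<i = ⊥-elim (ℤₚ.<-asym lt (between P i p<i i<j))
    ... | yes _ | inj₂ refl = refl
    ... | no _ | inj₁ p<i = go i p<i (<⇒≤ i<j)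
    ... | no nlt | inj₂ refl = ⊥-elim (nlt (smaller P))

  ps-cong : ∀ {S S′} j → (∀ i → i ≤ j → S i ≡ S′ i) → ps S j ≡ ps S′ j
  ps-cong {S} {S′} j e = trans (go (S j) j ≤-refl) (cong (λ v → searchPS S′ v j) (e j ≤-refl))
    where
    go : ∀ v i → i ≤ j → searchPS S v i ≡ searchPS S′ v i
    go v zero _ = refl
    go v (suc i) i<j with S i ℤ.<? v | S′ i ℤ.<? v
    ... | yes _ | yes _ = refl
    ... | no _ | no _ = go v i (<⇒≤ i<j)
    ... | yes lt | no nlt = ⊥-elim (nlt (subst (ℤ._< v) (e i (<⇒≤ i<j)) lt))
    ... | no nlt | yes lt = ⊥-elim (nlt (subst (ℤ._< v) (sym (e i (<⇒≤ i<j))) lt))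

  module Slope (a n : ℕ) (0<a : 0 < a) (a≤n : a ≤ n) (coprime : Coprime a (suc n)) where
    b : ℕ
    b = suc n

    0<n : 0 < n
    0<n = ≤-trans 0<a a≤n

    instance
      n-nonZero : NonZero n
      n-nonZero = ℕ.>-nonZero 0<n

    opaque
      T : (ℕ → ℕ) → ℕ → ℤ
      T Z i = + (b * Z i) - + (a * i)

      T-def : ∀ Z i → T Z i ≡ + (b * Z i) - + (a * i)
      T-def Z i = refl

    T-difference : ∀ Z i v u → Z (i + v) ≡ Z i + u → T Z (i + v) ≡ T Z i ℤ.+ (+ (b * u) - + (a * v))
    T-difference Z i v u e = trans (T-def Z (i + v)) (trans (cong₂ (λ p q → + p - + q) (trans (cong (b *_) e) (*-distribˡ-+ b (Z i) u)) (*-distribˡ-+ a i v))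
      (trans (lemma (+ (b * Z i)) (+ (b * u)) (+ (a * i)) (+ (a * v))) (cong (ℤ._+ (+ (b * u) - + (a * v))) (sym (T-def Z i)))))
      where
      lemma : ∀ p q r s → (p ℤ.+ q) - (r ℤ.+ s) ≡ (p - r) ℤ.+ (q - s)
      lemma = solve-∀

    <-shift : ∀ s p q → q < p → s ℤ.< s ℤ.+ (+ p - + q)
    <-shift s p q lt = subst (ℤ._< s ℤ.+ (+ p - + q)) (ℤₚ.+-identityʳ s) (ℤₚ.+-monoʳ-< s
      (subst (ℤ._< + p - + q) (ℤₚ.+-inverseʳ (+ q)) (ℤₚ.+-monoˡ-< (ℤ.- + q) (ℤ.+<+ lt))))

    >-shift : ∀ s p q → p < q → s ℤ.+ (+ p - + q) ℤ.< s
    >-shift s p q lt = subst (s ℤ.+ (+ p - + q) ℤ.<_) (ℤₚ.+-identityʳ s) (ℤₚ.+-monoʳ-< s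
      (subst (+ p - + q ℤ.<_) (ℤₚ.+-inverseʳ (+ q)) (ℤₚ.+-monoˡ-< (ℤ.- + q) (ℤ.+<+ lt))))

    <-unshift : ∀ s p q → s ℤ.< s ℤ.+ (+ p - + q) → q < p
    <-unshift s p q lt with <-cmp q p
    ... | tri< q<p _ _ = q<p
    ... | tri≈ _ refl _ = ⊥-elim (ℤₚ.<-irrefl (sym (trans (cong (ℤ._+_ s) (ℤₚ.+-inverseʳ (+ q))) (ℤₚ.+-identityʳ s))) lt)
    ... | tri> _ _ p<q = ⊥-elim (ℤₚ.<-asym lt (>-shift s p q p<q))

    >-unshift : ∀ s p q → s ℤ.+ (+ p - + q) ℤ.< s → p < q
    >-unshift s p q lt with <-cmp p q
    ... | tri< p<q _ _ = p<q
    ... | tri≈ _ refl _ = ⊥-elim (ℤₚ.<-irrefl (trans (cong (ℤ._+_ s) (ℤₚ.+-inverseʳ (+ q))) (ℤₚ.+-identityʳ s)) lt)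
    ... | tri> _ _ q<p = ⊥-elim (ℤₚ.<-asym lt (<-shift s p q q<p))

    T-flat : ∀ Z x → Z (suc x) ≡ Z x → T Z (suc x) ℤ.< T Z x
    T-flat Z x e = subst (ℤ._< T Z x) (sym (trans (cong (T Z) (+-comm 1 x)) (T-difference Z x 1 0 (trans (cong Z (+-comm x 1)) (trans e (sym (+-identityʳ _)))))))
      (>-shift (T Z x) (b * 0) (a * 1) (subst₂ _<_ (sym (*-zeroʳ b)) (sym (*-identityʳ a)) 0<a))

    T-rise : ∀ Z x → Z x < Z (suc x) → T Z x ℤ.< T Z (suc x)
    T-rise Z x lt = subst (T Z x ℤ.<_) (sym (trans (cong (T Z) (+-comm 1 x)) (T-difference Z x 1 u (trans (cong Z (+-comm x 1)) (sym (m+[n∸m]≡n (<⇒≤ lt)))))))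
      (<-shift (T Z x) (b * u) (a * 1) (<-≤-trans (s≤s (≤-trans (≤-reflexive (*-identityʳ a)) a≤n)) (m≤m*n b u {{ℕ.>-nonZero (m<n⇒0<n∸m lt)}})))
      where
      u = Z (suc x) ∸ Z x

    -- Equal values at distance `d` would make `b` divide `a d`, hence `d`, by coprimality. This is
    -- what makes all comparisons of the walk within a window of length `b` strict.
    T-distinct : ∀ Z i j → i < j → j < i + b → T Z i ≢ T Z j
    T-distinct Z i j i<j j<i+b e = <⇒≱ d<b (∣⇒≤ {{ℕ.>-nonZero 0<d}} (coprime-divisor (Coprimality.sym coprime) b∣ad))
      where
      d = j ∸ i
      i+d : i + d ≡ j
      i+d = m+[n∸m]≡n (<⇒≤ i<j)
      0<d : 0 < d
      0<d = m<n⇒0<n∸m i<j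
      d<b : d < b
      d<b = +-cancelˡ-< i d b (subst (_< i + b) (sym i+d) j<i+b)
      balance : b * Z i + a * j ≡ b * Z j + a * i
      balance = ℤₚ.+-injective (trans (cong (ℤ._+ + (a * j)) (lemma (+ (b * Z i)) (+ (a * i))))
        (trans (cong (λ t → t ℤ.+ + (a * i) ℤ.+ + (a * j)) (trans (sym (T-def Z i)) (trans e (T-def Z j)))) (lemma′ (+ (b * Z j)) (+ (a * j)) (+ (a * i)))))
        where
        lemma : ∀ p q → p ≡ p - q ℤ.+ q
        lemma = solve-∀
        lemma′ : ∀ p q r → p - q ℤ.+ r ℤ.+ q ≡ p ℤ.+ r
        lemma′ = solve-∀
      b∣ad : b ∣ a * d
      b∣ad = ∣m+n∣m⇒∣n (subst (b ∣_) (sym (+-cancelʳ-≡ (a * i) _ _ (trans (+-assoc (b * Z i) (a * d) (a * i))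
        (trans (cong (_+_ (b * Z i)) (trans (+-comm (a * d) (a * i)) (trans (sym (*-distribˡ-+ a i d)) (cong (a *_) i+d)))) balance)))) (m∣m*n (Z j))) (m∣m*n (Z i))

    -- `Y i` is the height of the `i`-th east step and `Y 0 = 0` is a convention. The difference
    -- `Y (suc x) − Y x` is then the north run at abscissa `x`, the origin included.
    record Dyck (Y : ℕ → ℕ) : Set where
      field
        start : Y 0 ≡ 0
        mono  : ∀ i → i ≤ n → Y i ≤ Y (suc i)
        end   : Y b ≡ a
        above : ∀ i → i ≤ b → a * i ≤ b * Y i
    open Dyck public

    rise : (ℕ → ℕ) → ℕ → ℕ
    rise Y x = Y (suc x) ∸ Y x

    mono-≤ : ∀ {Y} → Dyck Y → ∀ {i j} → i ≤ j → j ≤ b → Y i ≤ Y j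
    mono-≤ {Y} D {i} {j} i≤j j≤b = subst (λ k → Y i ≤ Y k) (m+[n∸m]≡n i≤j) (go (j ∸ i) (subst (_≤ b) (sym (m+[n∸m]≡n i≤j)) j≤b))
      where
      go : ∀ d → i + d ≤ b → Y i ≤ Y (i + d)
      go zero _ = ≤-reflexive (cong Y (sym (+-identityʳ i)))
      go (suc d) le rewrite +-suc i d = ≤-trans (go d (<⇒≤ le)) (mono D (i + d) (≤-pred le))

    module OfDyck {Y : ℕ → ℕ} (D : Dyck Y) where
      S : ℕ → ℤ
      S = T Y

      S0 : S 0 ≡ + 0
      S0 = trans (T-def Y 0) (trans (cong₂ (λ y t → + (b * y) - + t) (start D) (*-zeroʳ a)) (trans (cong (λ t → + t - + 0) (*-zeroʳ b)) refl))

      Sb : S b ≡ + 0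
      Sb = trans (trans (T-def Y b) (cong (λ y → + (b * y) - + (a * b)) (end D))) (trans (cong (λ t → + t - + (a * b)) (*-comm b a)) (ℤₚ.+-inverseʳ (+ (a * b))))

      S-positive : ∀ i → 0 < i → i ≤ n → S 0 ℤ.< S i
      S-positive i 0<i i≤n = ℤₚ.≤∧≢⇒< (subst₂ ℤ._≤_ (sym S0) (sym (T-def Y i)) (ℤₚ.i≤j⇒0≤j-i (ℤ.+≤+ (above D i (m≤n⇒m≤1+n i≤n)))))
        (T-distinct Y 0 i 0<i (s≤s i≤n))

      S-positive-b : ∀ i → 0 < i → i ≤ n → S b ℤ.< S i
      S-positive-b i 0<i i≤n = subst (ℤ._< S i) (trans S0 (sym Sb)) (S-positive i 0<i i≤n)

      psY : ℕ → ℕ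
      psY = ps S

      psY-spec : ∀ j → 0 < j → j ≤ n → PrevSmaller S (psY j) j
      psY-spec j 0<j j≤n with prevSmaller-exists S j 0 (λ t _ t<j → T-distinct Y t j t<j (<-≤-trans (s≤s j≤n) (m≤n+m b t))) 0<j (S-positive j 0<j j≤n)
      ... | p , P , _ = subst (λ t → PrevSmaller S t j) (sym (ps-of P)) P

      psY< : ∀ j → 0 < j → j ≤ n → psY j < j
      psY< j 0<j j≤n = before (psY-spec j 0<j j≤n)

      first-child : ∀ j → 0 < j → j ≤ n → PrevSmaller S (psY j) (suc (psY j))
      first-child j 0<j j≤n = prev ≤-refl low (λ t p<t t<1+p → ⊥-elim (<⇒≱ p<t (≤-pred t<1+p)))
        where
        P = psY-spec j 0<j j≤n
        low : S (psY j) ℤ.< S (suc (psY j))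
        low with m≤n⇒m<n∨m≡n (before P)
        ... | inj₁ lt = ℤₚ.<-trans (smaller P) (between P (suc (psY j)) ≤-refl lt)
        ... | inj₂ e = subst (λ t → S (psY j) ℤ.< S t) (sym e) (smaller P)

      rise-zero : ∀ x → x ≤ n → rise Y x ≡ 0 → S (suc x) ℤ.< S x
      rise-zero x x≤n e = T-flat Y x (≤-antisym (m∸n≡0⇒m≤n e) (mono D x x≤n))

      rise-positive : ∀ x → 0 < rise Y x → S x ℤ.< S (suc x)
      rise-positive x lt = T-rise Y x (≰⇒> λ le → <-irrefl (sym (m≤n⇒m∸n≡0 le)) lt)

      -- A north run at abscissa `n` would make `S b` larger than `S n`, but `S b` is 0 and `S n`
      -- positive.
      last-flat : Y n ≡ a
      last-flat with m≤n⇒m<n∨m≡n (mono D n ≤-refl)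
      ... | inj₂ e = trans e (end D)
      ... | inj₁ lt = ⊥-elim (ℤₚ.<-asym (T-rise Y n lt) (S-positive-b n 0<n ≤-refl))

  -- Rotation of paths

  indicator : Bool → ℕ
  indicator true = 1
  indicator false = 0

  count : (ℕ → Bool) → ℕ → ℕ
  count P zero = 0
  count P (suc K) = count P K + indicator (P K)

  count-cong : ∀ {P Q} K → (∀ x → x < K → P x ≡ Q x) → count P K ≡ count Q K
  count-cong zero e = refl
  count-cong (suc K) e = cong₂ (λ c p → c + indicator p) (count-cong K (λ x lt → e x (m≤n⇒m≤1+n lt))) (e K ≤-refl)

  count-suc : ∀ P K → count P (suc K) ≡ indicator (P 0) + count (λ x → P (suc x)) K
  count-suc P zero = +-comm 0 (indicator (P 0))
  count-suc P (suc K) = trans (cong (_+ indicator (P (suc K))) (count-suc P K)) (+-assoc (indicator (P 0)) _ _)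

  count-remove : ∀ P Q p K → p < K → P p ≡ true → Q p ≡ false → (∀ x → x < K → x ≢ p → P x ≡ Q x) → count P K ≡ suc (count Q K)
  count-remove P Q p (suc K) p<N Pp Qp e with p ℕ.≟ K
  ... | yes refl = trans (cong₂ (λ c i → c + indicator i) (count-cong K (λ x lt → e x (m≤n⇒m≤1+n lt) (<⇒≢ lt))) Pp)
        (trans (+-comm _ 1) (cong suc (sym (trans (cong (λ i → count Q K + indicator i) Qp) (+-identityʳ _)))))
  ... | no p≢N = cong₂ (λ c i → c + indicator i) (count-remove P Q p K (≤∧≢⇒< (≤-pred p<N) p≢N) Pp Qp (λ x lt → e x (m≤n⇒m≤1+n lt)))
        (e K ≤-refl (λ N≡p → p≢N (sym N≡p)))

  suc-% : ∀ r n .{{_ : NonZero n}} → suc (r % n) < n × suc r % n ≡ suc (r % n) ⊎ suc (r % n) ≡ n × suc r % n ≡ 0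
  suc-% r n with m≤n⇒m<n∨m≡n (m%n<n r n)
  ... | inj₁ lt = inj₁ (lt , trans reduce (m<n⇒m%n≡m lt))
    where
    reduce : suc r % n ≡ suc (r % n) % n
    reduce = trans (cong (λ t → suc t % n) (m≡m%n+[m/n]*n r n)) ([m+kn]%n≡m%n (suc (r % n)) (r / n) n)
  ... | inj₂ e = inj₂ (e , trans (trans (cong (λ t → suc t % n) (m≡m%n+[m/n]*n r n)) ([m+kn]%n≡m%n (suc (r % n)) (r / n) n)) (trans (cong (_% n) e) (n%n≡0 n)))

  module SlopeRot (a n : ℕ) (0<a : 0 < a) (a≤n : a ≤ n) (coprime : Coprime a (suc n)) where
    open Slope a n 0<a a≤n coprime public

    -- The subtree of u ends at the first e > u with S e < S u, and then
    -- b (Y e − Y u) < a (e − u) < b (Y e − Y u) + b determines Y u from Y e.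
    module Injective {Y Y′ : ℕ → ℕ} (D : Dyck Y) (D′ : Dyck Y′) where
      open OfDyck D
      module D′ = OfDyck D′

      module _ (ps≡ : ∀ j → 0 < j → j ≤ n → psY j ≡ D′.psY j) where
        private
          SubtreeEnd : ℕ → ℕ → Set
          SubtreeEnd u e = u < e × e ≤ b × (∀ t → u < t → t < e → S u ℤ.< S t) × S e ℤ.< S u

          subtreeEnd : ∀ u → 0 < u → u ≤ n → ∃ (SubtreeEnd u)
          subtreeEnd u 0<u u≤n = search (b ∸ u) (suc u) ≤-refl (s≤s u≤n) (≤-trans (≤-reflexive (sym (m∸n+n≡m (m≤n⇒m≤1+n u≤n)))) (+-monoʳ-≤ (b ∸ u) (n≤1+n u)))
            (λ t u<t t<1+u → ⊥-elim (<⇒≱ u<t (≤-pred t<1+u)))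
            where
            search : ∀ fuel e → u < e → e ≤ b → b ≤ fuel + e → (∀ t → u < t → t < e → S u ℤ.< S t) → ∃ (SubtreeEnd u)
            search zero e u<e e≤b b≤ inside with ≤-antisym e≤b b≤
            ... | refl = b , u<e , e≤b , inside , S-positive-b u 0<u u≤n
            search (suc fuel) e u<e e≤b b≤ inside with S e ℤ.<? S u
            ... | yes lt = e , u<e , e≤b , inside , lt
            ... | no nlt with m≤n⇒m<n∨m≡n e≤b
            ...   | inj₂ refl = ⊥-elim (nlt (S-positive-b u 0<u u≤n))
            ...   | inj₁ e<b = search fuel (suc e) (m≤n⇒m≤1+n u<e) e<b (subst (b ≤_) (sym (+-suc fuel e)) b≤) inside′
              where
              inside′ : ∀ t → u < t → t < suc e → S u ℤ.< S t
              inside′ t u<t (s≤s t≤e) with m≤n⇒m<n∨m≡n t≤e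
              ... | inj₁ t<e = inside t u<t t<e
              ... | inj₂ refl = ℤₚ.≤∧≢⇒< (ℤₚ.≮⇒≥ nlt) (T-distinct Y u t u<t (<-≤-trans e<b (m≤n+m b u)))

          -- The subtree of `u` can be read off the parents alone. Inside it, the chain of parents
          -- of `t` descends to `u` without passing below it; the end `e` is recognised by a parent
          -- that lies before `u`.
          transfer : ∀ u e → 0 < u → SubtreeEnd u e → (∀ t → u < t → t < e → D′.S u ℤ.< D′.S t) × D′.S e ℤ.< D′.S u
          transfer u e 0<u (u<e , e≤b , inside , low) = (λ t u<t t<e → inside′ t t u<t t<e ≤-refl) , low′
            where
            inside′ : ∀ fuel t → u < t → t < e → t ≤ fuel → D′.S u ℤ.< D′.S t
            inside′ zero t u<t _ t≤0 = ⊥-elim (<⇒≱ (≤-<-trans z≤n u<t) t≤0)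
            inside′ (suc fuel) t u<t t<e t≤ = ℤₚ.≤-<-trans below (smaller Q)
              where
              0<t = <-trans 0<u u<t
              t≤n : t ≤ n
              t≤n = ≤-pred (<-≤-trans t<e e≤b)
              P = psY-spec t 0<t t≤n
              Q : PrevSmaller D′.S (psY t) t
              Q = subst (λ p → PrevSmaller D′.S p t) (sym (ps≡ t 0<t t≤n)) (D′.psY-spec t 0<t t≤n)
              u≤p : u ≤ psY t
              u≤p = ≮⇒≥ λ p<u → ℤₚ.<-asym (inside t u<t t<e) (between P u p<u u<t)
              below : D′.S u ℤ.≤ D′.S (psY t)
              below with m≤n⇒m<n∨m≡n u≤p
              ... | inj₂ e = ℤₚ.≤-reflexive (cong D′.S e)
              ... | inj₁ u<p = ℤₚ.<⇒≤ (inside′ fuel (psY t) u<p (<-trans (before P) t<e) (≤-pred (<-≤-trans (before P) t≤)))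
            low′ : D′.S e ℤ.< D′.S u
            low′ with m≤n⇒m<n∨m≡n e≤b
            ... | inj₂ refl = D′.S-positive-b u 0<u (≤-pred u<e)
            ... | inj₁ e<b = between Q u p<u u<e
              where
              0<e = <-trans 0<u u<e
              e≤n = ≤-pred e<b
              P = psY-spec e 0<e e≤n
              Q : PrevSmaller D′.S (psY e) e
              Q = subst (λ p → PrevSmaller D′.S p e) (sym (ps≡ e 0<e e≤n)) (D′.psY-spec e 0<e e≤n)
              p<u : psY e < u
              p<u = ≰⇒> λ u≤p → ℤₚ.<-asym (ℤₚ.<-trans (smaller P) low) (lower (m≤n⇒m<n∨m≡n u≤p))
                where
                lower : u < psY e ⊎ u ≡ psY e → S u ℤ.< S (psY e)
                lower (inj₁ u<p) = inside (psY e) u<p (before P)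
                lower (inj₂ refl) = ⊥-elim (ℤₚ.<-asym (smaller P) low)

        -- The upper bound says that the walk has dropped below its value at `u`. For the lower one,
        -- one position earlier the walk is still at least its value at `u`, and a single step
        -- lowers it by at most `a < b`.
        bounds : ∀ {Z} (DZ : Dyck Z) u e → u < e → e ≤ b → (∀ t → u < t → t < e → T Z u ℤ.< T Z t) → T Z e ℤ.< T Z u →
          b * (Z e ∸ Z u) < a * (e ∸ u) × a * (e ∸ u) < b * (Z e ∸ Z u) + b
        bounds {Z} DZ u (suc e) (s≤s u≤e) e≤b inside low = upper , lower
          where
          diff : ∀ e → u ≤ e → e ≤ b → T Z e ≡ T Z u ℤ.+ (+ (b * (Z e ∸ Z u)) - + (a * (e ∸ u)))
          diff e u≤e e≤b = trans (cong (T Z) (sym (m+[n∸m]≡n u≤e))) (T-difference Z u (e ∸ u) (Z e ∸ Z u)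
            (trans (cong Z (m+[n∸m]≡n u≤e)) (sym (m+[n∸m]≡n (mono-≤ DZ u≤e e≤b)))))
          upper : b * (Z (suc e) ∸ Z u) < a * (suc e ∸ u)
          upper = >-unshift (T Z u) _ _ (subst (ℤ._< T Z u) (diff (suc e) (m≤n⇒m≤1+n u≤e) e≤b) low)
          a*suc : a * (suc e ∸ u) ≡ a * (e ∸ u) + a
          a*suc = trans (cong (a *_) (+-∸-assoc 1 u≤e)) (trans (*-suc a (e ∸ u)) (+-comm a _))
          lower : a * (suc e ∸ u) < b * (Z (suc e) ∸ Z u) + b
          lower = subst (_< b * (Z (suc e) ∸ Z u) + b) (sym a*suc) (+-mono-≤-< step (s≤s a≤n))
            where
            step : a * (e ∸ u) ≤ b * (Z (suc e) ∸ Z u)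
            step with m≤n⇒m<n∨m≡n u≤e
            ... | inj₂ refl = subst (_≤ b * (Z (suc e) ∸ Z u)) (sym (trans (cong (a *_) (n∸n≡0 u)) (*-zeroʳ a))) z≤n
            ... | inj₁ u<e = ≤-trans (<⇒≤ (<-unshift (T Z u) _ _ (subst (T Z u ℤ.<_) (diff e u≤e (<⇒≤ e≤b)) (inside e u<e ≤-refl))))
                  (*-monoʳ-≤ b (∸-monoˡ-≤ (Z u) (mono DZ e (≤-pred e≤b))))

        Y≡ : ∀ u → u ≤ b → Y u ≡ Y′ u
        Y≡ u u≤b = go (b ∸ u) u u≤b (≤-reflexive (sym (m∸n+n≡m u≤b)))
          where
          go : ∀ fuel u → u ≤ b → b ≤ fuel + u → Y u ≡ Y′ u
          go fuel zero _ _ = trans (start D) (sym (start D′))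
          go zero (suc u) u≤b b≤ rewrite ≤-antisym u≤b b≤ = trans (end D) (sym (end D′))
          go (suc fuel) u@(suc _) u≤b b≤ with m≤n⇒m<n∨m≡n u≤b
          ... | inj₂ refl = trans (end D) (sym (end D′))
          ... | inj₁ u<b with subtreeEnd u (s≤s z≤n) (≤-pred u<b)
          ...   | e , end@(u<e , e≤b , inside , low) with transfer u e (s≤s z≤n) end
          ...     | inside′ , low′ = +-cancelˡ-≡ (Y e ∸ Y u) _ _
                    (trans (m∸n+n≡m (mono-≤ D (<⇒≤ u<e) e≤b)) (trans Ye (sym (trans (cong (_+ Y′ u) Δ≡) (m∸n+n≡m (mono-≤ D′ (<⇒≤ u<e) e≤b))))))
            where
            Ye : Y e ≡ Y′ e
            Ye = go fuel e e≤b (≤-trans b≤ (≤-trans (≤-reflexive (sym (+-suc fuel u))) (+-monoʳ-≤ fuel u<e)))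
            B = bounds D u e u<e e≤b inside low
            B′ = bounds D′ u e u<e e≤b inside′ low′
            squeeze : ∀ x y L → b * x < L → L < b * y + b → x ≤ y
            squeeze x y L p q = ≤-pred (*-cancelˡ-< b x (suc y) (<-trans p (subst (L <_) (trans (+-comm (b * y) b) (sym (*-suc b y))) q)))
            -- Both differences are the integer part of `a (e − u) / b`.
            Δ≡ : Y e ∸ Y u ≡ Y′ e ∸ Y′ u
            Δ≡ = ≤-antisym (squeeze _ _ _ (proj₁ B) (proj₂ B′)) (squeeze _ _ _ (proj₁ B′) (proj₂ B))

      -- The least element of the block of j is the successor of its parent.
      ps-from-kin : (∀ i j → 0 < i → i ≤ n → 0 < j → j ≤ n → psY i ≡ psY j → D′.psY i ≡ D′.psY j) →
        ∀ j → 0 < j → j ≤ n → D′.psY j ≤ psY j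
      ps-from-kin kin j 0<j j≤n = ≤-pred (subst (_< suc (psY j))
        (kin (suc (psY j)) j (s≤s z≤n) sp≤n 0<j j≤n (ps-of (first-child j 0<j j≤n)))
        (D′.psY< (suc (psY j)) (s≤s z≤n) sp≤n))
        where
        sp≤n : suc (psY j) ≤ n
        sp≤n = ≤-trans (psY< j 0<j j≤n) j≤n

    kin-determines : ∀ {Y Y′} → Dyck Y → Dyck Y′ →
      (∀ i j → 0 < i → i ≤ n → 0 < j → j ≤ n → ps (T Y) i ≡ ps (T Y) j → ps (T Y′) i ≡ ps (T Y′) j) →
      (∀ i j → 0 < i → i ≤ n → 0 < j → j ≤ n → ps (T Y′) i ≡ ps (T Y′) j → ps (T Y) i ≡ ps (T Y) j) →
      ∀ u → u ≤ b → Y u ≡ Y′ u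
    kin-determines D D′ to from = Injective.Y≡ D D′ (λ j 0<j j≤n → ≤-antisym
      (Injective.ps-from-kin D′ D from j 0<j j≤n) (Injective.ps-from-kin D D′ to j 0<j j≤n))

    -- Labels are indexed by all natural numbers modulo `n`, so that rotation becomes addition.
    label : ℕ → ℕ
    label r = suc (r % n)

    0<label : ∀ r → 0 < label r
    0<label r = s≤s z≤n

    label≤n : ∀ r → label r ≤ n
    label≤n r = m%n<n r n

    parent : (ℕ → ℕ) → ℕ → ℕ
    parent Y r = ps (T Y) (label r)

    rank : (ℕ → ℕ) → ℕ → ℕ
    rank Y r = rise Y (parent Y r)

    nonflat : (ℕ → ℕ) → ℕ
    nonflat Y = count (λ x → 0 <ᵇ rise Y x) n

    record Rotated (c : ℕ) (Y Y′ : ℕ → ℕ) : Set where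
      field
        kin-to   : ∀ r s → parent Y r ≡ parent Y s → parent Y′ (r + c) ≡ parent Y′ (s + c)
        kin-from : ∀ r s → parent Y′ (r + c) ≡ parent Y′ (s + c) → parent Y r ≡ parent Y s
        rank≡    : ∀ r → rank Y′ (r + c) ≡ rank Y r
        nonflat≡ : nonflat Y′ ≡ nonflat Y
    open Rotated public

    -- Rotating the last label to the first position moves the north steps of its parent p to the origin.
    module Rotation {Y : ℕ → ℕ} (D : Dyck Y) where
      open OfDyck D
      private
        p = psY n
        P : PrevSmaller S p n
        P = psY-spec n 0<n ≤-refl
        p<n = before P
        hp = rise Y p

      rotated : ℕ → ℕ
      rotated zero = 0
      rotated (suc i) with i ℕ.≤? p
      ... | yes _ = Y i + hp
      ... | no _ = Y i

      private
        R≤ : ∀ i → i ≤ p → rotated (suc i) ≡ Y i + hp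
        R≤ i le with i ℕ.≤? p
        ... | yes _ = refl
        ... | no nle = ⊥-elim (nle le)

        R> : ∀ i → p < i → rotated (suc i) ≡ Y i
        R> i lt with i ℕ.≤? p
        ... | yes le = ⊥-elim (<⇒≱ lt le)
        ... | no _ = refl

        Ysp : Y p + hp ≡ Y (suc p)
        Ysp = m+[n∸m]≡n (mono D p (<⇒≤ p<n))

        0<hp : 0 < hp
        0<hp = n≢0⇒n>0 λ e → ℤₚ.<-asym (rise-zero p (<⇒≤ p<n) e) (smaller (first-child n 0<n ≤-refl))

        Sn : S n ≡ + a
        Sn = trans (trans (T-def Y n) (cong (λ y → + (b * y) - + (a * n)) last-flat)) (trans (cong (λ t → + t - + (a * n)) (trans (cong (_+_ a) (*-comm n a)) refl)) (lemma (+ a) (+ (a * n))))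
          where
          lemma : ∀ u v → (u ℤ.+ v) - v ≡ u
          lemma = solve-∀

        -- Moving the path one column to the right lowers the walk by `a`. Behind `p` no run
        -- compensates for this, but there the walk is at least `S n = a`, because `p` is the parent
        -- of `n`.
        S≥a : ∀ i → p < i → i ≤ n → + a ℤ.≤ S i
        S≥a i p<i i≤n with m≤n⇒m<n∨m≡n i≤n
        ... | inj₂ refl = ℤₚ.≤-reflexive (sym Sn)
        ... | inj₁ i<n = ℤₚ.<⇒≤ (subst (ℤ._< S i) Sn (between P i p<i i<n))

        above-high : ∀ i → p < i → i ≤ n → a * suc i ≤ b * Y i
        above-high i p<i i≤n = ℤₚ.drop‿+≤+ (subst₂ ℤ._≤_ (trans (sym (ℤₚ.pos-+ a (a * i))) (cong +_ (sym (*-suc a i)))) (trans (cong (ℤ._+ + (a * i)) (T-def Y i)) (lemma (+ (b * Y i)) (+ (a * i))))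
            (ℤₚ.+-monoˡ-≤ (+ (a * i)) (S≥a i p<i i≤n)))
          where
          lemma : ∀ u v → (u - v) ℤ.+ v ≡ u
          lemma = solve-∀

      rotated-Dyck : Dyck rotated
      rotated-Dyck = record { start = refl ; mono = mono′ ; end = trans (R> n p<n) last-flat ; above = above′ }
        where
        mono′ : ∀ i → i ≤ n → rotated i ≤ rotated (suc i)
        mono′ zero _ = z≤n
        mono′ (suc i) i<n with <-cmp i p
        ... | tri< i<p _ _ rewrite R≤ i (<⇒≤ i<p) | R≤ (suc i) i<p = +-monoˡ-≤ hp (mono D i (<⇒≤ i<n))
        ... | tri≈ _ refl _ rewrite R≤ i ≤-refl | R> (suc i) ≤-refl = ≤-reflexive Ysp
        ... | tri> _ _ p<i rewrite R> i p<i | R> (suc i) (m≤n⇒m≤1+n p<i) = mono D i (<⇒≤ i<n)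
        above′ : ∀ i → i ≤ b → a * i ≤ b * rotated i
        above′ zero _ = ≤-trans (≤-reflexive (*-zeroʳ a)) z≤n
        above′ (suc i) (s≤s i≤n) with i ℕ.≤? p
        ... | no nle = above-high i (≰⇒> nle) i≤n
        ... | yes le = begin-≤
          where
          begin-≤ : a * suc i ≤ b * (Y i + hp)
          begin-≤ = ≤-trans (≤-reflexive (trans (*-suc a i) (+-comm a (a * i))))
            (≤-trans (+-mono-≤ (above D i (m≤n⇒m≤1+n i≤n)) (≤-trans (m≤n⇒m≤1+n a≤n) (m≤m*n b hp {{ℕ.>-nonZero 0<hp}})))
              (≤-reflexive (sym (*-distribˡ-+ b (Y i) hp))))

      module R = OfDyck rotated-Dyck

      private
        c : ℤ
        c = + (b * hp) - + a

        S′≤ : ∀ i → i ≤ p → R.S (suc i) ≡ S i ℤ.+ c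
        S′≤ i le = trans (T-def rotated (suc i)) (trans (cong₂ (λ y t → + y - + t) (trans (cong (b *_) (R≤ i le)) (*-distribˡ-+ b (Y i) hp)) (*-suc a i))
          (trans (lemma (+ (b * Y i)) (+ (b * hp)) (+ a) (+ (a * i))) (cong (ℤ._+ c) (sym (T-def Y i)))))
          where
          lemma : ∀ y h a i → (y ℤ.+ h) - (a ℤ.+ i) ≡ (y - i) ℤ.+ (h - a)
          lemma = solve-∀

        S′> : ∀ i → p < i → R.S (suc i) ≡ S i - + a
        S′> i lt = trans (T-def rotated (suc i)) (trans (cong₂ (λ y t → + (b * y) - + t) (R> i lt) (*-suc a i)) (trans (lemma (+ (b * Y i)) (+ a) (+ (a * i))) (cong (_- + a) (sym (T-def Y i)))))
          where
          lemma : ∀ y a i → y - (a ℤ.+ i) ≡ (y - i) - a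
          lemma = solve-∀

        shift≤ : ∀ i j → i ≤ p → j ≤ p → S i ℤ.< S j → R.S (suc i) ℤ.< R.S (suc j)
        shift≤ i j i≤ j≤ lt = subst₂ ℤ._<_ (sym (S′≤ i i≤)) (sym (S′≤ j j≤)) (ℤₚ.+-monoˡ-< c lt)

        shift> : ∀ i j → p < i → p < j → S i ℤ.< S j → R.S (suc i) ℤ.< R.S (suc j)
        shift> i j i> j> lt = subst₂ ℤ._<_ (sym (S′> i i>)) (sym (S′> j j>)) (ℤₚ.+-monoˡ-< (ℤ.- + a) lt)

        -- The map induced on parents by the rotation: `p` goes to the origin, every other parent
        -- one column to the right. Its injectivity makes kinship carry over in both directions.
        τ : ℕ → ℕ
        τ q with q ℕ.≟ p
        ... | yes _ = 0
        ... | no _ = suc q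

        τp : τ p ≡ 0
        τp with p ℕ.≟ p
        ... | yes _ = refl
        ... | no n = ⊥-elim (n refl)

        τ-other : ∀ q → q ≢ p → τ q ≡ suc q
        τ-other q n with q ℕ.≟ p
        ... | yes e = ⊥-elim (n e)
        ... | no _ = refl

        τ-injective : ∀ q q′ → τ q ≡ τ q′ → q ≡ q′
        τ-injective q q′ e with q ℕ.≟ p | q′ ℕ.≟ p
        ... | yes refl | yes refl = refl
        ... | no _ | no _ = suc-injective e
        τ-injective q q′ () | yes _ | no _
        τ-injective q q′ () | no _ | yes _

        ps-1 : R.psY 1 ≡ 0
        ps-1 = ps-of {R.S} {0} {1} (prev (s≤s z≤n) (R.S-positive 1 (s≤s z≤n) 0<n) (λ { (suc t) _ (s≤s ()) }))

        ps-suc : ∀ i → 0 < i → i < n → R.psY (suc i) ≡ τ (psY i)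
        ps-suc i 0<i i<n with <-cmp (psY i) p
        ... | tri> _ q≢p p<q = trans (ps-of (prev (s≤s (before Q)) (shift> _ i p<q (<-trans p<q (before Q)) (smaller Q)) btw)) (sym (τ-other _ q≢p))
          where
          Q = psY-spec i 0<i (<⇒≤ i<n)
          btw : ∀ t → suc (psY i) < t → t < suc i → R.S (suc i) ℤ.< R.S t
          btw (suc t) (s≤s q<t) (s≤s t<i) = shift> i t (<-trans p<q (before Q)) (<-trans p<q q<t) (between Q t q<t t<i)
        -- A child of `p` becomes a child of the origin, so every earlier positive position must be
        -- higher. Those behind the image of `p` are higher as before. The others were raised by
        -- `b hp − a`, and this suffices since `S i ≤ S (suc p) < b hp`, where `S p < a` is used.
        ... | tri≈ _ q≡p _ = trans (ps-of (prev (s≤s z≤n) (R.S-positive (suc i) (s≤s z≤n) i<n) btw)) (sym (trans (cong τ q≡p) τp))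
          where
          Q : PrevSmaller S p i
          Q = subst (λ q → PrevSmaller S q i) q≡p (psY-spec i 0<i (<⇒≤ i<n))
          Ssp : S (suc p) ≡ S p ℤ.+ c
          Ssp = trans (cong S (+-comm 1 p)) (trans (T-difference Y p 1 hp (trans (cong Y (+-comm p 1)) (sym Ysp))) (cong (λ t → S p ℤ.+ (+ (b * hp) - + t)) (*-identityʳ a)))
          Si≤ : S i ℤ.≤ S (suc p)
          Si≤ with m≤n⇒m<n∨m≡n (before Q)
          ... | inj₂ refl = ℤₚ.≤-refl
          ... | inj₁ lt = ℤₚ.<⇒≤ (between Q (suc p) ≤-refl lt)
          Si< : S i ℤ.< + (b * hp)
          Si< = ℤₚ.≤-<-trans Si≤ (subst₂ ℤ._<_ (sym Ssp) (lemma (+ (b * hp)) (+ a)) (ℤₚ.+-monoˡ-< c (subst (S p ℤ.<_) Sn (smaller P))))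
            where
            lemma : ∀ h a → a ℤ.+ (h - a) ≡ h
            lemma = solve-∀
          0≤S : ∀ t → t ≤ n → + 0 ℤ.≤ S t
          0≤S zero _ = ℤₚ.≤-reflexive (sym S0)
          0≤S (suc t) le = ℤₚ.<⇒≤ (subst (ℤ._< S (suc t)) S0 (S-positive (suc t) (s≤s z≤n) le))
          btw : ∀ t → 0 < t → t < suc i → R.S (suc i) ℤ.< R.S t
          btw (suc t) _ (s≤s t<i) with ≤-<-connex t p
          ... | inj₂ p<t = shift> i t (before Q) p<t (between Q t p<t t<i)
          ... | inj₁ le = subst₂ ℤ._<_ (sym (S′> i (before Q))) (sym (trans (S′≤ t le) (lemma (S t) (+ (b * hp)) (+ a))))
                 (ℤₚ.+-monoˡ-< (ℤ.- + a) (ℤₚ.<-≤-trans Si< (subst (ℤ._≤ S t ℤ.+ + (b * hp)) (ℤₚ.+-identityˡ _) (ℤₚ.+-monoˡ-≤ (+ (b * hp)) (0≤S t (≤-trans (<⇒≤ t<i) (<⇒≤ i<n)))))))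
            where
            lemma : ∀ s h a → s ℤ.+ (h - a) ≡ (s ℤ.+ h) - a
            lemma = solve-∀
        ... | tri< q<p q≢p _ with ≤-<-connex i p
        ...   | inj₁ i≤p = trans (ps-of (prev (s≤s (before Q)) (shift≤ _ i (<⇒≤ q<p) i≤p (smaller Q)) btw)) (sym (τ-other _ q≢p))
          where
          Q = psY-spec i 0<i (<⇒≤ i<n)
          btw : ∀ t → suc (psY i) < t → t < suc i → R.S (suc i) ℤ.< R.S t
          btw (suc t) (s≤s q<t) (s≤s t<i) = shift≤ i t i≤p (≤-trans (<⇒≤ t<i) i≤p) (between Q t q<t t<i)
        -- A label behind `p` whose parent precedes `p` would have `S i < S p < S n`, whereas
        -- positions between `p` and `n` lie above `S n`.
        ...   | inj₂ p<i = ⊥-elim (ℤₚ.<-asym (ℤₚ.<-trans (between Q p q<p p<i) (smaller P)) (between P i p<i i<n))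
          where
          Q = psY-spec i 0<i (<⇒≤ i<n)

        parent-suc : ∀ r → parent rotated (suc r) ≡ τ (parent Y r)
        parent-suc r with suc-% r n
        ... | inj₁ (lt , e) = trans (cong (λ t → ps R.S (suc t)) e) (ps-suc (suc (r % n)) (s≤s z≤n) lt)
        ... | inj₂ (l≡n , e) = trans (cong (λ t → ps R.S (suc t)) e) (trans ps-1 (sym (trans (cong (λ t → τ (ps S t)) l≡n) τp)))

        rise-0 : rise rotated 0 ≡ hp
        rise-0 = trans (R≤ 0 z≤n) (cong (_+ hp) (start D))

        rise-suc : ∀ x → x ≢ p → rise rotated (suc x) ≡ rise Y x
        rise-suc x x≢p with <-cmp x p
        ... | tri< x<p _ _ = trans (cong₂ _∸_ (R≤ (suc x) x<p) (R≤ x (<⇒≤ x<p))) (trans (cong₂ _∸_ (+-comm (Y (suc x)) hp) (+-comm (Y x) hp)) ([m+n]∸[m+o]≡n∸o hp (Y (suc x)) (Y x)))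
        ... | tri≈ _ e _ = ⊥-elim (x≢p e)
        ... | tri> _ _ p<x = cong₂ _∸_ (R> (suc x) (m≤n⇒m≤1+n p<x)) (R> x p<x)

        rise-sp : rise rotated (suc p) ≡ 0
        rise-sp = trans (cong₂ _∸_ (R> (suc p) ≤-refl) (R≤ p ≤-refl)) (trans (cong (Y (suc p) ∸_) Ysp) (n∸n≡0 (Y (suc p))))

        rise-τ : ∀ q → rise rotated (τ q) ≡ rise Y q
        rise-τ q with q ℕ.≟ p
        ... | yes refl = rise-0
        ... | no q≢p = rise-suc q q≢p

        positive : ∀ {m} → 0 < m → (0 <ᵇ m) ≡ true
        positive (s≤s _) = refl

        count-rotated : ∀ K → n ≡ suc K → nonflat rotated ≡ nonflat Y
        count-rotated K n≡ = trans (cong (count _) n≡) (trans (count-suc _ K) (trans (cong₂ _+_ (trans (cong indicator (trans (cong (0 <ᵇ_) rise-0) (positive 0<hp))) refl) refl)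
            (trans (compare (m≤n⇒m<n∨m≡n (≤-pred (subst (p <_) n≡ p<n)))) (cong (count _) (sym n≡)))))
          where
          compare : p < K ⊎ p ≡ K → suc (count (λ x → 0 <ᵇ rise rotated (suc x)) K) ≡ count (λ x → 0 <ᵇ rise Y x) (suc K)
          compare (inj₂ refl) = trans (cong suc (count-cong K (λ x lt → cong (0 <ᵇ_) (rise-suc x (<⇒≢ lt)))))
            (trans (+-comm 1 _) (cong (λ t → count (λ x → 0 <ᵇ rise Y x) K + indicator t) (sym (positive 0<hp))))
          compare (inj₁ p<N) = trans (sym (count-remove (λ x → 0 <ᵇ rise Y x) _ p K p<N (positive 0<hp) (cong (0 <ᵇ_) rise-sp) (λ x _ x≢p → cong (0 <ᵇ_) (sym (rise-suc x x≢p)))))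
            (trans (sym (+-identityʳ _)) (cong (λ t → count (λ x → 0 <ᵇ rise Y x) K + indicator (0 <ᵇ t)) (sym flat)))
            where
            N<n : K < n
            N<n = ≤-reflexive (sym n≡)
            -- The run at abscissa `K = n − 1` would be shifted out of the counted range. It is
            -- empty unless it is the run that moves: a rise there would contradict `S n < S K`,
            -- which holds when `p < K`.
            flat : rise Y K ≡ 0
            flat with rise Y K in eq
            ... | zero = refl
            ... | suc _ = ⊥-elim (ℤₚ.<-asym (between P K p<N N<n) (subst (λ t → S K ℤ.< S t) (sym n≡) (rise-positive K (subst (0 <_) (sym eq) (s≤s z≤n)))))

      is-rotated : Rotated 1 Y rotated
      is-rotated = record
        { kin-to = λ r s e → trans (suc-parent r) (trans (cong τ e) (sym (suc-parent s)))
        ; kin-from = λ r s e → τ-injective _ _ (trans (sym (suc-parent r)) (trans e (suc-parent s)))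
        ; rank≡ = λ r → trans (cong (rise rotated) (suc-parent r)) (rise-τ (parent Y r))
        ; nonflat≡ = count-rotated (ℕ.pred n) (sym (suc-pred n)) }
        where
        suc-parent : ∀ r → parent rotated (r + 1) ≡ τ (parent Y r)
        suc-parent r = trans (cong (parent rotated) (+-comm r 1)) (parent-suc r)

    rotate : ∀ c {Y} → Dyck Y → ∃ λ Y′ → Dyck Y′ × Rotated c Y Y′
    rotate zero {Y} D = Y , D , record
      { kin-to = λ r s e → trans (zeroʳ r) (trans e (sym (zeroʳ s)))
      ; kin-from = λ r s e → trans (sym (zeroʳ r)) (trans e (zeroʳ s))
      ; rank≡ = λ r → cong (rank Y) (+-identityʳ r)
      ; nonflat≡ = refl }
      where
      zeroʳ : ∀ r → parent Y (r + 0) ≡ parent Y r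
      zeroʳ r = cong (parent Y) (+-identityʳ r)
    rotate (suc c) {Y} D with rotate c D
    ... | Y₁ , D₁ , R₁ = Rotation.rotated D₁ , Rotation.rotated-Dyck D₁ , record
      { kin-to = λ r s e → subst₂ _≡_ (at r) (at s) (kin-to R₂ (r + c) (s + c) (kin-to R₁ r s e))
      ; kin-from = λ r s e → kin-from R₁ r s (kin-from R₂ (r + c) (s + c) (subst₂ _≡_ (sym (at r)) (sym (at s)) e))
      ; rank≡ = λ r → trans (cong (rank Y₂) (shift r)) (trans (rank≡ R₂ (r + c)) (rank≡ R₁ r))
      ; nonflat≡ = trans (nonflat≡ R₂) (nonflat≡ R₁) }
      where
      Y₂ = Rotation.rotated D₁
      R₂ = Rotation.is-rotated D₁
      shift : ∀ r → r + suc c ≡ r + c + 1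
      shift r = trans (+-suc r c) (+-comm 1 (r + c))
      at : ∀ r → parent Y₂ (r + c + 1) ≡ parent Y₂ (r + suc c)
      at r = cong (parent Y₂) (sym (shift r))

  -- Lasers and partitions

  bool-ext : ∀ {x y : Bool} → (x ≡ true → y ≡ true) → (y ≡ true → x ≡ true) → x ≡ y
  bool-ext {true} {y} f g = sym (f refl)
  bool-ext {false} {true} f g = g refl
  bool-ext {false} {false} f g = refl

  does-cong : ∀ {a b} {A : Set a} {B : Set b} (p : Dec A) (q : Dec B) → (A → B) → (B → A) → does p ≡ does q
  does-cong (yes x) q f g = sym (dec-true q (f x))
  does-cong (no x) q f g = sym (dec-false q (λ y → x (g y)))

  does-true : ∀ {a} {A : Set a} (p : Dec A) → does p ≡ true → A
  does-true (yes x) _ = x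

  ⇒true : ∀ {x} → IsTrue x → x ≡ true
  ⇒true = Equivalence.to Boolₚ.T-≡

  true⇒ : ∀ {x} → x ≡ true → IsTrue x
  true⇒ = Equivalence.from Boolₚ.T-≡

  ∧-true : ∀ {x y} → x ∧ y ≡ true → x ≡ true × y ≡ true
  ∧-true {true} e = refl , e

  <ᵇ-true : ∀ m n → m < n → (m <ᵇ n) ≡ true
  <ᵇ-true m n = ⇒true ∘ <⇒<ᵇ

  true-<ᵇ : ∀ m n → (m <ᵇ n) ≡ true → m < n
  true-<ᵇ m n = <ᵇ⇒< m n ∘ true⇒

  nthD-map : ∀ {A B : Set} (d : B) (f : A → B) (g : ℕ → A) n i → i < n → nthD d (map f (applyUpTo g n)) i ≡ f (g i)
  nthD-map d f g (suc n) zero _ = refl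
  nthD-map d f g (suc n) (suc i) (s≤s lt) = nthD-map d f (g ∘ suc) n i lt

  length-filterᵇ-upTo : ∀ P Q n → (∀ r → r < n → P r ≡ Q r) → length (filterᵇ P (upTo n)) ≡ count Q n
  length-filterᵇ-upTo P Q zero e = refl
  length-filterᵇ-upTo P Q (suc n) e = trans (cong (length ∘ filterᵇ P) (sym (Listₚ.upTo-∷ʳ n)))
    (trans (cong length (Listₚ.filter-++ _ (upTo n) [ n ])) (trans (Listₚ.length-++ (filterᵇ P (upTo n)))
      (cong₂ _+_ (length-filterᵇ-upTo P Q n (λ r lt → e r (m≤n⇒m≤1+n lt))) single)))
    where
    single : length (filterᵇ P [ n ]) ≡ indicator (Q n)
    single rewrite sym (e n ≤-refl) with P n
    ... | true = refl
    ... | false = refl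

  matrix : ℕ → (ℕ → ℕ → Bool) → SetPartition
  matrix n f = map (λ r → map (f r) (upTo n)) (upTo n)

  map-upTo-cong : ∀ {A : Set} (f g : ℕ → A) n → (∀ i → i < n → f i ≡ g i) → map f (upTo n) ≡ map g (upTo n)
  map-upTo-cong f g n e = Allₚ′ (upTo n) (All.tabulate (λ i∈ → e _ (∈-upTo⁻ i∈)))
    where
    Allₚ′ : ∀ xs → All (λ i → f i ≡ g i) xs → map f xs ≡ map g xs
    Allₚ′ [] [] = refl
    Allₚ′ (x ∷ xs) (p ∷ ps) = cong₂ _∷_ p (Allₚ′ xs ps)

  matrix-cong : ∀ n f g → (∀ r s → r < n → s < n → f r s ≡ g r s) → matrix n f ≡ matrix n g
  matrix-cong n f g e = map-upTo-cong _ _ n (λ r r<n → map-upTo-cong _ _ n (λ s s<n → e r s r<n s<n))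

  rel-matrix : ∀ n f r s → r < n → s < n → rel (matrix n f) r s ≡ f r s
  rel-matrix n f r s r<n s<n = trans (cong (λ row → nthD false row s) (nthD-map [] (λ r → map (f r) (upTo n)) (λ i → i) n r r<n))
    (nthD-map false (f r) (λ i → i) n s s<n)

  rot-matrix : ∀ n f → rot n (matrix n f) ≡ matrix n (λ r s → f (rotInv n r) (rotInv n s))
  rot-matrix n f = matrix-cong n _ _ (λ r s r<n s<n → rel-matrix n f _ _ (rotInv< n r r<n) (rotInv< n s s<n))
    where
    rotInv< : ∀ n r → r < n → rotInv n r < n
    rotInv< (suc n) zero _ = ≤-refl
    rotInv< (suc n) (suc r) lt = <-trans (n<1+n r) lt

  height : ℕ → List Step → ℕ → ℕ
  height y w i = nthD 0 (eastHeights y w) i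

  height-≥ : ∀ y w i → i < countE w → y ≤ height y w i
  height-≥ y (N ∷ w) i lt = ≤-trans (n≤1+n y) (height-≥ (suc y) w i lt)
  height-≥ y (E ∷ w) zero _ = ≤-refl
  height-≥ y (E ∷ w) (suc i) (s≤s lt) = height-≥ y w i lt

  height-mono : ∀ y w i → suc i < countE w → height y w i ≤ height y w (suc i)
  height-mono y (N ∷ w) i lt = height-mono (suc y) w i lt
  height-mono y (E ∷ w) zero (s≤s lt) = height-≥ y w 0 lt
  height-mono y (E ∷ w) (suc i) (s≤s lt) = height-mono y w i lt

  height-≤ : ∀ y w i → i < countE w → height y w i ≤ y + countN w
  height-≤ y (N ∷ w) i lt = ≤-trans (height-≤ (suc y) w i lt) (≤-reflexive (sym (+-suc y (countN w))))
  height-≤ y (E ∷ w) zero _ = m≤m+n y _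
  height-≤ y (E ∷ w) (suc i) (s≤s lt) = height-≤ y w i lt

  above-head : ∀ a b x y w → staysAbove a b x y w ≡ true → a * x ≤ b * y
  above-head a b x y [] e = ≤ᵇ⇒≤ _ _ (true⇒ e)
  above-head a b x y (N ∷ w) e = ≤ᵇ⇒≤ _ _ (true⇒ (proj₁ (∧-true e)))
  above-head a b x y (E ∷ w) e = ≤ᵇ⇒≤ _ _ (true⇒ (proj₁ (∧-true e)))

  height-above : ∀ a b x y w → staysAbove a b x y w ≡ true → ∀ i → i < countE w → a * (x + suc i) ≤ b * height y w i
  height-above a b x y (N ∷ w) e i lt = height-above a b x (suc y) w (proj₂ (∧-true {aboveᵇ a b x y} e)) i lt
  height-above a b x y (E ∷ w) e zero _ = subst (λ t → a * t ≤ b * y) (+-comm 1 x) (above-head a b (suc x) y w (proj₂ (∧-true {aboveᵇ a b x y} e)))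
  height-above a b x y (E ∷ w) e (suc i) (s≤s lt) = subst (λ t → a * t ≤ b * height y w i) (sym (+-suc x (suc i)))
    (height-above a b (suc x) y w (proj₂ (∧-true {aboveᵇ a b x y} e)) i lt)

  valley-after : ∀ x w v → v ∈ valleysFrom x w → x < v
  valley-after x (N ∷ w) v v∈ = valley-after x w v v∈
  valley-after x (E ∷ N ∷ w) v (here refl) = ≤-refl
  valley-after x (E ∷ N ∷ w) v (there v∈) = <⇒≤ (valley-after (suc x) (N ∷ w) v v∈)
  valley-after x (E ∷ E ∷ w) v v∈ = <⇒≤ (valley-after (suc x) (E ∷ w) v v∈)

  rise⇒valley : ∀ x y w i → suc i < countE w → height y w i < height y w (suc i) → suc (x + i) ∈ valleysFrom x w
  rise⇒valley x y (N ∷ w) i lt r = rise⇒valley x (suc y) w i lt r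
  rise⇒valley x y (E ∷ []) i (s≤s ()) r
  rise⇒valley x y (E ∷ N ∷ w) zero lt r = here (cong suc (+-identityʳ x))
  rise⇒valley x y (E ∷ N ∷ w) (suc i) (s≤s lt) r = there (subst (_∈ valleysFrom (suc x) w) (cong suc (sym (+-suc x i))) (rise⇒valley (suc x) y (N ∷ w) i lt r))
  rise⇒valley x y (E ∷ E ∷ w) zero lt r = ⊥-elim (<-irrefl refl r)
  rise⇒valley x y (E ∷ E ∷ w) (suc i) (s≤s lt) r = subst (_∈ valleysFrom (suc x) (E ∷ w)) (cong suc (sym (+-suc x i))) (rise⇒valley (suc x) y (E ∷ w) i lt r)

  ∈-words : ∀ w → w ∈ words (length w)
  ∈-words [] = here refl
  ∈-words (s ∷ w) = ∈-concatMap⁺ (λ w → (N ∷ w) ∷ (E ∷ w) ∷ []) (lose (∈-words w) (choice s))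
    where
    choice : ∀ s → s ∷ w ∈ (N ∷ w) ∷ (E ∷ w) ∷ []
    choice N = here refl
    choice E = there (here refl)

  length-word : ∀ w → length w ≡ countN w + countE w
  length-word [] = refl
  length-word (N ∷ w) = cong suc (length-word w)
  length-word (E ∷ w) = trans (cong suc (length-word w)) (sym (+-suc (countN w) (countE w)))

  climb : ℕ → List Step → List Step
  climb u w = replicate u N ++ w

  climb-heights : ∀ u y w → eastHeights y (climb u w) ≡ eastHeights (u + y) w
  climb-heights zero y w = refl
  climb-heights (suc u) y w = trans (climb-heights u (suc y) w) (cong (λ t → eastHeights t w) (+-suc u y))

  climb-N : ∀ u w → countN (climb u w) ≡ u + countN w
  climb-N zero w = refl
  climb-N (suc u) w = cong suc (climb-N u w)

  climb-E : ∀ u w → countE (climb u w) ≡ countE w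
  climb-E zero w = refl
  climb-E (suc u) w = climb-E u w

  climb-above : ∀ a b x u y w → a * x ≤ b * y → staysAbove a b x (u + y) w ≡ true → staysAbove a b x y (climb u w) ≡ true
  climb-above a b x zero y w le e = e
  climb-above a b x (suc u) y w le e = cong₂ _∧_ (⇒true (≤⇒≤ᵇ le))
    (climb-above a b x u (suc y) w (≤-trans le (*-monoʳ-≤ b (n≤1+n y))) (trans (cong (λ t → staysAbove a b x t w) (+-suc u y)) e))

  module Correspondence (a n : ℕ) (0<a : 0 < a) (a≤n : a ≤ n) (coprime : Coprime a (suc n)) where
    open SlopeRot a n 0<a a≤n coprime public

    heights : List Step → ℕ → ℕ
    heights w zero = 0
    heights w (suc i) = height 0 w i

    module _ (w : List Step) (isDyck : isDyckᵇ a b w ≡ true) where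
      private
        splits = ∧-true {countN w ≡ᵇ a} isDyck
        cN : countN w ≡ a
        cN = ≡ᵇ⇒≡ _ _ (true⇒ (proj₁ splits))
        cE : countE w ≡ b
        cE = ≡ᵇ⇒≡ _ _ (true⇒ (proj₁ (∧-true {countE w ≡ᵇ b} (proj₂ splits))))
        stays : staysAbove a b 0 0 w ≡ true
        stays = proj₂ (∧-true {countE w ≡ᵇ b} (proj₂ splits))
        <E : ∀ {i} → i < b → i < countE w
        <E = subst (_ <_) (sym cE)

      heights-Dyck : Dyck (heights w)
      heights-Dyck = record { start = refl ; mono = mono′ ; end = end′ ; above = above′ }
        where
        mono′ : ∀ i → i ≤ n → heights w i ≤ heights w (suc i)
        mono′ zero _ = z≤n
        mono′ (suc i) i<n = height-mono 0 w i (<E (s≤s i<n))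
        above′ : ∀ i → i ≤ b → a * i ≤ b * heights w i
        above′ zero _ = ≤-trans (≤-reflexive (*-zeroʳ a)) z≤n
        above′ (suc i) i<b = height-above a b 0 0 w stays i (<E i<b)
        end′ : heights w b ≡ a
        end′ = ≤-antisym (≤-trans (height-≤ 0 w n (<E ≤-refl)) (≤-reflexive cN))
          (*-cancelˡ-≤ b (subst (_≤ b * heights w b) (*-comm a b) (above′ b ≤-refl)))

      valley-intro : ∀ x → 0 < x → x ≤ n → heights w x < heights w (suc x) → x ∈ valleys w
      valley-intro (suc x) _ x<n lt = rise⇒valley 0 0 w x (<E (s≤s x<n)) lt

    module FromHeights {Y : ℕ → ℕ} (D : Dyck Y) where
      tailWord : ℕ → ℕ → ℕ → List Step
      tailWord i y zero = []
      tailWord i y (suc k) = climb (Y (suc i) ∸ y) (E ∷ tailWord (suc i) (Y (suc i)) k)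

      private
        up : ∀ i y → y ≤ Y (suc i) → Y (suc i) ∸ y + y ≡ Y (suc i)
        up i y = m∸n+n≡m

      tail-heights : ∀ k i y → y ≤ Y (suc i) → i + k ≤ b → ∀ j → j < k → height y (tailWord i y k) j ≡ Y (suc (i + j))
      tail-heights (suc k) i y y≤ i+k≤ zero _ = trans (cong (λ hs → nthD 0 hs 0) (climb-heights (Y (suc i) ∸ y) y _)) (trans (up i y y≤) (cong (Y ∘ suc) (sym (+-identityʳ i))))
      tail-heights (suc k) i y y≤ i+k≤ (suc j) (s≤s j<k) = trans (cong (λ hs → nthD 0 hs (suc j)) (climb-heights (Y (suc i) ∸ y) y _))
        (trans (cong (λ t → height t (tailWord (suc i) (Y (suc i)) k) j) (up i y y≤))
        (trans (tail-heights k (suc i) (Y (suc i)) (mono D (suc i) (≤-pred (≤-trans (s≤s (≤-trans (s≤s (m≤m+n i j)) (subst (_≤ i + k) (+-suc i j) (+-monoʳ-≤ i j<k)))) (subst (_≤ b) (+-suc i k) i+k≤))))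
            (subst (_≤ b) (+-suc i k) i+k≤) j j<k)
          (cong (Y ∘ suc) (sym (+-suc i j)))))

      tail-E : ∀ k i y → countE (tailWord i y k) ≡ k
      tail-E zero i y = refl
      tail-E (suc k) i y = trans (climb-E (Y (suc i) ∸ y) _) (cong suc (tail-E k (suc i) (Y (suc i))))

      tail-N : ∀ k i → i + k ≤ b → countN (tailWord i (Y i) k) + Y i ≡ Y (i + k)
      tail-N zero i _ = cong Y (sym (+-identityʳ i))
      tail-N (suc k) i le = trans (cong (_+ Y i) (climb-N (Y (suc i) ∸ Y i) _))
        (trans (shuffle (Y (suc i) ∸ Y i) (countN (tailWord (suc i) (Y (suc i)) k)) (Y i))
        (trans (cong (_+_ (countN (tailWord (suc i) (Y (suc i)) k))) (m∸n+n≡m (mono D i (≤-pred (≤-trans (s≤s (m≤m+n i k)) le′)))))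
        (trans (tail-N k (suc i) le′) (cong Y (sym (+-suc i k))))))
        where
        le′ : suc (i + k) ≤ b
        le′ = subst (_≤ b) (+-suc i k) le
        shuffle : ∀ p q r → p + q + r ≡ q + (p + r)
        shuffle p q r = trans (cong (_+ r) (+-comm p q)) (+-assoc q p r)

      tail-above : ∀ k i → i + k ≤ b → staysAbove a b i (Y i) (tailWord i (Y i) k) ≡ true
      tail-above zero i le = ⇒true (≤⇒≤ᵇ (above D i (subst (_≤ b) (+-identityʳ i) le)))
      tail-above (suc k) i le = climb-above a b i (Y (suc i) ∸ Y i) (Y i) _ (above D i (<⇒≤ i<b))
        (trans (cong (λ t → staysAbove a b i t (E ∷ tailWord (suc i) (Y (suc i)) k)) (m∸n+n≡m (mono D i (≤-pred i<b))))
          (cong₂ _∧_ (⇒true (≤⇒≤ᵇ (≤-trans (above D i (<⇒≤ i<b)) (*-monoʳ-≤ b (mono D i (≤-pred i<b)))))) (tail-above k (suc i) le′)))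
        where
        le′ : suc (i + k) ≤ b
        le′ = subst (_≤ b) (+-suc i k) le
        i<b : i < b
        i<b = ≤-trans (s≤s (m≤m+n i k)) le′

      word : List Step
      word = tailWord 0 (Y 0) b

      word-N : countN word ≡ a
      word-N = trans (sym (+-identityʳ _)) (trans (cong (_+_ (countN word)) (sym (start D))) (trans (tail-N b 0 ≤-refl) (end D)))

      word-isDyck : isDyckᵇ a b word ≡ true
      word-isDyck = cong₂ _∧_ (⇒true (≡⇒≡ᵇ _ _ word-N)) (cong₂ _∧_ (⇒true (≡⇒≡ᵇ _ _ (tail-E b 0 (Y 0)))) above′)
        where
        above′ : staysAbove a b 0 0 word ≡ true
        above′ = trans (cong (λ t → staysAbove a b 0 t word) (sym (start D))) (tail-above b 0 ≤-refl)

      word∈ : word ∈ dyckPaths a b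
      word∈ = ∈-filter⁺ _ (subst (λ t → word ∈ words t) (trans (length-word word) (cong₂ _+_ word-N (tail-E b 0 (Y 0)))) (∈-words word)) (true⇒ word-isDyck)

      word-heights : ∀ i → i ≤ b → heights word i ≡ Y i
      word-heights zero _ = sym (start D)
      word-heights (suc i) i<b = trans (cong (λ t → height t word i) (sym (start D))) (tail-heights b 0 (Y 0) (mono D 0 z≤n) ≤-refl i i<b)

    -- `x` is a proper ancestor of `i` in the forest of parents. The labels cut off by the laser
    -- from a valley are its descendants.
    Anc : (ℕ → ℤ) → ℕ → ℕ → Set
    Anc S x i = x < i × (∀ t → x < t → t ≤ i → S x ℤ.< S t)

    module Blocks (w : List Step) (isDyck : isDyckᵇ a b w ≡ true) where
      private
        Y = heights w
        D = heights-Dyck w isDyck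
      open OfDyck D

      private
        difference : ∀ x j → x ≤ j → j ≤ b → S j ≡ S x ℤ.+ (ℤ.+ (b * (Y j ∸ Y x)) ℤ.- ℤ.+ (a * (j ∸ x)))
        difference x j x≤j j≤b = trans (cong S (sym (m+[n∸m]≡n x≤j))) (T-difference Y x (j ∸ x) (Y j ∸ Y x)
          (trans (cong Y (m+[n∸m]≡n x≤j)) (sym (m+[n∸m]≡n (mono-≤ D x≤j j≤b)))))

        yAt-heights : ∀ x → 0 < x → yAt w x ≡ Y x
        yAt-heights (suc x) _ = refl

        hit : ℕ → ℕ → Bool
        hit x j = (b * (yAt w j ∸ yAt w x)) <ᵇ (a * (j ∸ x))

        hit-true : ∀ x j → 0 < x → x < j → j ≤ b → S j ℤ.< S x → hit x j ≡ true
        hit-true x j 0<x x<j j≤b lt rewrite yAt-heights x 0<x | yAt-heights j (<-trans 0<x x<j) =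
          <ᵇ-true (b * (Y j ∸ Y x)) (a * (j ∸ x)) (>-unshift (S x) _ _ (subst (ℤ._< S x) (difference x j (<⇒≤ x<j) j≤b) lt))

        hit-false : ∀ x j → 0 < x → x < j → j ≤ b → hit x j ≡ true → S j ℤ.< S x
        hit-false x j 0<x x<j j≤b e rewrite yAt-heights x 0<x | yAt-heights j (<-trans 0<x x<j) =
          subst (ℤ._< S x) (sym (difference x j (<⇒≤ x<j) j≤b)) (>-shift (S x) (b * (Y j ∸ Y x)) (a * (j ∸ x)) (true-<ᵇ (b * (Y j ∸ Y x)) (a * (j ∸ x)) e))

        -- `f` lists the candidates `c , c + 1 , …`; the general `c` is what the recursion on the
        -- list of columns needs.
        firstHit-to : ∀ x i f k c → (∀ t → f t ≡ c + t) → i < firstHitFrom a b w x (yAt w x) (applyUpTo f k) → i < c + k →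
          ∀ j → c ≤ j → j ≤ i → hit x j ≡ false
        firstHit-to x i f zero c f≡ lt i<c j c≤j j≤i = ⊥-elim (<⇒≱ (subst (i <_) (+-identityʳ c) i<c) (≤-trans c≤j j≤i))
        firstHit-to x i f (suc k) c f≡ lt i<c j c≤j j≤i with trans (f≡ 0) (+-identityʳ c)
        ... | f0≡c rewrite f0≡c with hit x c in eq
        ...   | true = ⊥-elim (<⇒≱ lt (≤-trans c≤j j≤i))
        ...   | false with m≤n⇒m<n∨m≡n c≤j
        ...     | inj₂ refl = eq
        ...     | inj₁ c<j = firstHit-to x i (f ∘ suc) k (suc c) (λ t → trans (f≡ (suc t)) (+-suc c t)) lt (subst (i <_) (+-suc c k) i<c) j c<j j≤i

        firstHit-from : ∀ x i f k c → (∀ t → f t ≡ c + t) → i < b → (∀ j → c ≤ j → j ≤ i → hit x j ≡ false) →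
          i < firstHitFrom a b w x (yAt w x) (applyUpTo f k)
        firstHit-from x i f zero c f≡ i<b h = i<b
        firstHit-from x i f (suc k) c f≡ i<b h with trans (f≡ 0) (+-identityʳ c)
        ... | f0≡c rewrite f0≡c with hit x c in eq
        ...   | false = firstHit-from x i (f ∘ suc) k (suc c) (λ t → trans (f≡ (suc t)) (+-suc c t)) i<b (λ j c<j → h j (<⇒≤ c<j))
        ...   | true = ≰⇒> λ c≤i → true≢false (trans (sym eq) (h c ≤-refl c≤i))
          where
          true≢false : ¬ true ≡ false
          true≢false ()

        laser≡ : ∀ x → laserHitStep a b w x ≡ firstHitFrom a b w x (yAt w x) (applyUpTo (λ t → suc (x + t)) (b ∸ x))
        laser≡ x = cong (firstHitFrom a b w x (yAt w x)) (Listₚ.map-upTo (λ t → suc (x + t)) (b ∸ x))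

      cut⇒Anc : ∀ x i → 0 < x → i ≤ n → cutOffᵇ a b w x i ≡ true → Anc S x i
      cut⇒Anc x i 0<x i≤n e = x<i , inside
        where
        parts = ∧-true {x <ᵇ i} e
        x<i = true-<ᵇ x i (proj₁ parts)
        i<hit = true-<ᵇ i _ (proj₁ (∧-true {i <ᵇ laserHitStep a b w x} (proj₂ parts)))
        x≤b : x ≤ b
        x≤b = <⇒≤ (<-≤-trans x<i (m≤n⇒m≤1+n i≤n))
        inside : ∀ t → x < t → t ≤ i → S x ℤ.< S t
        inside t x<t t≤i = ℤₚ.≤∧≢⇒< (ℤₚ.≮⇒≥ no-hit) (T-distinct Y x t x<t (<-≤-trans (s≤s (≤-trans t≤i i≤n)) (m≤n+m b x)))
          where
          no-hit : ¬ S t ℤ.< S x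
          no-hit lt with trans (sym (hit-true x t 0<x x<t (m≤n⇒m≤1+n (≤-trans t≤i i≤n)) lt))
              (firstHit-to x i _ (b ∸ x) (suc x) (λ _ → refl) (subst (i <_) (laser≡ x) i<hit)
                (s≤s (≤-trans i≤n (≤-trans (n≤1+n n) (≤-reflexive (sym (m+[n∸m]≡n x≤b)))))) t x<t t≤i)
          ... | ()

      Anc⇒cut : ∀ x i → 0 < x → i ≤ n → Anc S x i → cutOffᵇ a b w x i ≡ true
      Anc⇒cut x i 0<x i≤n (x<i , inside) = cong₂ _∧_ (<ᵇ-true x i x<i) (cong₂ _∧_ (<ᵇ-true i (laserHitStep a b w x) i<hit) (<ᵇ-true (a * (i ∸ x)) (b * (yAt w i ∸ yAt w x)) low))
        where
        i<hit : i < laserHitStep a b w x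
        i<hit = subst (i <_) (sym (laser≡ x)) (firstHit-from x i _ (b ∸ x) (suc x) (λ _ → refl) (s≤s i≤n) (λ j x<j j≤i → no-hit j x<j j≤i (hit x j) refl))
          where
          no-hit : ∀ j → x < j → j ≤ i → ∀ h → hit x j ≡ h → hit x j ≡ false
          no-hit j x<j j≤i true eq = ⊥-elim (ℤₚ.<-asym (inside j x<j j≤i) (hit-false x j 0<x x<j (m≤n⇒m≤1+n (≤-trans j≤i i≤n)) eq))
          no-hit j x<j j≤i false eq = eq
        low : a * (i ∸ x) < b * (yAt w i ∸ yAt w x)
        low rewrite yAt-heights x 0<x | yAt-heights i (<-trans 0<x x<i) =
          <-unshift (S x) _ _ (subst (S x ℤ.<_) (difference x i (<⇒≤ x<i) (m≤n⇒m≤1+n i≤n)) (inside i x<i ≤-refl))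

      -- An ancestor of `i` is its parent `p` or an ancestor of `p`, and both kinds are ancestors of
      -- every other child of `p`.
      Anc-sibling : ∀ x i j p → PrevSmaller S p i → PrevSmaller S p j → Anc S x i → Anc S x j
      Anc-sibling x i j p P Q (x<i , inside) = ≤-<-trans x≤p (before Q) , inside′
        where
        x≤p : x ≤ p
        x≤p = ≮⇒≥ λ p<x → ℤₚ.<-asym (between P x p<x x<i) (inside i x<i ≤-refl)
        Sx≤Sp : S x ℤ.≤ S p
        Sx≤Sp with m≤n⇒m<n∨m≡n x≤p
        ... | inj₂ refl = ℤₚ.≤-refl
        ... | inj₁ x<p = ℤₚ.<⇒≤ (inside p x<p (<⇒≤ (before P)))
        inside′ : ∀ t → x < t → t ≤ j → S x ℤ.< S t
        inside′ t x<t t≤j with ≤-<-connex t p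
        ... | inj₁ t≤p = inside t x<t (≤-trans t≤p (<⇒≤ (before P)))
        ... | inj₂ p<t with m≤n⇒m<n∨m≡n t≤j
        ...   | inj₂ refl = ℤₚ.≤-<-trans Sx≤Sp (smaller Q)
        ...   | inj₁ t<j = ℤₚ.≤-<-trans Sx≤Sp (ℤₚ.<-trans (smaller Q) (between Q t p<t t<j))

      same-intro : ∀ i j → 0 < i → i ≤ n → 0 < j → j ≤ n → psY i ≡ psY j → sameBlockᵇ a b w i j ≡ true
      same-intro i j 0<i i≤n 0<j j≤n e = ⇒true (Allₚ.all⁻ _ (All.tabulate λ {x} x∈ → true⇒ (agree x (valley-after 0 w x x∈))))
        where
        P = psY-spec i 0<i i≤n
        Q : PrevSmaller S (psY i) j
        Q = subst (λ p → PrevSmaller S p j) (sym e) (psY-spec j 0<j j≤n)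
        agree : ∀ x → 0 < x → not (cutOffᵇ a b w x i xor cutOffᵇ a b w x j) ≡ true
        agree x 0<x = trans (cong (λ c → not (c xor cutOffᵇ a b w x j)) cuts≡) (xor-self (cutOffᵇ a b w x j))
          where
          cuts≡ : cutOffᵇ a b w x i ≡ cutOffᵇ a b w x j
          cuts≡ = bool-ext (λ c → Anc⇒cut x j 0<x j≤n (Anc-sibling x i j (psY i) P Q (cut⇒Anc x i 0<x i≤n c)))
                           (λ c → Anc⇒cut x i 0<x i≤n (Anc-sibling x j i (psY i) Q P (cut⇒Anc x j 0<x j≤n c)))
          xor-self : ∀ c → not (c xor c) ≡ true
          xor-self true = refl
          xor-self false = refl

      private
        -- The larger parent `q = psY j` is positive and begins a north run, so it is a valley. Its
        -- laser cuts off `j` but not `i`: if it did, `q` would be a smaller position between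
        -- `psY i` and `i`.
        separated : ∀ i j → 0 < i → i ≤ n → 0 < j → j ≤ n → psY i < psY j → (∀ x → x ∈ valleys w → cutOffᵇ a b w x j ≡ true → cutOffᵇ a b w x i ≡ true) → ¬ psY i < psY j
        separated i j 0<i i≤n 0<j j≤n p<q agree _ = ℤₚ.<-asym (between P q p<q (proj₁ anc)) (proj₂ anc i (proj₁ anc) ≤-refl)
          where
          q = psY j
          P = psY-spec i 0<i i≤n
          Q = psY-spec j 0<j j≤n
          0<q : 0 < q
          0<q = ≤-<-trans z≤n p<q
          q≤n : q ≤ n
          q≤n = <⇒≤ (<-≤-trans (before Q) j≤n)
          rises : Y q < Y (suc q)
          rises = ≰⇒> λ le → ℤₚ.<-asym (smaller (first-child j 0<j j≤n)) (rise-zero q q≤n (m≤n⇒m∸n≡0 le))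
          ancQ : Anc S q j
          ancQ = before Q , λ t q<t t≤j → inside t q<t (m≤n⇒m<n∨m≡n t≤j)
            where
            inside : ∀ t → q < t → t < j ⊎ t ≡ j → S q ℤ.< S t
            inside t q<t (inj₁ t<j) = ℤₚ.<-trans (smaller Q) (between Q t q<t t<j)
            inside t q<t (inj₂ refl) = smaller Q
          anc : Anc S q i
          anc = cut⇒Anc q i 0<q i≤n (agree q (valley-intro w isDyck q 0<q q≤n rises) (Anc⇒cut q j 0<q j≤n ancQ))

      same-elim : ∀ i j → 0 < i → i ≤ n → 0 < j → j ≤ n → sameBlockᵇ a b w i j ≡ true → psY i ≡ psY j
      same-elim i j 0<i i≤n 0<j j≤n e with <-cmp (psY i) (psY j)
      ... | tri≈ _ p _ = p
      ... | tri< p<q _ _ = ⊥-elim (separated i j 0<i i≤n 0<j j≤n p<q (λ x x∈ c → trans (agree x x∈) c) p<q)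
        where
        agree : ∀ x → x ∈ valleys w → cutOffᵇ a b w x i ≡ cutOffᵇ a b w x j
        agree x x∈ = not-xor (cutOffᵇ a b w x i) (cutOffᵇ a b w x j) (⇒true (All.lookup (Allₚ.all⁺ _ (valleys w) (true⇒ e)) x∈))
          where
          not-xor : ∀ c d → not (c xor d) ≡ true → c ≡ d
          not-xor true true _ = refl
          not-xor false false _ = refl
      ... | tri> _ _ q<p = ⊥-elim (separated j i 0<j j≤n 0<i i≤n q<p (λ x x∈ c → trans (sym (agree x x∈)) c) q<p)
        where
        agree : ∀ x → x ∈ valleys w → cutOffᵇ a b w x i ≡ cutOffᵇ a b w x j
        agree x x∈ = not-xor (cutOffᵇ a b w x i) (cutOffᵇ a b w x j) (⇒true (All.lookup (Allₚ.all⁺ _ (valleys w) (true⇒ e)) x∈))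
          where
          not-xor : ∀ c d → not (c xor d) ≡ true → c ≡ d
          not-xor true true _ = refl
          not-xor false false _ = refl

    kin? : (ℕ → ℕ) → ℕ → ℕ → Bool
    kin? Y r s = does (parent Y r ℕ.≟ parent Y s)

    partition : (ℕ → ℕ) → SetPartition
    partition Y = matrix n (kin? Y)

    parent-ps : ∀ Y r → r < n → parent Y r ≡ ps (T Y) (suc r)
    parent-ps Y r r<n = cong (λ t → ps (T Y) (suc t)) (m<n⇒m%n≡m r<n)

    parent-cong : ∀ {Y Y′} → (∀ i → i ≤ b → Y i ≡ Y′ i) → ∀ r → parent Y r ≡ parent Y′ r
    parent-cong {Y} {Y′} e r = ps-cong (label r) (λ i i≤ → T-cong i (e i (≤-trans i≤ (m≤n⇒m≤1+n (label≤n r)))))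
      where
      T-cong : ∀ i → Y i ≡ Y′ i → T Y i ≡ T Y′ i
      T-cong i eq = trans (T-def Y i) (trans (cong (λ y → ℤ.+ (b * y) ℤ.- ℤ.+ (a * i)) eq) (sym (T-def Y′ i)))

    partition-cong : ∀ {Y Y′} → (∀ r s → parent Y r ≡ parent Y s → parent Y′ r ≡ parent Y′ s) →
      (∀ r s → parent Y′ r ≡ parent Y′ s → parent Y r ≡ parent Y s) → partition Y ≡ partition Y′
    partition-cong to from = matrix-cong n _ _ (λ r s _ _ → does-cong (_ ℕ.≟ _) (_ ℕ.≟ _) (to r s) (from r s))

    partition-kin : ∀ {Y Y′} → partition Y ≡ partition Y′ → ∀ r s → r < n → s < n → parent Y r ≡ parent Y s → parent Y′ r ≡ parent Y′ s
    partition-kin {Y} {Y′} e r s r<n s<n p = does-true (_ ℕ.≟ _) (trans (sym (rel-matrix n (kin? Y′) r s r<n s<n))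
      (trans (cong (λ π → rel π r s) (sym e)) (trans (rel-matrix n (kin? Y) r s r<n s<n) (dec-true (_ ℕ.≟ _) p))))

    partition-injective : ∀ {Y Y′} → Dyck Y → Dyck Y′ → partition Y ≡ partition Y′ → ∀ u → u ≤ b → Y u ≡ Y′ u
    partition-injective {Y} {Y′} D D′ e = kin-determines D D′ (transfer {Y} {Y′} e) (transfer {Y′} {Y} (sym e))
      where
      transfer : ∀ {Y Y′} → partition Y ≡ partition Y′ → ∀ i j → 0 < i → i ≤ n → 0 < j → j ≤ n → ps (T Y) i ≡ ps (T Y) j → ps (T Y′) i ≡ ps (T Y′) j
      transfer {Y} {Y′} e (suc i) (suc j) _ i<n _ j<n p = trans (sym (parent-ps Y′ i i<n)) (trans
        (partition-kin {Y} {Y′} e i j i<n j<n (trans (parent-ps Y i i<n) (trans p (sym (parent-ps Y j j<n))))) (parent-ps Y′ j j<n))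

    πD-partition : ∀ w → isDyckᵇ a b w ≡ true → πD a b w ≡ partition (heights w)
    πD-partition w isDyck = matrix-cong n _ _ λ r s r<n s<n → bool-ext
      (λ e → dec-true (_ ℕ.≟ _) (trans (parent-ps (heights w) r r<n) (trans (same-elim (suc r) (suc s) (s≤s z≤n) r<n (s≤s z≤n) s<n e) (sym (parent-ps (heights w) s s<n)))))
      (λ e → same-intro (suc r) (suc s) (s≤s z≤n) r<n (s≤s z≤n) s<n (trans (sym (parent-ps (heights w) r r<n)) (trans (does-true (_ ℕ.≟ _) e) (parent-ps (heights w) s s<n))))
      where open Blocks w isDyck

    rot-partition : ∀ {Y Y′} → Rotated 1 Y Y′ → rot n (partition Y) ≡ partition Y′
    rot-partition {Y} {Y′} R = trans (rot-matrix n (kin? Y)) (matrix-cong n _ _ λ r s r<n s<n →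
      does-cong (_ ℕ.≟ _) (_ ℕ.≟ _) (λ e → subst₂ _≡_ (at r) (at s) (kin-to R _ _ e)) (λ e → kin-from R _ _ (subst₂ _≡_ (sym (at r)) (sym (at s)) e)))
      where
      at : ∀ r → parent Y′ (rotInv n r + 1) ≡ parent Y′ r
      at zero = cong (λ t → ps (T Y′) (suc t)) (trans (cong (_% n) (m∸n+n≡m 0<n)) (trans (n%n≡0 n) (sym (m<n⇒m%n≡m 0<n))))
      at (suc r) = cong (parent Y′) (+-comm r 1)

    iter-rot : ∀ d {Y} → Dyck Y → ∃ λ Y′ → Dyck Y′ × Rotated d Y Y′ × iter (rot n) d (partition Y) ≡ partition Y′
    iter-rot zero {Y} D with rotate 0 D
    ... | Y′ , D′ , R = Y′ , D′ , R , partition-cong {Y} {Y′}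
          (λ r s e → subst₂ _≡_ (at r) (at s) (kin-to R r s e)) (λ r s e → kin-from R r s (subst₂ _≡_ (sym (at r)) (sym (at s)) e))
      where
      at : ∀ r → parent Y′ (r + 0) ≡ parent Y′ r
      at r = cong (parent Y′) (+-identityʳ r)
    iter-rot (suc d) {Y} D with iter-rot d D
    ... | Y₁ , D₁ , R₁ , e = Rotation.rotated D₁ , Rotation.rotated-Dyck D₁ , compose-rotations
        , trans (cong (rot n) e) (rot-partition (Rotation.is-rotated D₁))
      where
      R₂ = Rotation.is-rotated D₁
      Y₂ = Rotation.rotated D₁
      shift : ∀ r → r + suc d ≡ r + d + 1
      shift r = trans (+-suc r d) (+-comm 1 (r + d))
      at : ∀ r → parent Y₂ (r + d + 1) ≡ parent Y₂ (r + suc d)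
      at r = cong (parent Y₂) (sym (shift r))
      compose-rotations : Rotated (suc d) Y Y₂
      compose-rotations = record
        { kin-to = λ r s e → subst₂ _≡_ (at r) (at s) (kin-to R₂ (r + d) (s + d) (kin-to R₁ r s e))
        ; kin-from = λ r s e → kin-from R₁ r s (kin-from R₂ (r + d) (s + d) (subst₂ _≡_ (sym (at r)) (sym (at s)) e))
        ; rank≡ = λ r → trans (cong (rank Y₂) (shift r)) (trans (rank≡ R₂ (r + d)) (rank≡ R₁ r))
        ; nonflat≡ = trans (nonflat≡ R₂) (nonflat≡ R₁) }

    module _ {Y : ℕ → ℕ} (D : Dyck Y) where
      open OfDyck D

      -- A block is opened exactly by the labels that follow a north run.
      first-of-block : ∀ r → r < n → 0 < rise Y r → ∀ s → s < r → parent Y s ≢ parent Y r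
      first-of-block r r<n pos s s<r e = <⇒≢ (<-≤-trans (subst (_< suc s) (sym (parent-ps Y s s<n)) (psY< (suc s) (s≤s z≤n) s<n)) s<r)
        (trans e (trans (parent-ps Y r r<n) (ps-of {S} (prev ≤-refl (rise-positive r pos) (λ t r<t t≤r → ⊥-elim (<⇒≱ r<t (≤-pred t≤r)))))))
        where
        s<n = <-trans s<r r<n

      not-first : ∀ r → r < n → rise Y r ≡ 0 → parent Y r < r × parent Y (parent Y r) ≡ parent Y r
      not-first r r<n flat = p<r , trans (parent-ps Y (parent Y r) (<-trans p<r r<n)) (trans (cong psY (cong suc (parent-ps Y r r<n)))
          (trans (ps-of (first-child (suc r) (s≤s z≤n) r<n)) (sym (parent-ps Y r r<n))))
        where
        P = psY-spec (suc r) (s≤s z≤n) r<n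
        p<r : parent Y r < r
        p<r = subst (_< r) (sym (parent-ps Y r r<n)) (≤∧≢⇒< (≤-pred (before P))
          (λ e → ℤₚ.<-asym (rise-zero r (<⇒≤ r<n) flat) (subst (λ t → S t ℤ.< S (suc r)) e (smaller P))))

      numBlocks-partition : numBlocks n (partition Y) ≡ nonflat Y
      numBlocks-partition = length-filterᵇ-upTo _ _ n same
        where
        same : ∀ r → r < n → not (any (λ s → rel (partition Y) s r) (upTo r)) ≡ (0 <ᵇ rise Y r)
        same r r<n with rise Y r in eq
        ... | zero = cong not (⇒true (Anyₚ.any⁺ _ (lose (∈-upTo⁺ (proj₁ nf)) (true⇒ (trans (rel-matrix n (kin? Y) (parent Y r) r (<-trans (proj₁ nf) r<n) r<n) (dec-true (_ ℕ.≟ _) (proj₂ nf)))))))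
          where nf = not-first r r<n eq
        ... | suc v with any (λ s → rel (partition Y) s r) (upTo r) in eq′
        ...   | false = refl
        ...   | true with Anyₚ.any⁻ (λ s → rel (partition Y) s r) (upTo r) (true⇒ eq′)
        ...     | any-s with find any-s
        ...       | s , s∈ , t = ⊥-elim (first-of-block r r<n (subst (0 <_) (sym eq) (s≤s z≤n)) s (∈-upTo⁻ s∈)
                      (does-true (_ ℕ.≟ _) (trans (sym (rel-matrix n (kin? Y) s r (<-trans (∈-upTo⁻ s∈) r<n) r<n)) (⇒true t))))

  -- Paths from periodic words

  sum : (ℕ → ℕ) → ℕ → ℕ
  sum z zero = 0
  sum z (suc i) = sum z i + z i

  sum-cong : ∀ {z z′} i → (∀ t → t < i → z t ≡ z′ t) → sum z i ≡ sum z′ i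
  sum-cong zero e = refl
  sum-cong (suc i) e = cong₂ _+_ (sum-cong i (λ t lt → e t (m≤n⇒m≤1+n lt))) (e i ≤-refl)

  sum-+ : ∀ z c i → sum z (i + c) ≡ sum (λ t → z (t + c)) i + sum z c
  sum-+ z c zero = refl
  sum-+ z c (suc i) = trans (cong (_+ z (i + c)) (sum-+ z c i)) (trans (+-assoc (sum (λ t → z (t + c)) i) (sum z c) _)
    (trans (cong (_+_ (sum (λ t → z (t + c)) i)) (+-comm (sum z c) _)) (sym (+-assoc (sum (λ t → z (t + c)) i) _ _))))

  sum-mono : ∀ z i d → sum z i ≤ sum z (i + d)
  sum-mono z i zero = ≤-reflexive (cong (sum z) (sym (+-identityʳ i)))
  sum-mono z i (suc d) rewrite +-suc i d = ≤-trans (sum-mono z i d) (m≤m+n _ _)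

  sum-rise : ∀ (Y : ℕ → ℕ) n → Y 0 ≡ 0 → (∀ i → i < n → Y i ≤ Y (suc i)) → ∀ i → i ≤ n → sum (λ x → Y (suc x) ∸ Y x) i ≡ Y i
  sum-rise Y n e mono zero _ = sym e
  sum-rise Y n e mono (suc i) i<n = trans (cong (_+ (Y (suc i) ∸ Y i)) (sum-rise Y n e mono i (<⇒≤ i<n))) (m+[n∸m]≡n (mono i i<n))

  argmin : ∀ (S : ℕ → ℤ) K → ∃ λ c → c ≤ K × (∀ t → t ≤ K → S c ℤ.≤ S t)
  argmin S zero = 0 , z≤n , λ { zero _ → ℤₚ.≤-refl }
  argmin S (suc K) with argmin S K
  ... | c , c≤N , min with S (suc K) ℤ.<? S c
  ...   | no nlt = c , m≤n⇒m≤1+n c≤N , λ t t≤ → split t (m≤n⇒m<n∨m≡n t≤)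
    where
    split : ∀ t → t < suc K ⊎ t ≡ suc K → S c ℤ.≤ S t
    split t (inj₁ (s≤s t≤N)) = min t t≤N
    split _ (inj₂ refl) = ℤₚ.≮⇒≥ nlt
  ...   | yes lt = suc K , ≤-refl , λ t t≤ → split t (m≤n⇒m<n∨m≡n t≤)
    where
    split : ∀ t → t < suc K ⊎ t ≡ suc K → S (suc K) ℤ.≤ S t
    split t (inj₁ (s≤s t≤N)) = ℤₚ.<⇒≤ (ℤₚ.<-≤-trans lt (min t t≤N))
    split _ (inj₂ refl) = ℤₚ.≤-refl

  count-+ : ∀ P c i → count P (i + c) ≡ count (λ t → P (t + c)) i + count P c
  count-+ P c zero = refl
  count-+ P c (suc i) = trans (cong (_+ indicator (P (i + c))) (count-+ P c i)) (trans (+-assoc (count (λ t → P (t + c)) i) (count P c) _)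
    (trans (cong (_+_ (count (λ t → P (t + c)) i)) (+-comm (count P c) _)) (sym (+-assoc (count (λ t → P (t + c)) i) _ _))))

  %-+ : ∀ n .{{_ : NonZero n}} x y c → x % n ≡ y % n → (x + c) % n ≡ (y + c) % n
  %-+ n x y c e = trans (%-distribˡ-+ x c n) (trans (cong (λ t → (t + c % n) % n) e) (sym (%-distribˡ-+ y c n)))

  %-+⁻ : ∀ n .{{_ : NonZero n}} x y c → (x + c) % n ≡ (y + c) % n → x % n ≡ y % n
  %-+⁻ n x y c e = trans (sym (back x)) (trans (%-+ n (x + c) (y + c) (c * (n ∸ 1)) e) (back y))
    where
    c*n : c + c * (n ∸ 1) ≡ c * n
    c*n = trans (sym (*-suc c (n ∸ 1))) (cong (c *_) (suc-pred n))
    back : ∀ x → (x + c + c * (n ∸ 1)) % n ≡ x % n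
    back x = trans (cong (_% n) (trans (+-assoc x c _) (cong (_+_ x) c*n))) ([m+kn]%n≡m%n x c n)

  residue-distinct : ∀ n .{{_ : NonZero n}} y d → 0 < d → d < n → (y + d) % n ≢ y % n
  residue-distinct n y d 0<d d<n e = <-irrefl (sym (trans (sym (m<n⇒m%n≡m d<n)) (trans (%-+⁻ n d 0 y (trans (cong (_% n) (+-comm d y)) e)) (m<n⇒m%n≡m (≤-trans (s≤s z≤n) d<n))))) 0<d

  module Walks (a n : ℕ) (0<a : 0 < a) (a≤n : a ≤ n) (coprime : Coprime a (suc n)) where
    open Correspondence a n 0<a a≤n coprime public

    parent-% : ∀ Y r s → r % n ≡ s % n → parent Y r ≡ parent Y s
    parent-% Y r s e = cong (λ t → ps (T Y) (suc t)) e

    Walk : (ℕ → ℕ) → ℕ → ℤ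
    Walk z = T (sum z)

    walk-shift : ∀ z k i → Walk z (i + k) ≡ Walk (λ t → z (t + k)) i ℤ.+ Walk z k
    walk-shift z k i = trans (T-def (sum z) (i + k)) (trans (cong₂ (λ u v → + u - + v) (trans (cong (b *_) (sum-+ z k i)) (*-distribˡ-+ b _ (sum z k))) (*-distribˡ-+ a i k))
      (trans (lemma (+ (b * sum (λ t → z (t + k)) i)) (+ (b * sum z k)) (+ (a * i)) (+ (a * k))) (cong₂ ℤ._+_ (sym (T-def (sum (λ t → z (t + k))) i)) (sym (T-def (sum z) k)))))
      where
      lemma : ∀ p q r s → (p ℤ.+ q) - (r ℤ.+ s) ≡ (p - r) ℤ.+ (q - s)
      lemma = solve-∀

    T-cong : ∀ {Z Z′} i → Z i ≡ Z′ i → T Z i ≡ T Z′ i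
    T-cong {Z} {Z′} i e = trans (T-def Z i) (trans (cong (λ y → + (b * y) - + (a * i)) e) (sym (T-def Z′ i)))

  module Periodic (a n : ℕ) (0<a : 0 < a) (a≤n : a ≤ n) (coprime : Coprime a (suc n))
                  (q m : ℕ) (n≡mq : n ≡ m * q) (2≤m : 2 ≤ m) where
    open Walks a n 0<a a≤n coprime public

    0<q : 0 < q
    0<q = n≢0⇒n>0 λ { refl → <-irrefl (sym (trans n≡mq (*-zeroʳ m))) 0<n }

    2q≤n : q + q ≤ n
    2q≤n = subst₂ _≤_ (cong (_+_ q) (+-identityʳ q)) (sym n≡mq) (*-monoˡ-≤ q 2≤m)

    q≤n : q ≤ n
    q≤n = ≤-trans (m≤m+n q q) 2q≤n

    IsPeriodic : (ℕ → ℕ) → Set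
    IsPeriodic z = ∀ i → z (i + q) ≡ z i

    multiple : ∀ {z} → IsPeriodic z → ∀ k i → z (i + k * q) ≡ z i
    multiple {z} per zero i = cong z (+-identityʳ i)
    multiple {z} per (suc k) i = trans (cong z (trans (cong (_+_ i) (+-comm q (k * q))) (sym (+-assoc i (k * q) q)))) (trans (per (i + k * q)) (multiple {z} per k i))

    period-n : ∀ {z} → IsPeriodic z → ∀ i → z (i + n) ≡ z i
    period-n {z} per i = trans (cong (λ t → z (i + t)) n≡mq) (multiple {z} per m i)

    mod-n : ∀ {z} → IsPeriodic z → ∀ i → z i ≡ z (i % n)
    mod-n {z} per i = trans (cong z (trans (m≡m%n+[m/n]*n i n) (cong (λ t → i % n + t) (trans (cong (i / n *_) n≡mq) (sym (*-assoc (i / n) m q)))))) (multiple {z} per (i / n * m) (i % n))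

    -- S is invariant in order under translation by k.
    Shiftable : (ℕ → ℤ) → ℕ → Set
    Shiftable S k = ∃ λ δ → ∀ i → S (i + k) ≡ S i ℤ.+ δ

    shift-< : ∀ {S k} → Shiftable S k → ∀ {i j} → S i ℤ.< S j → S (i + k) ℤ.< S (j + k)
    shift-< (δ , e) {i} {j} lt = subst₂ ℤ._<_ (sym (e i)) (sym (e j)) (ℤₚ.+-monoˡ-< δ lt)

    unshift-< : ∀ {S k} → Shiftable S k → ∀ {i j} → S (i + k) ℤ.< S (j + k) → S i ℤ.< S j
    unshift-< {S} (δ , e) {i} {j} lt = ℤₚ.≰⇒> λ le → ℤₚ.<⇒≱ lt (subst₂ ℤ._≤_ (sym (e j)) (sym (e i)) (ℤₚ.+-monoˡ-≤ δ le))

    split-≥ : ∀ {k t} → k ≤ t → ∃ λ t′ → t ≡ t′ + k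
    split-≥ {k} {t} le = t ∸ k , sym (m∸n+n≡m le)

    walk-periodic : ∀ {z} k → (∀ i → z (i + k) ≡ z i) → Shiftable (Walk z) k
    walk-periodic {z} k per = Walk z k , λ i → trans (walk-shift z k i) (cong (ℤ._+ Walk z k) (T-cong i (sum-cong i (λ t _ → per t))))

    walk-flat : ∀ z x → z x ≡ 0 → Walk z (suc x) ℤ.< Walk z x
    walk-flat z x e = T-flat (sum z) x (trans (cong (_+_ (sum z x)) e) (+-identityʳ _))

    walk-rise : ∀ z x → 0 < z x → Walk z x ℤ.< Walk z (suc x)
    walk-rise z x lt = T-rise (sum z) x (m<m+n (sum z x) lt)

    module Near (S : ℕ → ℤ) where
      -- A centre of rotation makes every other block narrower than q, so parents are sought within distance q;
      -- the labels without such a parent form the central block.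
      IsNear : ℕ → ℕ → Set
      IsNear x U = PrevSmaller S x U × U ≤ x + q

      None : ℕ → Set
      None U = ∀ x → x < U → U ≤ x + q → S U ℤ.< S x

      -- Parents are compared modulo `n` because `U` and `V` may be lifts of labels by different
      -- multiples of `n`.
      Kin : ℕ → ℕ → Set
      Kin U V = (None U × None V) ⊎ (∃₂ λ x y → IsNear x U × IsNear y V × x % n ≡ y % n)

      near-none : ∀ {x U} → IsNear x U → ¬ None U
      near-none (P , le) nn = ℤₚ.<-asym (smaller P) (nn _ (before P) le)

      near-shift : ∀ {k} → Shiftable S k → ∀ {x U} → IsNear x U → IsNear (x + k) (U + k)
      near-shift {k} sh {x} {U} (P , le) = prev (+-monoˡ-< k (before P)) (shift-< {S} sh (smaller P)) btw
        , subst (U + k ≤_) (shuffle x q k) (+-monoˡ-≤ k le)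
        where
        shuffle : ∀ x q k → x + q + k ≡ x + k + q
        shuffle x q k = trans (+-assoc x q k) (trans (cong (_+_ x) (+-comm q k)) (sym (+-assoc x k q)))
        btw : ∀ t → x + k < t → t < U + k → S (U + k) ℤ.< S t
        btw t lt lt′ with split-≥ {k} {t} (≤-trans (m≤n+m k x) (<⇒≤ lt))
        ... | t′ , refl = shift-< {S} sh (between P t′ (+-cancelʳ-< k x t′ lt) (+-cancelʳ-< k t′ U lt′))

      near-unshift : ∀ {k} → Shiftable S k → ∀ {x U} → IsNear (x + k) (U + k) → IsNear x U
      near-unshift {k} sh {x} {U} (P , le) = prev (+-cancelʳ-< k x U (before P)) (unshift-< {S} sh (smaller P))
          (λ t lt lt′ → unshift-< {S} sh (between P (t + k) (+-monoˡ-< k lt) (+-monoˡ-< k lt′)))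
        , +-cancelʳ-≤ k U (x + q) (subst (U + k ≤_) (shuffle x q k) le)
        where
        shuffle : ∀ x q k → x + k + q ≡ x + q + k
        shuffle x q k = trans (+-assoc x k q) (trans (cong (_+_ x) (+-comm k q)) (sym (+-assoc x q k)))

      -- `q ≤ U` ensures that every position in the window of `U + k` is the translate by `k` of a
      -- natural number.
      none-shift : ∀ {k} → Shiftable S k → ∀ {U} → q ≤ U → None U → None (U + k)
      none-shift {k} sh {U} q≤U nn x lt le with split-≥ {k} {x} (+-cancelʳ-≤ q k x (≤-trans (subst (_≤ U + k) (+-comm q k) (+-monoˡ-≤ k q≤U)) le))
      ... | x′ , refl = shift-< {S} sh (nn x′ (+-cancelʳ-< k x′ U lt) (+-cancelʳ-≤ k U (x′ + q) (subst (U + k ≤_) (shuffle x′ q k) le)))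
        where
        shuffle : ∀ x q k → x + k + q ≡ x + q + k
        shuffle x q k = trans (+-assoc x k q) (trans (cong (_+_ x) (+-comm k q)) (sym (+-assoc x q k)))

      none-unshift : ∀ {k} → Shiftable S k → ∀ {U} → None (U + k) → None U
      none-unshift {k} sh {U} nn x lt le = unshift-< {S} sh (nn (x + k) (+-monoˡ-< k lt) (subst (U + k ≤_) (shuffle x q k) (+-monoˡ-≤ k le)))
        where
        shuffle : ∀ x q k → x + q + k ≡ x + k + q
        shuffle x q k = trans (+-assoc x q k) (trans (cong (_+_ x) (+-comm q k)) (sym (+-assoc x k q)))

      kin-shift : ∀ {k} → Shiftable S k → ∀ {U V} → q ≤ U → q ≤ V → Kin U V → Kin (U + k) (V + k)
      kin-shift sh qU qV (inj₁ (u , v)) = inj₁ (none-shift sh qU u , none-shift sh qV v)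
      kin-shift {k} sh qU qV (inj₂ (x , y , nu , nv , e)) = inj₂ (x + k , y + k , near-shift sh nu , near-shift sh nv , %-+ n x y k e)

      kin-unshift : ∀ {k} → Shiftable S k → ∀ {U V} → q ≤ U → q ≤ V → Kin (U + k) (V + k) → Kin U V
      kin-unshift sh qU qV (inj₁ (u , v)) = inj₁ (none-unshift sh u , none-unshift sh v)
      kin-unshift {k} sh {U} {V} qU qV (inj₂ (x , y , nu , nv , e)) with split-≥ {k} {x} (low qU nu) | split-≥ {k} {y} (low qV nv)
        where
        low : ∀ {U x} → q ≤ U → IsNear x (U + k) → k ≤ x
        low {U} {x} qU (_ , le) = +-cancelʳ-≤ q k x (≤-trans (subst (_≤ U + k) (+-comm q k) (+-monoˡ-≤ k qU)) le)
      ... | x′ , refl | y′ , refl = inj₂ (x′ , y′ , near-unshift sh nu , near-unshift sh nv , %-+⁻ n x′ y′ k e)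

    near-or-none : ∀ z U → 0 < U → (∃ λ x → Near.IsNear (Walk z) x U) ⊎ Near.None (Walk z) U
    near-or-none z U 0<U with anyUpTo? (λ x → (U ℕ.≤? x + q) ×-dec (Walk z x ℤ.<? Walk z U)) U
    ... | yes (t , t<U , le , low) with prevSmaller-exists (Walk z) U t (λ t′ t≤ t′<U → T-distinct (sum z) t′ U t′<U (≤-<-trans le (+-mono-≤-< t≤ (s≤s q≤n)))) t<U low
    ...   | x , P , t≤x = inj₁ (x , P , ≤-trans le (+-monoˡ-≤ q t≤x))
    near-or-none z U 0<U | no none = inj₂ λ x x<U le → ℤₚ.≤∧≢⇒< (ℤₚ.≮⇒≥ (λ low → none (x , x<U , le , low)))
      (λ e → T-distinct (sum z) x U x<U (≤-<-trans le (+-monoʳ-< x (s≤s q≤n))) (sym e))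

    central : (ℕ → ℕ) → ℕ
    central z = a ∸ sum z n

    -- Labels are lifted by `n` before their kinship is tested: as `q ≤ n`, the window of length `q`
    -- to the left of a lifted label then lies within ℕ.
    record Represents (Y z : ℕ → ℕ) : Set where
      open Near (Walk z)
      field
        kin⇒    : ∀ r s → parent Y r ≡ parent Y s → Kin (suc (r + n)) (suc (s + n))
        kin⇐    : ∀ r s → Kin (suc (r + n)) (suc (s + n)) → parent Y r ≡ parent Y s
        rank-z  : ∀ x → 0 < z x → rank Y x ≡ z x
        blocks  : nonflat Y ≡ m * count (λ t → 0 <ᵇ z t) q + indicator (0 <ᵇ central z)
    open Represents public

    count-multiple : ∀ {z} → IsPeriodic z → ∀ k → count (λ t → 0 <ᵇ z t) (k * q) ≡ k * count (λ t → 0 <ᵇ z t) q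
    count-multiple per zero = refl
    count-multiple {z} per (suc k) = trans (cong (count (λ t → 0 <ᵇ z t)) (+-comm q (k * q))) (trans (count-+ (λ t → 0 <ᵇ z t) q (k * q))
      (trans (cong (_+ count (λ t → 0 <ᵇ z t) q) (trans (count-cong (k * q) (λ t _ → cong (0 <ᵇ_) (per t))) (count-multiple {z} per k))) (+-comm _ (count (λ t → 0 <ᵇ z t) q))))

    -- The words that can be cut open at position 0. The run of the central block is put at the
    -- origin, so the letter there must be 0 if such a block exists; `positive` says that the
    -- resulting path stays above the diagonal.
    record Good (z : ℕ → ℕ) : Set where
      field
        periodic : IsPeriodic z
        bounded  : sum z n ≤ a
        centred  : central z ≡ 0 ⊎ z 0 ≡ 0
        positive : ∀ i → 0 < i → i ≤ n → a * i < b * (central z + sum z i)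

    -- The path whose north runs are z, with the central block (if any) opened at the origin.
    path : (ℕ → ℕ) → ℕ → ℕ
    path z zero = 0
    path z (suc i) = central z + sum z (suc i ⊓ n)

    module GoodPath {z : ℕ → ℕ} (G : Good z) where
      open Good G
      open Near (Walk z)
      private
        Y = path z
        r₀ = central z

      path-≤ : ∀ i → 0 < i → i ≤ n → Y i ≡ r₀ + sum z i
      path-≤ (suc i) _ le = cong (λ t → r₀ + sum z t) (m≤n⇒m⊓n≡m le)

      path-Dyck : Dyck Y
      path-Dyck = record { start = refl ; mono = mono′ ; end = end′ ; above = above′ }
        where
        end′ : Y b ≡ a
        end′ = trans (cong (λ t → r₀ + sum z t) (m≥n⇒m⊓n≡n (n≤1+n n))) (m∸n+n≡m bounded)
        mono′ : ∀ i → i ≤ n → Y i ≤ Y (suc i)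
        mono′ zero _ = z≤n
        mono′ (suc i) i<n = +-monoʳ-≤ r₀ (≤-trans (≤-reflexive (cong (sum z) (m≤n⇒m⊓n≡m i<n)))
          (≤-trans (sum-mono z (suc i) (suc (suc i) ⊓ n ∸ suc i)) (≤-reflexive (cong (sum z) (m+[n∸m]≡n (⊓-glb (n≤1+n (suc i)) i<n))))))
        above′ : ∀ i → i ≤ b → a * i ≤ b * Y i
        above′ zero _ = ≤-trans (≤-reflexive (*-zeroʳ a)) z≤n
        above′ (suc i) i≤b with m≤n⇒m<n∨m≡n i≤b
        ... | inj₁ (s≤s i<n) = subst (λ y → a * suc i ≤ b * y) (sym (path-≤ (suc i) (s≤s z≤n) i<n)) (<⇒≤ (positive (suc i) (s≤s z≤n) i<n))
        ... | inj₂ refl = ≤-reflexive (trans (*-comm a b) (cong (b *_) (sym end′)))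

      open OfDyck path-Dyck

      private
        shift-n : Shiftable (Walk z) n
        shift-n = walk-periodic n (period-n {z} periodic)

        shift-q : Shiftable (Walk z) q
        shift-q = walk-periodic q periodic

        S-walk : ∀ i → 0 < i → i ≤ n → S i ≡ Walk z i ℤ.+ + (b * r₀)
        S-walk i 0<i i≤n = trans (T-def Y i) (trans (cong (λ y → + y - + (a * i)) (trans (cong (b *_) (path-≤ i 0<i i≤n)) (*-distribˡ-+ b r₀ (sum z i))))
          (trans (lemma (+ (b * r₀)) (+ (b * sum z i)) (+ (a * i))) (cong (ℤ._+ + (b * r₀)) (sym (T-def (sum z) i)))))
          where
          lemma : ∀ r s t → (r ℤ.+ s) - t ≡ (s - t) ℤ.+ r
          lemma = solve-∀

        S⇒walk : ∀ i j → 0 < i → i ≤ n → 0 < j → j ≤ n → S i ℤ.< S j → Walk z i ℤ.< Walk z j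
        S⇒walk i j 0<i i≤n 0<j j≤n lt = ℤₚ.≰⇒> λ le → ℤₚ.<⇒≱ lt (subst₂ ℤ._≤_ (sym (S-walk j 0<j j≤n)) (sym (S-walk i 0<i i≤n)) (ℤₚ.+-monoˡ-≤ (+ (b * r₀)) le))

        walk-0 : r₀ ≡ 0 → ∀ j → 0 < j → j ≤ n → Walk z 0 ℤ.< Walk z j
        walk-0 r₀≡0 j 0<j j≤n = subst₂ ℤ._<_ (trans S0 (sym walk0)) (trans (S-walk j 0<j j≤n) (trans (cong (λ t → Walk z j ℤ.+ + t) (trans (cong (b *_) r₀≡0) (*-zeroʳ b))) (ℤₚ.+-identityʳ _))) (S-positive j 0<j j≤n)
          where
          walk0 : Walk z 0 ≡ + 0
          walk0 = trans (T-def (sum z) 0) (cong₂ (λ u v → + u - + v) (*-zeroʳ b) (*-zeroʳ a))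

        δ-formula : Walk z n ≡ + a - + (b * r₀)
        δ-formula = trans (T-def (sum z) n) (trans (lemma (+ (b * sum z n)) (+ (b * r₀)) (+ (a * n)))
          (trans (cong (λ t → + t - + (a * n) - + (b * r₀)) (trans (sym (*-distribˡ-+ b (sum z n) r₀)) (trans (cong (b *_) (m+[n∸m]≡n bounded)) (trans (cong (_+_ a) (*-comm n a)) refl))))
            (lemma′ (+ a) (+ (a * n)) (+ (b * r₀)))))
          where
          lemma : ∀ s r t → s - t ≡ (s ℤ.+ r) - t - r
          lemma = solve-∀
          lemma′ : ∀ a t r → (a ℤ.+ t) - t - r ≡ a - r
          lemma′ = solve-∀

        -- Black stands for the presence of a central block, white for its absence. Over `n` letters
        -- the walk changes by `a − b r₀`, which is negative in the black case and equals `a` in the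
        -- white one.
        black-drift : 0 < r₀ → ∀ i → Walk z (i + n) ℤ.< Walk z i
        black-drift lt i = subst (ℤ._< Walk z i) (sym (trans (proj₂ shift-n i) (cong (ℤ._+_ (Walk z i)) δ-formula)))
          (>-shift (Walk z i) a (b * r₀) (<-≤-trans (s≤s a≤n) (m≤m*n b r₀ {{ℕ.>-nonZero lt}})))

        -- The drift over one period q has the same sign as the drift over n = m q.
        iterate-≥ : ∀ k → (∀ i → Walk z i ℤ.≤ Walk z (i + q)) → ∀ i → Walk z i ℤ.≤ Walk z (i + k * q)
        iterate-≥ zero h i = ℤₚ.≤-reflexive (cong (Walk z) (sym (+-identityʳ i)))
        iterate-≥ (suc k) h i = ℤₚ.≤-trans (ℤₚ.≤-trans (iterate-≥ k h i) (h (i + k * q)))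
          (ℤₚ.≤-reflexive (cong (Walk z) (sym (trans (cong (_+_ i) (+-comm q (k * q))) (sym (+-assoc i (k * q) q))))))

        i+n : ∀ i → i + n ≡ i + m * q
        i+n i = cong (_+_ i) n≡mq

        black-q : 0 < r₀ → ∀ i → Walk z (i + q) ℤ.< Walk z i
        black-q lt i = ℤₚ.≰⇒> λ le → ℤₚ.<⇒≱ (black-drift lt i) (subst (λ t → Walk z i ℤ.≤ Walk z t) (sym (i+n i)) (iterate-≥ m (λ j → ℤₚ.≮⇒≥ λ lt′ → up j lt′ le) i))
          where
          up : ∀ j → Walk z (j + q) ℤ.< Walk z j → Walk z i ℤ.≤ Walk z (i + q) → ⊥
          up j lt′ le = ℤₚ.<⇒≱ lt′ (flip j le)
            where
            flip : ∀ j → Walk z i ℤ.≤ Walk z (i + q) → Walk z j ℤ.≤ Walk z (j + q)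
            flip j le = subst (Walk z j ℤ.≤_) (sym (proj₂ shift-q j)) (subst (ℤ._≤ Walk z j ℤ.+ δ) (ℤₚ.+-identityʳ _) (ℤₚ.+-monoʳ-≤ (Walk z j)
              (subst₂ ℤ._≤_ (cancel (Walk z i) (+ 0)) (cancel (Walk z i) δ) (ℤₚ.+-monoʳ-≤ (ℤ.- Walk z i) (subst₂ ℤ._≤_ (sym (ℤₚ.+-identityʳ _)) (proj₂ shift-q i) le)))))
              where
              δ = proj₁ shift-q
              cancel : ∀ u v → ℤ.- u ℤ.+ (u ℤ.+ v) ≡ v
              cancel = solve-∀

      -- If the parent `p` were more than `q` away, `p + q` would lie before `u`, hence above it. In
      -- the black case this contradicts the downward drift. In the white case translating back by
      -- `q` puts `u − q` below `p`, although it lies between `p` and `u`. The origin as parent is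
      -- excluded in the black case, where it belongs to the central block.
      near-parent : ∀ u → 0 < u → u ≤ n → 0 < psY u ⊎ r₀ ≡ 0 → IsNear (psY u) u
      near-parent u 0<u u≤n side = P′ , bound side
        where
        P = psY-spec u 0<u u≤n
        p = psY u
        p≤n = ≤-trans (<⇒≤ (before P)) u≤n
        low : 0 < p ⊎ r₀ ≡ 0 → Walk z p ℤ.< Walk z u
        low (inj₁ 0<p) = S⇒walk p u 0<p p≤n 0<u u≤n (smaller P)
        low (inj₂ e) with m≤n⇒m<n∨m≡n (z≤n {p})
        ... | inj₁ 0<p = S⇒walk p u 0<p p≤n 0<u u≤n (smaller P)
        ... | inj₂ 0≡p = subst (λ t → Walk z t ℤ.< Walk z u) 0≡p (walk-0 e u 0<u u≤n)
        P′ : PrevSmaller (Walk z) p u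
        P′ = prev (before P) (low side) (λ t p<t t<u → S⇒walk u t 0<u u≤n (≤-<-trans z≤n p<t) (≤-trans (<⇒≤ t<u) u≤n) (between P t p<t t<u))
        white-bound : r₀ ≡ 0 → u ≤ p + q
        white-bound e = ≮⇒≥ λ lt → contradiction lt (split-≥ {q} {u} (≤-trans (m≤n+m q p) (<⇒≤ lt)))
          where
          contradiction : p + q < u → (∃ λ u′ → u ≡ u′ + q) → ⊥
          contradiction lt (u′ , u≡) = ℤₚ.<-asym (unshift-< {Walk z} shift-q (subst (λ t → Walk z t ℤ.< Walk z (p + q)) u≡ (between P′ (p + q) (m<m+n p 0<q) lt)))
            (ℤₚ.<-trans (smaller P′) (between P′ u′ (+-cancelʳ-< q p u′ (subst (p + q <_) u≡ lt)) (subst (u′ <_) (sym u≡) (m<m+n u′ 0<q))))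
        bound : 0 < p ⊎ r₀ ≡ 0 → u ≤ p + q
        bound (inj₂ e) = white-bound e
        bound (inj₁ 0<p) with m≤n⇒m<n∨m≡n (z≤n {r₀})
        ... | inj₂ 0≡r₀ = white-bound (sym 0≡r₀)
        ... | inj₁ 0<r₀ = ≮⇒≥ λ lt → ℤₚ.<-asym (between P′ (p + q) (m<m+n p 0<q) lt) (ℤₚ.<-trans (black-q 0<r₀ p) (smaller P′))

      -- Positions between `n` and `u + n` are higher because the origin is the parent of `u`.
      -- Positions up to `n` are higher because the walk at `u + n` is at most its value `− b r₀` at
      -- `1 + n`, while `S x > 0` means that the walk at `x` exceeds `− b r₀`. The value at `1 + n`
      -- uses `z 0 = 0`.
      none-root : ∀ u → 0 < u → u ≤ n → psY u ≡ 0 → 0 < r₀ → None (u + n)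
      none-root u 0<u u≤n e 0<r₀ x x<U U≤ with ≤-<-connex x n
      ... | inj₂ n<x = inner (split-≥ {n} {x} (<⇒≤ n<x))
        where
        P : PrevSmaller S 0 u
        P = subst (λ p → PrevSmaller S p u) e (psY-spec u 0<u u≤n)
        inner : (∃ λ x′ → x ≡ x′ + n) → Walk z (u + n) ℤ.< Walk z x
        inner (x′ , refl) = shift-< {Walk z} shift-n (S⇒walk u x′ 0<u u≤n 0<x′ (≤-trans (<⇒≤ x′<u) u≤n) (between P x′ 0<x′ x′<u))
          where
          0<x′ : 0 < x′
          0<x′ = +-cancelʳ-< n 0 x′ n<x
          x′<u : x′ < u
          x′<u = +-cancelʳ-< n x′ u x<U
      ... | inj₁ x≤n = ℤₚ.≤-<-trans U≤1 1<x
        where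
        P : PrevSmaller S 0 u
        P = subst (λ p → PrevSmaller S p u) e (psY-spec u 0<u u≤n)
        0<x : 0 < x
        0<x = n≢0⇒n>0 λ { refl → <⇒≱ (+-mono-<-≤ 0<u q≤n) U≤ }
        U≤1 : Walk z (u + n) ℤ.≤ Walk z (1 + n)
        U≤1 with m≤n⇒m<n∨m≡n 0<u
        ... | inj₂ refl = ℤₚ.≤-refl
        ... | inj₁ 1<u = ℤₚ.<⇒≤ (shift-< {Walk z} shift-n (S⇒walk u 1 0<u u≤n (s≤s z≤n) 0<n (between P 1 (s≤s z≤n) 1<u)))
        z0≡0 : z 0 ≡ 0
        z0≡0 with centred
        ... | inj₁ e′ = ⊥-elim (<-irrefl (sym e′) 0<r₀)
        ... | inj₂ e′ = e′
        walk-1+n : Walk z (1 + n) ≡ ℤ.- + (b * r₀)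
        walk-1+n = trans (proj₂ shift-n 1) (trans (cong₂ ℤ._+_ (trans (T-def (sum z) 1) (cong₂ (λ u v → + u - + v) (trans (cong (b *_) z0≡0) (*-zeroʳ b)) (*-identityʳ a))) δ-formula) (lemma (+ a) (+ (b * r₀))))
          where
          lemma : ∀ a r → (+ 0 - a) ℤ.+ (a - r) ≡ ℤ.- r
          lemma = solve-∀
        1<x : Walk z (1 + n) ℤ.< Walk z x
        1<x = subst (ℤ._< Walk z x) (sym walk-1+n) (subst₂ ℤ._<_ (ℤₚ.+-identityˡ (ℤ.- + (b * r₀))) (trans (cong (_- + (b * r₀)) (S-walk x 0<x x≤n)) (lemma (Walk z x) (+ (b * r₀))))
            (ℤₚ.+-monoˡ-< (ℤ.- + (b * r₀)) (subst (ℤ._< S x) S0 (S-positive x 0<x x≤n))))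
          where
          lemma : ∀ u v → (u ℤ.+ v) - v ≡ u
          lemma = solve-∀

      private
        lift : ∀ r → suc (r + n) ≡ label r + n + r / n * n
        lift r = cong suc (trans (cong (_+ n) (m≡m%n+[m/n]*n r n)) (trans (+-assoc (r % n) _ n) (trans (cong (_+_ (r % n)) (+-comm (r / n * n) n)) (sym (+-assoc (r % n) n _)))))

        shift-kn : ∀ k → Shiftable (Walk z) (k * n)
        shift-kn k = walk-periodic (k * n) (λ i → trans (cong (λ t → z (i + t)) (trans (cong (k *_) n≡mq) (sym (*-assoc k m q)))) (multiple {z} periodic (k * m) i))

        classify : ∀ r → (∃ λ x → IsNear x (suc (r + n)) × x % n ≡ parent Y r) ⊎ (None (suc (r + n)) × parent Y r ≡ 0 × 0 < r₀)
        classify r with m≤n⇒m<n∨m≡n (z≤n {r₀}) | m≤n⇒m<n∨m≡n (z≤n {parent Y r})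
        ... | inj₂ 0≡r₀ | _ = inj₁ (near (inj₂ (sym 0≡r₀)))
          where
          near : 0 < parent Y r ⊎ r₀ ≡ 0 → ∃ λ x → IsNear x (suc (r + n)) × x % n ≡ parent Y r
          near side = parent Y r + n + r / n * n , subst (IsNear (parent Y r + n + r / n * n)) (sym (lift r)) (near-shift (shift-kn (r / n)) (near-shift shift-n (near-parent (label r) (0<label r) (label≤n r) side)))
            , trans ([m+kn]%n≡m%n (parent Y r + n) (r / n) n) (trans ([m+n]%n≡m%n (parent Y r) n) (m<n⇒m%n≡m (<-≤-trans (psY< (label r) (0<label r) (label≤n r)) (label≤n r))))
        ... | inj₁ _ | inj₁ 0<p = inj₁ (parent Y r + n + r / n * n , subst (IsNear (parent Y r + n + r / n * n)) (sym (lift r)) (near-shift (shift-kn (r / n)) (near-shift shift-n (near-parent (label r) (0<label r) (label≤n r) (inj₁ 0<p))))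
            , trans ([m+kn]%n≡m%n (parent Y r + n) (r / n) n) (trans ([m+n]%n≡m%n (parent Y r) n) (m<n⇒m%n≡m (<-≤-trans (psY< (label r) (0<label r) (label≤n r)) (label≤n r)))))
        ... | inj₁ 0<r₀ | inj₂ 0≡p = inj₂ (subst None (sym (lift r)) (none-shift (shift-kn (r / n)) (≤-trans q≤n (m≤n+m n _)) (none-root (label r) (0<label r) (label≤n r) (sym 0≡p) 0<r₀)) , sym 0≡p , 0<r₀)

      rise-path : ∀ x → 0 < x → x < n → rise Y x ≡ z x
      rise-path x 0<x x<n = trans (cong₂ _∸_ (path-≤ (suc x) (s≤s z≤n) x<n) (path-≤ x 0<x (<⇒≤ x<n)))
        (trans (cong (_∸ (r₀ + sum z x)) (sym (+-assoc r₀ (sum z x) (z x)))) (m+n∸m≡n (r₀ + sum z x) (z x)))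

      rise-path-0 : rise Y 0 ≡ r₀ + z 0
      rise-path-0 = path-≤ 1 (s≤s z≤n) 0<n

      path-represents : Represents Y z
      path-represents = record { kin⇒ = to ; kin⇐ = from ; rank-z = ranks ; blocks = blocks′ }
        where
        to : ∀ r s → parent Y r ≡ parent Y s → Kin (suc (r + n)) (suc (s + n))
        to r s e with classify r | classify s
        ... | inj₁ (x , nx , ex) | inj₁ (y , ny , ey) = inj₂ (x , y , nx , ny , trans ex (trans e (sym ey)))
        ... | inj₂ (nn , _) | inj₂ (nn′ , _) = inj₁ (nn , nn′)
        ... | inj₁ (x , nx , ex) | inj₂ (nn , p≡0 , 0<r₀) with centred
        ...   | inj₁ r₀≡0 = ⊥-elim (<-irrefl (sym r₀≡0) 0<r₀)
        ...   | inj₂ _ = ⊥-elim (impossible r (x , nx) (trans e p≡0) 0<r₀)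
          where
          impossible : ∀ r → (∃ λ x → IsNear x (suc (r + n))) → parent Y r ≡ 0 → 0 < r₀ → ⊥
          impossible r (x , nx) p≡0 0<r₀ = near-none nx (subst None (sym (lift r)) (none-shift (shift-kn (r / n)) (≤-trans q≤n (m≤n+m n _)) (none-root (label r) (0<label r) (label≤n r) p≡0 0<r₀)))
        to r s e | inj₂ (nn , p≡0 , 0<r₀) | inj₁ (y , ny , ey) =
          ⊥-elim (near-none ny (subst None (sym (lift s)) (none-shift (shift-kn (s / n)) (≤-trans q≤n (m≤n+m n _)) (none-root (label s) (0<label s) (label≤n s) (trans (sym e) p≡0) 0<r₀))))
        from : ∀ r s → Kin (suc (r + n)) (suc (s + n)) → parent Y r ≡ parent Y s
        from r s k with classify r | classify s
        from r s (inj₁ (nn , _)) | inj₁ (x , nx , _) | _ = ⊥-elim (near-none nx nn)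
        from r s (inj₁ (_ , nn)) | inj₂ _ | inj₁ (y , ny , _) = ⊥-elim (near-none ny nn)
        from r s _ | inj₂ (_ , p≡0 , _) | inj₂ (_ , p′≡0 , _) = trans p≡0 (sym p′≡0)
        from r s (inj₂ (_ , _ , nx , _)) | inj₂ (nn , _) | inj₁ _ = ⊥-elim (near-none nx nn)
        from r s (inj₂ (_ , _ , _ , ny , _)) | inj₁ _ | inj₂ (nn , _) = ⊥-elim (near-none ny nn)
        from r s (inj₂ (x′ , y′ , nx′ , ny′ , e)) | inj₁ (x , nx , ex) | inj₁ (y , ny , ey) =
          trans (sym ex) (trans (cong (_% n) (prevSmaller-unique (proj₁ nx) (proj₁ nx′))) (trans e (trans (cong (_% n) (prevSmaller-unique (proj₁ ny′) (proj₁ ny))) ey)))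
        ranks : ∀ x → 0 < z x → rank Y x ≡ z x
        ranks x 0<zx = trans (cong (rise Y) parent≡) rise≡
          where
          x′ = x % n
          z≡ : z x ≡ z x′
          z≡ = mod-n {z} periodic x
          rise≡ : rise Y x′ ≡ z x
          rise≡ with m≤n⇒m<n∨m≡n (z≤n {x′})
          ... | inj₁ 0<x′ = trans (rise-path x′ 0<x′ (m%n<n x n)) (sym z≡)
          ... | inj₂ 0≡x′ with centred
          ...   | inj₁ r₀≡0 = trans (cong (rise Y) (sym 0≡x′)) (trans rise-path-0 (trans (cong (_+ z 0) r₀≡0) (trans (cong z 0≡x′) (sym z≡))))
          ...   | inj₂ z0≡0 = ⊥-elim (<-irrefl (sym (trans z≡ (trans (cong z (sym 0≡x′)) z0≡0))) 0<zx)
          parent≡ : parent Y x ≡ x′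
          parent≡ = ps-of {S} (prev ≤-refl (rise-positive x′ (subst (0 <_) (sym rise≡) 0<zx)) (λ t x′<t t≤x′ → ⊥-elim (<⇒≱ x′<t (≤-pred t≤x′))))
        blocks′ : nonflat Y ≡ m * count (λ t → 0 <ᵇ z t) q + indicator (0 <ᵇ r₀)
        blocks′ = trans split (cong (_+ indicator (0 <ᵇ r₀)) (trans (cong (count (λ t → 0 <ᵇ z t)) n≡mq) (count-multiple {z} periodic m)))
          where
          split′ : ∀ K → n ≡ suc K → nonflat Y ≡ count (λ t → 0 <ᵇ z t) n + indicator (0 <ᵇ r₀)
          split′ K n≡ = trans (cong (count (λ x → 0 <ᵇ rise Y x)) n≡) (trans (count-suc _ K) (trans (cong₂ _+_ heads (count-cong K (λ x x<N → cong (0 <ᵇ_) (rise-path (suc x) (s≤s z≤n) (subst (suc x <_) (sym n≡) (s≤s x<N))))))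
              (trans (trans (+-assoc (indicator (0 <ᵇ z 0)) _ _) (trans (cong (_+_ (indicator (0 <ᵇ z 0))) (+-comm (indicator (0 <ᵇ r₀)) _)) (sym (+-assoc (indicator (0 <ᵇ z 0)) _ _))))
                (cong (_+ indicator (0 <ᵇ r₀)) (trans (sym (count-suc _ K)) (cong (count (λ t → 0 <ᵇ z t)) (sym n≡)))))))
            where
            -- The run at the origin is `r₀ + z 0` with one summand equal to zero, so it counts as a
            -- single block opening.
            heads : indicator (0 <ᵇ rise Y 0) ≡ indicator (0 <ᵇ z 0) + indicator (0 <ᵇ r₀)
            heads with centred
            ... | inj₁ e = trans (cong (λ t → indicator (0 <ᵇ t)) (trans rise-path-0 (cong (_+ z 0) e))) (sym (trans (cong (λ t → indicator (0 <ᵇ z 0) + indicator (0 <ᵇ t)) e) (+-identityʳ _)))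
            ... | inj₂ e = trans (cong (λ t → indicator (0 <ᵇ t)) (trans rise-path-0 (trans (cong (_+_ r₀) e) (+-identityʳ r₀)))) (sym (cong (λ t → indicator (0 <ᵇ t) + indicator (0 <ᵇ r₀)) e))
          split : nonflat Y ≡ count (λ t → 0 <ᵇ z t) n + indicator (0 <ᵇ r₀)
          split = split′ (ℕ.pred n) (sym (suc-pred n))

  -- Uniqueness of the periodic word

  module FixedPaths (a n : ℕ) (0<a : 0 < a) (a≤n : a ≤ n) (coprime : Coprime a (suc n))
                    (q m : ℕ) (n≡mq : n ≡ m * q) (2≤m : 2 ≤ m) where
    open Periodic a n 0<a a≤n coprime q m n≡mq 2≤m public

    q-nonZero : NonZero q
    q-nonZero = ℕ.>-nonZero 0<q

    shift : ℕ → (ℕ → ℕ) → ℕ → ℕ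
    shift c z t = z (t + c)

    shift-periodic : ∀ c {z} → IsPeriodic z → IsPeriodic (shift c z)
    shift-periodic c {z} per i = trans (cong z (trans (+-assoc i q c) (trans (cong (_+_ i) (+-comm q c)) (sym (+-assoc i c q))))) (per (i + c))

    private
      sum-shift-n : ∀ c {z} → (∀ i → z (i + n) ≡ z i) → sum (shift c z) n ≡ sum z n
      sum-shift-n c {z} per = +-cancelʳ-≡ (sum z c) _ _ (trans (sym (sum-+ z c n)) (trans (cong (sum z) (+-comm n c))
        (trans (sum-+ z n c) (trans (cong (_+ sum z n) (sum-cong c (λ t _ → per t))) (+-comm (sum z c) (sum z n))))))

      count-shift-q : ∀ c {z} → IsPeriodic z → count (λ t → 0 <ᵇ z (t + c)) q ≡ count (λ t → 0 <ᵇ z t) q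
      count-shift-q c {z} per = +-cancelʳ-≡ (count P c) _ _ (trans (sym (count-+ P c q)) (trans (cong (count P) (+-comm q c))
        (trans (count-+ P q c) (trans (cong (_+ count P q) (count-cong c (λ t _ → cong (0 <ᵇ_) (per t)))) (+-comm (count P c) (count P q))))))
        where P = λ t → 0 <ᵇ z t

    sum-shift : ∀ c {z} → IsPeriodic z → sum (shift c z) n ≡ sum z n
    sum-shift c {z} per = sum-shift-n c {z} (period-n {z} per)

    central-shift : ∀ c {z} → IsPeriodic z → central (shift c z) ≡ central z
    central-shift c {z} per = cong (a ∸_) (sum-shift-n c {z} (period-n {z} per))

    private
      module Translate (c : ℕ) (z : ℕ → ℕ) where
        module N = Near (Walk z)
        module Nc = Near (Walk (shift c z))

        up : ∀ {i j} → Walk (shift c z) i ℤ.< Walk (shift c z) j → Walk z (i + c) ℤ.< Walk z (j + c)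
        up {i} {j} lt = subst₂ ℤ._<_ (sym (walk-shift z c i)) (sym (walk-shift z c j)) (ℤₚ.+-monoˡ-< (Walk z c) lt)

        down : ∀ {i j} → Walk z (i + c) ℤ.< Walk z (j + c) → Walk (shift c z) i ℤ.< Walk (shift c z) j
        down {i} {j} lt = ℤₚ.≰⇒> λ le → ℤₚ.<⇒≱ lt (subst₂ ℤ._≤_ (sym (walk-shift z c j)) (sym (walk-shift z c i)) (ℤₚ.+-monoˡ-≤ (Walk z c) le))

        swap : ∀ x → x + q + c ≡ x + c + q
        swap x = trans (+-assoc x q c) (trans (cong (_+_ x) (+-comm q c)) (sym (+-assoc x c q)))

        near-up : ∀ {x U} → Nc.IsNear x U → N.IsNear (x + c) (U + c)
        near-up {x} {U} (P , le) = prev (+-monoˡ-< c (before P)) (up (smaller P)) btw , subst (U + c ≤_) (swap x) (+-monoˡ-≤ c le)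
          where
          btw : ∀ t → x + c < t → t < U + c → Walk z (U + c) ℤ.< Walk z t
          btw t lt lt′ with split-≥ {c} {t} (≤-trans (m≤n+m c x) (<⇒≤ lt))
          ... | t′ , refl = up (between P t′ (+-cancelʳ-< c x t′ lt) (+-cancelʳ-< c t′ U lt′))

        near-down : ∀ {x U} → N.IsNear (x + c) (U + c) → Nc.IsNear x U
        near-down {x} {U} (P , le) = prev (+-cancelʳ-< c x U (before P)) (down (smaller P))
            (λ t lt lt′ → down (between P (t + c) (+-monoˡ-< c lt) (+-monoˡ-< c lt′)))
          , +-cancelʳ-≤ c U (x + q) (subst (U + c ≤_) (sym (swap x)) le)

        low : ∀ {U x} → q ≤ U → U + c ≤ x + q → c ≤ x
        low {U} {x} qU le = +-cancelʳ-≤ q c x (≤-trans (subst (_≤ U + c) (+-comm q c) (+-monoˡ-≤ c qU)) le)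

        none-up : ∀ {U} → q ≤ U → Nc.None U → N.None (U + c)
        none-up {U} qU nn x lt le with split-≥ {c} {x} (low qU le)
        ... | x′ , refl = up (nn x′ (+-cancelʳ-< c x′ U lt) (+-cancelʳ-≤ c U (x′ + q) (subst (U + c ≤_) (sym (swap x′)) le)))

        none-down : ∀ {U} → N.None (U + c) → Nc.None U
        none-down {U} nn x lt le = down (nn (x + c) (+-monoˡ-< c lt) (subst (U + c ≤_) (swap x) (+-monoˡ-≤ c le)))

        kin-up : ∀ {U V} → q ≤ U → q ≤ V → Nc.Kin U V → N.Kin (U + c) (V + c)
        kin-up qU qV (inj₁ (u , v)) = inj₁ (none-up qU u , none-up qV v)
        kin-up qU qV (inj₂ (x , y , nu , nv , e)) = inj₂ (x + c , y + c , near-up nu , near-up nv , %-+ n x y c e)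

        kin-down : ∀ {U V} → q ≤ U → q ≤ V → N.Kin (U + c) (V + c) → Nc.Kin U V
        kin-down qU qV (inj₁ (u , v)) = inj₁ (none-down u , none-down v)
        kin-down qU qV (inj₂ (x , y , nu , nv , e)) with split-≥ {c} {x} (low qU (proj₂ nu)) | split-≥ {c} {y} (low qV (proj₂ nv))
        ... | x′ , refl | y′ , refl = inj₂ (x′ , y′ , near-down nu , near-down nv , %-+⁻ n x′ y′ c e)

      q≤lift : ∀ r → q ≤ suc (r + n)
      q≤lift r = ≤-trans q≤n (≤-trans (m≤n+m n r) (n≤1+n _))

      swap-n : ∀ r c → suc (r + c + n) ≡ suc (r + n) + c
      swap-n r c = cong suc (trans (+-assoc r c n) (trans (cong (_+_ r) (+-comm c n)) (sym (+-assoc r n c))))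

    represents-shift : ∀ c {Y Y′ z} → IsPeriodic z → Rotated c Y Y′ → Represents Y′ z → Represents Y (shift c z)
    represents-shift c {Y} {Y′} {z} per R rep = record
      { kin⇒ = λ r s e → Tr.kin-down (q≤lift r) (q≤lift s) (subst₂ Tr.N.Kin (swap-n r c) (swap-n s c) (kin⇒ rep (r + c) (s + c) (kin-to R r s e)))
      ; kin⇐ = λ r s k → kin-from R r s (kin⇐ rep (r + c) (s + c) (subst₂ Tr.N.Kin (sym (swap-n r c)) (sym (swap-n s c)) (Tr.kin-up (q≤lift r) (q≤lift s) k)))
      ; rank-z = λ x pos → trans (sym (rank≡ R x)) (rank-z rep (x + c) pos)
      ; blocks = trans (sym (nonflat≡ R)) (trans (blocks rep) (cong₂ (λ u v → m * u + indicator (0 <ᵇ v)) (sym (count-shift-q c {z} per)) (sym (central-shift c {z} per)))) }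
      where module Tr = Translate c z

    represents-unshift : ∀ c {Y Y′ z} → IsPeriodic z → Rotated c Y Y′ → Represents Y (shift c z) → Represents Y′ z
    represents-unshift c {Y} {Y′} {z} per R rep = record
      { kin⇒ = λ r s e → N.kin-unshift sh (q≤lift r) (q≤lift s) (subst₂ N.Kin (goal r) (goal s)
          (Tr.kin-up (q≤lift (back r)) (q≤lift (back s)) (kin⇒ rep (back r) (back s) (kin-from R (back r) (back s) (trans (at r) (trans e (sym (at s))))))))
      ; kin⇐ = λ r s k → trans (sym (at r)) (trans (kin-to R (back r) (back s) (kin⇐ rep (back r) (back s)
          (Tr.kin-down (q≤lift (back r)) (q≤lift (back s)) (subst₂ N.Kin (sym (goal r)) (sym (goal s)) (N.kin-shift sh (q≤lift r) (q≤lift s) k))))) (at s))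
      ; rank-z = λ x pos → trans (cong (rise Y′) (sym (at x))) (trans (rank≡ R (back x)) (trans (rank-z rep (back x) (subst (0 <_) (sym (zat x)) pos)) (zat x)))
      ; blocks = trans (nonflat≡ R) (trans (blocks rep) (cong₂ (λ u v → m * u + indicator (0 <ᵇ v)) (count-shift-q c {z} per) (central-shift c {z} per))) }
      where
      module Tr = Translate c z
      module N = Near (Walk z)
      -- Subtraction of `c` modulo `n`, written as addition of `c (n − 1)`.
      back : ℕ → ℕ
      back r = r + c * (n ∸ 1)
      back+c : ∀ r → back r + c ≡ r + c * n
      back+c r = trans (+-assoc r _ c) (cong (_+_ r) (trans (+-comm _ c) (trans (sym (*-suc c (n ∸ 1))) (cong (c *_) (suc-pred n)))))
      at : ∀ r → parent Y′ (back r + c) ≡ parent Y′ r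
      at r = parent-% Y′ (back r + c) r (trans (cong (_% n) (back+c r)) ([m+kn]%n≡m%n r c n))
      per-cn : ∀ i → z (i + c * n) ≡ z i
      per-cn i = trans (cong (λ t → z (i + t)) (trans (cong (c *_) n≡mq) (sym (*-assoc c m q)))) (multiple {z} per (c * m) i)
      zat : ∀ x → z (back x + c) ≡ z x
      zat x = trans (cong z (back+c x)) (per-cn x)
      sh : Shiftable (Walk z) (c * n)
      sh = walk-periodic (c * n) per-cn
      goal : ∀ r → suc (back r + n) + c ≡ suc (r + n) + c * n
      goal r = trans (sym (swap-n (back r) c)) (trans (cong (λ t → suc (t + n)) (back+c r)) (swap-n r (c * n)))

    represents-fixed : ∀ {Y z} → IsPeriodic z → Represents Y z → ∀ r s → parent Y r ≡ parent Y s → parent Y (r + q) ≡ parent Y (s + q)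
    represents-fixed {Y} {z} per rep r s e = kin⇐ rep (r + q) (s + q) (subst₂ N.Kin (sym (swap-n r q)) (sym (swap-n s q))
      (N.kin-shift (walk-periodic q per) (q≤lift r) (q≤lift s) (kin⇒ rep r s e)))
      where module N = Near (Walk z)

    represents-same : ∀ {Y Y′ z} → Represents Y z → Represents Y′ z → partition Y ≡ partition Y′
    represents-same {Y} {Y′} R R′ = partition-cong {Y} {Y′} (λ r s e → kin⇐ R′ r s (kin⇒ R r s e)) (λ r s e → kin⇐ R r s (kin⇒ R′ r s e))

    -- None of the `q` labels cyclically before the one at `x` is its kin; going back by `l` is
    -- going forward by `n − l`. The positions of the positive letters are recovered from the
    -- partition in this way.
    FirstOfHull : (ℕ → ℕ) → ℕ → Set
    FirstOfHull Y x = ∀ l → 0 < l → l ≤ q → parent Y (x + (n ∸ l)) ≢ parent Y x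

    module Recover {Y z : ℕ → ℕ} (per : IsPeriodic z) (rep : Represents Y z) (x : ℕ) where
      open Near (Walk z)
      private
        W = x + n + n
        zW : z W ≡ z x
        zW = trans (period-n {z} per (x + n)) (period-n {z} per x)

        sh-n : Shiftable (Walk z) n
        sh-n = walk-periodic n (period-n {z} per)

        lift-l : ∀ l → l ≤ q → suc (x + (n ∸ l) + n) + l ≡ suc W
        lift-l l l≤q = cong suc (trans (+-assoc (x + (n ∸ l)) n l) (trans (cong (_+_ (x + (n ∸ l))) (+-comm n l)) (trans (sym (+-assoc (x + (n ∸ l)) l n))
          (cong (_+ n) (trans (+-assoc x (n ∸ l) l) (cong (_+_ x) (m∸n+n≡m (≤-trans l≤q q≤n))))))))

        q≤x : q ≤ suc (x + n)
        q≤x = q≤lift x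

      -- both labels lifted next to W; the second differs from suc W by l
      kin-lift : ∀ l → 0 < l → l ≤ q → parent Y (x + (n ∸ l)) ≡ parent Y x → Kin (suc (x + (n ∸ l) + n)) (suc W)
      kin-lift l 0<l l≤q e = to (kin⇒ rep (x + (n ∸ l)) x e)
        where
        to : Kin (suc (x + (n ∸ l) + n)) (suc (x + n)) → Kin (suc (x + (n ∸ l) + n)) (suc W)
        to (inj₁ (u , v)) = inj₁ (u , none-shift sh-n q≤x v)
        to (inj₂ (y , y′ , nu , nv , e)) = inj₂ (y , y′ + n , nu , near-shift sh-n nv , trans e (sym ([m+n]%n≡m%n y′ n)))

      kin-unlift : ∀ l → Kin (suc (x + (n ∸ l) + n)) (suc W) → parent Y (x + (n ∸ l)) ≡ parent Y x
      kin-unlift l k = kin⇐ rep (x + (n ∸ l)) x (to k)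
        where
        to : Kin (suc (x + (n ∸ l) + n)) (suc W) → Kin (suc (x + (n ∸ l) + n)) (suc (x + n))
        to (inj₁ (u , v)) = inj₁ (u , none-unshift sh-n v)
        to (inj₂ (y , y′ , nu , nv , e)) with split-≥ {n} {y′} (+-cancelʳ-≤ q n y′ (≤-trans (subst (_≤ suc W) (+-comm q n) (+-monoˡ-≤ n q≤x)) (proj₂ nv)))
        ... | y″ , refl = inj₂ (y , y″ , nu , near-unshift sh-n nv , trans e ([m+n]%n≡m%n y″ n))

      positive⇒first : 0 < z x → FirstOfHull Y x
      positive⇒first pos l 0<l l≤q e = contradiction (kin-lift l 0<l l≤q e)
        where
        near-W : IsNear W (suc W)
        near-W = prev ≤-refl (walk-rise z W (subst (0 <_) (sym zW) pos)) (λ t lt lt′ → ⊥-elim (<⇒≱ lt (≤-pred lt′)))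
          , subst (_≤ W + q) (+-comm W 1) (+-monoʳ-≤ W 0<q)
        contradiction : Kin (suc (x + (n ∸ l) + n)) (suc W) → ⊥
        contradiction (inj₁ (_ , nn)) = near-none near-W nn
        contradiction (inj₂ (y , y′ , (P , le) , ny′ , r)) = residue-distinct n y (W ∸ y) (m<n⇒0<n∸m y<W) d<n
            (trans (cong (_% n) (m+[n∸m]≡n (<⇒≤ y<W))) (trans (cong (_% n) (prevSmaller-unique (proj₁ near-W) (proj₁ ny′))) (sym r)))
          where
          U = suc (x + (n ∸ l) + n)
          U+l : U + l ≡ suc W
          U+l = lift-l l l≤q
          y<W : y < W
          y<W = ≤-pred (subst₂ _<_ (+-comm y 1) U+l (+-mono-<-≤ (before P) 0<l))
          d<n : W ∸ y < n
          d<n = <-≤-trans (+-cancelˡ-< y (W ∸ y) (q + q) (subst (_< y + (q + q)) (sym (m+[n∸m]≡n (<⇒≤ y<W)))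
             (subst₂ _≤_ U+l (+-assoc y q q) (+-mono-≤ le l≤q)))) 2q≤n

      -- The lift `suc W` either has no near parent, and then neither has the label `q` before it,
      -- so both are central; or it has a near parent `p` different from `W`, since the walk falls
      -- at `W`, and then `suc p` is an earlier kin at distance at most `q`.
      zero⇒not-first : z x ≡ 0 → ¬ FirstOfHull Y x
      zero⇒not-first z≡0 first with near-or-none z (suc W) (s≤s z≤n)
      ... | inj₂ nn = first q 0<q ≤-refl (kin-unlift q (inj₁ (none-unshift (walk-periodic q per) (subst None (sym (lift-l q ≤-refl)) nn) , nn)))
      ... | inj₁ (p , P , le) = first l 0<l l≤q (kin-unlift l (inj₂ (p , p , subst (IsNear p) (sym U≡) near-sp , (P , le) , refl)))
        where
        p≢W : p ≢ W
        p≢W refl = ℤₚ.<-asym (smaller P) (walk-flat z W (trans zW z≡0))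
        p<W : p < W
        p<W = ≤∧≢⇒< (≤-pred (before P)) p≢W
        l = W ∸ p
        0<l : 0 < l
        0<l = m<n⇒0<n∸m p<W
        l≤q : l ≤ q
        l≤q = +-cancelˡ-≤ p l q (subst (_≤ p + q) (sym (m+[n∸m]≡n (<⇒≤ p<W))) (<⇒≤ le))
        U≡ : suc (x + (n ∸ l) + n) ≡ suc p
        U≡ = +-cancelʳ-≡ l _ _ (trans (lift-l l l≤q) (sym (cong suc (m+[n∸m]≡n (<⇒≤ p<W)))))
        near-sp : IsNear p (suc p)
        near-sp = prev ≤-refl (ℤₚ.<-trans (smaller P) (between P (suc p) ≤-refl (s≤s p<W))) (λ t lt lt′ → ⊥-elim (<⇒≱ lt (≤-pred lt′)))
          , subst (_≤ p + q) (+-comm p 1) (+-monoʳ-≤ p 0<q)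

    represents-unique : ∀ {Y z z′} → IsPeriodic z → IsPeriodic z′ → Represents Y z → Represents Y z′ → ∀ x → z x ≡ z′ x
    represents-unique {Y} {z} {z′} per per′ R R′ x with z x in e | z′ x in e′
    ... | zero | zero = refl
    ... | zero | suc v = ⊥-elim (Recover.zero⇒not-first per R x e (Recover.positive⇒first per′ R′ x (subst (0 <_) (sym e′) (s≤s z≤n))))
    ... | suc u | zero = ⊥-elim (Recover.zero⇒not-first per′ R′ x e′ (Recover.positive⇒first per R x (subst (0 <_) (sym e) (s≤s z≤n))))
    ... | suc u | suc v = trans (sym e) (trans (sym (rank-z R x (subst (0 <_) (sym e) (s≤s z≤n)))) (trans (rank-z R′ x (subst (0 <_) (sym e′) (s≤s z≤n))) e′))

    -- Some translate starts at a minimum of the walk (white centre) or at a record (black centre).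
    module GoodShift {z : ℕ → ℕ} (per : IsPeriodic z) (bounded : sum z n ≤ a) where
      private
        r₀ = central z
        W = Walk z

        W-n : ∀ t → W (t + n) ≡ W t ℤ.+ (+ a - + (b * r₀))
        W-n t = trans (walk-shift z n t) (cong₂ ℤ._+_ (T-cong t (sum-cong t (λ i _ → period-n {z} per i))) drift)
          where
          drift : W n ≡ + a - + (b * r₀)
          drift = trans (T-def (sum z) n) (trans (lemma (+ (b * sum z n)) (+ (b * r₀)) (+ (a * n)))
            (trans (cong (λ t → + t - + (a * n) - + (b * r₀)) (trans (sym (*-distribˡ-+ b (sum z n) r₀)) (trans (cong (b *_) (m+[n∸m]≡n bounded)) (cong (_+_ a) (*-comm n a)))))
              (lemma′ (+ a) (+ (a * n)) (+ (b * r₀)))))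
            where
            lemma : ∀ s r t → s - t ≡ (s ℤ.+ r) - t - r
            lemma = solve-∀
            lemma′ : ∀ a t r → (a ℤ.+ t) - t - r ≡ a - r
            lemma′ = solve-∀

        build : ∀ c → r₀ ≡ 0 ⊎ z c ≡ 0 → (∀ i → 0 < i → i ≤ n → W c ℤ.< W (i + c) ℤ.+ + (b * r₀)) → Good (shift c z)
        build c centred above = record
          { periodic = shift-periodic c {z} per
          ; bounded = subst (_≤ a) (sym (sum-shift-n c {z} (period-n {z} per))) bounded
          ; centred = centre centred
          ; positive = λ i 0<i i≤n → subst (λ t → a * i < b * (t + sum (shift c z) i)) (sym (central-shift c {z} per)) (pos i 0<i i≤n) }
          where
          centre : r₀ ≡ 0 ⊎ z c ≡ 0 → central (shift c z) ≡ 0 ⊎ z c ≡ 0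
          centre (inj₁ e) = inj₁ (trans (central-shift c {z} per) e)
          centre (inj₂ e) = inj₂ e
          pos : ∀ i → 0 < i → i ≤ n → a * i < b * (r₀ + sum (shift c z) i)
          pos i 0<i i≤n = <-unshift (W c) (b * (r₀ + sum (shift c z) i)) (a * i) (subst (W c ℤ.<_) (trans (cong (ℤ._+ + (b * r₀)) (trans (walk-shift z c i) (cong (ℤ._+ W c) (T-def (sum (shift c z)) i))))
              (trans (lemma (+ (b * sum (shift c z) i)) (+ (a * i)) (W c) (+ (b * r₀))) (cong (λ t → W c ℤ.+ (+ t - + (a * i))) (sym (*-distribˡ-+ b r₀ (sum (shift c z) i))))))
            (above i 0<i i≤n))
            where
            lemma : ∀ s t w r → (s - t ℤ.+ w) ℤ.+ r ≡ w ℤ.+ ((r ℤ.+ s) - t)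
            lemma = solve-∀

        white : r₀ ≡ 0 → ∃ λ c → Good (shift c z)
        white r₀≡0 with argmin W n
        ... | c , c≤n , min = c , build c (inj₁ r₀≡0) λ i 0<i i≤n → subst (W c ℤ.<_) (sym (trans (cong (λ t → W (i + c) ℤ.+ + (b * t)) r₀≡0) (trans (cong (λ t → W (i + c) ℤ.+ + t) (*-zeroʳ b)) (ℤₚ.+-identityʳ _)))) (low i 0<i i≤n)
          where
          rising : ∀ t → W t ℤ.< W (t + n)
          rising t = subst (W t ℤ.<_) (sym (W-n t)) (<-shift (W t) a (b * r₀) (subst (_< a) (sym (trans (cong (b *_) r₀≡0) (*-zeroʳ b))) 0<a))
          low : ∀ i → 0 < i → i ≤ n → W c ℤ.< W (i + c)
          low i 0<i i≤n with ≤-<-connex (i + c) n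
          ... | inj₁ le = ℤₚ.≤∧≢⇒< (min (i + c) le) (T-distinct (sum z) c (i + c) (m<n+m c 0<i) (subst (i + c <_) (+-comm b c) (+-monoˡ-< c (s≤s i≤n))))
          ... | inj₂ gt with split-≥ {n} {i + c} (<⇒≤ gt)
          ...   | t , e = subst (λ u → W c ℤ.< W u) (sym e) (ℤₚ.≤-<-trans (min t (+-cancelʳ-≤ n t n (subst (_≤ n + n) e (+-mono-≤ i≤n c≤n)))) (rising t))

        black : 0 < r₀ → ∃ λ c → Good (shift c z)
        black 0<r₀ with argmin (λ t → W (suc t)) (n ∸ 1)
        -- The cut is made one step before the minimum. The walk cannot rise into a minimum, so the
        -- letter at the cut is 0 and the origin is free for the run of the central block.
        ... | c , c≤ , min = c , build c (inj₂ z≡0) low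
          where
          c<n : c < n
          c<n = subst (c <_) (suc-pred n) (s≤s c≤)
          min′ : ∀ t → 0 < t → t ≤ n → W (suc c) ℤ.≤ W t
          min′ (suc t) _ le = min t (≤-pred (subst (suc t ≤_) (sym (suc-pred n)) le))
          falling : ∀ t → W (t + n) ℤ.< W t
          falling t = subst (ℤ._< W t) (sym (W-n t)) (>-shift (W t) a (b * r₀) (<-≤-trans (s≤s a≤n) (m≤m*n b r₀ {{ℕ.>-nonZero 0<r₀}})))
          Wsc≤ : W (suc c) ℤ.≤ W c
          Wsc≤ with m≤n⇒m<n∨m≡n (z≤n {c})
          ... | inj₁ 0<c = min′ c 0<c (<⇒≤ c<n)
          ... | inj₂ refl = ℤₚ.≤-trans (min′ n 0<n ≤-refl) (ℤₚ.<⇒≤ (falling 0))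
          z≡0 : z c ≡ 0
          z≡0 with z c in e
          ... | zero = refl
          ... | suc _ = ⊥-elim (ℤₚ.<⇒≱ (walk-rise z c (subst (0 <_) (sym e) (s≤s z≤n))) Wsc≤)
          Wsc : W (suc c) ≡ W c - + a
          Wsc = trans (cong W (+-comm 1 c)) (trans (T-difference (sum z) c 1 0 (trans (cong (sum z) (+-comm c 1)) (cong (_+_ (sum z c)) z≡0)))
            (trans (cong₂ (λ u v → W c ℤ.+ (+ u - + v)) (*-zeroʳ b) (*-identityʳ a)) (lemma (W c) (+ a))))
            where
            lemma : ∀ w a → w ℤ.+ (+ 0 - a) ≡ w - a
            lemma = solve-∀
          a<br : + a ℤ.< + (b * r₀)
          a<br = ℤ.+<+ (<-≤-trans (s≤s a≤n) (m≤m*n b r₀ {{ℕ.>-nonZero 0<r₀}}))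
          low : ∀ i → 0 < i → i ≤ n → W c ℤ.< W (i + c) ℤ.+ + (b * r₀)
          low i 0<i i≤n with ≤-<-connex (i + c) n
          ... | inj₁ le = ℤₚ.≤-<-trans (ℤₚ.≤-reflexive (lemma (W c) (+ a))) (ℤₚ.+-mono-≤-< (subst (ℤ._≤ W (i + c)) Wsc (min′ (i + c) (<-≤-trans 0<i (m≤m+n i c)) le)) a<br)
            where
            lemma : ∀ w a → w ≡ w - a ℤ.+ a
            lemma = solve-∀
          ... | inj₂ gt with split-≥ {n} {i + c} (<⇒≤ gt)
          ...   | t , e = subst (W c ℤ.<_) (sym (trans (cong (λ u → W u ℤ.+ + (b * r₀)) e) (trans (cong (ℤ._+ + (b * r₀)) (W-n t)) (lemma (W t) (+ a) (+ (b * r₀))))))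
                    (ℤₚ.≤-<-trans (ℤₚ.≤-reflexive (lemma′ (W c) (+ a))) (ℤₚ.+-monoˡ-< (+ a) (subst (ℤ._< W t) Wsc strict)))
            where
            lemma : ∀ w a r → w ℤ.+ (a - r) ℤ.+ r ≡ w ℤ.+ a
            lemma = solve-∀
            lemma′ : ∀ w a → w ≡ w - a ℤ.+ a
            lemma′ = solve-∀
            0<t : 0 < t
            0<t = +-cancelʳ-< n 0 t (subst (n <_) e gt)
            t≤c : t ≤ c
            t≤c = +-cancelʳ-≤ n t c (subst₂ _≤_ e (+-comm n c) (+-monoˡ-≤ c i≤n))
            strict : W (suc c) ℤ.< W t
            strict = ℤₚ.≤∧≢⇒< (min′ t 0<t (≤-trans t≤c (<⇒≤ c<n))) (λ eq → T-distinct (sum z) t (suc c) (s≤s t≤c) (<-≤-trans (s≤s c<n) (m≤n+m b t)) (sym eq))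

      good-shift : ∃ λ c → Good (shift c z)
      good-shift with m≤n⇒m<n∨m≡n (z≤n {r₀})
      ... | inj₁ 0<r₀ = black 0<r₀
      ... | inj₂ 0≡r₀ = white (sym 0≡r₀)

    represented : ∀ {z} → IsPeriodic z → sum z n ≤ a → ∃ λ Y → Dyck Y × Represents Y z
    represented {z} per bounded with GoodShift.good-shift {z} per bounded
    ... | c , G with rotate c (GoodPath.path-Dyck G)
    ...   | Y , D , R = Y , D , represents-unshift c {z = z} per R (GoodPath.path-represents G)

  -- Existence of the periodic word

  module TotalFixed (a n : ℕ) (0<a : 0 < a) (a≤n : a ≤ n) (coprime : Coprime a (suc n))
                    (q m : ℕ) (n≡mq : n ≡ m * q) (2≤m : 2 ≤ m) where
    open FixedPaths a n 0<a a≤n coprime q m n≡mq 2≤m public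

    private instance
      q≢0 : NonZero q
      q≢0 = q-nonZero

    represents-cong : ∀ {Y Y′ z} → Dyck Y → (∀ i → i ≤ b → Y i ≡ Y′ i) → Represents Y z → Represents Y′ z
    represents-cong {Y} {Y′} {z} D e rep = record
      { kin⇒ = λ r s k → kin⇒ rep r s (trans (p≡ r) (trans k (sym (p≡ s))))
      ; kin⇐ = λ r s k → trans (sym (p≡ r)) (trans (kin⇐ rep r s k) (p≡ s))
      ; rank-z = λ x pos → trans (trans (cong (rise Y′) (sym (p≡ x))) (sym (rise≡ (parent Y x) (<-≤-trans (OfDyck.psY< D (label x) (0<label x) (label≤n x)) (label≤n x))))) (rank-z rep x pos)
      ; blocks = trans (count-cong n (λ x x<n → cong (0 <ᵇ_) (sym (rise≡ x x<n)))) (blocks rep) }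
      where
      p≡ : ∀ r → parent Y r ≡ parent Y′ r
      p≡ = parent-cong {Y} {Y′} e
      rise≡ : ∀ x → x < n → rise Y x ≡ rise Y′ x
      rise≡ x x<n = cong₂ _∸_ (e (suc x) (m≤n⇒m≤1+n x<n)) (e x (≤-trans (<⇒≤ x<n) (n≤1+n n)))

    record FixedDyck (Y : ℕ → ℕ) : Set where
      field
        dyck       : Dyck Y
        kin-shift  : ∀ r s → parent Y r ≡ parent Y s → parent Y (r + q) ≡ parent Y (s + q)
        rank-shift : ∀ r → rank Y (r + q) ≡ rank Y r

    +n-parent : ∀ Y r → parent Y (r + n) ≡ parent Y r
    +n-parent Y r = parent-% Y (r + n) r ([m+n]%n≡m%n r n)

    kin-unshift : ∀ {Y} → (∀ r s → parent Y r ≡ parent Y s → parent Y (r + q) ≡ parent Y (s + q)) →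
      ∀ r s → parent Y (r + q) ≡ parent Y (s + q) → parent Y r ≡ parent Y s
    kin-unshift {Y} ks r s e = trans (sym (around r)) (trans (iterate (m ∸ 1) (r + q) (s + q) e) (around s))
      where
      iterate : ∀ k r s → parent Y r ≡ parent Y s → parent Y (r + k * q) ≡ parent Y (s + k * q)
      iterate zero r s e = subst₂ (λ u v → parent Y u ≡ parent Y v) (sym (+-identityʳ r)) (sym (+-identityʳ s)) e
      iterate (suc k) r s e = subst₂ (λ u v → parent Y u ≡ parent Y v) (+-assoc r q (k * q)) (+-assoc s q (k * q)) (iterate k (r + q) (s + q) (ks r s e))
      around : ∀ r → parent Y (r + q + (m ∸ 1) * q) ≡ parent Y r
      around r = trans (cong (parent Y) (trans (+-assoc r q _) (cong (_+_ r) (trans (cong (_* q) (m+[n∸m]≡n {1} {m} (<⇒≤ 2≤m))) (sym n≡mq))))) (+n-parent Y r)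

    -- Ranks need no separate hypothesis: the path rotated by `q` has the same partition, hence is
    -- the same path, and rotation carries ranks along.
    fixed-from-kin : ∀ {Y} → Dyck Y → (∀ r s → parent Y r ≡ parent Y s → parent Y (r + q) ≡ parent Y (s + q)) → FixedDyck Y
    fixed-from-kin {Y} D ks = record { dyck = D ; kin-shift = ks ; rank-shift = ranks }
      where
      ranks : ∀ r → rank Y (r + q) ≡ rank Y r
      ranks r with rotate q D
      ... | Y′ , D′ , R = trans (cong₂ _∸_ (Y≡ (suc p) (m≤n⇒m≤1+n p<n)) (Y≡ p (<⇒≤ (m≤n⇒m≤1+n p<n)))) (trans (cong (rise Y′) p≡) (rank≡ R r))
        where
        back : ∀ r → ∃ λ r′ → parent Y (r′ + q) ≡ parent Y r × parent Y′ (r′ + q) ≡ parent Y′ r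
        back r = r + (m ∸ 1) * q , at Y , at Y′
          where
          at : ∀ Y → parent Y (r + (m ∸ 1) * q + q) ≡ parent Y r
          at Y = trans (cong (parent Y) (trans (+-assoc r _ q) (cong (_+_ r) (trans (+-comm _ q) (trans (cong (_* q) (m+[n∸m]≡n {1} {m} (<⇒≤ 2≤m))) (sym n≡mq)))))) (+n-parent Y r)
        same : partition Y ≡ partition Y′
        same = partition-cong {Y} {Y′} to from
          where
          to : ∀ r s → parent Y r ≡ parent Y s → parent Y′ r ≡ parent Y′ s
          to r s e with back r | back s
          ... | r′ , er , er′ | s′ , es , es′ = trans (sym er′) (trans (kin-to R r′ s′ (kin-unshift {Y} ks r′ s′ (trans er (trans e (sym es))))) es′)
          from : ∀ r s → parent Y′ r ≡ parent Y′ s → parent Y r ≡ parent Y s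
          from r s e with back r | back s
          ... | r′ , er , er′ | s′ , es , es′ = trans (sym er) (trans (ks r′ s′ (kin-from R r′ s′ (trans er′ (trans e (sym es′))))) es)
        Y≡ : ∀ u → u ≤ b → Y u ≡ Y′ u
        Y≡ = partition-injective D D′ same
        p = parent Y (r + q)
        p≡ : p ≡ parent Y′ (r + q)
        p≡ = parent-cong {Y} {Y′} Y≡ (r + q)
        p<n : p < n
        p<n = <-≤-trans (OfDyck.psY< D (label (r + q)) (0<label (r + q)) (label≤n (r + q))) (label≤n (r + q))

    module RotatedBack {c : ℕ} {Y Y′ : ℕ → ℕ} (R : Rotated c Y Y′) where
      back : ℕ → ℕ
      back r = r + c * (n ∸ 1)

      at-back : ∀ r → parent Y′ (back r + c) ≡ parent Y′ r
      at-back r = parent-% Y′ (back r + c) r (trans (cong (_% n) (trans (+-assoc r _ c) (cong (_+_ r) (trans (+-comm _ c) (trans (sym (*-suc c (n ∸ 1))) (cong (c *_) (suc-pred n))))))) ([m+kn]%n≡m%n r c n))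

      kin-back : ∀ r s → parent Y′ r ≡ parent Y′ s → parent Y (back r) ≡ parent Y (back s)
      kin-back r s e = kin-from R (back r) (back s) (trans (at-back r) (trans e (sym (at-back s))))

      kin-forth : ∀ r s → parent Y (back r) ≡ parent Y (back s) → parent Y′ r ≡ parent Y′ s
      kin-forth r s e = trans (sym (at-back r)) (trans (kin-to R (back r) (back s) e) (at-back s))

      back-+ : ∀ r l → back (r + l) ≡ back r + l
      back-+ r l = trans (+-assoc r l _) (trans (cong (_+_ r) (+-comm l _)) (sym (+-assoc r _ l)))

    rotate-fixed : ∀ c {Y} → FixedDyck Y → ∃ λ Y′ → FixedDyck Y′ × Rotated c Y Y′
    rotate-fixed c {Y} F with rotate c (FixedDyck.dyck F)
    ... | Y′ , D′ , R = Y′ , fixed-from-kin D′ (λ r s e → kin-forth (r + q) (s + q) (subst₂ (λ u v → parent Y u ≡ parent Y v) (sym (back-+ r q)) (sym (back-+ s q))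
            (FixedDyck.kin-shift F (back r) (back s) (kin-back r s e)))) , R
      where open RotatedBack R

    module Fix {Y : ℕ → ℕ} (F : FixedDyck Y) where
      open FixedDyck F
      open OfDyck dyck
      private
        K : ℕ → ℕ → Set
        K r s = parent Y r ≡ parent Y s

        unshift : ∀ r s → K (r + q) (s + q) → K r s
        unshift = kin-unshift {Y} kin-shift

      rise-parent : ∀ r → r < n → 0 < rise Y r → parent Y r ≡ r
      rise-parent r r<n pos = trans (parent-ps Y r r<n) (ps-of {S} (prev ≤-refl (rise-positive r pos) (λ t r<t t≤r → ⊥-elim (<⇒≱ r<t (≤-pred t≤r)))))

      -- Of the parents of `u` and `x`, the larger one would have to lie both above and below labels
      -- of the other block if they differed; in either order the four positions give a cycle of
      -- strict inequalities.
      noncrossing : ∀ u x w v → u < x → x < w → w < v → v < n → K u w → K x v → K u x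
      noncrossing u x w v u<x x<w w<v v<n uw xv with <-cmp (psY (suc u)) (psY (suc x))
      ... | tri≈ _ e _ = trans (parent-ps Y u u<n) (trans e (sym (parent-ps Y x x<n)))
        where
        x<n = <-trans x<w (<-trans w<v v<n)
        u<n = <-trans u<x x<n
      ... | tri< p<p′ _ _ = ⊥-elim (ℤₚ.<-asym (smaller V) (ℤₚ.<-trans (between V (suc w) (<-trans (before X) (s≤s x<w)) (s≤s w<v)) (between W (psY (suc x)) p<p′ (<-trans (before X) (s≤s x<w)))))
        where
        w<n = <-trans w<v v<n
        x<n = <-trans x<w w<n
        u<n = <-trans u<x x<n
        X = psY-spec (suc x) (s≤s z≤n) x<n
        W : PrevSmaller S (psY (suc u)) (suc w)
        W = subst (λ p → PrevSmaller S p (suc w)) (trans (sym (parent-ps Y w w<n)) (trans (sym uw) (parent-ps Y u u<n))) (psY-spec (suc w) (s≤s z≤n) w<n)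
        V : PrevSmaller S (psY (suc x)) (suc v)
        V = subst (λ p → PrevSmaller S p (suc v)) (trans (sym (parent-ps Y v v<n)) (trans (sym xv) (parent-ps Y x x<n))) (psY-spec (suc v) (s≤s z≤n) v<n)
      ... | tri> _ _ p′<p = ⊥-elim (ℤₚ.<-asym (ℤₚ.<-trans (smaller W) (between W (suc x) (<-trans (before U) (s≤s u<x)) (s≤s x<w))) (between X (psY (suc u)) p′<p (<-trans (before U) (s≤s u<x))))
        where
        w<n = <-trans w<v v<n
        x<n = <-trans x<w w<n
        u<n = <-trans u<x x<n
        U = psY-spec (suc u) (s≤s z≤n) u<n
        X = psY-spec (suc x) (s≤s z≤n) x<n
        W : PrevSmaller S (psY (suc u)) (suc w)
        W = subst (λ p → PrevSmaller S p (suc w)) (trans (sym (parent-ps Y w w<n)) (trans (sym uw) (parent-ps Y u u<n))) (psY-spec (suc w) (s≤s z≤n) w<n)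

      -- A label has a run just before it when it opens its block, and this property is compatible
      -- with translation by `q`. The exception is an earlier kin of `r + q` in the first period,
      -- which has no translate to the left; the hypothesis on `p < q` covers it.
      rise-step : ∀ r → r + q < n → (∀ p → p < q → K p (r + q) → rise Y r ≡ 0) → rise Y (r + q) ≡ rise Y r
      rise-step r r+q<n clean with rise Y (r + q) in eq | rise Y r in eq′
      ... | zero | zero = refl
      ... | suc u | zero = ⊥-elim (first-of-block dyck (r + q) r+q<n (subst (0 <_) (sym eq) (s≤s z≤n)) (p + q) (+-monoˡ-< q (proj₁ nf)) (kin-shift p r (proj₂ nf)))
        where
        r<n = ≤-<-trans (m≤m+n r q) r+q<n
        nf = not-first dyck r r<n eq′
        p = parent Y r
      ... | suc u | suc v = trans (sym eq) (trans (cong (rise Y) (sym (rise-parent (r + q) r+q<n (subst (0 <_) (sym eq) (s≤s z≤n)))))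
            (trans (rank-shift r) (trans (cong (rise Y) (rise-parent r r<n (subst (0 <_) (sym eq′) (s≤s z≤n)))) eq′)))
        where
        r<n = ≤-<-trans (m≤m+n r q) r+q<n
      ... | zero | suc v with ≤-<-connex q (parent Y (r + q))
      ...   | inj₂ p<q = sym (clean (parent Y (r + q)) p<q (proj₂ (not-first dyck (r + q) r+q<n eq)))
      ...   | inj₁ q≤p with split-≥ q≤p
      ...     | p′ , p≡ = ⊥-elim (first-of-block dyck r (≤-<-trans (m≤m+n r q) r+q<n) (subst (0 <_) (sym eq′) (s≤s z≤n)) p′
                  (+-cancelʳ-< q p′ r (subst (_< r + q) p≡ (proj₁ nf))) (unshift p′ r (trans (cong (parent Y) (sym p≡)) (proj₂ nf))))
        where nf = not-first dyck (r + q) r+q<n eq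

      -- A q-periodic z that agrees with the north runs away from the origin represents Y.
      represents-from-rises : ∀ z → IsPeriodic z → (∀ i → 0 < i → i < n → rise Y i ≡ z i) → z 0 ≡ 0 ⊎ rise Y 0 ≡ z 0 → ∃ λ z → IsPeriodic z × sum z n ≤ a × Represents Y z
      represents-from-rises z per rises origin = z , per , bounded , represents-cong (GoodPath.path-Dyck G) path≡ (GoodPath.path-represents G)
        where
        sumY : ∀ i → i ≤ n → sum (rise Y) i ≡ Y i
        sumY i i≤n = sum-rise Y n (start dyck) (λ j j<n → mono dyck j (<⇒≤ j<n)) i i≤n
        split : z 0 ≡ 0 ⊎ rise Y 0 ≡ z 0 → ∃ λ r → rise Y 0 ≡ r + z 0 × (r ≡ 0 ⊎ z 0 ≡ 0)
        split (inj₁ e) = rise Y 0 , sym (trans (cong (_+_ (rise Y 0)) e) (+-identityʳ _)) , inj₂ e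
        split (inj₂ e) = 0 , e , inj₁ refl
        head = split origin
        r = proj₁ head
        sum≡ : ∀ i → suc i ≤ n → sum (rise Y) (suc i) ≡ r + sum z (suc i)
        sum≡ zero _ = proj₁ (proj₂ head)
        sum≡ (suc i) lt = trans (cong₂ _+_ (sum≡ i (<⇒≤ lt)) (rises (suc i) (s≤s z≤n) lt)) (+-assoc r _ _)
        Y≡ : ∀ i → 0 < i → i ≤ n → Y i ≡ r + sum z i
        Y≡ (suc i) _ le = trans (sym (sumY (suc i) le)) (sum≡ i le)
        total : r + sum z n ≡ a
        total = trans (sym (Y≡ n 0<n ≤-refl)) last-flat
        bounded : sum z n ≤ a
        bounded = subst (sum z n ≤_) total (m≤n+m _ r)
        central≡ : central z ≡ r
        central≡ = trans (cong (_∸ sum z n) (sym total)) (m+n∸n≡m r (sum z n))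
        centre : r ≡ 0 ⊎ z 0 ≡ 0 → central z ≡ 0 ⊎ z 0 ≡ 0
        centre (inj₁ e) = inj₁ (trans central≡ e)
        centre (inj₂ e) = inj₂ e
        strict : ∀ i → 0 < i → i ≤ n → a * i < b * Y i
        strict i 0<i i≤n = ≤∧≢⇒< (above dyck i (m≤n⇒m≤1+n i≤n)) λ e → ℤₚ.<-irrefl
          (trans S0 (sym (trans (T-def Y i) (trans (cong (λ t → + t - + (a * i)) (sym e)) (ℤₚ.+-inverseʳ (+ (a * i))))))) (S-positive i 0<i i≤n)
        G : Good z
        G = record { periodic = per ; bounded = bounded ; centred = centre (proj₂ (proj₂ head))
          ; positive = λ i 0<i i≤n → subst (λ t → a * i < b * t) (trans (Y≡ i 0<i i≤n) (cong (_+ sum z i) (sym central≡))) (strict i 0<i i≤n) }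
        path≡ : ∀ i → i ≤ b → path z i ≡ Y i
        path≡ zero _ = sym (start dyck)
        path≡ (suc i) i<b with m≤n⇒m<n∨m≡n i<b
        ... | inj₁ (s≤s i<n) = trans (GoodPath.path-≤ G (suc i) (s≤s z≤n) i<n) (trans (cong (_+ sum z (suc i)) central≡) (sym (Y≡ (suc i) (s≤s z≤n) i<n)))
        ... | inj₂ refl = trans (end (GoodPath.path-Dyck G)) (sym (end dyck))

      private
        decompose : ∀ (P : ℕ → Set) → (∀ r k → r < q → P (r + k * q)) → ∀ i → P i
        decompose P h i = subst P (sym (m≡m%n+[m/n]*n i q)) (h (i % q) (i / q) (m%n<n i q))

        next : ∀ r k → r + suc k * q ≡ r + k * q + q
        next r k = trans (cong (_+_ r) (+-comm q (k * q))) (sym (+-assoc r (k * q) q))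

      module Black (E0q : K 0 q) where
        E0kq : ∀ k → K 0 (k * q)
        E0kq zero = refl
        E0kq (suc k) = trans E0q (trans (kin-shift 0 (k * q) (E0kq k)) (cong (parent Y) (+-comm (k * q) q)))

        m₁ = m ∸ 1
        n≡ : n ≡ q + m₁ * q
        n≡ = trans n≡mq (cong (_* q) (sym (m+[n∸m]≡n {1} {m} (<⇒≤ 2≤m))))

        root-flat : ∀ i → 0 < i → i < n → K 0 i → rise Y i ≡ 0
        root-flat i 0<i i<n e with rise Y i in eq
        ... | zero = refl
        ... | suc _ = ⊥-elim (first-of-block dyck i i<n (subst (0 <_) (sym eq) (s≤s z≤n)) 0 0<i e)

        -- Translated back by `q` around the circle, `p` becomes `v = p + (m − 1) q`, at or behind
        -- the multiple `w = (m − 1) q` of `q`, which is kin to 0. As `0 < r < w ≤ v`, the block of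
        -- `r` and `v` cannot avoid that of 0 and `w`, and within the block of 0 only 0 opens it.
        clean : ∀ r → 0 < r → r + q < n → ∀ p → p < q → K p (r + q) → rise Y r ≡ 0
        clean r 0<r r+q<n p p<q e = root-flat r 0<r (≤-<-trans (m≤m+n r q) r+q<n) (root (m≤n⇒m<n∨m≡n (z≤n {p})))
          where
          w = m₁ * q
          v = p + w
          r<w : r < w
          r<w = +-cancelʳ-< q r w (subst (r + q <_) (trans n≡ (+-comm q w)) r+q<n)
          v<n : v < n
          v<n = subst (v <_) (sym n≡) (+-monoˡ-< w p<q)
          rv : K r v
          rv = unshift r v (trans (sym e) (sym (trans (cong (parent Y) (trans (+-assoc p w q) (cong (_+_ p) (trans (+-comm w q) (sym n≡))))) (+n-parent Y p))))
          root : 0 < p ⊎ 0 ≡ p → K 0 r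
          root (inj₂ refl) = trans (E0kq m₁) (sym rv)
          root (inj₁ 0<p) = noncrossing 0 r w v 0<r r<w (m<n+m w 0<p) v<n (E0kq m₁) rv

        z : ℕ → ℕ
        z i with i % q
        ... | zero = 0
        ... | suc r = rise Y (suc r)

        z-zero : ∀ i → i % q ≡ 0 → z i ≡ 0
        z-zero i e rewrite e = refl

        z-suc : ∀ i r → i % q ≡ suc r → z i ≡ rise Y (suc r)
        z-suc i r e rewrite e = refl

        z-cong : ∀ i j → i % q ≡ j % q → z i ≡ z j
        z-cong i j e with j % q in eq
        ... | zero = z-zero i e
        ... | suc r = z-suc i r e

        rises : ∀ i → 0 < i → i < n → rise Y i ≡ z i
        rises = decompose (λ i → 0 < i → i < n → rise Y i ≡ z i) go
          where
          residue : ∀ r k → r < q → (r + k * q) % q ≡ r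
          residue r k r<q = trans ([m+kn]%n≡m%n r k q) (m<n⇒m%n≡m r<q)
          go : ∀ r k → r < q → 0 < r + k * q → r + k * q < n → rise Y (r + k * q) ≡ z (r + k * q)
          go zero k r<q 0<i i<n = trans (root-flat (k * q) 0<i i<n (E0kq k)) (sym (z-zero (k * q) (residue 0 k r<q)))
          go (suc r) zero r<q 0<i i<n = trans (cong (rise Y) (+-identityʳ (suc r))) (sym (z-suc (suc r + 0) r (residue (suc r) 0 r<q)))
          go (suc r) (suc k) r<q 0<i i<n = trans (cong (rise Y) (next (suc r) k)) (trans (rise-step (suc r + k * q) i<n′ (clean (suc r + k * q) (s≤s z≤n) i<n′))
              (trans (go (suc r) k r<q (s≤s z≤n) (≤-<-trans (m≤m+n (suc r + k * q) q) i<n′)) (z-cong (suc r + k * q) (suc r + suc k * q) (trans (residue (suc r) k r<q) (sym (residue (suc r) (suc k) r<q))))))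
            where
            i<n′ : suc r + k * q + q < n
            i<n′ = subst (_< n) (next (suc r) k) i<n

        result : ∃ λ z → IsPeriodic z × sum z n ≤ a × Represents Y z
        result = represents-from-rises z (λ i → z-cong (i + q) i ([m+n]%n≡m%n i q)) rises (inj₁ (z-zero 0 (m<n⇒m%n≡m 0<q)))

      -- No block is fixed; 0 and l are kin at the largest distance below q, so the hull of their block is maximal
      -- and no block straddles the cut just before 0 (mod q).
      module White (free : ∀ r → ¬ K r (r + q)) (l : ℕ) (l<q : l < q) (E0l : K 0 l) (maximal : ∀ x l′ → l < l′ → l′ < q → ¬ K x (x + l′)) where
        private
          too-wide : ∀ x y → x + l < y → y < x + q → ¬ K x y
          too-wide x y lt lt′ e = maximal x (y ∸ x) (+-cancelˡ-< x l (y ∸ x) (subst (x + l <_) (sym x+) lt)) (+-cancelˡ-< x (y ∸ x) q (subst (_< x + q) (sym x+) lt′)) (trans e (cong (parent Y) (sym x+)))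
            where
            x+ : x + (y ∸ x) ≡ y
            x+ = m+[n∸m]≡n (≤-trans (m≤m+n x l) (<⇒≤ lt))

          -- A kin `j` of 0 brings along `j + q`, a kin of `q`. If `j + q < n` the two pairs cross.
          -- Otherwise it comes around to `u = j + q − n`, and comparing `u` with the hull from 0 to
          -- `l` yields a block equal to its translate or a pair that is too wide.
          root-kin : ∀ j → q < j → j < q + q → j < n → K 0 j → ⊥
          root-kin j q<j j<2q j<n e with <-cmp (j + q) n
          ... | tri< lt _ _ = free 0 (noncrossing 0 q j (j + q) 0<q q<j (m<m+n j 0<q) lt e (kin-shift 0 j e))
          ... | tri≈ _ eq _ = free j (trans (sym e) (sym (trans (cong (parent Y) eq) (+n-parent Y 0))))
          ... | tri> _ _ gt with split-≥ {n} {j + q} (<⇒≤ gt)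
          ...   | u , j+q≡ = compare (<-cmp l u)
            where
            qu : K q u
            qu = trans (kin-shift 0 j e) (trans (cong (parent Y) j+q≡) (+n-parent Y u))
            0<u : 0 < u
            0<u = +-cancelʳ-< n 0 u (subst (n <_) j+q≡ gt)
            compare : Tri (l < u) (l ≡ u) (u < l) → ⊥
            compare (tri< l<u _ _) = too-wide j (n + l) (subst (j + l <_) refl (+-monoˡ-< l j<n)) n+l<j+q (trans (sym e) (trans E0l (sym (trans (cong (parent Y) (+-comm n l)) (+n-parent Y l)))))
              where
              n+l<j+q : n + l < j + q
              n+l<j+q = subst (n + l <_) (sym (trans j+q≡ (+-comm u n))) (+-monoʳ-< n l<u)
            compare (tri≈ _ refl _) = free j (trans (sym e) (trans E0l (sym (trans (cong (parent Y) j+q≡) (+n-parent Y l)))))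
            compare (tri> _ _ u<l) = free 0 (trans (noncrossing 0 u l q 0<u u<l l<q (<-trans q<j j<n) E0l (sym qu)) (sym qu))

          -- If `p ≤ l`, the hull from 0 to `l` forces `j` into the block of 0. If `p > l`, the
          -- interval from `p` to `j` meets the translated hull from `q` to `q + l`, and one obtains
          -- a kin pair at a distance strictly between `l` and `q`.
          narrow : ∀ p j → p < q → q ≤ j → j < n → j < p + q → K p j → ⊥
          narrow p j p<q q≤j j<n j<p+q e with ≤-<-connex p l
          ... | inj₁ p≤l = finish (m≤n⇒m<n∨m≡n q≤j)
            where
            root : 0 < p ⊎ 0 ≡ p → p < l ⊎ p ≡ l → K 0 p
            root (inj₂ refl) _ = refl
            root _ (inj₂ refl) = E0l
            root (inj₁ 0<p) (inj₁ p<l) = noncrossing 0 p l j 0<p p<l (<-≤-trans l<q q≤j) j<n E0l e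
            E0j : K 0 j
            E0j = trans (root (m≤n⇒m<n∨m≡n z≤n) (m≤n⇒m<n∨m≡n p≤l)) e
            finish : q < j ⊎ q ≡ j → ⊥
            finish (inj₂ refl) = free 0 E0j
            finish (inj₁ q<j) = root-kin j q<j (<-trans j<p+q (+-monoˡ-< q p<q)) j<n E0j
          ... | inj₂ l<p = compare (<-cmp j (q + l)) (m≤n⇒m<n∨m≡n q≤j)
            where
            Eql : K q (q + l)
            Eql = trans (kin-shift 0 l E0l) (cong (parent Y) (+-comm l q))
            p+l<q+l : p + l < q + l
            p+l<q+l = +-monoˡ-< l p<q
            q+l<p+q : q + l < p + q
            q+l<p+q = subst (_< p + q) (+-comm l q) (+-monoˡ-< q l<p)
            q+l<n : q + l < n
            q+l<n = <-≤-trans (+-monoʳ-< q l<q) 2q≤n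
            compare : Tri (j < q + l) (j ≡ q + l) (q + l < j) → q < j ⊎ q ≡ j → ⊥
            compare (tri> _ _ gt) _ = too-wide p j (<-trans p+l<q+l gt) j<p+q e
            compare (tri≈ _ refl _) _ = too-wide p (q + l) p+l<q+l q+l<p+q e
            compare (tri< _ _ _) (inj₂ refl) = too-wide p (q + l) p+l<q+l q+l<p+q (trans e Eql)
            compare (tri< lt _ _) (inj₁ q<j) = too-wide p (q + l) p+l<q+l q+l<p+q (trans (noncrossing p q j (q + l) p<q q<j lt q+l<n e Eql) Eql)

        -- Distances below `q` are `narrow`. A distance above `n − q` becomes one below `q` after
        -- translation by `q` around the circle. In between, a block crosses its translate and would
        -- coincide with it, against `free`.
        clean : ∀ p j → p < q → q ≤ j → j < n → ¬ K p j
        clean p j p<q q≤j j<n e with <-cmp j (p + q)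
        ... | tri< lt _ _ = narrow p j p<q q≤j j<n lt e
        ... | tri≈ _ refl _ = free p e
        ... | tri> _ _ gt with <-cmp (j + q) (p + n)
        ...   | tri≈ _ eq _ = free j (trans (sym e) (sym (trans (cong (parent Y) eq) (+n-parent Y p))))
        ...   | tri> _ _ gt′ with split-≥ {n} {j + q} (≤-trans (m≤n+m n p) (<⇒≤ gt′))
        ...     | u , eq = narrow u (p + q) u<q (m≤n+m q p) (<-≤-trans (+-monoˡ-< q p<q) 2q≤n) (+-monoˡ-< q p<u)
                    (sym (trans (kin-shift p j e) (trans (cong (parent Y) eq) (+n-parent Y u))))
          where
          p<u : p < u
          p<u = +-cancelʳ-< n p u (subst (p + n <_) eq gt′)
          u<q : u < q
          u<q = +-cancelʳ-< n u q (subst₂ _<_ eq (+-comm n q) (+-monoˡ-< q j<n))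
        clean p j p<q q≤j j<n e | tri> _ _ gt | tri< lt _ _ with ≤-<-connex n (j + q)
        ... | inj₂ j+q<n = free p (noncrossing p (p + q) j (j + q) (m<m+n p 0<q) gt (m<m+n j 0<q) j+q<n e (kin-shift p j e))
        ... | inj₁ n≤j+q with split-≥ n≤j+q
        ...   | u , eq = free p (trans (sym (noncrossing u p (p + q) j u<p (m<m+n p 0<q) gt j<n (sym pu) e)) (sym pu))
          where
          pu : K (p + q) u
          pu = trans (kin-shift p j e) (trans (cong (parent Y) eq) (+n-parent Y u))
          u<p : u < p
          u<p = +-cancelʳ-< n u p (subst (_< p + n) eq lt)

        z : ℕ → ℕ
        z i = rise Y (i % q)

        rises : ∀ i → i < n → rise Y i ≡ z i
        rises = decompose (λ i → i < n → rise Y i ≡ z i) go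
          where
          residue : ∀ r k → r < q → (r + k * q) % q ≡ r
          residue r k r<q = trans ([m+kn]%n≡m%n r k q) (m<n⇒m%n≡m r<q)
          go : ∀ r k → r < q → r + k * q < n → rise Y (r + k * q) ≡ z (r + k * q)
          go r zero r<q i<n = cong (rise Y) (trans (+-identityʳ r) (sym (residue r 0 r<q)))
          go r (suc k) r<q i<n = trans (cong (rise Y) (next r k)) (trans (rise-step (r + k * q) i<n′ (λ p p<q e → ⊥-elim (clean p (r + k * q + q) p<q (m≤n+m q _) i<n′ e)))
              (trans (go r k r<q (≤-<-trans (m≤m+n (r + k * q) q) i<n′)) (cong (rise Y) (trans (residue r k r<q) (sym (residue r (suc k) r<q))))))
            where
            i<n′ : r + k * q + q < n
            i<n′ = subst (_< n) (next r k) i<n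

        result : ∃ λ z → IsPeriodic z × sum z n ≤ a × Represents Y z
        result = represents-from-rises z (λ i → cong (rise Y) ([m+n]%n≡m%n i q)) (λ i _ → rises i) (inj₂ (rises 0 0<n))

    fixed-represented : ∀ {Y} → FixedDyck Y → ∃ λ z → IsPeriodic z × sum z n ≤ a × Represents Y z
    fixed-represented {Y} F with anyUpTo? (λ r → parent Y r ℕ.≟ parent Y (r + q)) n
    -- A block equal to its translate by `q` is the central one; it is rotated until it contains the
    -- label at 0.
    ... | yes (r , r<n , e) = back (rotate-fixed (n ∸ r) F)
      where
      back : (∃ λ Y′ → FixedDyck Y′ × Rotated (n ∸ r) Y Y′) → ∃ λ z → IsPeriodic z × sum z n ≤ a × Represents Y z
      back (Y′ , F′ , R) with Fix.Black.result F′ E0q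
        where
        to-n : r + (n ∸ r) ≡ n
        to-n = m+[n∸m]≡n (<⇒≤ r<n)
        E0q : parent Y′ 0 ≡ parent Y′ q
        E0q = trans (sym (+n-parent Y′ 0)) (trans (cong (parent Y′) (sym to-n)) (trans (kin-to R r (r + q) e)
          (trans (cong (parent Y′) (trans (+-assoc r q _) (trans (cong (_+_ r) (+-comm q _)) (trans (sym (+-assoc r _ q)) (trans (cong (_+ q) to-n) (+-comm n q)))))) (+n-parent Y′ q))))
      ... | z , per , bounded , rep = shift (n ∸ r) z , shift-periodic (n ∸ r) {z} per
          , subst (_≤ a) (sym (sum-shift (n ∸ r) {z} per)) bounded , represents-shift (n ∸ r) {z = z} per R rep
    ... | no none = from-widest (search q ≤-refl (λ x l′ q≤l′ l′<q → ⊥-elim (<⇒≱ l′<q q≤l′)))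
      where
      K : ℕ → ℕ → Set
      K r s = parent Y r ≡ parent Y s
      reduce : ∀ x l → K x (x + l) → K (x % n) (x % n + l)
      reduce x l e = trans (parent-% Y (x % n) x (m%n%n≡m%n x n)) (trans e (parent-% Y (x + l) (x % n + l) (%-+ n x (x % n) l (sym (m%n%n≡m%n x n)))))
      free : ∀ r → ¬ K r (r + q)
      free r e = none (r % n , m%n<n r n , reduce r q e)
      Widest : ℕ → Set
      Widest l = l < q × (∃ λ x → x < n × K x (x + l)) × (∀ x l′ → l < l′ → l′ < q → ¬ K x (x + l′))
      search : ∀ k → k ≤ q → (∀ x l′ → k ≤ l′ → l′ < q → ¬ K x (x + l′)) → ∃ Widest
      -- Distance 0 is always attained, so the search for the largest attained distance below `q`
      -- cannot fail.
      search zero _ h = ⊥-elim (h 0 0 z≤n 0<q refl)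
      search (suc l) l<q h with anyUpTo? (λ x → parent Y x ℕ.≟ parent Y (x + l)) n
      ... | yes found = l , l<q , found , λ x l′ l<l′ → h x l′ l<l′
      ... | no nf = search l (<⇒≤ l<q) h′
        where
        h′ : ∀ x l′ → l ≤ l′ → l′ < q → ¬ K x (x + l′)
        h′ x l′ l≤l′ l′<q e with m≤n⇒m<n∨m≡n l≤l′
        ... | inj₁ l<l′ = h x l′ l<l′ l′<q e
        ... | inj₂ refl = nf (x % n , m%n<n x n , reduce x l e)
      from-widest : ∃ Widest → ∃ λ z → IsPeriodic z × sum z n ≤ a × Represents Y z
      from-widest (l , l<q , (x , x<n , e) , maximal) = back (rotate-fixed (n ∸ x) F)
        where
        back : (∃ λ Y′ → FixedDyck Y′ × Rotated (n ∸ x) Y Y′) → ∃ λ z → IsPeriodic z × sum z n ≤ a × Represents Y z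
        back (Y′ , F′ , R) with Fix.White.result F′ free′ l l<q E0l maximal′
          where
          module B = RotatedBack R
          to-n : x + (n ∸ x) ≡ n
          to-n = m+[n∸m]≡n (<⇒≤ x<n)
          E0l : parent Y′ 0 ≡ parent Y′ l
          E0l = trans (sym (+n-parent Y′ 0)) (trans (cong (parent Y′) (sym to-n)) (trans (kin-to R x (x + l) e)
            (trans (cong (parent Y′) (trans (+-assoc x l _) (trans (cong (_+_ x) (+-comm l _)) (trans (sym (+-assoc x _ l)) (trans (cong (_+ l) to-n) (+-comm n l)))))) (+n-parent Y′ l))))
          free′ : ∀ r → ¬ parent Y′ r ≡ parent Y′ (r + q)
          free′ r e′ = free (B.back r) (trans (B.kin-back r (r + q) e′) (cong (parent Y) (B.back-+ r q)))
          maximal′ : ∀ y l′ → l < l′ → l′ < q → ¬ parent Y′ y ≡ parent Y′ (y + l′)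
          maximal′ y l′ lt lt′ e′ = maximal (B.back y) l′ lt lt′ (trans (B.kin-back y (y + l′) e′) (cong (parent Y) (B.back-+ y l′)))
        ... | z , per , bounded , rep = shift (n ∸ x) z , shift-periodic (n ∸ x) {z} per
          , subst (_≤ a) (sym (sum-shift (n ∸ x) {z} per)) bounded , represents-shift (n ∸ x) {z = z} per R rep

  -- Compositions

  module _ {A B : Set} (R : A → B → Set) where
    -- Formulated for a relation: the correspondences counted below pass through a path that
    -- realises both sides, and only its existence enters.
    injection-length : ∀ xs (ys : List B) → Unique xs → (∀ {x} → x ∈ xs → ∃ λ y → y ∈ ys × R x y) →
      (∀ {x x′ y} → R x y → R x′ y → x ≡ x′) → length xs ≤ length ys
    injection-length [] ys _ _ _ = z≤n
    injection-length (x ∷ xs) ys (x∉ ∷ uniq) total inj with total (here refl)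
    ... | y , y∈ , r with ∈-∃++ y∈
    ...   | us , vs , refl = ≤-trans (s≤s (injection-length xs (us ++ vs) uniq total′ inj))
              (≤-reflexive (trans (cong suc (Listₚ.length-++ us)) (trans (sym (+-suc (length us) (length vs))) (sym (Listₚ.length-++ us)))))
      where
      total′ : ∀ {x′} → x′ ∈ xs → ∃ λ y′ → y′ ∈ us ++ vs × R x′ y′
      total′ {x′} x′∈ with total (there x′∈)
      ... | y′ , y′∈ , r′ with ∈-++⁻ us y′∈
      ...   | inj₁ p = y′ , ∈-++⁺ˡ p , r′
      ...   | inj₂ (there p) = y′ , ∈-++⁺ʳ us p , r′
      ...   | inj₂ (here refl) = ⊥-elim (All.lookup x∉ x′∈ (inj r r′))

  bijection-length : ∀ {A B : Set} (R : A → B → Set) xs ys → Unique xs → Unique ys →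
    (∀ {x} → x ∈ xs → ∃ λ y → y ∈ ys × R x y) → (∀ {y} → y ∈ ys → ∃ λ x → x ∈ xs × R x y) →
    (∀ {x x′ y} → R x y → R x′ y → x ≡ x′) → (∀ {x y y′} → R x y → R x y′ → y ≡ y′) → length xs ≡ length ys
  bijection-length R xs ys ux uy tx ty injx injy = ≤-antisym (injection-length R xs ys ux tx injx)
    (injection-length (λ y x → R x y) ys xs uy ty injy)

  entries : List ℕ → ℕ → ℕ
  entries zs i = nthD 0 zs i

  total : List ℕ → ℕ
  total [] = 0
  total (z ∷ zs) = z + total zs

  support : List ℕ → ℕ
  support [] = 0
  support (z ∷ zs) = indicator (0 <ᵇ z) + support zs

  -- The lists of q naturals with t nonzero entries whose sum s ≤ M satisfies accept (M − s).
  module Compositions (accept : ℕ → Bool) where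
    compositions : ℕ → ℕ → ℕ → List (List ℕ)
    compositions zero M zero = if accept M then [ [] ] else []
    compositions zero M (suc t) = []
    compositions (suc q) M zero = map (0 ∷_) (compositions q M zero)
    -- `i` is what remains of `M` after a positive first letter `M − i`. Indexing by the remainder
    -- turns the count into the sum of binomials over a column of Pascal's triangle.
    compositions (suc q) M (suc t) = map (0 ∷_) (compositions q M (suc t)) ++ concatMap (λ i → map ((M ∸ i) ∷_) (compositions q i t)) (upTo M)

    record IsComposition (q M t : ℕ) (zs : List ℕ) : Set where
      constructor composition
      field
        rest     : ℕ
        length≡  : length zs ≡ q
        total≡   : total zs + rest ≡ M
        support≡ : support zs ≡ t
        accepted : accept rest ≡ true

    positive : ∀ {v} → 0 < v → indicator (0 <ᵇ v) ≡ 1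
    positive (s≤s _) = refl

    sound : ∀ q M t {zs} → zs ∈ compositions q M t → IsComposition q M t zs
    sound-zero : ∀ q M t {zs} → zs ∈ map (0 ∷_) (compositions q M t) → IsComposition (suc q) M t zs
    sound zero M zero zs∈ with accept M in e
    sound zero M zero (here refl) | true = composition M refl refl refl e
    sound (suc q) M zero zs∈ = sound-zero q M zero zs∈
    sound (suc q) M (suc t) zs∈ with ∈-++⁻ (map (0 ∷_) (compositions q M (suc t))) zs∈
    ... | inj₁ p = sound-zero q M (suc t) p
    ... | inj₂ p with find (∈-concatMap⁻ (λ i → map ((M ∸ i) ∷_) (compositions q i t)) {xs = upTo M} p)
    ...   | i , i∈ , p′ with ∈-map⁻ ((M ∸ i) ∷_) p′
    ...     | zs , zs∈′ , refl with sound q i t zs∈′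
    ...       | composition r l s n acc = composition r (cong suc l)
                  (trans (+-assoc (M ∸ i) (total zs) r) (trans (cong (_+_ (M ∸ i)) s) (m∸n+n≡m (<⇒≤ (∈-upTo⁻ i∈)))))
                  (trans (cong (_+ support zs) (positive (m<n⇒0<n∸m (∈-upTo⁻ i∈)))) (cong suc n)) acc
    sound-zero q M t p with ∈-map⁻ (0 ∷_) p
    ... | zs , zs∈ , refl with sound q M t zs∈
    ...   | composition r l s n acc = composition r (cong suc l) s n acc

    complete : ∀ q M t zs → IsComposition q M t zs → zs ∈ compositions q M t
    complete zero M zero [] (composition r refl refl refl acc) rewrite acc = here refl
    complete (suc q) M zero (zero ∷ zs) (composition r l s n acc) = ∈-map⁺ (0 ∷_) (complete q M zero zs (composition r (suc-injective l) s n acc))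
    complete (suc q) M (suc t) (zero ∷ zs) (composition r l s n acc) = ∈-++⁺ˡ (∈-map⁺ (0 ∷_) (complete q M (suc t) zs (composition r (suc-injective l) s n acc)))
    complete (suc q) M (suc t) (suc v ∷ zs) (composition r l s n acc) = ∈-++⁺ʳ (map (0 ∷_) (compositions q M (suc t)))
      (∈-concatMap⁺ (λ i → map ((M ∸ i) ∷_) (compositions q i t)) {xs = upTo M} (lose (∈-upTo⁺ i<M)
        (subst (λ h → suc v ∷ zs ∈ map (h ∷_) (compositions q i t)) (sym h≡) (∈-map⁺ (suc v ∷_) (complete q i t zs (composition r (suc-injective l) refl (suc-injective n) acc))))))
      where
      i = total zs + r
      M≡ : suc v + i ≡ M
      M≡ = trans (sym (+-assoc (suc v) (total zs) r)) s
      i<M : i < M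
      i<M = subst (i <_) M≡ (s≤s (m≤n+m i v))
      h≡ : M ∸ i ≡ suc v
      h≡ = trans (cong (_∸ i) (sym M≡)) (m+n∸n≡m (suc v) i)

    unique : ∀ q M t → Unique (compositions q M t)
    unique zero M zero with accept M
    ... | true = [] ∷ []
    ... | false = []
    unique zero M (suc t) = []
    unique (suc q) M zero = Uniqueₚ.map⁺ Listₚ.∷-injectiveʳ (unique q M zero)
    unique (suc q) M (suc t) = Uniqueₚ.++⁺ (Uniqueₚ.map⁺ Listₚ.∷-injectiveʳ (unique q M (suc t)))
      (heads (upTo M) (Uniqueₚ.upTo⁺ M) (All.tabulate ∈-upTo⁻)) (λ (p , p′) → disjoint p p′)
      where
      block : ℕ → List (List ℕ)
      block i = map ((M ∸ i) ∷_) (compositions q i t)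
      head-of : ∀ is {zs} → zs ∈ concatMap block is → ∃ λ i → i ∈ is × ∃ λ ws → zs ≡ (M ∸ i) ∷ ws
      head-of is p with find (∈-concatMap⁻ block {xs = is} p)
      ... | i , i∈ , p′ with ∈-map⁻ ((M ∸ i) ∷_) p′
      ...   | ws , _ , e = i , i∈ , ws , e
      disjoint : ∀ {zs} → zs ∈ map (0 ∷_) (compositions q M (suc t)) → ¬ zs ∈ concatMap block (upTo M)
      disjoint p p′ with ∈-map⁻ (0 ∷_) p | head-of (upTo M) p′
      ... | _ , _ , refl | i , i∈ , _ , e = <-irrefl (Listₚ.∷-injectiveˡ e) (m<n⇒0<n∸m (∈-upTo⁻ i∈))
      heads : ∀ is → Unique is → All (_< M) is → Unique (concatMap block is)
      heads [] _ _ = []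
      heads (i ∷ is) (i∉ ∷ u) (i<M ∷ <M) = Uniqueₚ.++⁺ (Uniqueₚ.map⁺ Listₚ.∷-injectiveʳ (unique q i t)) (heads is u <M) (λ (p , p′) → apart p p′)
        where
        apart : ∀ {zs} → zs ∈ block i → ¬ zs ∈ concatMap block is
        apart p p′ with ∈-map⁻ ((M ∸ i) ∷_) p | head-of is p′
        ... | _ , _ , refl | j , j∈ , _ , e = All.lookup i∉ j∈ (∸-cancelˡ-≡ (<⇒≤ i<M) (<⇒≤ (All.lookup <M j∈)) (Listₚ.∷-injectiveˡ e))

    length-heads : ∀ q M t → length (concatMap (λ i → map ((M ∸ i) ∷_) (compositions q i t)) (upTo M)) ≡ sum (λ i → length (compositions q i t)) M
    length-heads q M t = trans (blocks (upTo M)) (upTo-sum M)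
      where
      f : ℕ → ℕ
      f i = length (compositions q i t)
      listSum : List ℕ → ℕ
      listSum [] = 0
      listSum (i ∷ is) = f i + listSum is
      blocks : ∀ is → length (concatMap (λ i → map ((M ∸ i) ∷_) (compositions q i t)) is) ≡ listSum is
      blocks [] = refl
      blocks (i ∷ is) = trans (Listₚ.length-++ (map ((M ∸ i) ∷_) (compositions q i t))) (cong₂ _+_ (Listₚ.length-map _ (compositions q i t)) (blocks is))
      listSum-++ : ∀ is js → listSum (is ++ js) ≡ listSum is + listSum js
      listSum-++ [] js = refl
      listSum-++ (i ∷ is) js = trans (cong (_+_ (f i)) (listSum-++ is js)) (sym (+-assoc (f i) _ _))
      upTo-sum : ∀ M → listSum (upTo M) ≡ sum f M
      upTo-sum zero = refl
      upTo-sum (suc M) = trans (cong listSum (sym (Listₚ.upTo-∷ʳ M))) (trans (listSum-++ (upTo M) [ M ]) (cong₂ _+_ (upTo-sum M) (+-identityʳ (f M))))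

  sum-choose : ∀ c t M → sum (λ i → c * choose i t) M ≡ c * choose M (suc t)
  sum-choose c t zero = sym (*-zeroʳ c)
  sum-choose c t (suc M) = trans (cong (_+ c * choose M t) (sum-choose c t M)) (trans (sym (*-distribˡ-+ c (choose M (suc t)) (choose M t))) (cong (c *_) (+-comm (choose M (suc t)) (choose M t))))

  sum-ext : ∀ {f g : ℕ → ℕ} → (∀ i → f i ≡ g i) → ∀ M → sum f M ≡ sum g M
  sum-ext e zero = refl
  sum-ext e (suc M) = cong₂ _+_ (sum-ext e M) (e M)

  anything isZero : ℕ → Bool
  anything _ = true
  isZero zero = true
  isZero (suc _) = false

  module Bounded = Compositions anything
  module Exact = Compositions isZero

  -- The places of the `t` nonzero letters and their `t` distinct partial sums between 1 and `M` are
  -- chosen independently.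
  length-bounded : ∀ q M t → length (Bounded.compositions q M t) ≡ choose q t * choose M t
  length-bounded zero M zero = refl
  length-bounded zero M (suc t) = refl
  length-bounded (suc q) M zero = trans (Listₚ.length-map _ (Bounded.compositions q M zero)) (length-bounded q M zero)
  length-bounded (suc q) M (suc t) = trans (Listₚ.length-++ (map (0 ∷_) (Bounded.compositions q M (suc t))))
    (trans (cong₂ _+_ (trans (Listₚ.length-map _ (Bounded.compositions q M (suc t))) (length-bounded q M (suc t)))
        (trans (Bounded.length-heads q M t) (trans (sum-ext (λ i → length-bounded q i t) M) (sum-choose (choose q t) t M))))
      (trans (+-comm (choose q (suc t) * choose M (suc t)) _) (sym (*-distribʳ-+ (choose M (suc t)) (choose q t) (choose q (suc t))))))

  length-exact-0 : ∀ q M → length (Exact.compositions q (suc M) 0) ≡ 0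
  length-exact-0 zero M = refl
  length-exact-0 (suc q) M = trans (Listₚ.length-map _ (Exact.compositions q (suc M) 0)) (length-exact-0 q M)

  length-exact-00 : ∀ q → length (Exact.compositions q 0 0) ≡ 1
  length-exact-00 zero = refl
  length-exact-00 (suc q) = trans (Listₚ.length-map _ (Exact.compositions q 0 0)) (length-exact-00 q)

  length-exact-low : ∀ q t → length (Exact.compositions q 0 (suc t)) ≡ 0
  length-exact-low zero t = refl
  length-exact-low (suc q) t = trans (Listₚ.length-++ (map (0 ∷_) (Exact.compositions q 0 (suc t))))
    (trans (+-identityʳ _) (trans (Listₚ.length-map _ (Exact.compositions q 0 (suc t))) (length-exact-low q t)))

  -- As for `length-bounded`, with the last of the `suc t` partial sums forced to be `suc M`.
  length-exact : ∀ q M t → length (Exact.compositions q (suc M) (suc t)) ≡ choose q (suc t) * choose M t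
  sum-exact : ∀ q M t → sum (λ i → length (Exact.compositions q i t)) (suc M) ≡ choose q t * choose M t

  length-exact zero M t = refl
  length-exact (suc q) M t = trans (Listₚ.length-++ (map (0 ∷_) (Exact.compositions q (suc M) (suc t))))
    (trans (cong₂ _+_ (trans (Listₚ.length-map _ (Exact.compositions q (suc M) (suc t))) (length-exact q M t)) (trans (Exact.length-heads q (suc M) t) (sum-exact q M t)))
      (trans (+-comm (choose q (suc t) * choose M t) _) (sym (*-distribʳ-+ (choose M t) (choose q t) (choose q (suc t))))))

  sum-exact q zero zero = length-exact-00 q
  sum-exact q (suc M) zero = trans (cong₂ _+_ (sum-exact q M zero) (length-exact-0 q M)) (+-identityʳ _)
  sum-exact q zero (suc t) = trans (length-exact-low q t) (sym (*-zeroʳ (choose q (suc t))))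
  sum-exact q (suc M) (suc t) = trans (cong₂ _+_ (sum-exact q M (suc t)) (length-exact q M t))
    (trans (sym (*-distribˡ-+ (choose q (suc t)) (choose M (suc t)) (choose M t))) (cong (choose q (suc t) *_) (+-comm (choose M (suc t)) (choose M t))))

  choose-absorb : ∀ n k → suc k * choose (suc n) (suc k) ≡ suc n * choose n k
  choose-absorb zero zero = refl
  choose-absorb zero (suc k) = *-zeroʳ (suc (suc k))
  choose-absorb (suc n) zero = trans (*-identityˡ (suc (choose (suc n) 1))) (cong suc (trans (sym (*-identityˡ _)) (choose-absorb n 0)))
  choose-absorb (suc n) (suc k) = begin
    suc (suc k) * (choose (suc n) (suc k) + choose (suc n) (suc (suc k)))
      ≡⟨ expand (suc k) (choose (suc n) (suc k)) (choose (suc n) (suc (suc k))) ⟩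
    choose (suc n) (suc k) + suc k * choose (suc n) (suc k) + suc (suc k) * choose (suc n) (suc (suc k))
      ≡⟨ cong₂ (λ u v → choose (suc n) (suc k) + u + v) (choose-absorb n k) (choose-absorb n (suc k)) ⟩
    choose (suc n) (suc k) + suc n * choose n k + suc n * choose n (suc k)
      ≡⟨ collect (choose n k) (choose n (suc k)) (suc n) ⟩
    suc (suc n) * choose (suc n) (suc k) ∎
    where
    open ≡-Reasoning
    expand : ∀ k c d → suc k * (c + d) ≡ c + k * c + suc k * d
    expand = ℕSolver.solve-∀
    collect : ∀ c d n → (c + d) + n * c + n * d ≡ suc n * (c + d)
    collect = ℕSolver.solve-∀

  tabulated : (ℕ → ℕ) → ℕ → List ℕ
  tabulated z q = applyUpTo z q

  tabulated-entry : ∀ z q i → i < q → entries (tabulated z q) i ≡ z i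
  tabulated-entry z (suc q) zero _ = refl
  tabulated-entry z (suc q) (suc i) (s≤s lt) = tabulated-entry (λ t → z (suc t)) q i lt

  total-tabulated : ∀ z q → total (tabulated z q) ≡ sum z q
  total-tabulated z zero = refl
  total-tabulated z (suc q) = trans (cong (_+_ (z 0)) (total-tabulated (λ t → z (suc t)) q)) (sum-suc z q)
    where
    sum-suc : ∀ z q → z 0 + sum (λ t → z (suc t)) q ≡ sum z (suc q)
    sum-suc z zero = +-comm (z 0) 0
    sum-suc z (suc q) = trans (sym (+-assoc (z 0) _ _)) (cong (_+ z (suc q)) (sum-suc z q))

  support-tabulated : ∀ z q → support (tabulated z q) ≡ count (λ t → 0 <ᵇ z t) q
  support-tabulated z zero = refl
  support-tabulated z (suc q) = trans (cong (_+_ (indicator (0 <ᵇ z 0))) (support-tabulated (λ t → z (suc t)) q)) (sym (count-suc _ q))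

  tabulated-entries : ∀ zs → tabulated (entries zs) (length zs) ≡ zs
  tabulated-entries [] = refl
  tabulated-entries (z ∷ zs) = cong (z ∷_) (tabulated-entries zs)

  tabulated-cong : ∀ {z z′} q → (∀ i → i < q → z i ≡ z′ i) → tabulated z q ≡ tabulated z′ q
  tabulated-cong zero e = refl
  tabulated-cong (suc q) e = cong₂ _∷_ (e 0 (s≤s z≤n)) (tabulated-cong q (λ i lt → e (suc i) (s≤s lt)))

  -- Counting invariant partitions

  divMod-unique : ∀ m x y r r′ → r < m → r′ < m → x * m + r ≡ y * m + r′ → x ≡ y × r ≡ r′
  divMod-unique m@(suc _) x y r r′ r<m r′<m e = x≡y , r≡r′
    where
    residue : ∀ x r → r < m → (x * m + r) % m ≡ r
    residue x r lt = trans (cong (_% m) (+-comm (x * m) r)) (trans ([m+kn]%n≡m%n r x m) (m<n⇒m%n≡m lt))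
    r≡r′ : r ≡ r′
    r≡r′ = trans (sym (residue x r r<m)) (trans (cong (_% m) e) (residue y r′ r′<m))
    x≡y : x ≡ y
    x≡y = *-cancelʳ-≡ x y m (+-cancelʳ-≡ r (x * m) (y * m) (trans e (cong (_+_ (y * m)) (sym r≡r′))))

  module Counted (a n : ℕ) (0<a : 0 < a) (a≤n : a ≤ n) (coprime : Coprime a (suc n)) where
    open Walks a n 0<a a≤n coprime public

    fixedList : ℕ → ℕ → List SetPartition
    fixedList k d = filterᵇ (λ π → does (iter (rot n) d π ≟SP π)) (NCk a b k)

    fixedList-unique : ∀ k d → Unique (fixedList k d)
    fixedList-unique k d = Uniqueₚ.filter⁺ (λ π → T? (does (iter (rot n) d π ≟SP π)))
      (UniqueDecₚ.deduplicate-! _≟SP_ (filterᵇ (λ π → numBlocks n π ≡ᵇ k) (map (πD a b) (dyckPaths a b))))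

    record Member (k d : ℕ) (π : SetPartition) : Set where
      constructor member
      field
        Y      : ℕ → ℕ
        dyck   : Dyck Y
        π≡     : π ≡ partition Y
        blocks≡ : nonflat Y ≡ k
        fixed  : iter (rot n) d (partition Y) ≡ partition Y

    fixedList-sound : ∀ k d {π} → π ∈ fixedList k d → Member k d π
    fixedList-sound k d {π} π∈ with ∈-filter⁻ _ {xs = NCk a b k} π∈
    ... | π∈NC , fixed with ∈-filter⁻ _ {xs = map (πD a b) (dyckPaths a b)} (∈-deduplicate⁻ _≟SP_ _ π∈NC)
    ...   | π∈map , blocks with ∈-map⁻ (πD a b) π∈map
    ...     | w , w∈ , refl with ⇒true (proj₂ (∈-filter⁻ _ {xs = words (a + b)} w∈))
    ...       | isDyck = member (heights w) D (πD-partition w isDyck)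
                  (trans (sym (numBlocks-partition D)) (trans (cong (numBlocks n) (sym (πD-partition w isDyck))) (≡ᵇ⇒≡ _ k blocks)))
                  (subst (λ π → iter (rot n) d π ≡ π) (πD-partition w isDyck) (does-true (_ ≟SP _) (⇒true fixed)))
      where D = heights-Dyck w isDyck

    fixedList-complete : ∀ k d {Y} → Dyck Y → nonflat Y ≡ k → iter (rot n) d (partition Y) ≡ partition Y → partition Y ∈ fixedList k d
    fixedList-complete k d {Y} D bl fixed = ∈-filter⁺ _ (∈-deduplicate⁺ _≟SP_ (∈-filter⁺ _ (subst (_∈ map (πD a b) (dyckPaths a b)) π≡ (∈-map⁺ (πD a b) word∈))
        (≡⇒≡ᵇ _ k (trans (numBlocks-partition D) bl)))) (true⇒ (dec-true (_ ≟SP _) fixed))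
      where
      open FromHeights D
      same : ∀ r → parent (heights word) r ≡ parent Y r
      same = parent-cong {heights word} {Y} word-heights
      π≡ : πD a b word ≡ partition Y
      π≡ = trans (πD-partition word word-isDyck) (partition-cong {heights word} {Y}
        (λ r s e → trans (sym (same r)) (trans e (same s))) (λ r s e → trans (same r) (trans e (sym (same s)))))

    Shifted : ℕ → (ℕ → ℕ) → Set
    Shifted d Y = (∀ r s → parent Y r ≡ parent Y s → parent Y (r + d) ≡ parent Y (s + d))
                × (∀ r s → parent Y (r + d) ≡ parent Y (s + d) → parent Y r ≡ parent Y s)

    private
      once : ∀ Y r → parent Y (r + n) ≡ parent Y r
      once Y r = parent-% Y (r + n) r ([m+n]%n≡m%n r n)

      parent-kin : ∀ {Y Y′} → partition Y ≡ partition Y′ → ∀ r s → parent Y r ≡ parent Y s → parent Y′ r ≡ parent Y′ s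
      parent-kin {Y} {Y′} e r s p = trans (reduce Y′ r) (trans (partition-kin {Y} {Y′} e (r % n) (s % n) (m%n<n r n) (m%n<n s n)
        (trans (sym (reduce Y r)) (trans p (reduce Y s)))) (sym (reduce Y′ s)))
        where
        reduce : ∀ Y r → parent Y r ≡ parent Y (r % n)
        reduce Y r = parent-% Y r (r % n) (sym (m%n%n≡m%n r n))

    shifted-n : ∀ Y → Shifted n Y
    shifted-n Y = (λ r s p → trans (once Y r) (trans p (sym (once Y s)))) , (λ r s p → trans (sym (once Y r)) (trans p (once Y s)))

    fixed⇒shifted : ∀ d {Y} → Dyck Y → iter (rot n) d (partition Y) ≡ partition Y → Shifted d Y
    fixed⇒shifted d {Y} D fixed with iter-rot d D
    ... | Y′ , D′ , R , e = (λ r s p → parent-kin {Y′} {Y} same (r + d) (s + d) (kin-to R r s p))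
                          , (λ r s p → kin-from R r s (parent-kin {Y} {Y′} (sym same) (r + d) (s + d) p))
      where
      same : partition Y′ ≡ partition Y
      same = trans (sym e) fixed

    shifted⇒fixed : ∀ d {Y} → Dyck Y → Shifted d Y → iter (rot n) d (partition Y) ≡ partition Y
    shifted⇒fixed d {Y} D (to , from) with iter-rot d D
    ... | Y′ , D′ , R , e = trans e (partition-cong {Y′} {Y}
        (λ r s p → trans (sym (at Y r)) (trans (to (back r) (back s) (kin-from R (back r) (back s) (trans (at Y′ r) (trans p (sym (at Y′ s)))))) (at Y s)))
        (λ r s p → trans (sym (at Y′ r)) (trans (kin-to R (back r) (back s) (from (back r) (back s) (trans (at Y r) (trans p (sym (at Y s)))))) (at Y′ s))))
      where
      back : ℕ → ℕ
      back r = r + d * (n ∸ 1)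
      at : ∀ Y r → parent Y (back r + d) ≡ parent Y r
      at Y r = parent-% Y (back r + d) r (trans (cong (_% n) (trans (+-assoc r _ d) (cong (_+_ r) (trans (+-comm _ d) (trans (sym (*-suc d (n ∸ 1))) (cong (d *_) (suc-pred n))))))) ([m+kn]%n≡m%n r d n))

    shifted-multiple : ∀ k d {Y} → Shifted d Y → Shifted (k * d) Y
    shifted-multiple zero d {Y} _ = (λ r s p → subst₂ (λ u v → parent Y u ≡ parent Y v) (sym (+-identityʳ r)) (sym (+-identityʳ s)) p)
                              , (λ r s p → subst₂ (λ u v → parent Y u ≡ parent Y v) (+-identityʳ r) (+-identityʳ s) p)
    shifted-multiple (suc k) d {Y} sh@(to , from) with shifted-multiple k d {Y} sh
    ... | to′ , from′ = (λ r s p → subst₂ (λ u v → parent Y u ≡ parent Y v) (+-assoc r d (k * d)) (+-assoc s d (k * d)) (to′ (r + d) (s + d) (to r s p)))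
                      , (λ r s p → from r s (from′ (r + d) (s + d) (subst₂ (λ u v → parent Y u ≡ parent Y v) (sym (+-assoc r d (k * d))) (sym (+-assoc s d (k * d))) p)))

    -- Bézout for `d` and `n`: shifts by multiples of `n` leave kinship unchanged, so the shift by
    -- the gcd is a multiple of the shift by `d`, or the inverse of one.
    shifted-gcd : ∀ d {Y} → Shifted d Y → Shifted (gcd d n) Y
    shifted-gcd d {Y} sh with Bézout.identity (gcd-GCD d n)
    ... | Bézout.+- x y e = (λ r s p → trans (sym (at r)) (trans (to r s p) (at s))) , (λ r s p → from r s (trans (at r) (trans p (sym (at s)))))
      where
      to = proj₁ (shifted-multiple x d {Y} sh)
      from = proj₂ (shifted-multiple x d {Y} sh)
      at : ∀ r → parent Y (r + x * d) ≡ parent Y (r + gcd d n)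
      at r = parent-% Y _ _ (trans (cong (λ t → (r + t) % n) (sym e)) (trans (cong (_% n) (sym (+-assoc r _ _))) ([m+kn]%n≡m%n (r + gcd d n) y n)))
    ... | Bézout.-+ x y e = (λ r s p → from (r + gcd d n) (s + gcd d n) (trans (at r) (trans p (sym (at s))))) , (λ r s p → trans (sym (at r)) (trans (to (r + gcd d n) (s + gcd d n) p) (at s)))
      where
      to = proj₁ (shifted-multiple x d {Y} sh)
      from = proj₂ (shifted-multiple x d {Y} sh)
      at : ∀ r → parent Y (r + gcd d n + x * d) ≡ parent Y r
      at r = parent-% Y _ _ (trans (cong (_% n) (trans (+-assoc r _ _) (cong (_+_ r) e))) ([m+kn]%n≡m%n r y n))

    shifted-from-gcd : ∀ d {Y} → Shifted (gcd d n) Y → Shifted d Y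
    shifted-from-gcd d {Y} sh with gcd[m,n]∣m d n
    ... | divides e d≡ = subst (λ t → Shifted t Y) (sym d≡) (shifted-multiple e (gcd d n) {Y} sh)

  module CountSymmetric (a n : ℕ) (0<a : 0 < a) (a≤n : a ≤ n) (coprime : Coprime a (suc n))
                        (d q m : ℕ) (q≡gcd : gcd d n ≡ q) (n≡mq : n ≡ m * q) (2≤m : 2 ≤ m) where
    open Counted a n 0<a a≤n coprime using (fixedList; fixedList-unique; fixedList-sound; fixedList-complete; Member; member; Shifted; fixed⇒shifted; shifted⇒fixed; shifted-gcd; shifted-from-gcd)
    open TotalFixed a n 0<a a≤n coprime q m n≡mq 2≤m

    private instance
      q≢0 : NonZero q
      q≢0 = q-nonZero

    periodically : List ℕ → ℕ → ℕ
    periodically zs i = entries zs (i % q)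

    periodically-periodic : ∀ zs → IsPeriodic (periodically zs)
    periodically-periodic zs i = cong (entries zs) ([m+n]%n≡m%n i q)

    sum-multiple : ∀ {z} → IsPeriodic z → ∀ k → sum z (k * q) ≡ k * sum z q
    sum-multiple per zero = refl
    sum-multiple {z} per (suc k) = trans (cong (sum z) (+-comm q (k * q))) (trans (sum-+ z q (k * q))
      (trans (cong (_+ sum z q) (trans (sum-cong (k * q) (λ t _ → per t)) (sum-multiple {z} per k))) (+-comm _ (sum z q))))

    represents-ext : ∀ {Y z z′} → (∀ i → z i ≡ z′ i) → Represents Y z → Represents Y z′
    represents-ext {Y} {z} {z′} e rep = record
      { kin⇒ = λ r s p → kin-ext e (kin⇒ rep r s p)
      ; kin⇐ = λ r s k → kin⇐ rep r s (kin-ext (λ i → sym (e i)) k)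
      ; rank-z = λ x pos → trans (rank-z rep x (subst (0 <_) (sym (e x)) pos)) (e x)
      ; blocks = trans (blocks rep) (cong₂ (λ u v → m * u + indicator (0 <ᵇ v)) (count-cong q (λ t _ → cong (0 <ᵇ_) (e t))) (cong (a ∸_) (sum-cong n (λ t _ → e t)))) }
      where
      walk-ext : ∀ {z z′} → (∀ i → z i ≡ z′ i) → ∀ i → Walk z i ≡ Walk z′ i
      walk-ext e i = T-cong i (sum-cong i (λ t _ → e t))
      near-ext : ∀ {z z′} → (∀ i → z i ≡ z′ i) → ∀ {x U} → Near.IsNear (Walk z) x U → Near.IsNear (Walk z′) x U
      near-ext {z} {z′} e (P , le) = prev (before P) (subst₂ ℤ._<_ (walk-ext e _) (walk-ext e _) (smaller P))
        (λ t lt lt′ → subst₂ ℤ._<_ (walk-ext e _) (walk-ext e _) (between P t lt lt′)) , le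
      none-ext : ∀ {z z′} → (∀ i → z i ≡ z′ i) → ∀ {U} → Near.None (Walk z) U → Near.None (Walk z′) U
      none-ext e nn x lt le = subst₂ ℤ._<_ (walk-ext e _) (walk-ext e _) (nn x lt le)
      kin-ext : ∀ {z z′} → (∀ i → z i ≡ z′ i) → ∀ {U V} → Near.Kin (Walk z) U V → Near.Kin (Walk z′) U V
      kin-ext e (inj₁ (u , v)) = inj₁ (none-ext e u , none-ext e v)
      kin-ext e (inj₂ (x , y , nx , ny , r)) = inj₂ (x , y , near-ext e nx , near-ext e ny , r)

    Relates : SetPartition → List ℕ → Set
    Relates π zs = length zs ≡ q × (∃ λ Y → Dyck Y × π ≡ partition Y × Represents Y (periodically zs))

    -- A word stands for one period. Every letter occurs `m` times around the circle, and the rest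
    -- of `a` is the rank of the central block, which adds one block if positive.
    Coded : ℕ → List ℕ → Set
    Coded k zs = length zs ≡ q × m * total zs ≤ a × m * support zs + indicator (0 <ᵇ a ∸ m * total zs) ≡ k

    private
      sum-q : ∀ zs → length zs ≡ q → sum (periodically zs) q ≡ total zs
      sum-q zs refl = trans (sum-cong (length zs) (λ t t<q → cong (entries zs) (m<n⇒m%n≡m t<q))) (trans (sym (total-tabulated (entries zs) (length zs))) (cong total (tabulated-entries zs)))

      sum-n : ∀ zs → length zs ≡ q → sum (periodically zs) n ≡ m * total zs
      sum-n zs l = trans (cong (sum (periodically zs)) n≡mq) (trans (sum-multiple {periodically zs} (periodically-periodic zs) m) (cong (m *_) (sum-q zs l)))

      count-q : ∀ zs → length zs ≡ q → count (λ t → 0 <ᵇ periodically zs t) q ≡ support zs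
      count-q zs refl = trans (count-cong (length zs) (λ t t<q → cong (λ i → 0 <ᵇ entries zs i) (m<n⇒m%n≡m t<q))) (trans (sym (support-tabulated (entries zs) (length zs))) (cong support (tabulated-entries zs)))

      coded-blocks : ∀ zs {Y} → length zs ≡ q → Represents Y (periodically zs) → nonflat Y ≡ m * support zs + indicator (0 <ᵇ a ∸ m * total zs)
      coded-blocks zs l rep = trans (blocks rep) (cong₂ (λ u v → m * u + indicator (0 <ᵇ a ∸ v)) (count-q zs l) (sum-n zs l))

      shifted-q : ∀ {Y} → Shifted (gcd d n) Y → Shifted q Y
      shifted-q {Y} = subst (λ t → Shifted t Y) q≡gcd

    encode : ∀ k {π} → π ∈ fixedList k d → ∃ λ zs → Coded k zs × Relates π zs
    encode k {π} π∈ with fixedList-sound k d π∈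
    ... | member Y D π≡ bl fixed with fixed-represented (fixed-from-kin D (proj₁ (shifted-q {Y} (shifted-gcd d {Y} (fixed⇒shifted d D fixed)))))
    ...   | z , per , bounded , rep = zs , (l , subst (_≤ a) (trans (sum-cong n (λ t _ → same t)) (sum-n zs l)) bounded , trans (sym (coded-blocks zs l rep′)) bl) , (l , Y , D , π≡ , rep′)
      where
      zs = tabulated z q
      l : length zs ≡ q
      l = Listₚ.length-applyUpTo z q
      mod-q : ∀ i → z i ≡ z (i % q)
      mod-q i = trans (cong z (m≡m%n+[m/n]*n i q)) (multiple {z} per (i / q) (i % q))
      same : ∀ i → z i ≡ periodically zs i
      same i = trans (mod-q i) (sym (tabulated-entry z q (i % q) (m%n<n i q)))
      rep′ : Represents Y (periodically zs)
      rep′ = represents-ext same rep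

    decode : ∀ k {zs} → Coded k zs → ∃ λ π → π ∈ fixedList k d × Relates π zs
    decode k {zs} (l , le , bl) with represented {periodically zs} (periodically-periodic zs) (subst (_≤ a) (sym (sum-n zs l)) le)
    ... | Y , D , rep = partition Y , fixedList-complete k d D (trans (coded-blocks zs l rep) bl)
            (shifted⇒fixed d D (shifted-from-gcd d {Y} (subst (λ t → Shifted t Y) (sym q≡gcd) (kin , kin-unshift {Y} kin)))) , l , Y , D , refl , rep
      where
      kin = represents-fixed {Y} {periodically zs} (periodically-periodic zs) rep

    relates-injectiveˡ : ∀ {π π′ zs} → Relates π zs → Relates π′ zs → π ≡ π′
    relates-injectiveˡ (_ , Y , _ , π≡ , rep) (_ , Y′ , _ , π′≡ , rep′) = trans π≡ (trans (represents-same rep rep′) (sym π′≡))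

    relates-injectiveʳ : ∀ {π zs zs′} → Relates π zs → Relates π zs′ → zs ≡ zs′
    relates-injectiveʳ {π} {zs} {zs′} (l , Y , D , π≡ , rep) (l′ , Y′ , D′ , π≡′ , rep′) =
      trans (sym (tabulated-entries zs)) (trans (cong (tabulated (entries zs)) l) (trans (tabulated-cong q (λ i i<q → trans (cong (entries zs) (sym (m<n⇒m%n≡m i<q)))
        (trans (same i) (cong (entries zs′) (m<n⇒m%n≡m i<q))))) (trans (cong (tabulated (entries zs′)) (sym l′)) (tabulated-entries zs′))))
      where
      same : ∀ i → periodically zs i ≡ periodically zs′ i
      same = represents-unique (periodically-periodic zs) (periodically-periodic zs′) rep
        (represents-cong D′ (λ i i≤b → sym (partition-injective D D′ (trans (sym π≡) π≡′) i i≤b)) rep′)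

    fixedCount-coded : ∀ k Z → Unique Z → (∀ {zs} → Coded k zs → zs ∈ Z) → (∀ {zs} → zs ∈ Z → Coded k zs) → fixedCount a (suc n) k d ≡ length Z
    fixedCount-coded k Z uniq to from = bijection-length Relates (fixedList k d) Z (fixedList-unique k d) uniq
      (λ π∈ → let zs , c , r = encode k π∈ in zs , to {zs} c , r) (λ {zs} zs∈ → decode k {zs} (from zs∈))
      (λ {π} {π′} {zs} → relates-injectiveˡ {π} {π′} {zs}) (λ {π} {zs} {zs′} → relates-injectiveʳ {π} {zs} {zs′})

    private
      1<m : 1 < m
      1<m = 2≤m

      case-indicator : ∀ x → (0 < x × indicator (0 <ᵇ x) ≡ 1) ⊎ (x ≡ 0 × indicator (0 <ᵇ x) ≡ 0)
      case-indicator zero = inj₂ (refl , refl)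
      case-indicator (suc x) = inj₁ (s≤s z≤n , refl)

      -- Comparing k = m·(support) + [a central block] with k = v m + s + 1.
      central-code : ∀ {k v s} zs → k ≡ suc (v * m + s) → suc s ≤ m → Coded k zs →
        (s ≡ 0 × support zs ≡ v × m * total zs < a) ⊎ (suc s ≡ m × support zs ≡ suc v × m * total zs ≡ a)
      central-code {k} {v} {s} zs k≡ s<m (_ , le , bl) with case-indicator (a ∸ m * total zs)
      ... | inj₁ (pos , ind) with divMod-unique m (support zs) v 0 s (<-trans (s≤s z≤n) 1<m) s<m eq
        where
        eq : support zs * m + 0 ≡ v * m + s
        eq = trans (+-identityʳ _) (suc-injective (trans (trans (+-comm 1 _) (trans (cong₂ _+_ (*-comm (support zs) m) (sym ind)) bl)) k≡))
      ...   | sup , s0 = inj₁ (sym s0 , sup , ≰⇒> λ ge → <-irrefl (sym (m≤n⇒m∸n≡0 ge)) pos)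
      central-code {k} {v} {s} zs k≡ s<m (_ , le , bl) | inj₂ (flat , ind) with m≤n⇒m<n∨m≡n s<m
      ... | inj₂ e = inj₂ (e , proj₁ (divMod-unique m (support zs) (suc v) 0 0 (<-trans (s≤s z≤n) 1<m) (<-trans (s≤s z≤n) 1<m)
              (cong (_+ 0) (trans (*-comm (support zs) m) (trans (sym (+-identityʳ _)) (trans (cong (_+_ (m * support zs)) (sym ind)) (trans bl (trans k≡ (trans (sym (+-suc (v * m) s)) (trans (cong (_+_ (v * m)) e) (+-comm (v * m) m)))))))))) , ≤-antisym le (m∸n≡0⇒m≤n flat))
      ... | inj₁ lt with divMod-unique m (support zs) v 0 (suc s) (<-trans (s≤s z≤n) 1<m) lt
              (trans (+-identityʳ _) (trans (*-comm (support zs) m) (trans (sym (+-identityʳ _)) (trans (cong (_+_ (m * support zs)) (sym ind)) (trans bl (trans k≡ (sym (+-suc (v * m) s))))))))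
      ...   | _ , ()

      ∈[]-elim : ∀ {k} → (∀ {zs} → Coded k zs → ⊥) → ∀ {zs} → Coded k zs → zs ∈ []
      ∈[]-elim h {zs} c = ⊥-elim (h {zs} c)

    count-central : ∀ {k v} u r → k ≡ suc (v * m + 0) → r < m → a ≡ suc (u * m + r) → fixedCount a (suc n) k d ≡ choose u v * choose q v
    count-central {k} {v} u r k≡ r<m a≡ = trans (fixedCount-coded k (Bounded.compositions q u v) (Bounded.unique q u v) (λ {zs} → to {zs}) from)
        (trans (length-bounded q u v) (*-comm (choose q v) (choose u v)))
      where
      to : ∀ {zs} → Coded k zs → zs ∈ Bounded.compositions q u v
      to {zs} c with central-code {k} {v} {_} zs k≡ (<-trans (s≤s z≤n) 1<m) c
      ... | inj₂ (e , _) = ⊥-elim (<⇒≢ 1<m e)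
      ... | inj₁ (_ , sup , lt) = Bounded.complete q u v zs (Bounded.composition (u ∸ total zs) (proj₁ c) (m+[n∸m]≡n tot≤u) sup refl)
        where
        tot≤u : total zs ≤ u
        tot≤u = ≮⇒≥ λ u<t → <⇒≱ (subst (m * total zs <_) a≡ lt) (<-≤-trans (+-monoʳ-< (u * m) r<m)
          (≤-trans (≤-reflexive (trans (+-comm (u * m) m) (*-comm (suc u) m))) (*-monoʳ-≤ m u<t)))
      from : ∀ {zs} → zs ∈ Bounded.compositions q u v → Coded k zs
      from {zs} zs∈ with Bounded.sound q u v zs∈
      ... | Bounded.composition rest l t s _ = l , <⇒≤ lt , trans (cong₂ (λ p i → m * p + i) s (positive-indicator (m<n⇒0<n∸m lt)))
              (trans (+-comm _ 1) (trans (cong suc (trans (*-comm m v) (sym (+-identityʳ _)))) (sym k≡)))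
        where
        positive-indicator : ∀ {x} → 0 < x → indicator (0 <ᵇ x) ≡ 1
        positive-indicator (s≤s _) = refl
        lt : m * total zs < a
        lt = subst (m * total zs <_) (sym a≡) (s≤s (≤-trans (*-monoʳ-≤ m (≤-trans (m≤m+n _ rest) (≤-reflexive t))) (≤-trans (≤-reflexive (*-comm m u)) (m≤m+n _ r))))

    count-free : ∀ {k v s} u → k ≡ suc (v * m + s) → suc s ≡ m → a ≡ suc (u * m + s) → fixedCount a (suc n) k d ≡ choose q (suc v) * choose u v
    count-free {k} {v} {s} u k≡ s≡ a≡ = trans (fixedCount-coded k (Exact.compositions q (suc u) (suc v)) (Exact.unique q (suc u) (suc v)) (λ {zs} → to {zs}) from) (length-exact q u v)
      where
      next : ∀ x → suc (x * m + s) ≡ m * suc x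
      next x = trans (sym (+-suc (x * m) s)) (trans (cong (_+_ (x * m)) s≡) (trans (+-comm (x * m) m) (*-comm (suc x) m)))
      instance
        m≢0 : NonZero m
        m≢0 = ℕ.>-nonZero (<-trans (s≤s z≤n) 1<m)
      to : ∀ {zs} → Coded k zs → zs ∈ Exact.compositions q (suc u) (suc v)
      to {zs} c with central-code {k} {v} {_} zs k≡ (≤-reflexive s≡) c
      ... | inj₁ (s0 , _) = ⊥-elim (<⇒≢ 1<m (trans (cong suc (sym s0)) s≡))
      ... | inj₂ (_ , sup , tot) = Exact.complete q (suc u) (suc v) zs (Exact.composition 0 (proj₁ c) (trans (+-identityʳ _) (*-cancelˡ-≡ (total zs) (suc u) m (trans tot (trans a≡ (next u))))) sup refl)
      from : ∀ {zs} → zs ∈ Exact.compositions q (suc u) (suc v) → Coded k zs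
      from {zs} zs∈ with Exact.sound q (suc u) (suc v) zs∈
      ... | Exact.composition zero l t sup _ = l , ≤-reflexive eq , trans (cong₂ (λ p i → m * p + i) sup (cong (λ x → indicator (0 <ᵇ x)) (trans (cong (a ∸_) eq) (n∸n≡0 a))))
              (trans (+-identityʳ _) (trans (sym (next v)) (sym k≡)))
        where
        eq : m * total zs ≡ a
        eq = trans (cong (m *_) (trans (sym (+-identityʳ _)) t)) (trans (sym (next u)) (sym a≡))

    count-free-empty : ∀ {k v s} u r → k ≡ suc (v * m + s) → suc s ≡ m → r < s → a ≡ suc (u * m + r) → fixedCount a (suc n) k d ≡ 0
    count-free-empty {k} {v} {s} u r k≡ s≡ r<s a≡ = fixedCount-coded k [] AllPairs.[] (λ {zs} → ∈[]-elim (λ {zs} → impossible {zs}) {zs}) (λ ())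
      where
      impossible : ∀ {zs} → Coded k zs → ⊥
      impossible {zs} c with central-code {k} {v} {_} zs k≡ (≤-reflexive s≡) c
      ... | inj₁ (s0 , _) = <⇒≢ 1<m (trans (cong suc (sym s0)) s≡)
      ... | inj₂ (_ , _ , tot) with divMod-unique m (total zs) u 0 (suc r) (<-trans (s≤s z≤n) 1<m) (subst (suc r <_) s≡ (s≤s r<s))
                (trans (+-identityʳ _) (trans (*-comm (total zs) m) (trans tot (trans a≡ (sym (+-suc (u * m) r))))))
      ...   | _ , ()

    count-other : ∀ {k v s} → k ≡ suc (v * m + s) → 0 < s → suc s < m → fixedCount a (suc n) k d ≡ 0
    count-other {k} {v} {s} k≡ 0<s s<m = fixedCount-coded k [] AllPairs.[] (λ {zs} → ∈[]-elim (λ {zs} → impossible {zs}) {zs}) (λ ())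
      where
      impossible : ∀ {zs} → Coded k zs → ⊥
      impossible {zs} c with central-code {k} {v} {_} zs k≡ (<⇒≤ s<m) c
      ... | inj₁ (s0 , _) = <-irrefl (sym s0) 0<s
      ... | inj₂ (e , _) = <⇒≢ s<m e

  -- The cycle lemma

  sum-period : ∀ h p c → (∀ i → h (i + p) ≡ h i) → sum (λ t → h (t + c)) p ≡ sum h p
  sum-period h p c per = +-cancelʳ-≡ (sum h c) _ _ (trans (sym (sum-+ h c p)) (trans (cong (sum h) (+-comm p c))
    (trans (sum-+ h p c) (trans (cong (_+ sum h p) (sum-cong c (λ t _ → per t))) (+-comm (sum h c) (sum h p))))))

  count-sum : ∀ P K → count P K ≡ sum (λ t → indicator (P t)) K
  count-sum P zero = refl
  count-sum P (suc K) = cong (_+ indicator (P K)) (count-sum P K)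

  length-cartesianProduct : ∀ {A B : Set} (xs : List A) (ys : List B) → length (cartesianProduct xs ys) ≡ length xs * length ys
  length-cartesianProduct [] ys = refl
  length-cartesianProduct (x ∷ xs) ys = trans (Listₚ.length-++ (map (x ,_) ys)) (cong₂ _+_ (Listₚ.length-map (x ,_) ys) (length-cartesianProduct xs ys))

  module CycleLemma (a n : ℕ) (0<a : 0 < a) (a≤n : a ≤ n) (coprime : Coprime a (suc n))
                    (d : ℕ) (gcd≡n : gcd d n ≡ n) where
    open Counted a n 0<a a≤n coprime

    cyclically : List ℕ → ℕ → ℕ
    cyclically hs i = entries hs (i % b)

    cyclically-periodic : ∀ hs i → cyclically hs (i + b) ≡ cyclically hs i
    cyclically-periodic hs i = cong (entries hs) ([m+n]%n≡m%n i b)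

    private
      sum-b : ∀ hs → length hs ≡ b → sum (cyclically hs) b ≡ total hs
      sum-b hs l = trans (sum-cong b (λ t t<b → cong (entries hs) (m<n⇒m%n≡m t<b)))
        (trans (sym (total-tabulated (entries hs) b)) (cong total (trans (cong (tabulated (entries hs)) (sym l)) (tabulated-entries hs))))

      count-b : ∀ hs → length hs ≡ b → count (λ t → 0 <ᵇ cyclically hs t) b ≡ support hs
      count-b hs l = trans (count-cong b (λ t t<b → cong (λ i → 0 <ᵇ entries hs i) (m<n⇒m%n≡m t<b)))
        (trans (sym (support-tabulated (entries hs) b)) (cong support (trans (cong (tabulated (entries hs)) (sym l)) (tabulated-entries hs))))

      back : ℕ → ℕ → ℕ
      back c i = (i + (b ∸ c)) % b

      back-+ : ∀ {c} i → c < b → i < b → (back c i + c) % b ≡ i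
      back-+ {c} i c<b i<b = trans (%-+ b (back c i) (i + (b ∸ c)) c (m%n%n≡m%n (i + (b ∸ c)) b))
        (trans (cong (_% b) (trans (+-assoc i (b ∸ c) c) (cong (_+_ i) (m∸n+n≡m (<⇒≤ c<b))))) (trans ([m+n]%n≡m%n i b) (m<n⇒m%n≡m i<b)))

      +-back : ∀ {c} j → c < b → j < b → back c ((j + c) % b) ≡ j
      +-back {c} j c<b j<b = trans (%-+ b ((j + c) % b) (j + c) (b ∸ c) (m%n%n≡m%n (j + c) b))
        (trans (cong (_% b) (trans (+-assoc j c (b ∸ c)) (cong (_+_ j) (m+[n∸m]≡n (<⇒≤ c<b))))) (trans ([m+n]%n≡m%n j b) (m<n⇒m%n≡m j<b)))

    -- Y is read off the cyclic word hs from position c on, which is then the minimum of the walk of hs.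
    record Cut (Y : ℕ → ℕ) (c : ℕ) (hs : List ℕ) : Set where
      constructor cut
      field
        dyck  : Dyck Y
        c<b   : c < b
        steps : ∀ j → j < b → cyclically hs (j + c) ≡ rise Y j
    open Cut

    cut-sum : ∀ {Y c hs} → Cut Y c hs → ∀ i → i ≤ b → sum (λ t → cyclically hs (t + c)) i ≡ Y i
    cut-sum {Y} C i i≤b = trans (sum-cong i (λ t t<i → steps C t (<-≤-trans t<i i≤b)))
      (sum-rise Y b (start (dyck C)) (λ t t<b → mono (dyck C) t (≤-pred t<b)) i i≤b)

    cut-total : ∀ {Y c hs} → length hs ≡ b → Cut Y c hs → total hs ≡ a
    cut-total {Y} {c} {hs} l C = trans (sym (sum-b hs l)) (trans (sym (sum-period (cyclically hs) b c (cyclically-periodic hs)))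
      (trans (cut-sum {Y} {c} {hs} C b ≤-refl) (end (dyck C))))

    cut-support : ∀ {Y c hs} → length hs ≡ b → Cut Y c hs → support hs ≡ nonflat Y
    cut-support {Y} {c} {hs} l C = trans (sym (count-b hs l)) (trans (count-sum _ b)
      (trans (sym (sum-period (λ t → indicator (0 <ᵇ cyclically hs t)) b c (λ i → cong (λ v → indicator (0 <ᵇ v)) (cyclically-periodic hs i))))
      (trans (sum-cong b (λ t t<b → cong (λ v → indicator (0 <ᵇ v)) (steps C t t<b))) (trans (sym (count-sum _ b))
      (trans (cong (λ v → nonflat Y + indicator (0 <ᵇ v)) flat) (+-identityʳ _))))))
      where
      flat : rise Y n ≡ 0
      flat = trans (cong₂ _∸_ (end (dyck C)) (OfDyck.last-flat (dyck C))) (n∸n≡0 a)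

    module _ (hs : List ℕ) (l : length hs ≡ b) (tot : total hs ≡ a) where
      private
        h = cyclically hs
        W = Walk h

        shifted-walk : ∀ c i → W (i + c) ≡ T (sum (λ t → h (t + c))) i ℤ.+ W c
        shifted-walk c i = walk-shift h c i

        W-b : W b ≡ + 0
        W-b = trans (T-def (sum h) b) (trans (cong (λ v → + v - + (a * b)) (trans (cong (b *_) (trans (sum-b hs l) tot)) (*-comm b a))) (ℤₚ.+-inverseʳ (+ (a * b))))

        W-period : ∀ i → W (i + b) ≡ W i
        W-period i = trans (walk-shift h b i) (trans (cong₂ ℤ._+_ (T-cong i (sum-cong i (λ t _ → cyclically-periodic hs t))) W-b) (ℤₚ.+-identityʳ (W i)))

        W-mod : ∀ i → W i ≡ W (i % b)
        W-mod i = trans (cong W (m≡m%n+[m/n]*n i b)) (multiples (i / b) (i % b))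
          where
          multiples : ∀ k i → W (i + k * b) ≡ W i
          multiples zero i = cong W (+-identityʳ i)
          multiples (suc k) i = trans (cong W (trans (cong (_+_ i) (+-comm b (k * b))) (sym (+-assoc i (k * b) b)))) (trans (W-period (i + k * b)) (multiples k i))

      -- The word has total `a` over `b` letters, so its walk is periodic and attains its minimum;
      -- read from there on, the walk stays nonnegative and is that of a Dyck path.
      exists-cut : ∃ λ Y → ∃ λ c → Cut Y c hs
      exists-cut with argmin W n
      ... | c , c≤n , minimal = Y , c , cut
          (record { start = refl ; mono = λ i _ → m≤m+n _ _
                  ; end = trans (sum-period h b c (cyclically-periodic hs)) (trans (sum-b hs l) tot) ; above = λ i _ → above′ i })
          (s≤s c≤n) (λ j _ → sym (m+n∸m≡n (Y j) (h (j + c))))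
        where
        Y : ℕ → ℕ
        Y i = sum (λ t → h (t + c)) i
        nonneg : ∀ i → + 0 ℤ.≤ T Y i
        nonneg i = ℤₚ.≮⇒≥ λ neg → ℤₚ.<⇒≱ (ℤₚ.+-monoˡ-< (W c) neg)
          (subst₂ ℤ._≤_ (sym (ℤₚ.+-identityˡ (W c))) (trans (sym (W-mod (i + c))) (shifted-walk c i)) (minimal ((i + c) % b) (≤-pred (m%n<n (i + c) b))))
        above′ : ∀ i → a * i ≤ b * Y i
        above′ i = ℤₚ.drop‿+≤+ (ℤₚ.0≤i-j⇒j≤i (subst (+ 0 ℤ.≤_) (T-def Y i) (nonneg i)))

      cut-minimal : ∀ {Y c} → Cut Y c hs → ∀ x → x < b → W c ℤ.≤ W x
      cut-minimal {Y} {c} C x x<b = subst₂ ℤ._≤_ (ℤₚ.+-identityˡ (W c)) (trans (sym (shifted-walk c i)) (trans (W-mod (i + c)) (cong W (back-+ x (c<b C) x<b)))) (ℤₚ.+-monoˡ-≤ (W c) nonneg)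
        where
        i = back c x
        i≤b : i ≤ b
        i≤b = <⇒≤ (m%n<n (x + (b ∸ c)) b)
        nonneg : + 0 ℤ.≤ T (sum (λ t → h (t + c))) i
        nonneg = subst (+ 0 ℤ.≤_) (sym (trans (T-cong i (cut-sum {Y} {c} {hs} C i i≤b)) (T-def Y i))) (ℤₚ.i≤j⇒0≤j-i (ℤ.+≤+ (above (dyck C) i i≤b)))

      -- A cut is at a minimum of the walk over one period, and within a period the values are
      -- distinct by coprimality.
      cut-unique : ∀ {Y Y′ c c′} → Cut Y c hs → Cut Y′ c′ hs → c ≡ c′
      cut-unique {Y} {Y′} {c} {c′} C C′ with <-cmp c c′ | ℤₚ.≤-antisym (cut-minimal C c′ (c<b C′)) (cut-minimal C′ c (c<b C))
      ... | tri≈ _ e _ | _ = e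
      ... | tri< lt _ _ | e = ⊥-elim (T-distinct (sum h) c c′ lt (<-≤-trans (c<b C′) (m≤n+m b c)) e)
      ... | tri> _ _ gt | e = ⊥-elim (T-distinct (sum h) c′ c gt (<-≤-trans (c<b C) (m≤n+m b c′)) (sym e))

    Relates : SetPartition × ℕ → List ℕ → Set
    Relates (π , c) hs = length hs ≡ b × ∃ λ Y → π ≡ partition Y × Cut Y c hs

    relates-injectiveˡ : ∀ {x x′ hs} → Relates x hs → Relates x′ hs → x ≡ x′
    relates-injectiveˡ {_ , c} {_ , c′} {hs} (l , Y , refl , C) (_ , Y′ , refl , C′) with cut-unique hs l (cut-total {Y} {c} {hs} l C) C C′
    ... | refl = cong (_, c) (partition-cong {Y} {Y′} (λ r s e → trans (sym (same r)) (trans e (same s))) (λ r s e → trans (same r) (trans e (sym (same s)))))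
      where
      same : ∀ r → parent Y r ≡ parent Y′ r
      same = parent-cong {Y} {Y′} (λ i i≤b → trans (sym (cut-sum {Y} {c} {hs} C i i≤b)) (cut-sum {Y′} {c} {hs} C′ i i≤b))

    relates-injectiveʳ : ∀ {x hs hs′} → Relates x hs → Relates x hs′ → hs ≡ hs′
    relates-injectiveʳ {_ , c} {hs} {hs′} (l , Y , refl , C) (l′ , Y′ , e , C′) =
      trans (sym (tabulated-entries hs)) (trans (cong (tabulated (entries hs)) l) (trans (tabulated-cong b same) (trans (cong (tabulated (entries hs′)) (sym l′)) (tabulated-entries hs′))))
      where
      Y≡ : ∀ i → i ≤ b → Y i ≡ Y′ i
      Y≡ = partition-injective (dyck C) (dyck C′) e
      same : ∀ i → i < b → entries hs i ≡ entries hs′ i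
      same i i<b = subst (λ t → entries hs t ≡ entries hs′ t) (back-+ i (c<b C) i<b)
        (trans (steps C j j<b) (trans (cong₂ _∸_ (Y≡ (suc j) j<b) (Y≡ j (<⇒≤ j<b))) (sym (steps C′ j j<b))))
        where
        j = back c i
        j<b : j < b
        j<b = m%n<n (i + (b ∸ c)) b

    -- Since `n` divides `d`, all partitions are fixed. Pairs of a partition and a position modulo
    -- `b` correspond to the words of length `b` with total `a` and `suc k` nonzero letters: the
    -- path is written around the circle from that position on.
    fixedCount-cycle : ∀ k → fixedCount a b (suc k) d * b ≡ choose b (suc k) * choose (ℕ.pred a) k
    fixedCount-cycle k = trans (cong (fixedCount a b (suc k) d *_) (sym (Listₚ.length-upTo b)))
      (trans (sym (length-cartesianProduct (fixedList (suc k) d) (upTo b)))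
      (trans (bijection-length Relates (cartesianProduct (fixedList (suc k) d) (upTo b)) (Exact.compositions b a (suc k))
        (Uniqueₚ.cartesianProduct⁺ (fixedList-unique (suc k) d) (Uniqueₚ.upTo⁺ b)) (Exact.unique b a (suc k)) left right
        (λ {x} {x′} {hs} → relates-injectiveˡ {x} {x′} {hs}) (λ {x} {hs} {hs′} → relates-injectiveʳ {x} {hs} {hs′}))
      (trans (cong (λ v → length (Exact.compositions b v (suc k))) (sym a≡)) (length-exact b (ℕ.pred a) k))))
      where
      a≡ : suc (ℕ.pred a) ≡ a
      a≡ = suc-pred a {{ℕ.>-nonZero 0<a}}
      left : ∀ {x} → x ∈ cartesianProduct (fixedList (suc k) d) (upTo b) → ∃ λ hs → hs ∈ Exact.compositions b a (suc k) × Relates x hs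
      left {π , c} x∈ with ∈-cartesianProduct⁻ (fixedList (suc k) d) (upTo b) x∈
      ... | π∈ , c∈ with fixedList-sound (suc k) d π∈
      ...   | member Y D π≡ bl _ = hs , Exact.complete b a (suc k) hs (Exact.composition 0 l (trans (+-identityʳ _) (cut-total {Y} {c} {hs} l C)) (trans (cut-support {Y} {c} {hs} l C) bl) refl) , l , Y , π≡ , C
        where
        hs = tabulated (λ i → rise Y (back c i)) b
        l : length hs ≡ b
        l = Listₚ.length-applyUpTo (λ i → rise Y (back c i)) b
        C : Cut Y c hs
        C = cut D (∈-upTo⁻ c∈) (λ j j<b → trans (tabulated-entry (λ i → rise Y (back c i)) b ((j + c) % b) (m%n<n (j + c) b)) (cong (rise Y) (+-back j (∈-upTo⁻ c∈) j<b)))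
      right : ∀ {hs} → hs ∈ Exact.compositions b a (suc k) → ∃ λ x → x ∈ cartesianProduct (fixedList (suc k) d) (upTo b) × Relates x hs
      right {hs} hs∈ with Exact.sound b a (suc k) hs∈
      ... | Exact.composition zero l t sup _ with exists-cut hs l (trans (sym (+-identityʳ _)) t)
      ...   | Y , c , C = (partition Y , c) , ∈-cartesianProduct⁺ (fixedList-complete (suc k) d (dyck C) (trans (sym (cut-support {Y} {c} {hs} l C)) sup)
              (shifted⇒fixed d (dyck C) (shifted-from-gcd d {Y} (subst (λ t → Shifted t Y) (sym gcd≡n) (shifted-n Y))))) (∈-upTo⁺ (c<b C)) , l , Y , refl , C

open Unimodality
open Polynomials
open Paths

-- Comparison of the values of X with the numbers of fixed partitions

module Sieving (a′ k′ j : ℕ) (k′≤a′ : k′ ≤ a′) (a≤n : suc a′ ≤ suc k′ ℕ.+ j) (coprime : Coprime (suc a′) (suc (suc k′ ℕ.+ j))) where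
  private
    n = suc k′ ℕ.+ j
    gcd≡1 = coprime⇒gcd≡1 coprime
    0<a : 0 < suc a′
    0<a = s≤s z≤n
    i = a′ ∸ k′
  open Narayana a′ k′ j gcd≡1 k′≤a′ using (X; X-k; X-factorials)
  module Numerator = Product k′ i k′ (suc j)

  private
    X-GG : mulP Gx.[ suc k′ ] X ≈ Numerator.GG
    X-GG = ≈-trans X-k (mk λ t → cong₂ (λ u v → coeff (mulP (Gx.G u k′) (Gx.G v k′)) t) (sym (m+[n∸m]≡n k′≤a′)) (sym (+-suc k′ j)))

  nonneg : ∀ t → + 0 ℤ.≤ coeff X t
  nonneg = QuotientPositive.coeff-nonneg X Numerator.GG k′ (Levels.top k′ i k′ (suc j)) X-GG (Numerator.coeff-GG-nonneg 0) Numerator.coeff-increasing Numerator.coeff-decreasing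

  P : List ℕ
  P = toℕPoly X

  P≈X : toPoly P ≈ X
  P≈X = toPoly-toℕPoly X nonneg

  module _ (d q m′ : ℕ) (q≡gcd : gcd d n ≡ q) (n≡mq : n ≡ suc m′ ℕ.* q) where
    private
      m = suc m′
      module V = NarayanaValues a′ k′ j gcd≡1 k′≤a′ d q m′ q≡gcd (trans n≡mq (*-comm m q))

      value : ∀ {c c′} → (∀ p → p ≈ X → EvalRootOfUnity n d p (+ c)) → c′ ≡ c → EvalRootOfUnity n d (toPoly P) (+ c′)
      value {c} ev e = subst (λ c → EvalRootOfUnity n d (toPoly P) (+ c)) (sym e) (ev (toPoly P) P≈X)

      division : ∀ x → x ≡ x / m ℕ.* m ℕ.+ x % m
      division x = trans (m≡m%n+[m/n]*n x m) (+-comm (x % m) _)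

    sieve-free : 2 ≤ m → EvalRootOfUnity n d (toPoly P) (+ fixedCount (suc a′) (suc n) (suc k′) d)
    sieve-free 2≤m = by-residue (k′ % m) (division k′) (m%n<n k′ m)
      where
      module C = CountSymmetric (suc a′) n 0<a a≤n coprime d q m q≡gcd n≡mq 2≤m
      u = a′ / m
      r = a′ % m
      v = k′ / m
      r<m : r < m
      r<m = m%n<n a′ m
      -- Non-central blocks come in orbits of size `m`. So `k` congruent to 1 requires a central
      -- block, `k` congruent to 0 excludes one, which needs `m ∣ a`, and for other residues nothing
      -- is fixed. The cases of q-Lucas for `k′ = k − 1` match these.
      by-residue : ∀ s → k′ ≡ v ℕ.* m ℕ.+ s → s < m → EvalRootOfUnity n d (toPoly P) (+ fixedCount (suc a′) (suc n) (suc k′) d)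
      by-residue zero k≡ _ = value (V.eval-central 2≤m u r v r<m (division a′) k≡) (C.count-central {v = v} u r (cong suc k≡) r<m (cong suc (division a′)))
      by-residue s@(suc _) k≡ s<m with m≤n⇒m<n∨m≡n s<m
      ... | inj₁ lt = value (V.eval-other u r v s r<m (s≤s z≤n) lt (division a′) k≡) (C.count-other {v = v} (cong suc k≡) (s≤s z≤n) lt)
      ... | inj₂ refl with m≤n⇒m<n∨m≡n r<m
      ...   | inj₂ e = value (V.eval-free 2≤m u v a≡ k≡) (C.count-free {v = v} u (cong suc k≡) refl (cong suc a≡))
        where
        a≡ : a′ ≡ u ℕ.* m ℕ.+ m′
        a≡ = trans (division a′) (cong (u ℕ.* m ℕ.+_) (suc-injective e))
      ...   | inj₁ lt = value (V.eval-free-empty 2≤m u r v (≤-pred lt) (division a′) k≡) (C.count-free-empty {v = v} u r (cong suc k≡) refl (≤-pred lt) (cong suc (division a′)))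

    sieve-trivial : m′ ≡ 0 → EvalRootOfUnity n d (toPoly P) (+ fixedCount (suc a′) (suc n) (suc k′) d)
    sieve-trivial refl = value {c = c} (V.eval-one refl c narayana) refl
      where
      c = fixedCount (suc a′) (suc n) (suc k′) d
      open CycleLemma (suc a′) n 0<a a≤n coprime d (trans q≡gcd (trans (sym (*-identityˡ q)) (sym n≡mq)))
      swap : ∀ x y z → x ℕ.* y ℕ.* z ≡ x ℕ.* (y ℕ.* z)
      swap = ℕSolver.solve-∀
      rearrange : ∀ x y z → z ℕ.* y ℕ.* x ≡ x ℕ.* y ℕ.* z
      rearrange = ℕSolver.solve-∀
      -- After multiplication by `b`, the cycle lemma supplies the left side, and absorption of `k`
      -- into the binomial of `b` over `k` turns it into `b` times the right side.
      narayana : suc k′ ℕ.* c ≡ choose a′ k′ ℕ.* choose n k′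
      narayana = *-cancelʳ-≡ (suc k′ ℕ.* c) (choose a′ k′ ℕ.* choose n k′) (suc n) (trans (swap (suc k′) c (suc n))
        (trans (cong (suc k′ ℕ.*_) (fixedCount-cycle k′)) (trans (sym (swap (suc k′) (choose (suc n) (suc k′)) (choose a′ k′)))
        (trans (cong (ℕ._* choose a′ k′) (choose-absorb n k′)) (sym (rearrange (suc n) (choose n k′) (choose a′ k′)))))))

  sieve : ∀ d → EvalRootOfUnity n d (toPoly P) (+ fixedCount (suc a′) (suc n) (suc k′) d)
  sieve d with gcd[m,n]∣n d n
  ... | divides zero ()
  ... | divides (suc zero) e = sieve-trivial d (gcd d n) 0 refl e refl
  ... | divides (suc (suc m)) e = sieve-free d (gcd d n) (suc m) refl e (s≤s (s≤s z≤n))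

  factorials : mulP (toPoly P) (mulP (qInt (suc a′)) (mulP (qFact (suc k′)) (mulP (qFact i) (mulP (qFact k′) (qFact (suc n ∸ suc k′)))))) ≈P mulP (qFact (suc a′)) (qFact n)
  factorials = subst (λ t → mulP (toPoly P) (mulP (qInt (suc a′)) (mulP (qFact (suc k′)) (mulP (qFact i) (mulP (qFact k′) (qFact t))))) ≈P mulP (qFact (suc a′)) (qFact n))
    (sym (trans (cong (_∸ k′) (sym (+-suc k′ j))) (m+n∸m≡n k′ (suc j))))
    (≈⇒≈P (≈-trans (mul-cong P≈X ≈-refl) (X-factorials i (cong suc (m+[n∸m]≡n k′≤a′)))))

theorem5p2 : (a b k : ℕ) → 0 < a → a < b → Coprime a b → 1 ≤ k → k ≤ a →
  Σ (List ℕ) (λ P →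
    (mulP (toPoly P) (mulP (qInt a) (mulP (qFact k) (mulP (qFact (a ∸ k))
        (mulP (qFact (k ∸ 1)) (qFact (b ∸ k))))))
      ≈P mulP (qFact a) (qFact (b ∸ 1)))
    × ((d : ℕ) → EvalRootOfUnity (b ∸ 1) d (toPoly P) (+ fixedCount a b k d)))
-- The witness `j` extracted here is `b − 1 − k`, which is a natural number because `k ≤ a < b`.
theorem5p2 (suc a′) (suc n) (suc k′) _ (s≤s a≤n) coprime _ (s≤s k′≤a′) with m≤n⇒∃[o]m+o≡n (≤-trans (s≤s k′≤a′) a≤n)
... | j , refl = S.P , S.factorials , S.sieve
  where module S = Sieving a′ k′ j k′≤a′ a≤n coprime
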